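{- Let $w\in S_\infty$, $\varphi$ a flag, $r^{(\bullet)}\in\mathrm{RFC}(w,\varphi)$ and $i>0$. If $e_i(r^{(\bullet)})\neq0$, then $\hat P(e_i(r^{(\bullet)}))=\hat P(r^{(\bullet)})$ and $\hat Q(e_i(r^{(\bullet)}))=e_i\big(\hat Q(r^{(\bullet)})\big)$.
   Context: $s_i\in S_\infty$ swaps $i,i+1$; reduced words for $w$ are minimal-length words $i_1\cdots i_m$ with $w=s_{i_1}\cdots s_{i_m}$. An increasing factorization $r^{(\bullet)}=(r^{(k)}|\cdots|r^{(1)})$ of $r$ writes $r=r^{(k)}\cdots r^{(1)}$ with consecutive, possibly empty, strictly increasing subwords (one may pad with empty components on the left). A flag is a weakly increasing $\varphi:\mathbb{Z}_{>0}\to\mathbb{Z}_{>0}$ with $\varphi(m)\ge m$; $r^{(\bullet)}$ is $\varphi$-flagged if $\varphi(r^{(j)}_1)\ge j$ whenever $r^{(j)}$ is nonempty. $\mathrm{RFC}(w,\varphi)$ is the set of $\varphi$-flagged increasing factorizations of reduced words for $w$. Raising operator on factorizations (Morse–Schilling), acting on components $i+1,i$: take elements $b$ of $r^{(i)}$ in decreasing order, pairing each with the smallest not-yet-paired $a\in r^{(i+1)}$ with $a>b$ (else $b$ unpaired); $L_i$ = unpaired letters of $r^{(i+1)}$. If $L_i=\varnothing$, $e_i(r^{(\bullet)})=0$; otherwise with $a=\max L_i$, $s=\min\{t\ge0:a+t+1\notin r^{(i+1)}\}$, $e_i$ removes $a$ from $r^{(i+1)}$ and adds $a+s$ to $r^{(i)}$.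 Coxeter–Knuth equivalence $\sim$: transitive closure of $\mathbf a xyz\mathbf b\sim\mathbf a xzy\mathbf b$ ($y<x<z$), $\mathbf a xyz\mathbf b\sim\mathbf a yxz\mathbf b$ ($y<z<x$), $\mathbf a\, i(i+1)i\,\mathbf b\sim\mathbf a\,(i+1)i(i+1)\,\mathbf b$. Tableaux are fillings of finite sets of boxes (row $r\in\mathbb{Z}$, column $c\in\mathbb{Z}_{>0}$), rows left-justified, rows indexed upward. Weak descent tableau $\mathsf{WeakDesTab}(\rho)$: with run factorization (maximal strictly increasing runs) $(\sigma^{(k)}|\cdots|\sigma^{(1)})$, place $\sigma^{(k)}$ in row $\sigma^{(k)}_1$; for $i=k-1,\dots,1$ place $\sigma^{(i)}$ in row $\sigma^{(i)}_1$ if that is below the row of $\sigma^{(i+1)}$, else directly below it. Virtual: uses a non-positive row; else $\mathrm{des}(\rho)$ is its shape. $\mu\le\nu$ iff all partial sums satisfy $\sum_{i\le k}\mu_i\le\sum_{i\le k}\nu_i$; for non-virtual reduced words $\rho\le\tau$ iff $\rho\sim\tau$ and $\mathrm{des}(\rho)\le\mathrm{des}(\tau)$; each $\sim$-class has a unique non-virtual $\le$-minimal element $\hat\rho$; $\hat P(r^{(\bullet)})=\hat P(r):=\mathsf{WeakDesTab}(\hat r)$. It is known that if $\sigma x$ is reduced, the diagram of $\hat P(\sigma x)$ is that of $\hat P(\sigma)$ plus one box. $\hat Q(r^{(\bullet)})$ fills the diagram of $\hat P(r)$, a box getting $j$ iff it lies in the diagram of $\hat P(r^{(k)}\cdots r^{(j)})$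 but not of $\hat P(r^{(k)}\cdots r^{(j+1)})$; it is a key tableau. Raising operator on key tableaux $T$: for a word $\rho=\rho_1\cdots\rho_k$, $m_i(\rho,j)$ = number of $i+1$'s minus number of $i$'s in $\rho_j\cdots\rho_k$, $m_i(\rho)=\max_jm_i(\rho,j)$; $\mathsf{col}(T)$ reads entries down each column, columns right to left. If $m_i(\mathsf{col}(T))\le0$, $e_i(T)=0$; otherwise with $q$ the largest index with $m_i(\mathsf{col}(T),q)=m_i(\mathsf{col}(T))$, change to $i$ all entries $i+1$ to the right of $\mathsf{col}(T)_q$ in its row, then change to $i+1$ all entries $i$ in the same columns as these entries. -}

module Defs where

open import Data.Bool using (Bool; true; false; if_then_else_; _∧_; _∨_; not; T)
open import Data.Nat using (ℕ; zero; suc; _+_; _∸_; _^_; _≤_; _<_; _⊔_; _≡ᵇ_; _<ᵇ_; _≤ᵇ_)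
open import Data.Integer as ℤ using (ℤ)
open import Data.List using (List; []; _∷_; _++_; map; concat; concatMap; reverse; length;
  foldr; foldl; take; drop; upTo; downFrom; filterᵇ; deduplicateᵇ)
open import Data.Nat.ListAction using (sum)
open import Data.List.Relation.Unary.All using (All)
open import Data.List.Relation.Unary.Linked using (Linked)
open import Data.Maybe using (Maybe; just; nothing)
open import Data.Product using (_×_; _,_)
open import Data.Unit using (⊤)
open import Relation.Binary.PropositionalEquality using (_≡_)

Word : Set
Word = List ℕ

eqWᵇ : Word → Word → Bool
eqWᵇ []       []       = true
eqWᵇ (x ∷ xs) (y ∷ ys) = (x ≡ᵇ y) ∧ eqWᵇ xs ys
eqWᵇ _        _        = false

allᵇ : {A : Set} → (A → Bool) → List A → Bool
allᵇ p = foldr (λ x b → p x ∧ b) true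

anyᵇ : {A : Set} → (A → Bool) → List A → Bool
anyᵇ p = foldr (λ x b → p x ∨ b) false

memᵇ : ℕ → List ℕ → Bool
memᵇ a xs = anyᵇ (λ x → a ≡ᵇ x) xs

at : {A : Set} → A → List A → ℕ → A
at d []       _       = d
at d (x ∷ xs) zero    = x
at d (x ∷ xs) (suc n) = at d xs n

setAt : {A : Set} → A → List A → ℕ → A → List A
setAt d []       zero    v = v ∷ []
setAt d []       (suc n) v = d ∷ setAt d [] n v
setAt d (x ∷ xs) zero    v = v ∷ xs
setAt d (x ∷ xs) (suc n) v = x ∷ setAt d xs n v

maxL : List ℕ → ℕ
maxL = foldr _⊔_ 0

-- Permutations in S_∞ and reduced words.
-- A permutation w is given as a function ℕ → ℕ (positions 1,2,…; position 0
-- is fixed by every s_i with i ≥ 1).  s_i swaps i and i+1.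

swap : ℕ → ℕ → ℕ
swap i n = if n ≡ᵇ i then suc i else (if n ≡ᵇ suc i then i else n)

act : Word → ℕ → ℕ
act []      n = n
act (i ∷ u) n = swap i (act u n)

PositiveWord : Word → Set
PositiveWord = All (λ x → 1 ≤ x)

Represents : (ℕ → ℕ) → Word → Set
Represents w u = PositiveWord u × (∀ n → act u n ≡ w n)

ReducedWordFor : (ℕ → ℕ) → Word → Set
ReducedWordFor w ρ = Represents w ρ × (∀ u → Represents w u → length ρ ≤ length u)

record Flag : Set where
  field
    φ      : ℕ → ℕ
    mono   : ∀ m n → 1 ≤ m → m ≤ n → φ m ≤ φ n
    extens : ∀ m → 1 ≤ m → m ≤ φ m
open Flag public

-- Increasing factorizations.
-- A factorization (r^(k)|⋯|r^(1)) is stored as the list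
-- r^(1) ∷ r^(2) ∷ ⋯ ∷ r^(k) ∷ [] (component j at 0-based index j-1);
-- missing components (padding on the left) are empty.

Fac : Set
Fac = List Word

facWord : Fac → Word
facWord f = concat (reverse f)

Increasing : Fac → Set
Increasing = All (Linked _<_)

flaggedFrom : (ℕ → ℕ) → ℕ → Fac → Set
flaggedFrom φ j []             = ⊤
flaggedFrom φ j ([] ∷ cs)      = flaggedFrom φ (suc j) cs
flaggedFrom φ j ((x ∷ _) ∷ cs) = (j ≤ φ x) × flaggedFrom φ (suc j) cs

Flagged : Flag → Fac → Set
Flagged F = flaggedFrom (φ F) 1

RFC : (ℕ → ℕ) → Flag → Fac → Set
RFC w F f = Increasing f × ReducedWordFor w (facWord f) × Flagged F f

-- Raising operator e_i on factorizations (Morse–Schilling)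

-- remove the smallest a (in increasing list) with a > b
removeFirstGT : ℕ → List ℕ → List ℕ
removeFirstGT b []       = []
removeFirstGT b (a ∷ as) = if b <ᵇ a then as else a ∷ removeFirstGT b as

-- unpaired letters L_i of X = r^(i+1) against Y = r^(i)
-- (elements b of Y processed in decreasing order)
unpaired : List ℕ → List ℕ → List ℕ
unpaired X Y = foldl (λ av b → removeFirstGT b av) X (reverse Y)

runEnd : ℕ → ℕ → List ℕ → ℕ
runEnd zero    a X = a
runEnd (suc f) a X = if memᵇ (suc a) X then runEnd f (suc a) X else a

insertSorted : ℕ → List ℕ → List ℕ
insertSorted x []       = x ∷ []
insertSorted x (y ∷ ys) = if x ≤ᵇ y then x ∷ y ∷ ys else y ∷ insertSorted x ys

removeVal : ℕ → List ℕ → List ℕ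
removeVal a = filterᵇ (λ x → not (x ≡ᵇ a))

-- e_i, for i ≥ 1; nothing stands for 0
eFac : ℕ → Fac → Maybe Fac
eFac zero    f = nothing
eFac (suc k) f with unpaired X Y
  where X = at [] f (suc k)   -- r^(i+1), i = suc k
        Y = at [] f k         -- r^(i)
... | []      = nothing
... | L@(_ ∷ _) =
  let X  = at [] f (suc k)
      Y  = at [] f k
      a  = maxL L
      as = runEnd (length X) a X
  in just (setAt [] (setAt [] f (suc k) (removeVal a X)) k (insertSorted as Y))

-- Tableaux: a tableau with boxes in rows 1,2,… is a list of rows,
-- 0-based index ρ-1 holding row ρ (left-justified, read left to right).

Tab : Set
Tab = List (List ℕ)

-- maximal strictly increasing runs, left to right (σ^(k) first)
consRun : ℕ → List Word → List Word
consRun x []               = (x ∷ []) ∷ []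
consRun x ([] ∷ rs)        = (x ∷ []) ∷ rs
consRun x ((y ∷ ys) ∷ rs)  = if x <ᵇ y then (x ∷ y ∷ ys) ∷ rs else (x ∷ []) ∷ (y ∷ ys) ∷ rs

runs : Word → List Word
runs []       = []
runs (x ∷ xs) = consRun x (runs xs)

headOr0 : Word → ℕ
headOr0 []      = 0
headOr0 (x ∷ _) = x

consM : {A : Set} → A → Maybe (List A) → Maybe (List A)
consM x (just xs) = just (x ∷ xs)
consM x nothing   = nothing

-- placement of σ^(i), i = k-1,…,1, given the row of σ^(i+1);
-- nothing = a non-positive row is used (virtual)
placeRest : ℕ → List Word → Maybe (List (ℕ × Word))
placeRest prev []       = just []
placeRest prev (σ ∷ rs) =
  let h   = headOr0 σ
      row = if h <ᵇ prev then h else prev ∸ 1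
  in if row ≡ᵇ 0 then nothing else consM (row , σ) (placeRest row rs)

place : List Word → Maybe (List (ℕ × Word))
place []       = just []
place (σ ∷ rs) =
  let h = headOr0 σ in
  if h ≡ᵇ 0 then nothing else consM (h , σ) (placeRest h rs)

rowAt : ℕ → List (ℕ × Word) → Word
rowAt ρ []             = []
rowAt ρ ((r , σ) ∷ ps) = if r ≡ᵇ ρ then σ else rowAt ρ ps

topRow : List (ℕ × Word) → ℕ
topRow []             = 0
topRow ((r , _) ∷ _)  = r

buildTab : List (ℕ × Word) → Tab
buildTab ps = map (λ k → rowAt (suc k) ps) (upTo (topRow ps))

-- WeakDesTab(ρ); nothing iff the weak descent tableau is virtual
weakDesTab : Word → Maybe Tab
weakDesTab ρ with place (runs ρ)
... | just ps = just (buildTab ps)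
... | nothing = nothing

nonVirtualᵇ : Word → Bool
nonVirtualᵇ ρ with weakDesTab ρ
... | just _  = true
... | nothing = false

shape : Tab → List ℕ
shape = map length

-- des(ρ) (for non-virtual ρ)
des : Word → List ℕ
des ρ with weakDesTab ρ
... | just t  = shape t
... | nothing = []

-- dominance μ ≤ ν: all partial sums (rows 1..k); checking k up to
-- length μ + length ν suffices since the partial sums are constant beyond.
domᵇ : List ℕ → List ℕ → Bool
domᵇ μ ν = allᵇ (λ k → sum (take k μ) ≤ᵇ sum (take k ν)) (upTo (suc (length μ + length ν)))

-- all words obtained from the triple a b c by one elementary CK move
-- (in either direction)
moves3 : ℕ → ℕ → ℕ → List Word
moves3 p q r =
     (if (r <ᵇ p) ∧ (p <ᵇ q) then (p ∷ r ∷ q ∷ []) ∷ [] else [])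
  ++ (if (q <ᵇ p) ∧ (p <ᵇ r) then (p ∷ r ∷ q ∷ []) ∷ [] else [])
  ++ (if (q <ᵇ r) ∧ (r <ᵇ p) then (q ∷ p ∷ r ∷ []) ∷ [] else [])
  ++ (if (p <ᵇ r) ∧ (r <ᵇ q) then (q ∷ p ∷ r ∷ []) ∷ [] else [])
  ++ (if (p ≡ᵇ r) ∧ ((q ≡ᵇ suc p) ∨ (p ≡ᵇ suc q)) then (q ∷ p ∷ q ∷ []) ∷ [] else [])

ckNeighbours : Word → List Word
ckNeighbours (a ∷ xs@(b ∷ c ∷ rest)) =
  map (_++ rest) (moves3 a b c) ++ map (a ∷_) (ckNeighbours xs)
ckNeighbours _ = []

ckStep : List Word → List Word
ckStep S = deduplicateᵇ eqWᵇ (S ++ concatMap ckNeighbours S)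

iterateN : {A : Set} → ℕ → (A → A) → A → A
iterateN zero    f x = x
iterateN (suc n) f x = iterateN n f (f x)

-- The ∼-class of ρ.  CK moves preserve the length and the set of letters,
-- so the class has at most (suc (max ρ)) ^ length ρ elements; each ckStep
-- either stabilises or adds a new word, so this many iterations reach the
-- full transitive closure.
ckClass : Word → List Word
ckClass ρ = iterateN (suc (maxL ρ) ^ length ρ) ckStep (ρ ∷ [])

findᵇ' : {A : Set} → (A → Bool) → List A → Maybe A
findᵇ' p []       = nothing
findᵇ' p (x ∷ xs) = if p x then just x else findᵇ' p xs

hat : Word → Maybe Word
hat ρ =
  let nv = filterᵇ nonVirtualᵇ (ckClass ρ) in
  findᵇ' (λ τ → allᵇ (λ τ' → domᵇ (des τ) (des τ')) nv) nv

Phat : Word → Maybe Tab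
Phat ρ with hat ρ
... | just τ  = weakDesTab τ
... | nothing = nothing

PhatFac : Fac → Maybe Tab
PhatFac f = Phat (facWord f)

-- box (row ρ, column c), both 1-based, lies in the diagram
inDiag : Maybe Tab → ℕ → ℕ → Bool
inDiag nothing  ρ c = false
inDiag (just t) ρ c = (1 ≤ᵇ ρ) ∧ (1 ≤ᵇ c) ∧ (c ≤ᵇ length (at [] t (ρ ∸ 1)))

-- the word r^(k) ⋯ r^(j)  (j ≥ 1)
prefixFac : Fac → ℕ → Word
prefixFac f j = concat (reverse (drop (j ∸ 1) f))

qEntry : Fac → ℕ → ℕ → ℕ
qEntry f ρ c with findᵇ' (λ j → inDiag (Phat (prefixFac f j)) ρ c
                              ∧ not (inDiag (Phat (prefixFac f (suc j))) ρ c))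
                         (map suc (upTo (length f)))
... | just j  = j
... | nothing = 0

fillRows : (ℕ → ℕ → ℕ) → Tab → Tab
fillRows g t = map (λ k → map (λ c → g (suc k) (suc c)) (upTo (length (at [] t k)))) (upTo (length t))

Qhat : Fac → Tab
Qhat f with PhatFac f
... | just t  = fillRows (qEntry f) t
... | nothing = []

entry : Tab → ℕ → ℕ → ℕ   -- 1-based row, column
entry t ρ c = at 0 (at [] t (ρ ∸ 1)) (c ∸ 1)

maxRowLen : Tab → ℕ
maxRowLen t = maxL (map length t)

-- col(T) with positions: (value , row , column); columns right to left,
-- each column read downwards (from the top row to row 1)
colWord : Tab → List (ℕ × ℕ × ℕ)
colWord t =
  concatMap (λ c → concatMap (λ ρ →
      if c ≤ᵇ length (at [] t (ρ ∸ 1)) then (entry t ρ c , ρ , c) ∷ [] else [])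
    (map suc (downFrom (length t))))
  (map suc (downFrom (maxRowLen t)))

δ : ℕ → ℕ → ℤ
δ i x = if x ≡ᵇ suc i then ℤ.+ 1 else (if x ≡ᵇ i then ℤ.- (ℤ.+ 1) else ℤ.+ 0)

suffixM : ℕ → List ℕ → List ℤ
suffixM i []       = []
suffixM i (x ∷ xs) with suffixM i xs
... | []      = δ i x ∷ []
... | (m ∷ ms) = (δ i x ℤ.+ m) ∷ m ∷ ms

zipL : {A B : Set} → List A → List B → List (A × B)
zipL (a ∷ as) (b ∷ bs) = (a , b) ∷ zipL as bs
zipL _        _        = []

-- best (m , row , col): maximal m, the largest index among ties
pickMax : List (ℤ × ℕ × ℕ) → Maybe (ℤ × ℕ × ℕ)
pickMax = foldl step nothing
  where
  step : Maybe (ℤ × ℕ × ℕ) → ℤ × ℕ × ℕ → Maybe (ℤ × ℕ × ℕ)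
  step nothing x = just x
  step (just (m , p)) (m' , p') = if m ℤ.≤ᵇ m' then just (m' , p') else just (m , p)

-- e_i on a key tableau; nothing stands for 0
eKey : ℕ → Tab → Maybe Tab
eKey i t with pickMax (zipL (suffixM i (map (λ { (v , _) → v }) cw)) (map (λ { (_ , p) → p }) cw))
  where cw = colWord t
... | nothing = nothing
... | just (m , R , C) =
  if m ℤ.≤ᵇ ℤ.+ 0 then nothing else just (fillRows new t)
  where
  changed : ℕ → Bool
  changed c = (C ≤ᵇ c) ∧ (entry t R c ≡ᵇ suc i) ∧ (c ≤ᵇ length (at [] t (R ∸ 1)))
  new : ℕ → ℕ → ℕ
  new ρ c = if (ρ ≡ᵇ R) ∧ changed c then i
            else (if not (ρ ≡ᵇ R) ∧ changed c ∧ (entry t ρ c ≡ᵇ i) then suc i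
            else entry t ρ c)

{-# OPTIONS --safe #-}
module Submission where

-- Edelman–Greene insertion gives every Coxeter–Knuth class of reduced words a
-- shape, and reversing a word transposes it.  Deleting row c from the shape of
-- the reversed word removes a horizontal strip, that is, splits off an increasing
-- factor; its letters are the rows occupied in column c of a key whose row
-- lengths are those of P̂.  When an increasing
-- factor is appended, the key gains at most one box per column, and the row of
-- that box is forced by the column to its right; hence Q̂ is determined by P̂ and
-- the shapes of the prefixes.  The raising operator on two factors changes only
-- the middle shape.  Sliding the letters of the prefix in from the left shows that
-- it removes the box selected by the bracketing of the two strips, and comparing
-- the strips column by column turns this into e_i on Q̂.

open import Defs
open import Data.Bool using (Bool; true; false; if_then_else_; _∧_; _∨_; not; T; T?)
open import Data.Empty using (⊥; ⊥-elim)
open import Data.Integer as ℤ using (ℤ)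
import Data.Integer.Properties as ℤₚ
open import Data.List using (List; []; _∷_; _++_; _∷ʳ_; map; concat; concatMap; reverse; length; foldl; take; drop; upTo; downFrom; applyUpTo; filterᵇ; deduplicateᵇ)
open import Data.List.Properties using (++-assoc; ++-identityʳ; length-++; reverse-++; unfold-reverse; reverse-involutive; length-reverse; foldl-++; ∷ʳ-injective; length-map; length-upTo; map-cong; concat-++; take++drop≡id; ≡-dec)
open import Data.List.Membership.Propositional using (_∈_; _∉_)
open import Data.List.Membership.Propositional.Properties using (∈-++⁺ˡ; ∈-++⁺ʳ; ∈-++⁻; ∈-map⁺; ∈-map⁻; ∈-upTo⁺; ∈-filter⁺; ∈-filter⁻; ∈-deduplicate⁻)
open import Data.List.Relation.Unary.All as All using (All; []; _∷_)
import Data.List.Relation.Unary.All.Properties as Allₚ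
open import Data.List.Relation.Unary.Any using (here; there; any?)
open import Data.List.Relation.Unary.AllPairs as AllPairs using (AllPairs; []; _∷_)
open import Data.List.Relation.Unary.Linked using (Linked; []; _∷_)
open import Data.List.Relation.Unary.Linked.Properties using (Linked⇒AllPairs)
open import Data.List.Reverse using (Reverse; []; _∶_∶ʳ_; reverseView)
open import Data.Maybe using (just; nothing)
open import Data.Nat using (ℕ; zero; suc; _+_; _*_; _∸_; _^_; _⊔_; _⊓_; _≤_; _<_; z≤n; s≤s; _≡ᵇ_; _<ᵇ_; _≤ᵇ_; pred)
open import Data.Nat.ListAction using (sum)
open import Data.Nat.Properties
open import Data.Product using (∃; _×_; _,_; proj₁; proj₂; uncurry)
open import Data.Sum using (_⊎_; inj₁; inj₂)
open import Data.Unit using (tt)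
open import Function using (_∘_; id; case_of_)
open import Relation.Binary.Definitions using (tri<; tri≈; tri>)
open import Relation.Binary.PropositionalEquality using (_≡_; _≢_; _≗_; refl; sym; trans; cong; cong₂; subst; subst₂)
open import Relation.Nullary using (¬_; Dec; yes; no)
open import Relation.Nullary.Decidable using (¬?)

-- `P̂` is found by a search through a whole class, with no recursion along the word, so nothing can
-- be said about `P̂` of successive prefixes until its diagram is known by other means. The key
-- supplies this: in dominance order its row lengths bound from below every non-virtual weak descent
-- tableau of the class, and one word of the class attains the bound. That the diagram grows by one
-- box per letter is then derived for keys and not assumed. The two bracketings in the theorem
-- cannot be compared directly: one pairs letters, the other reads the boxes of a filling known only
-- through shapes. Both are replaced by a potential, the number of boxes of one strip minus that of
-- the other within an initial set of rows or columns. Over rows it can be followed while a word is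
-- extended on the left, because every shape involved then changes by a single box; transposition
-- turns it into a potential over columns, and this is the quantity that `e_i` on key tableaux
-- maximises.

infix 30 #_ !_
infixl 20 _⊕_
infix 10 _≼_by_

-- Linear inequalities over the natural numbers, checked by computation

data Lin : Set where
  #_  : ℕ → Lin
  !_  : ℕ → Lin
  _⊕_ : Lin → Lin → Lin

eval : List ℕ → Lin → ℕ
eval e (# i)   = at 0 e i
eval e (! n)   = n
eval e (a ⊕ b) = eval e a + eval e b

constant : Lin → ℕ
constant (# i)   = 0
constant (! n)   = n
constant (a ⊕ b) = constant a + constant b

addCoeffs : List ℕ → List ℕ → List ℕ
addCoeffs []       ys       = ys
addCoeffs (x ∷ xs) []       = x ∷ xs
addCoeffs (x ∷ xs) (y ∷ ys) = x + y ∷ addCoeffs xs ys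

unitCoeffs : ℕ → List ℕ
unitCoeffs zero    = 1 ∷ []
unitCoeffs (suc i) = 0 ∷ unitCoeffs i

coeffs : Lin → List ℕ
coeffs (# i)   = unitCoeffs i
coeffs (! n)   = []
coeffs (a ⊕ b) = addCoeffs (coeffs a) (coeffs b)

leCoeffs : List ℕ → List ℕ → Bool
leCoeffs []       _        = true
leCoeffs (x ∷ xs) []       = (x ≤ᵇ 0) ∧ leCoeffs xs []
leCoeffs (x ∷ xs) (y ∷ ys) = (x ≤ᵇ y) ∧ leCoeffs xs ys

dot : List ℕ → List ℕ → ℕ
dot []       _       = 0
dot (c ∷ cs) []      = 0
dot (c ∷ cs) (x ∷ e) = c * x + dot cs e

+-interchange : ∀ a b c d → (a + b) + (c + d) ≡ (a + c) + (b + d)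
+-interchange a b c d = trans (+-assoc a b (c + d)) (trans (cong (a +_) (trans (sym (+-assoc b c d)) (trans (cong (_+ d) (+-comm b c)) (+-assoc c b d)))) (sym (+-assoc a c (b + d))))

dot-add : ∀ xs ys e → dot (addCoeffs xs ys) e ≡ dot xs e + dot ys e
dot-add []       ys       e       = refl
dot-add (x ∷ xs) []       e       = sym (+-identityʳ _)
dot-add (x ∷ xs) (y ∷ ys) []      = refl
dot-add (x ∷ xs) (y ∷ ys) (z ∷ e) = trans (cong₂ _+_ (*-distribʳ-+ z x y) (dot-add xs ys e)) (+-interchange (x * z) (y * z) (dot xs e) (dot ys e))

dot-unit : ∀ i e → dot (unitCoeffs i) e ≡ at 0 e i
dot-unit zero    []      = refl
dot-unit zero    (x ∷ e) = trans (+-identityʳ _) (*-identityˡ x)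
dot-unit (suc i) []      = refl
dot-unit (suc i) (x ∷ e) = dot-unit i e

eval-coeffs : ∀ e a → eval e a ≡ constant a + dot (coeffs a) e
eval-coeffs e (# i)   = sym (dot-unit i e)
eval-coeffs e (! n)   = sym (+-identityʳ n)
eval-coeffs e (a ⊕ b) = trans (cong₂ _+_ (eval-coeffs e a) (eval-coeffs e b)) (trans (+-interchange (constant a) (dot (coeffs a) e) (constant b) (dot (coeffs b) e)) (cong (constant a + constant b +_) (sym (dot-add (coeffs a) (coeffs b) e))))

T-∧ˡ : ∀ {a b} → T (a ∧ b) → T a
T-∧ˡ {true} _ = tt

T-∧ʳ : ∀ {a b} → T (a ∧ b) → T b
T-∧ʳ {true} t = t

T-∧ : ∀ {a b} → T a → T b → T (a ∧ b)
T-∧ {true} _ t = t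

dot-mono : ∀ xs ys e → T (leCoeffs xs ys) → dot xs e ≤ dot ys e
dot-mono []       ys       e       t = z≤n
dot-mono (x ∷ xs) []       []      t = z≤n
dot-mono (x ∷ xs) []       (z ∷ e) t with x | T-∧ˡ {x ≤ᵇ 0} t
... | zero | _ = dot-mono xs [] e (T-∧ʳ {x ≤ᵇ 0} t)
dot-mono (x ∷ xs) (y ∷ ys) []      t = z≤n
dot-mono (x ∷ xs) (y ∷ ys) (z ∷ e) t = +-mono-≤ (*-monoˡ-≤ z (≤ᵇ⇒≤ x y (T-∧ˡ t))) (dot-mono xs ys e (T-∧ʳ {x ≤ᵇ y} t))

data Hyp (e : List ℕ) : Set where
  _≼_by_ : ∀ a b → eval e a ≤ eval e b → Hyp e

lefts rights : ∀ {e} → List (Hyp e) → Lin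
lefts []                = ! 0
lefts ((a ≼ b by _) ∷ hs) = a ⊕ lefts hs
rights []                = ! 0
rights ((a ≼ b by _) ∷ hs) = b ⊕ rights hs

hyps : ∀ {e} (hs : List (Hyp e)) → eval e (lefts hs) ≤ eval e (rights hs)
hyps []                  = z≤n
hyps ((a ≼ b by p) ∷ hs) = +-mono-≤ p (hyps hs)

dominates : Lin → Lin → Bool
dominates a b = (constant a ≤ᵇ constant b) ∧ leCoeffs (coeffs a) (coeffs b)

-- The goal a ≤ b follows by adding up the hypotheses and comparing
-- coefficients; a hypothesis that is needed twice has to be listed twice.
lin : ∀ e (hs : List (Hyp e)) a b → {T (dominates (a ⊕ rights hs) (b ⊕ lefts hs))} → eval e a ≤ eval e b
lin e hs a b {t} = +-cancelʳ-≤ (eval e (rights hs)) (eval e a) (eval e b)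
  (≤-trans (subst₂ _≤_ (sym (eval-coeffs e l)) (sym (eval-coeffs e r))
             (+-mono-≤ (≤ᵇ⇒≤ (constant l) (constant r) (T-∧ˡ t)) (dot-mono (coeffs l) (coeffs r) e (T-∧ʳ {constant l ≤ᵇ constant r} t))))
           (+-monoʳ-≤ (eval e b) (hyps hs)))
  where l = a ⊕ rights hs
        r = b ⊕ lefts hs

lin-absurd : ∀ {A : Set} e (hs : List (Hyp e)) → {T (dominates (! 1 ⊕ rights hs) (! 0 ⊕ lefts hs))} → A
lin-absurd e hs {t} with lin e hs (! 1) (! 0) {t}
... | ()

-- Reduced words and Coxeter–Knuth equivalence

infix 4 _∼_

-- One orientation of each elementary relation suffices, as `∼sym` supplies the other. Reversal
-- exchanges `bac` with `cab` and fixes `braid`, which is why `∼-reverse` can be checked on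
-- generators.
data Tri : ℕ → ℕ → ℕ → ℕ → ℕ → ℕ → Set where
  bac   : ∀ {a b c} → a < b → b < c → Tri b a c b c a
  cab   : ∀ {a b c} → a < b → b < c → Tri c a b a c b
  braid : ∀ {i} → Tri (suc i) i (suc i) i (suc i) i

data _∼_ : Word → Word → Set where
  ∼tri   : ∀ {x y z x' y' z' u} → Tri x y z x' y' z' → (x ∷ y ∷ z ∷ u) ∼ (x' ∷ y' ∷ z' ∷ u)
  ∼cons  : ∀ x {u v} → u ∼ v → (x ∷ u) ∼ (x ∷ v)
  ∼refl  : ∀ {u} → u ∼ u
  ∼sym   : ∀ {u v} → u ∼ v → v ∼ u
  ∼trans : ∀ {u v t} → u ∼ v → v ∼ t → u ∼ t

∼≡ : ∀ {u v} → u ≡ v → u ∼ v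
∼≡ refl = ∼refl

∼-++ˡ : ∀ s {u v} → u ∼ v → (s ++ u) ∼ (s ++ v)
∼-++ˡ []      p = p
∼-++ˡ (x ∷ s) p = ∼cons x (∼-++ˡ s p)

∼-++ʳ : ∀ {u v} s → u ∼ v → (u ++ s) ∼ (v ++ s)
∼-++ʳ s (∼tri t)     = ∼tri t
∼-++ʳ s (∼cons x p)  = ∼cons x (∼-++ʳ s p)
∼-++ʳ s ∼refl        = ∼refl
∼-++ʳ s (∼sym p)     = ∼sym (∼-++ʳ s p)
∼-++ʳ s (∼trans p q) = ∼trans (∼-++ʳ s p) (∼-++ʳ s q)

∼-length : ∀ {u v} → u ∼ v → length u ≡ length v
∼-length (∼tri t)     = refl
∼-length (∼cons x p)  = cong suc (∼-length p)
∼-length ∼refl        = refl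
∼-length (∼sym p)     = sym (∼-length p)
∼-length (∼trans p q) = trans (∼-length p) (∼-length q)

-- Both directions are carried through the induction because `∼sym` exchanges them.
∼-All⇔ : ∀ {P : ℕ → Set} {u v} → u ∼ v → (All P u → All P v) × (All P v → All P u)
∼-All⇔ (∼tri (bac _ _))    = (λ { (p ∷ q ∷ r ∷ s) → p ∷ r ∷ q ∷ s }) , (λ { (p ∷ q ∷ r ∷ s) → p ∷ r ∷ q ∷ s })
∼-All⇔ (∼tri (cab _ _))    = (λ { (p ∷ q ∷ r ∷ s) → q ∷ p ∷ r ∷ s }) , (λ { (p ∷ q ∷ r ∷ s) → q ∷ p ∷ r ∷ s })
∼-All⇔ (∼tri braid)        = (λ { (p ∷ q ∷ r ∷ s) → q ∷ p ∷ q ∷ s }) , (λ { (p ∷ q ∷ r ∷ s) → q ∷ p ∷ q ∷ s })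
∼-All⇔ (∼cons x p)         = (λ { (a ∷ b) → a ∷ proj₁ (∼-All⇔ p) b }) , (λ { (a ∷ b) → a ∷ proj₂ (∼-All⇔ p) b })
∼-All⇔ ∼refl               = id , id
∼-All⇔ (∼sym p)            = proj₂ (∼-All⇔ p) , proj₁ (∼-All⇔ p)
∼-All⇔ (∼trans p q)        = proj₁ (∼-All⇔ q) ∘ proj₁ (∼-All⇔ p) , proj₂ (∼-All⇔ p) ∘ proj₂ (∼-All⇔ q)

∼-All : ∀ {P : ℕ → Set} {u v} → u ∼ v → All P u → All P v
∼-All p = proj₁ (∼-All⇔ p)

reverse-tri : ∀ x y z (u : Word) → reverse (x ∷ y ∷ z ∷ u) ≡ reverse u ++ z ∷ y ∷ x ∷ []
reverse-tri x y z u = reverse-++ (x ∷ y ∷ z ∷ []) u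

∼-tri′ : ∀ s {x y z x' y' z'} → Tri x y z x' y' z' → (s ++ x ∷ y ∷ z ∷ []) ∼ (s ++ x' ∷ y' ∷ z' ∷ [])
∼-tri′ s t = ∼-++ˡ s (∼tri t)

∼-reverse : ∀ {u v} → u ∼ v → reverse u ∼ reverse v
∼-reverse (∼tri {x} {y} {z} {x'} {y'} {z'} {u} t) rewrite reverse-tri x y z u | reverse-tri x' y' z' u = go t
  where
  go : ∀ {x y z x' y' z'} → Tri x y z x' y' z' → (reverse u ++ z ∷ y ∷ x ∷ []) ∼ (reverse u ++ z' ∷ y' ∷ x' ∷ [])
  go (bac p q) = ∼-tri′ (reverse u) (cab p q)
  go (cab p q) = ∼-tri′ (reverse u) (bac p q)
  go braid     = ∼-tri′ (reverse u) braid
∼-reverse (∼cons x {u} {v} p) rewrite unfold-reverse x u | unfold-reverse x v = ∼-++ʳ (x ∷ []) (∼-reverse p)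
∼-reverse ∼refl        = ∼refl
∼-reverse (∼sym p)     = ∼sym (∼-reverse p)
∼-reverse (∼trans p q) = ∼trans (∼-reverse p) (∼-reverse q)

swap-suc : ∀ i n → swap (suc i) (suc n) ≡ suc (swap i n)
swap-suc i n with n ≡ᵇ i
... | true = refl
... | false with n ≡ᵇ suc i
...   | true  = refl
...   | false = refl

swap-involutive : ∀ i n → swap i (swap i n) ≡ n
swap-involutive zero    zero          = refl
swap-involutive zero    (suc zero)    = refl
swap-involutive zero    (suc (suc n)) = refl
swap-involutive (suc i) zero          = refl
swap-involutive (suc i) (suc n) rewrite swap-suc i n | swap-suc i (swap i n) = cong suc (swap-involutive i n)

swap-comm : ∀ i j n → suc i < j → swap i (swap j n) ≡ swap j (swap i n)
swap-comm zero (suc (suc j)) zero          p = refl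
swap-comm zero (suc (suc j)) (suc zero)    p = refl
swap-comm zero (suc (suc j)) (suc (suc n)) p rewrite swap-suc (suc j) (suc n) | swap-suc j n = refl
swap-comm zero (suc zero) n (s≤s ())
swap-comm (suc i) (suc j) zero    p = refl
swap-comm (suc i) (suc j) (suc n) (s≤s p) rewrite swap-suc j n | swap-suc i n | swap-suc i (swap j n) | swap-suc j (swap i n) = cong suc (swap-comm i j n p)

swap-braid : ∀ i n → swap (suc i) (swap i (swap (suc i) n)) ≡ swap i (swap (suc i) (swap i n))
swap-braid zero    zero                = refl
swap-braid zero    (suc zero)          = refl
swap-braid zero    (suc (suc zero))    = refl
swap-braid zero    (suc (suc (suc n))) = refl
swap-braid (suc i) zero                = refl
swap-braid (suc i) (suc n) rewrite swap-suc (suc i) n | swap-suc i n | swap-suc i (swap (suc i) n) | swap-suc (suc i) (swap i n)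
  | swap-suc (suc i) (swap i (swap (suc i) n)) | swap-suc i (swap (suc i) (swap i n)) = cong suc (swap-braid i n)

act-++ : ∀ u v n → act (u ++ v) n ≡ act u (act v n)
act-++ []      v n = refl
act-++ (x ∷ u) v n = cong (swap x) (act-++ u v n)

∼-act : ∀ {u v} → u ∼ v → ∀ n → act u n ≡ act v n
∼-act (∼tri {u = u} (bac {a} {b} {c} p q)) n = cong (swap b) (swap-comm a c (act u n) (≤-<-trans p q))
∼-act (∼tri {u = u} (cab {a} {b} {c} p q)) n = sym (swap-comm a c (swap b (act u n)) (≤-<-trans p q))
∼-act (∼tri {u = u} (braid {i})) n = swap-braid i (act u n)
∼-act (∼cons x p)  n = cong (swap x) (∼-act p n)
∼-act ∼refl        n = refl
∼-act (∼sym p)     n = sym (∼-act p n)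
∼-act (∼trans p q) n = trans (∼-act p n) (∼-act q n)

-- Reducedness without a named permutation, so that it passes to factors, to reversals and along
-- `∼`.
record Red (w : Word) : Set where
  constructor mkRed
  field
    positive : PositiveWord w
    shortest : ∀ v → PositiveWord v → (∀ n → act v n ≡ act w n) → length w ≤ length v
open Red

Red-∼ : ∀ {u v} → u ∼ v → Red u → Red v
Red-∼ p (mkRed pos short) = mkRed (∼-All p pos)
  λ v pv e → subst (_≤ length v) (∼-length p) (short v pv λ n → trans (e n) (sym (∼-act p n)))

Red-prefix : ∀ u v → Red (u ++ v) → Red u
Red-prefix u v (mkRed pos short) = mkRed (Allₚ.++⁻ˡ u pos)
  λ u' pu e → +-cancelʳ-≤ (length v) _ _ (subst₂ _≤_ (length-++ u) (length-++ u')
    (short (u' ++ v) (Allₚ.++⁺ pu (Allₚ.++⁻ʳ u pos)) λ n → trans (act-++ u' v n) (trans (e (act v n)) (sym (act-++ u v n)))))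

Red-suffix : ∀ u v → Red (u ++ v) → Red v
Red-suffix u v (mkRed pos short) = mkRed (Allₚ.++⁻ʳ u pos)
  λ v' pv e → +-cancelˡ-≤ (length u) _ _ (subst₂ _≤_ (length-++ u) (length-++ u)
    (short (u ++ v') (Allₚ.++⁺ (Allₚ.++⁻ˡ u pos) pv) λ n → trans (act-++ u v' n) (trans (cong (act u) (e n)) (sym (act-++ u v n)))))

Far : ℕ → ℕ → Set
Far x t = (suc x < t) ⊎ (suc t < x)

swap-act : ∀ x T n → All (Far x) T → swap x (act T n) ≡ act T (swap x n)
swap-act x []      n []            = refl
swap-act x (t ∷ T) n (inj₁ p ∷ ps) = trans (swap-comm x t (act T n) p) (cong (swap t) (swap-act x T n ps))
swap-act x (t ∷ T) n (inj₂ p ∷ ps) = trans (sym (swap-comm t x (act T n) p)) (cong (swap t) (swap-act x T n ps))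

-- The two letters `x` cancel because everything between them commutes with `x`. The configurations
-- that insertion cannot handle are refuted through this.
Red-square : ∀ x T u → All (Far x) T → Red (x ∷ T ++ x ∷ u) → ⊥
Red-square x T u far r = lin-absurd (length T ∷ [])
  ((! 2 ⊕ # 0 ≼ # 0 by subst (_≤ length T) (trans (cong suc (length-++ T)) (cong suc (+-comm (length T) 1))) (shortest r' T (Allₚ.++⁻ˡ T (All.tail (positive r'))) e)) ∷ [])
  where
  r' : Red (x ∷ T ++ x ∷ [])
  r' = Red-prefix (x ∷ T ++ x ∷ []) u (subst Red (sym (cong (x ∷_) (++-assoc T (x ∷ []) u))) r)
  e : ∀ n → act T n ≡ act (x ∷ T ++ x ∷ []) n
  e n = sym (trans (cong (swap x) (act-++ T (x ∷ []) n)) (trans (swap-act x T (swap x n) far) (cong (act T) (swap-involutive x n))))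

act-reverse : ∀ u n → act u (act (reverse u) n) ≡ n
act-reverse []      n = refl
act-reverse (x ∷ u) n rewrite unfold-reverse x u | act-++ (reverse u) (x ∷ []) n = trans (cong (swap x) (act-reverse u (swap x n))) (swap-involutive x n)

reverse-All : ∀ {P : ℕ → Set} u → All P u → All P (reverse u)
reverse-All []      []       = []
reverse-All (x ∷ u) (p ∷ ps) rewrite unfold-reverse x u = Allₚ.++⁺ (reverse-All u ps) (p ∷ [])

Red-reverse : ∀ w → Red w → Red (reverse w)
Red-reverse w r = mkRed (reverse-All w (positive r)) λ v pv e →
  subst₂ _≤_ (sym (length-reverse w)) (length-reverse v)
    (shortest r (reverse v) (reverse-All v pv) λ n →
      trans (sym (act-reverse w (act (reverse v) n))) (cong (act w) (trans (sym (e (act (reverse v) n))) (act-reverse v n))))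

ReducedWordFor⇒Red : ∀ {w ρ} → ReducedWordFor w ρ → Red ρ
ReducedWordFor⇒Red ((pos , rep) , short) = mkRed pos λ v pv e → short v (pv , λ n → trans (e n) (rep n))

-- Edelman–Greene insertion into a row

Inc : Word → Set
Inc = AllPairs _<_

-- `spec` is the special rule of Edelman and Greene: if `x` and `suc x` are both present, the row
-- stays and `suc x` is bumped. There is no constructor for `x` present without `suc x`; reducedness
-- excludes that case.
data Ins : Word → ℕ → Word → Word → Set where
  app  : ∀ {x} → Ins [] x (x ∷ []) []
  bump : ∀ {x y R} → x < y → Ins (y ∷ R) x (x ∷ R) (y ∷ [])
  spec : ∀ {x R} → Ins (x ∷ suc x ∷ R) x (x ∷ suc x ∷ R) (suc x ∷ [])
  skip : ∀ {x y R R' o} → y < x → Ins R x R' o → Ins (y ∷ R) x (y ∷ R') o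

-- Total functions that agree with `Ins` on reduced input; in the case of equality they presume that
-- `suc y` comes next.
insRow insOut : Word → ℕ → Word
insRow []      x = x ∷ []
insRow (y ∷ R) x with <-cmp x y
... | tri< _ _ _ = x ∷ R
... | tri≈ _ _ _ = y ∷ R
... | tri> _ _ _ = y ∷ insRow R x
insOut []      x = []
insOut (y ∷ R) x with <-cmp x y
... | tri< _ _ _ = y ∷ []
... | tri≈ _ _ _ = suc y ∷ []
... | tri> _ _ _ = insOut R x

Ins-insRow : ∀ {R x R' o} → Ins R x R' o → insRow R x ≡ R'
Ins-insRow app = refl
Ins-insRow (bump {x} {y} p) with <-cmp x y
... | tri< _ _ _ = refl
... | tri≈ ¬p _ _ = ⊥-elim (¬p p)
... | tri> ¬p _ _ = ⊥-elim (¬p p)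
Ins-insRow (spec {x}) with <-cmp x x
... | tri< p _ _ = ⊥-elim (<-irrefl refl p)
... | tri≈ _ _ _ = refl
... | tri> _ _ p = ⊥-elim (<-irrefl refl p)
Ins-insRow (skip {x} {y} p d) with <-cmp x y
... | tri< _ _ ¬p = ⊥-elim (¬p p)
... | tri≈ _ _ ¬p = ⊥-elim (¬p p)
... | tri> _ _ _ = cong (y ∷_) (Ins-insRow d)

Ins-insOut : ∀ {R x R' o} → Ins R x R' o → insOut R x ≡ o
Ins-insOut app = refl
Ins-insOut (bump {x} {y} p) with <-cmp x y
... | tri< _ _ _ = refl
... | tri≈ ¬p _ _ = ⊥-elim (¬p p)
... | tri> ¬p _ _ = ⊥-elim (¬p p)
Ins-insOut (spec {x}) with <-cmp x x
... | tri< p _ _ = ⊥-elim (<-irrefl refl p)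
... | tri≈ _ _ _ = refl
... | tri> _ _ p = ⊥-elim (<-irrefl refl p)
Ins-insOut (skip {x} {y} p d) with <-cmp x y
... | tri< _ _ ¬p = ⊥-elim (¬p p)
... | tri≈ _ _ ¬p = ⊥-elim (¬p p)
... | tri> _ _ _ = Ins-insOut d

-- If `x` equals the entry `y` and `suc y` does not follow, all later entries exceed `suc y`, so
-- they commute with `x` and the inserted `x` cancels `y`.
Ins-total : ∀ {R} x → Inc R → Red (R ++ x ∷ []) → Ins R x (insRow R x) (insOut R x)
Ins-total {[]}    x i r = app
Ins-total {y ∷ R} x (p ∷ i) r with <-cmp x y
... | tri< x<y _ _ = bump x<y
... | tri> _ _ y<x = skip y<x (Ins-total x i (Red-suffix (y ∷ []) _ r))
Ins-total {y ∷ []} y (p ∷ i) r | tri≈ _ refl _ = ⊥-elim (Red-square y [] [] [] r)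
Ins-total {y ∷ z ∷ R} y ((p ∷ _) ∷ q ∷ i) r | tri≈ _ refl _ with <-cmp (suc y) z
... | tri≈ _ refl _ = spec
... | tri< s _ _ = ⊥-elim (Red-square y (z ∷ R) [] (inj₁ s ∷ All.map (λ z<t → inj₁ (<-trans s z<t)) q) r)
... | tri> _ _ s = ⊥-elim (<⇒≱ s p)

Ins-All : ∀ {P : ℕ → Set} {R x R' o} → Ins R x R' o → All P R → P x → All P R'
Ins-All app        _        px = px ∷ []
Ins-All (bump _)   (_ ∷ ps) px = px ∷ ps
Ins-All spec       ps       px = ps
Ins-All (skip _ d) (p ∷ ps) px = p ∷ Ins-All d ps px

Ins-out-All : ∀ {P : ℕ → Set} {R x R' o} → Ins R x R' o → All P R → All P o
Ins-out-All app        _            = []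
Ins-out-All (bump _)   (p ∷ ps)     = p ∷ []
Ins-out-All spec       (_ ∷ p ∷ ps) = p ∷ []
Ins-out-All (skip _ d) (p ∷ ps)     = Ins-out-All d ps

Ins-x : ∀ {P : ℕ → Set} {R x R' o} → Ins R x R' o → All P R' → P x
Ins-x app        (p ∷ _)  = p
Ins-x (bump _)   (p ∷ _)  = p
Ins-x spec       (p ∷ _)  = p
Ins-x (skip _ d) (_ ∷ ps) = Ins-x d ps

Ins-out> : ∀ {R x R' z} → Ins R x R' (z ∷ []) → x < z
Ins-out> (bump p)   = p
Ins-out> spec       = n<1+n _
Ins-out> (skip _ d) = Ins-out> d

Ins-Inc : ∀ {R x R' o} → Inc R → Ins R x R' o → Inc R'
Ins-Inc i       app        = [] ∷ []
Ins-Inc (p ∷ i) (bump q)   = All.map (<-trans q) p ∷ i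
Ins-Inc i       spec       = i
Ins-Inc (p ∷ i) (skip q d) = Ins-All d p q ∷ Ins-Inc i d

Ins-head< : ∀ {R x R' z} → Ins R x R' (z ∷ []) → ∃ λ r → ∃ λ R₀ → (R' ≡ r ∷ R₀) × (r < z)
Ins-head< (bump p)   = _ , _ , refl , p
Ins-head< spec       = _ , _ , refl , n<1+n _
Ins-head< (skip p d) = _ , _ , refl , <-trans p (Ins-out> d)

pull : ∀ {x y} R → x < y → All (y <_) R → Inc R → (y ∷ R ++ x ∷ []) ∼ (y ∷ x ∷ R)
pull []      p _        _       = ∼refl
pull (r ∷ R) p (q ∷ _)  (s ∷ i) = ∼trans (∼cons _ (pull R (<-trans p q) s i)) (∼sym (∼tri (bac p q)))

data ≤1 : Word → Set where
  none : ≤1 []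
  one  : ∀ z → ≤1 (z ∷ [])

Ins-≤1 : ∀ {R x R' o} → Ins R x R' o → ≤1 o
Ins-≤1 app        = none
Ins-≤1 (bump _)   = one _
Ins-≤1 spec       = one _
Ins-≤1 (skip _ d) = Ins-≤1 d

-- A bumping letter is pulled left through the larger entries behind the bumped one; the special
-- rule ends with a braid relation; a skipped `y` changes places with the bumped letter `z` by
-- `cab`, since the entry `r` after `y` satisfies `y < r < z`.
Ins-∼ : ∀ {R x R' o} → Inc R → Ins R x R' o → (R ++ x ∷ []) ∼ (o ++ R')
Ins-∼ i       app                = ∼refl
Ins-∼ (p ∷ i) (bump {R = R} q)   = pull R q p i
Ins-∼ (_ ∷ p ∷ i) (spec {R = R}) = ∼trans (∼cons _ (pull R (n<1+n _) p i)) (∼sym (∼tri braid))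
Ins-∼ (p ∷ i) (skip {y = y} q d) with Ins-≤1 d
... | none = ∼cons y (Ins-∼ i d)
... | one z with Ins-head< d
...   | r , R₀ , refl , r<z with Ins-All d p q
...     | y<r ∷ _ = ∼trans (∼cons y (Ins-∼ i d)) (∼sym (∼tri (cab y<r r<z)))

-- With `Ins-out-<` and `Ins-smaller` this is the row bumping lemma for a single row: a larger
-- second letter acts further right, a smaller one always bumps.
Ins-app-app : ∀ {T b T₁ c T₂ o} → Ins T b T₁ [] → b < c → Ins T₁ c T₂ o → o ≡ []
Ins-app-app app        p (bump q)   = ⊥-elim (<-asym p q)
Ins-app-app app        p (skip q app) = refl
Ins-app-app (skip q d) p (bump r)   = ⊥-elim (<-asym r (<-trans q p))
Ins-app-app (skip q d) p spec       = ⊥-elim (<-asym p q)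
Ins-app-app (skip q d) p (skip r e) = Ins-app-app d p e

Ins-out-< : ∀ {T b T₁ c T₂ e d} → Inc T → Ins T b T₁ (e ∷ []) → b < c → Ins T₁ c T₂ (d ∷ []) → e < d
Ins-out-< i       (bump _)   p (bump q)   = ⊥-elim (<-asym p q)
Ins-out-< i       (bump _)   p spec       = ⊥-elim (<-irrefl refl p)
Ins-out-< (q ∷ i) (bump _)   p (skip _ d) = All.head (Ins-out-All d q)
Ins-out-< i       spec       p (bump q)   = ⊥-elim (<-asym p q)
Ins-out-< i       spec       p spec       = ⊥-elim (<-irrefl refl p)
Ins-out-< i       spec       p (skip _ d) = ≤-<-trans p (Ins-out> d)
Ins-out-< i       (skip q d) p (bump r)   = ⊥-elim (<-asym r (<-trans q p))
Ins-out-< i       (skip q d) p spec       = ⊥-elim (<-asym p q)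
Ins-out-< (_ ∷ i) (skip q d) p (skip r e) = Ins-out-< i d p e

Ins-smaller : ∀ {T c T₁ o b T₂ o'} → Ins T c T₁ o → b < c → Ins T₁ b T₂ o' → ∃ λ f → (o' ≡ f ∷ []) × (f ≤ c)
Ins-smaller app        p (bump q)   = _ , refl , ≤-refl
Ins-smaller app        p (skip q _) = ⊥-elim (<-asym p q)
Ins-smaller (bump r)   p (bump q)   = _ , refl , ≤-refl
Ins-smaller (bump r)   p spec       = ⊥-elim (<-irrefl refl p)
Ins-smaller (bump r)   p (skip q _) = ⊥-elim (<-asym p q)
Ins-smaller spec       p (bump q)   = _ , refl , ≤-refl
Ins-smaller spec       p spec       = ⊥-elim (<-irrefl refl p)
Ins-smaller spec       p (skip q _) = ⊥-elim (<-asym p q)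
Ins-smaller (skip r d) p (bump q)   = _ , refl , <⇒≤ r
Ins-smaller (skip r d) p spec       = _ , refl , p
Ins-smaller (skip r d) p (skip q e) = Ins-smaller d p e

data RIns : Word → Word → Word → Word → Set where
  []  : ∀ {R} → RIns R [] R []
  _∷_ : ∀ {R x w R₁ R₂ o₁ o₂} → Ins R x R₁ o₁ → RIns R₁ w R₂ o₂ → RIns R (x ∷ w) R₂ (o₁ ++ o₂)

swapOut : ∀ {e y o} → y < e → ≤1 o → All (e <_) o → (e ∷ y ∷ o ++ []) ∼ (e ∷ o ++ y ∷ [])
swapOut p none    q       = ∼refl
swapOut p (one z) (q ∷ _) = ∼tri (bac p q)

-- Recursion along the row while all three letters skip its head. Otherwise `a` acts on the head and
-- `c` behind it, so that they can be interchanged, and the letters they bump are exchanged by a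
-- `bac` move whenever both exist.
triple-bac : ∀ {a b c R R₁ R₂ R₃ o₁ o₂ o₃} → Inc R → a < b → b < c →
  Ins R b R₁ o₁ → Ins R₁ a R₂ o₂ → Ins R₂ c R₃ o₃ →
  ∃ λ S → ∃ λ p → ∃ λ q → Ins R₁ c S p × Ins S a R₃ q × (o₁ ++ o₂ ++ o₃ ++ []) ∼ (o₁ ++ p ++ q ++ [])
triple-bac i ab bc app (bump p) (bump q) = ⊥-elim (<-asym q (<-trans ab bc))
triple-bac i ab bc app (bump p) (skip q app) = _ , _ , _ , skip bc app , bump ab , ∼refl
triple-bac i ab bc app (skip p d) _ = ⊥-elim (<-asym p ab)
triple-bac (y< ∷ i) ab bc (bump b<y) (bump p) (skip q d₃) = _ , _ , _ , skip bc d₃ , bump ab , swapOut b<y (Ins-≤1 d₃) (Ins-out-All d₃ y<)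
triple-bac i ab bc (bump b<y) (bump p) (bump q) = ⊥-elim (<-asym q (<-trans ab bc))
triple-bac i ab bc (bump b<y) (bump p) spec = ⊥-elim (<-asym bc ab)
triple-bac i ab bc (bump b<y) spec d₃ = ⊥-elim (<-irrefl refl ab)
triple-bac i ab bc (bump b<y) (skip p d) d₃ = ⊥-elim (<-asym p ab)
triple-bac {b = b} {c} i ab bc spec (bump p) (skip q d₃) = _ , _ , _ , skip bc d₃ , bump ab , swapOut (n<1+n _) (Ins-≤1 d₃) (go (Ins-≤1 d₃) d₃)
  where
  go : ∀ {o S T} → ≤1 o → Ins S c T o → All (suc b <_) o
  go none    d = []
  go (one z) d = ≤-<-trans bc (Ins-out> d) ∷ []
triple-bac i ab bc spec (bump p) (bump q) = ⊥-elim (<-asym q (<-trans ab bc))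
triple-bac i ab bc spec (bump p) spec = ⊥-elim (<-asym bc ab)
triple-bac i ab bc spec spec d₃ = ⊥-elim (<-irrefl refl ab)
triple-bac i ab bc spec (skip p d) d₃ = ⊥-elim (<-asym p ab)
triple-bac i ab bc (skip yb d₁) (bump p) (bump q) = ⊥-elim (<-asym q (<-trans ab bc))
triple-bac i ab bc (skip yb d₁) (bump p) spec = ⊥-elim (<-asym bc ab)
triple-bac {b = b} {c} (_ ∷ i) ab bc (skip {y = y} yb d₁) (bump p) (skip q d₃) =
  _ , _ , _ , skip (<-trans yb bc) d₃ , bump p , go i (Ins-≤1 d₁) d₁ (Ins-≤1 d₃) d₃
  where
  go : ∀ {R S T o₁ o₃} → Inc R → ≤1 o₁ → Ins R b S o₁ → ≤1 o₃ → Ins S c T o₃ → (o₁ ++ y ∷ o₃ ++ []) ∼ (o₁ ++ o₃ ++ y ∷ [])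
  go i none    d₁ l       d₃ rewrite Ins-app-app d₁ bc d₃ = ∼refl
  go i (one e) d₁ none    d₃ = ∼refl
  go i (one e) d₁ (one d) d₃ = ∼tri (bac (<-trans yb (Ins-out> d₁)) (Ins-out-< i d₁ bc d₃))
triple-bac i ab bc (skip yb d₁) spec (bump q) = ⊥-elim (<-asym q (<-trans ab bc))
triple-bac i ab bc (skip yb d₁) spec spec = ⊥-elim (<-asym bc ab)
triple-bac i ab bc (skip yb d₁) spec (skip q (bump r)) = ⊥-elim (<⇒≱ (<-trans ab bc) (≤-pred r))
triple-bac i ab bc (skip yb d₁) spec (skip q spec) = ⊥-elim (<⇒≱ bc ab)
triple-bac {a} {b} {c} (_ ∷ i) ab bc (skip yb d₁) spec (skip q (skip r d₃)) =
  _ , _ , _ , skip q (skip r d₃) , spec , go i (Ins-≤1 d₁) d₁ (Ins-≤1 d₃) (skip r d₃)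
  where
  go : ∀ {R S T o₁ o₃} → Inc R → ≤1 o₁ → Ins R b S o₁ → ≤1 o₃ → Ins S c T o₃ → (o₁ ++ suc a ∷ o₃ ++ []) ∼ (o₁ ++ o₃ ++ suc a ∷ [])
  go i none    d₁ l       d₃ rewrite Ins-app-app d₁ bc d₃ = ∼refl
  go i (one e) d₁ none    d₃ = ∼refl
  go i (one e) d₁ (one d) d₃ = ∼tri (bac (≤-<-trans ab (Ins-out> d₁)) (Ins-out-< i d₁ bc d₃))
triple-bac i ab bc (skip yb d₁) (skip p d₂) (bump q) = ⊥-elim (<-asym q (<-trans p (<-trans ab bc)))
triple-bac i ab bc (skip yb d₁) (skip p d₂) spec = ⊥-elim (<-asym p (<-trans ab bc))
triple-bac (_ ∷ i) ab bc (skip yb d₁) (skip p d₂) (skip q d₃) with triple-bac i ab bc d₁ d₂ d₃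
... | S , o , o' , e , e' , r = _ , _ , _ , skip q e , skip p e' , r

triple-cab : ∀ {a b c R R₁ R₂ R₃ o₁ o₂ o₃} → Inc R → a < b → b < c →
  Ins R c R₁ o₁ → Ins R₁ a R₂ o₂ → Ins R₂ b R₃ o₃ →
  ∃ λ o → RIns R (a ∷ c ∷ b ∷ []) R₃ o × (o₁ ++ o₂ ++ o₃ ++ []) ∼ o
triple-cab i ab bc app (bump p) (bump q) = ⊥-elim (<-asym q ab)
triple-cab i ab bc app (bump p) (skip q app) = _ , app ∷ skip (<-trans ab bc) app ∷ skip ab (bump bc) ∷ [] , ∼refl
triple-cab i ab bc app (skip p d) d₃ = ⊥-elim (<-asym p (<-trans ab bc))
triple-cab i ab bc (bump cy) (bump p) (bump q) = ⊥-elim (<-asym q ab)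
triple-cab i ab bc (bump cy) (bump p) spec = ⊥-elim (<-irrefl refl ab)
triple-cab i ab bc (bump cy) (bump p) (skip q app) = _ , bump (<-trans p cy) ∷ skip (<-trans ab bc) app ∷ skip ab (bump bc) ∷ [] , ∼refl
triple-cab ((yt ∷ _) ∷ i) ab bc (bump cy) (bump p) (skip q (bump r)) =
  _ , bump (<-trans p cy) ∷ skip p (bump (<-trans cy yt)) ∷ skip q (bump bc) ∷ [] , ∼tri (bac cy yt)
triple-cab ((yt ∷ _) ∷ i) ab bc (bump cy) (bump p) (skip q spec) = ⊥-elim (<-asym bc (<-trans cy yt))
triple-cab ((yt ∷ _) ∷ i) ab bc (bump cy) (bump p) (skip q (skip r d)) = ⊥-elim (<-asym r (<-trans bc (<-trans cy yt)))
triple-cab i ab bc (bump cy) spec d₃ = ⊥-elim (<-asym ab bc)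
triple-cab i ab bc (bump cy) (skip p d) d₃ = ⊥-elim (<-asym p (<-trans ab bc))
triple-cab i ab bc spec (bump p) (bump q) = ⊥-elim (<-asym q ab)
triple-cab i ab bc spec (bump p) (skip q (bump r)) = _ , bump p ∷ skip p (bump (n<1+n _)) ∷ skip q (bump bc) ∷ [] , ∼tri braid
triple-cab i ab bc spec (bump p) (skip q spec) = ⊥-elim (<-asym bc (n<1+n _))
triple-cab i ab bc spec (bump p) (skip q (skip r d)) = ⊥-elim (<-asym bc (<-trans (n<1+n _) r))
triple-cab i ab bc spec (bump p) spec = ⊥-elim (<-irrefl refl ab)
triple-cab i ab bc spec spec d₃ = ⊥-elim (<-asym ab bc)
triple-cab i ab bc spec (skip p d) d₃ = ⊥-elim (<-asym p (<-trans ab bc))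
triple-cab i ab bc (skip yc d₁) (bump p) (bump q) = ⊥-elim (<-asym q ab)
triple-cab i ab bc (skip yc d₁) (bump p) spec = ⊥-elim (<-irrefl refl ab)
triple-cab {a} {b} {c} (y< ∷ i) ab bc (skip {y = y} yc d₁) (bump p) (skip q d₃) =
  _ , bump p ∷ skip (<-trans ab bc) d₁ ∷ skip q d₃ ∷ [] , go (Ins-≤1 d₁) y< d₁ d₃
  where
  go : ∀ {R S T o₁ o₃} → ≤1 o₁ → All (y <_) R → Ins R c S o₁ → Ins S b T o₃ → (o₁ ++ y ∷ o₃ ++ []) ∼ (y ∷ o₁ ++ o₃ ++ [])
  go none    y< d₁ d₃ = ∼refl
  go (one d) y< d₁ d₃ with Ins-smaller d₁ bc d₃
  ... | f , refl , f≤c = ∼tri (cab (All.head (Ins-out-All d₃ (Ins-All d₁ y< yc))) (≤-<-trans f≤c (Ins-out> d₁)))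
triple-cab i ab bc (skip yc d₁) spec (bump q) = ⊥-elim (<-asym q ab)
triple-cab i ab bc (skip yc d₁) spec spec = ⊥-elim (<-irrefl refl ab)
triple-cab i ab bc (skip yc app) spec (skip q d₃) = ⊥-elim (<⇒≱ bc ab)
triple-cab i ab bc (skip yc (bump r)) spec (skip q d₃) = ⊥-elim (<⇒≱ bc ab)
triple-cab i ab bc (skip yc spec) spec (skip q d₃) = ⊥-elim (<⇒≱ bc ab)
triple-cab {a} {b} {c} (y< ∷ i) ab bc (skip yc (skip r d₁)) spec (skip q d₃) =
  _ , spec ∷ skip yc (skip r d₁) ∷ skip q d₃ ∷ [] , go (Ins-≤1 d₁) (skip r d₁) d₃
  where
  go : ∀ {R S T o₁ o₃} → ≤1 o₁ → Ins R c S o₁ → Ins S b T o₃ → (o₁ ++ suc a ∷ o₃ ++ []) ∼ (suc a ∷ o₁ ++ o₃ ++ [])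
  go none    d₁ d₃ = ∼refl
  go (one d) d₁ d₃ with Ins-smaller d₁ bc d₃
  ... | f , refl , f≤c = ∼tri (cab (≤-<-trans ab (Ins-out> d₃)) (≤-<-trans f≤c (Ins-out> d₁)))
triple-cab i ab bc (skip yc d₁) (skip p d₂) (bump q) = ⊥-elim (<-asym q (<-trans p ab))
triple-cab i ab bc (skip yc d₁) (skip p d₂) spec = ⊥-elim (<-asym p ab)
triple-cab (_ ∷ i) ab bc (skip yc d₁) (skip p d₂) (skip q d₃) with triple-cab i ab bc d₁ d₂ d₃
... | _ , e₁ ∷ e₂ ∷ e₃ ∷ [] , r = _ , skip p e₁ ∷ skip yc e₂ ∷ skip q e₃ ∷ [] , r

triple-braid : ∀ {i R R₁ R₂ R₃ o₁ o₂ o₃} → Inc R →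
  Ins R (suc i) R₁ o₁ → Ins R₁ i R₂ o₂ → Ins R₂ (suc i) R₃ o₃ →
  ∃ λ o → RIns R (i ∷ suc i ∷ i ∷ []) R₃ o × (o₁ ++ o₂ ++ o₃ ++ []) ∼ o
triple-braid I app (bump p) (bump q) = ⊥-elim (<-asym p q)
triple-braid I app (bump p) (skip q app) = _ , app ∷ skip q app ∷ spec ∷ [] , ∼refl
triple-braid I app (skip p d) d₃ = ⊥-elim (<-asym p (n<1+n _))
triple-braid I (bump iy) (bump p) (bump q) = ⊥-elim (<-asym p q)
triple-braid I (bump iy) (bump p) (skip q app) = _ , bump (<-trans p iy) ∷ skip q app ∷ spec ∷ [] , ∼refl
triple-braid ((yt ∷ _) ∷ I) (bump iy) (bump p) (skip q (bump r)) = _ , bump (<-trans p iy) ∷ skip q (bump r) ∷ spec ∷ [] , ∼tri (bac iy yt)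
triple-braid ((yt ∷ _) ∷ I) (bump iy) (bump p) (skip q spec) = ⊥-elim (<-asym iy yt)
triple-braid ((yt ∷ _) ∷ I) (bump iy) (bump p) (skip q (skip r d)) = ⊥-elim (<-asym r (<-trans iy yt))
triple-braid I (bump iy) (skip p d) d₃ = ⊥-elim (<-asym p (n<1+n _))
triple-braid I spec (bump p) (bump q) = ⊥-elim (<-asym p q)
triple-braid I spec (bump p) (skip q (bump r)) = _ , bump p ∷ skip q (bump r) ∷ spec ∷ [] , ∼tri braid
triple-braid I spec (bump p) (skip q (skip r d)) = ⊥-elim (<-asym r (n<1+n _))
triple-braid I spec (skip p d) d₃ = ⊥-elim (<-asym p (n<1+n _))
triple-braid I (skip yi d₁) (bump p) d₃ = ⊥-elim (<⇒≱ p (≤-pred yi))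
triple-braid I (skip yi d₁) spec (bump q) = ⊥-elim (<-asym q yi)
triple-braid I (skip yi d₁) spec (skip q (bump r)) = ⊥-elim (<-irrefl refl r)
triple-braid I (skip yi d₁) spec (skip q (skip r d)) = ⊥-elim (<-irrefl refl r)
triple-braid (_ ∷ (yz ∷ _) ∷ I) (skip yi (bump s)) spec (skip q spec) = ⊥-elim (<⇒≱ s (≤-pred yz))
triple-braid I (skip yi spec) spec (skip q spec) = _ , spec ∷ skip q spec ∷ spec ∷ [] , ∼tri braid
triple-braid I (skip yi (skip s d₁)) spec (skip q spec) = ⊥-elim (<-irrefl refl s)
triple-braid I (skip yi d₁) (skip p d₂) (bump q) = ⊥-elim (<-asym q yi)
triple-braid I (skip yi d₁) (skip p d₂) spec = ⊥-elim (<-irrefl refl yi)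
triple-braid (_ ∷ I) (skip yi d₁) (skip p d₂) (skip q d₃) with triple-braid I d₁ d₂ d₃
... | _ , e₁ ∷ e₂ ∷ e₃ ∷ [] , r = _ , skip p e₁ ∷ skip q e₂ ∷ skip p e₃ ∷ [] , r

-- An elementary relation passes through a row: the final row is the same and the bumped words are
-- again equivalent. The next row can therefore be treated alike, which makes the shape an invariant
-- of the class.
triple : ∀ {x y z x' y' z' R R₃ o} → Inc R → Tri x y z x' y' z' → RIns R (x ∷ y ∷ z ∷ []) R₃ o →
  ∃ λ o' → RIns R (x' ∷ y' ∷ z' ∷ []) R₃ o' × o ∼ o'
triple i (bac p q) (d₁ ∷ d₂ ∷ d₃ ∷ []) with triple-bac i p q d₁ d₂ d₃
... | _ , _ , _ , e₂ , e₃ , r = _ , d₁ ∷ e₂ ∷ e₃ ∷ [] , r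
triple i (cab p q) (d₁ ∷ d₂ ∷ d₃ ∷ []) = triple-cab i p q d₁ d₂ d₃
triple i braid     (d₁ ∷ d₂ ∷ d₃ ∷ []) = triple-braid i d₁ d₂ d₃

-- Insertion of words; the shape of a reduced word

rins routs : Word → Word → Word
rins R []       = R
rins R (x ∷ w)  = rins (insRow R x) w
routs R []      = []
routs R (x ∷ w) = insOut R x ++ routs (insRow R x) w

rins-++ : ∀ R u v → rins R (u ++ v) ≡ rins (rins R u) v
rins-++ R []      v = refl
rins-++ R (x ∷ u) v = rins-++ (insRow R x) u v

routs-++ : ∀ R u v → routs R (u ++ v) ≡ routs R u ++ routs (rins R u) v
routs-++ R []      v = refl
routs-++ R (x ∷ u) v = trans (cong (insOut R x ++_) (routs-++ (insRow R x) u v)) (sym (++-assoc (insOut R x) _ _))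

RIns-rins : ∀ {R w R' o} → RIns R w R' o → (rins R w ≡ R') × (routs R w ≡ o)
RIns-rins [] = refl , refl
RIns-rins (d ∷ ds) rewrite Ins-insRow d | Ins-insOut d with RIns-rins ds
... | refl , refl = refl , refl

∷ʳ-++ : ∀ (R : Word) x w → (R ∷ʳ x) ++ w ≡ R ++ x ∷ w
∷ʳ-++ R x w = ++-assoc R (x ∷ []) w

++-∷ʳ : ∀ (s V : Word) x → s ++ (V ∷ʳ x) ≡ (s ++ V) ∷ʳ x
++-∷ʳ s V x = sym (++-assoc s V (x ∷ []))

Red-Ins : ∀ {R x R' o w} → Inc R → Ins R x R' o → Red (R ++ x ∷ w) → Red (R' ++ w)
Red-Ins {R} {x} {R'} {o} {w} i d r = Red-suffix o _ (subst Red (++-assoc o R' w) (Red-∼ (∼-++ʳ w (Ins-∼ i d)) (subst Red (sym (∷ʳ-++ R x w)) r)))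

RIns-total : ∀ {R} w → Inc R → Red (R ++ w) → RIns R w (rins R w) (routs R w)
RIns-total []      i r = []
RIns-total {R} (x ∷ w) i r = d ∷ RIns-total w (Ins-Inc i d) (Red-Ins i d r)
  where d = Ins-total x i (Red-prefix (R ∷ʳ x) w (subst Red (sym (∷ʳ-++ R x w)) r))

RIns-Inc : ∀ {R w R' o} → Inc R → RIns R w R' o → Inc R'
RIns-Inc i []       = i
RIns-Inc i (d ∷ ds) = RIns-Inc (Ins-Inc i d) ds

RIns-∼ : ∀ {R w R' o} → Inc R → RIns R w R' o → (R ++ w) ∼ (o ++ R')
RIns-∼ {R} i [] = ∼≡ (++-identityʳ R)
RIns-∼ {R} i (_∷_ {x = x} {w} {R₁} {R₂} {o₁} {o₂} d ds) =
  ∼trans (∼≡ (sym (∷ʳ-++ R x w))) (∼trans (∼-++ʳ w (Ins-∼ i d)) (∼trans (∼≡ (++-assoc o₁ R₁ w))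
    (∼trans (∼-++ˡ o₁ (RIns-∼ (Ins-Inc i d) ds)) (∼≡ (sym (++-assoc o₁ o₂ R₂))))))

rins-replace : ∀ {R m m' R₃ o o'} u → RIns R m R₃ o → RIns R m' R₃ o' → o ∼ o' → (rins R (m ++ u) ≡ rins R (m' ++ u)) × (routs R (m ++ u) ∼ routs R (m' ++ u))
rins-replace {R} {m} {m'} u d e s with RIns-rins d | RIns-rins e
... | p , q | p' , q' =
  trans (rins-++ R m u) (trans (cong (λ S → rins S u) (trans p (sym p'))) (sym (rins-++ R m' u))) ,
  ∼trans (∼≡ (trans (routs-++ R m u) (cong₂ (λ o S → o ++ routs S u) q p))) (∼trans (∼-++ʳ _ s)
    (∼≡ (sym (trans (routs-++ R m' u) (cong₂ (λ o S → o ++ routs S u) q' p')))))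

rins-tri : ∀ {R x y z x' y' z' R₃ o} u → Inc R → Tri x y z x' y' z' → RIns R (x ∷ y ∷ z ∷ []) R₃ o →
  (rins R (x ∷ y ∷ z ∷ u) ≡ rins R (x' ∷ y' ∷ z' ∷ u)) × (routs R (x ∷ y ∷ z ∷ u) ∼ routs R (x' ∷ y' ∷ z' ∷ u))
rins-tri {R} {x} {y} {z} {x'} {y'} {z'} u i t d = rins-replace {R} {x ∷ y ∷ z ∷ []} {x' ∷ y' ∷ z' ∷ []} u d (proj₁ (proj₂ (triple i t d))) (proj₂ (proj₂ (triple i t d)))

rins-∼ : ∀ {u v} → u ∼ v → ∀ R → Inc R → Red (R ++ u) → (rins R u ≡ rins R v) × (routs R u ∼ routs R v)
rins-∼ (∼tri {x} {y} {z} {u = u} t) R i r =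
  rins-tri u i t (RIns-total (x ∷ y ∷ z ∷ []) i (Red-prefix (R ++ x ∷ y ∷ z ∷ []) u (subst Red (sym (++-assoc R (x ∷ y ∷ z ∷ []) u)) r)))
rins-∼ (∼cons x {u} p) R i r with rins-∼ p (insRow R x) (Ins-Inc i d) (Red-Ins i d r)
  where d = Ins-total x i (Red-prefix (R ∷ʳ x) u (subst Red (sym (∷ʳ-++ R x u)) r))
... | a , b = a , ∼-++ˡ (insOut R x) b
rins-∼ ∼refl R i r = refl , ∼refl
rins-∼ (∼sym p) R i r with rins-∼ p R i (Red-∼ (∼-++ˡ R (∼sym p)) r)
... | a , b = sym a , ∼sym b
rins-∼ (∼trans p q) R i r with rins-∼ p R i r | rins-∼ q R i (Red-∼ (∼-++ˡ R p) r)
... | a , b | c , d = trans a c , ∼trans b d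

row out : Word → Word
row w = rins [] w
out w = routs [] w

-- Length of row `r`, counted from 0, of the Edelman-Greene tableau: the word bumped out of one row
-- is inserted into the next.
sh : Word → ℕ → ℕ
sh w zero    = length (row w)
sh w (suc r) = sh (out w) r

∼-out-row : ∀ {w} → Red w → w ∼ (out w ++ row w)
∼-out-row {w} r = RIns-∼ [] (RIns-total w [] r)

Red-out : ∀ {w} → Red w → Red (out w)
Red-out {w} r = Red-prefix (out w) (row w) (Red-∼ (∼-out-row r) r)

Inc-row : ∀ {w} → Red w → Inc (row w)
Inc-row {w} r = RIns-Inc [] (RIns-total w [] r)

row-∷ʳ : ∀ w x → row (w ∷ʳ x) ≡ insRow (row w) x
row-∷ʳ w x = rins-++ [] w (x ∷ [])

out-∷ʳ : ∀ w x → out (w ∷ʳ x) ≡ out w ++ insOut (row w) x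
out-∷ʳ w x = trans (routs-++ [] w (x ∷ [])) (cong (out w ++_) (++-identityʳ _))

row-Ins : ∀ w x → Red (w ∷ʳ x) → ∃ λ o → Ins (row w) x (row (w ∷ʳ x)) o × (out (w ∷ʳ x) ≡ out w ++ o)
row-Ins w x r = insOut (row w) x , subst (λ S → Ins (row w) x S (insOut (row w) x)) (sym (row-∷ʳ w x))
  (Ins-total x (Inc-row (Red-prefix w (x ∷ []) r)) (Red-suffix (out w) _ (subst Red (++-assoc (out w) (row w) (x ∷ [])) (Red-∼ (∼-++ʳ (x ∷ []) (∼-out-row (Red-prefix w (x ∷ []) r))) r)))) , out-∷ʳ w x

data Grow : Word → ℕ → ℕ → Set where
  stop : ∀ {w x} → Ins (row w) x (row (w ∷ʳ x)) [] → out (w ∷ʳ x) ≡ out w → Grow w x 0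
  next : ∀ {w x y r} → Ins (row w) x (row (w ∷ʳ x)) (y ∷ []) → out (w ∷ʳ x) ≡ out w ∷ʳ y → Grow (out w) y r → Grow w x (suc r)

-- The Kronecker delta, as a number, so that adding a box is adding a function.
ι : ℕ → ℕ → ℕ
ι zero    zero    = 1
ι zero    (suc s) = 0
ι (suc r) zero    = 0
ι (suc r) (suc s) = ι r s

ι-refl : ∀ r → ι r r ≡ 1
ι-refl zero    = refl
ι-refl (suc r) = ι-refl r

ι-≢ : ∀ {r s} → r ≢ s → ι r s ≡ 0
ι-≢ {zero}  {zero}  p = ⊥-elim (p refl)
ι-≢ {zero}  {suc s} p = refl
ι-≢ {suc r} {zero}  p = refl
ι-≢ {suc r} {suc s} p = ι-≢ (p ∘ cong suc)

ι-pos : ∀ r s → 1 ≤ ι r s → r ≡ s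
ι-pos zero    zero    p = refl
ι-pos (suc r) (suc s) p = cong suc (ι-pos r s p)

-- The trace of `Grow` on shapes. As it mentions no bumped letters, it is transported along `∼` at
-- once; `GrowsAt⇒Grow` recovers the insertion path.
record GrowsAt (w : Word) (x r : ℕ) : Set where
  constructor growsAt
  field grown : ∀ s → sh (w ∷ʳ x) s ≡ sh w s + ι r s
open GrowsAt

Ins-length : ∀ {R x R' o} → Ins R x R' o → length R' + length o ≡ suc (length R)
Ins-length app          = refl
Ins-length (bump {R = R} _) = +-comm (suc (length R)) 1
Ins-length (spec {R = R}) = +-comm (suc (suc (length R))) 1
Ins-length (skip _ d)   = cong suc (Ins-length d)

Grow-sh : ∀ {w x r} → Grow w x r → ∀ s → sh (w ∷ʳ x) s ≡ sh w s + ι r s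
Grow-sh (stop d e)   zero    = trans (sym (+-identityʳ _)) (trans (Ins-length d) (+-comm 1 _))
Grow-sh {w} (stop d e) (suc s) rewrite e = sym (+-identityʳ _)
Grow-sh (next d e g) zero    = trans (suc-injective (trans (+-comm 1 _) (Ins-length d))) (sym (+-identityʳ _))
Grow-sh (next d e g) (suc s) rewrite e = Grow-sh g s

length-out-row : ∀ {w} → Red w → length w ≡ length (out w) + length (row w)
length-out-row {w} r = trans (∼-length (∼-out-row r)) (length-++ (out w))

Ins-nonempty : ∀ {R x R' z} → Ins R x R' (z ∷ []) → 1 ≤ length R
Ins-nonempty (bump _)   = s≤s z≤n
Ins-nonempty spec       = s≤s z≤n
Ins-nonempty (skip _ _) = s≤s z≤n

grow-bounded : ∀ n w x → length w ≤ n → Red (w ∷ʳ x) → ∃ (Grow w x)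
grow-bounded n w x l r with row-Ins w x r
... | o , d , e with Ins-≤1 d
grow-bounded n w x l r | _ , d , e | none = 0 , stop d (trans e (++-identityʳ _))
grow-bounded n w x l r | _ , d , e | one y = go n l
  where
  shorter : length (out w) < length w
  shorter = lin (length (out w) ∷ length (row w) ∷ length w ∷ [])
    ((# 0 ⊕ # 1 ≼ # 2 by ≤-reflexive (sym (length-out-row (Red-prefix w (x ∷ []) r)))) ∷ (! 1 ≼ # 1 by Ins-nonempty d) ∷ []) (! 1 ⊕ # 0) (# 2)
  go : ∀ n → length w ≤ n → ∃ (Grow w x)
  go zero    l = ⊥-elim (<⇒≱ shorter (≤-trans l z≤n))
  go (suc n) l with grow-bounded n (out w) y (≤-pred (<-≤-trans shorter l)) (subst Red e (Red-out r))
  ... | q , g = suc q , next d e g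

abstract
  grow : ∀ w x → Red (w ∷ʳ x) → ∃ (Grow w x)
  grow w x = grow-bounded (length w) w x ≤-refl

GrowsAt-injective : ∀ {w x r r'} → GrowsAt w x r → GrowsAt w x r' → r ≡ r'
GrowsAt-injective {w} {x} {r} {r'} g g' = sym (ι-pos r' r (subst (1 ≤_) (trans (sym (ι-refl r)) (+-cancelˡ-≡ (sh w r) _ _ (trans (sym (grown g r)) (grown g' r)))) ≤-refl))

GrowsAt⇒Grow : ∀ {w x r} → Red (w ∷ʳ x) → GrowsAt w x r → Grow w x r
GrowsAt⇒Grow {w} {x} {r} red g with grow w x red
... | q , h rewrite GrowsAt-injective {w} {x} {r} {q} g (growsAt (Grow-sh h)) = h

grows : ∀ w x → Red (w ∷ʳ x) → ∃ (GrowsAt w x)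
grows w x r = proj₁ (grow w x r) , growsAt (Grow-sh (proj₂ (grow w x r)))

sh-∼ : ∀ {u v} → Red u → u ∼ v → ∀ r → sh u r ≡ sh v r
sh-∼ r p zero    = cong length (proj₁ (rins-∼ p [] [] r))
sh-∼ r p (suc q) = sh-∼ (Red-out r) (proj₂ (rins-∼ p [] [] r)) q

GrowsAt-∼ : ∀ {w w' x r} → Red (w ∷ʳ x) → w ∼ w' → GrowsAt w x r → GrowsAt w' x r
GrowsAt-∼ {w} {w'} {x} {r} red p g = growsAt λ s → trans (sym (sh-∼ red (∼-++ʳ (x ∷ []) p) s)) (trans (grown g s) (cong (_+ ι r s) (sh-∼ (Red-prefix w _ red) p s)))

-- In every row the letters bumped by an ascent form an ascent again (`Ins-out-<`), and where the
-- first path stops the second one stops too.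
Grow-≤ : ∀ {w x y p q} → Red w → x < y → Grow w x p → Grow (w ∷ʳ x) y q → q ≤ p
Grow-≤ r x<y g            (stop d e)   = z≤n
Grow-≤ r x<y (stop d' e') (next d e h) with Ins-app-app d' x<y d
... | ()
Grow-≤ r x<y (next d' e' g) (next d e h) = s≤s (Grow-≤ (Red-out r) (Ins-out-< (Inc-row r) d' x<y d) g (subst (λ t → Grow t _ _) e' h))

Grow-> : ∀ {w x y p q} → y < x → Grow w x p → Grow (w ∷ʳ x) y q → p < q
Grow-> y<x (stop d' e')   (stop d e) with Ins-smaller d' y<x d
... | _ , () , _
Grow-> y<x (next d' e' g) (stop d e) with Ins-smaller d' y<x d
... | _ , () , _
Grow-> y<x (stop d' e')   (next d e h) = s≤s z≤n
Grow-> y<x (next d' e' g) (next d e h) with Ins-smaller d' y<x d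
... | f , refl , f≤x = s≤s (Grow-> (≤-<-trans f≤x (Ins-out> d')) g (subst (λ t → Grow t _ _) e' h))

Red-≢ : ∀ w x y → Red ((w ∷ʳ x) ∷ʳ y) → x ≢ y
Red-≢ w x .x r refl = Red-square x [] [] [] (Red-suffix w _ (subst Red (∷ʳ-++ w x (x ∷ [])) r))

ascent-rows : ∀ {w x y p q} → Red ((w ∷ʳ x) ∷ʳ y) → GrowsAt w x p → GrowsAt (w ∷ʳ x) y q → x < y → q ≤ p
ascent-rows {w} {x} {y} r g h x<y = Grow-≤ (Red-prefix w _ r') x<y (GrowsAt⇒Grow r' g) (GrowsAt⇒Grow r h)
  where r' = Red-prefix (w ∷ʳ x) (y ∷ []) r

descent-rows : ∀ {w x y p q} → Red ((w ∷ʳ x) ∷ʳ y) → GrowsAt w x p → GrowsAt (w ∷ʳ x) y q → y < x → p < q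
descent-rows {w} {x} {y} r g h y<x = Grow-> y<x (GrowsAt⇒Grow r' g) (GrowsAt⇒Grow r h)
  where r' = Red-prefix (w ∷ʳ x) (y ∷ []) r

rows-ascent : ∀ {w x y p q} → Red ((w ∷ʳ x) ∷ʳ y) → GrowsAt w x p → GrowsAt (w ∷ʳ x) y q → q ≤ p → x < y
rows-ascent {w} {x} {y} r g h q≤p with <-cmp x y
... | tri< l _ _ = l
... | tri≈ _ e _ = ⊥-elim (Red-≢ w x y r e)
... | tri> _ _ l = ⊥-elim (<⇒≱ (descent-rows r g h l) q≤p)

rows-descent : ∀ {w x y p q} → Red ((w ∷ʳ x) ∷ʳ y) → GrowsAt w x p → GrowsAt (w ∷ʳ x) y q → p < q → y < x
rows-descent {w} {x} {y} r g h p<q with <-cmp x y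
... | tri< l _ _ = ⊥-elim (<⇒≱ p<q (ascent-rows r g h l))
... | tri≈ _ e _ = ⊥-elim (Red-≢ w x y r e)
... | tri> _ _ l = l

-- Column-strictness of two consecutive rows, which makes shapes partitions. With the roles of the
-- factors exchanged it later expresses that the raising operator leaves no letter unpaired.
data Dom : Word → Word → Set where
  []  : ∀ {R} → Dom R []
  _∷_ : ∀ {x y R S} → x < y → Dom R S → Dom (x ∷ R) (y ∷ S)

Dom-mono : ∀ {R x R' o S} → Ins R x R' o → Dom R S → Dom R' S
Dom-mono d          []      = []
Dom-mono (bump q)   (p ∷ D) = <-trans q p ∷ D
Dom-mono spec       (p ∷ D) = p ∷ D
Dom-mono (skip q d) (p ∷ D) = p ∷ Dom-mono d D

Dom-Ins : ∀ {R S x R' y S' o} → Dom R S → Ins R x R' (y ∷ []) → Ins S y S' o → Dom R' S'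
Dom-Ins [] d app with Ins-head< d
... | _ , _ , refl , l = l ∷ []
Dom-Ins (p ∷ D) (bump q)   (bump s)   = q ∷ D
Dom-Ins (p ∷ D) (bump q)   spec       = ⊥-elim (<-irrefl refl p)
Dom-Ins (p ∷ D) (bump q)   (skip s e) = ⊥-elim (<-asym p s)
Dom-Ins (p ∷ D) spec       (bump s)   = n<1+n _ ∷ D
Dom-Ins (p ∷ D) spec       spec       = p ∷ D
Dom-Ins (p ∷ D) spec       (skip s e) = ⊥-elim (<⇒≱ p (≤-pred s))
Dom-Ins (p ∷ D) (skip q d) (bump s)   = <-trans q (Ins-out> d) ∷ Dom-mono d D
Dom-Ins (p ∷ D) (skip q d) spec       = p ∷ Dom-mono d D
Dom-Ins (p ∷ D) (skip q d) (skip s e) = p ∷ Dom-Ins D d e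

Dom-length : ∀ {R S} → Dom R S → length S ≤ length R
Dom-length []      = z≤n
Dom-length (_ ∷ D) = s≤s (Dom-length D)

Dom-row′ : ∀ {w} → Reverse w → Red w → Dom (row w) (row (out w))
Dom-row′ [] r = []
Dom-row′ (w ∶ v ∶ʳ x) r with row-Ins w x r
... | o , d , e with Ins-≤1 d
... | none rewrite trans e (++-identityʳ (out w)) = Dom-mono d (Dom-row′ v (Red-prefix w _ r))
... | one y with row-Ins (out w) y (subst Red e (Red-out r))
...   | o' , d' , e' rewrite e = Dom-Ins (Dom-row′ v (Red-prefix w _ r)) d d'

Dom-row : ∀ {w} → Red w → Dom (row w) (row (out w))
Dom-row {w} = Dom-row′ (reverseView w)

sh-part : ∀ {w} → Red w → ∀ r → sh w (suc r) ≤ sh w r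
sh-part r zero    = Dom-length (Dom-row r)
sh-part r (suc s) = sh-part (Red-out r) s

antitone : ∀ {f : ℕ → ℕ} → (∀ r → f (suc r) ≤ f r) → ∀ {r s} → r ≤ s → f s ≤ f r
antitone {f} p {r} {s} l with m≤n⇒∃[o]m+o≡n l
... | k , refl = go k
  where
  go : ∀ k → f (r + k) ≤ f r
  go zero    = ≤-reflexive (cong f (+-identityʳ r))
  go (suc k) = ≤-trans (≤-trans (≤-reflexive (cong f (+-suc r k))) (p (r + k))) (go k)

sh-anti : ∀ {w} → Red w → ∀ {r s} → r ≤ s → sh w s ≤ sh w r
sh-anti r = antitone (sh-part r)

length-insRow : ∀ R x → length R ≤ length (insRow R x)
length-insRow []      x = z≤n
length-insRow (y ∷ R) x with <-cmp x y
... | tri< _ _ _ = ≤-refl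
... | tri≈ _ _ _ = ≤-refl
... | tri> _ _ _ = s≤s (length-insRow R x)

length-rins : ∀ R w → length R ≤ length (rins R w)
length-rins R []      = ≤-refl
length-rins R (x ∷ w) = ≤-trans (length-insRow R x) (length-rins (insRow R x) w)

length-out : ∀ {w n} → Red w → length w ≤ suc n → length (out w) ≤ n
length-out {[]}    r l = z≤n
length-out {x ∷ w} {n} r l = lin (length (out (x ∷ w)) ∷ length (row (x ∷ w)) ∷ length (x ∷ w) ∷ n ∷ [])
  ((# 0 ⊕ # 1 ≼ # 2 by ≤-reflexive (sym (length-out-row r))) ∷ (! 1 ≼ # 1 by length-rins (x ∷ []) w) ∷ (# 2 ≼ ! 1 ⊕ # 3 by l) ∷ []) (# 0) (# 3)

sh-zero : ∀ {w} r → Red w → length w ≤ r → sh w r ≡ 0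
sh-zero {[]} zero red l = refl
sh-zero (suc r) red l = sh-zero r (Red-out red) (length-out red l)

sh-mono : ∀ s V → Red (s ++ V) → ∀ r → sh s r ≤ sh (s ++ V) r
sh-mono s V = go (reverseView V)
  where
  go : ∀ {V} → Reverse V → Red (s ++ V) → ∀ r → sh s r ≤ sh (s ++ V) r
  go [] red r = ≤-reflexive (cong (λ t → sh t r) (sym (++-identityʳ s)))
  go (V ∶ v ∶ʳ x) red r rewrite ++-∷ʳ s V x with grows (s ++ V) x red
  ... | q , g = ≤-trans (go v (Red-prefix (s ++ V) _ red) r) (≤-trans (m≤m+n _ _) (≤-reflexive (sym (grown g r))))

AP-∷ʳ : ∀ {R : ℕ → ℕ → Set} {V x} → AllPairs R V → All (λ v → R v x) V → AllPairs R (V ∷ʳ x)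
AP-∷ʳ []      []       = [] ∷ []
AP-∷ʳ (p ∷ a) (q ∷ qs) = Allₚ.++⁺ p (q ∷ []) ∷ AP-∷ʳ a qs

AP-∷ʳ⁻ : ∀ {R : ℕ → ℕ → Set} V {x} → AllPairs R (V ∷ʳ x) → AllPairs R V × All (λ v → R v x) V
AP-∷ʳ⁻ []      a       = [] , []
AP-∷ʳ⁻ (v ∷ V) (p ∷ a) with AP-∷ʳ⁻ V a
... | b , c = Allₚ.++⁻ˡ V p ∷ b , All.head (Allₚ.++⁻ʳ V p) ∷ c

AP-last : ∀ {R : ℕ → ℕ → Set} V {y x} → AllPairs R ((V ∷ʳ y) ∷ʳ x) → R y x
AP-last V {y} a = All.head (Allₚ.++⁻ʳ V (proj₂ (AP-∷ʳ⁻ (V ∷ʳ y) a)))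

AP-∷ʳ² : ∀ {R : ℕ → ℕ → Set} → (∀ {a b c} → R a b → R b c → R a c) → ∀ V {y x} → AllPairs R (V ∷ʳ y) → R y x → AllPairs R ((V ∷ʳ y) ∷ʳ x)
AP-∷ʳ² t V {y} a p = AP-∷ʳ a (Allₚ.++⁺ (All.map (λ q → t q p) (proj₂ (AP-∷ʳ⁻ V a))) (p ∷ []))

-- The row indices at which an increasing word grows weakly decrease, so no earlier letter has
-- reached a row before `q`.
strip-rows : ∀ s V x q → Inc (V ∷ʳ x) → Red ((s ++ V) ∷ʳ x) → GrowsAt (s ++ V) x q → ∀ {r} → r < q → sh (s ++ V) r ≡ sh s r
strip-rows s V x q = go (reverseView V) x q
  where
  go : ∀ {V} → Reverse V → ∀ x q → Inc (V ∷ʳ x) → Red ((s ++ V) ∷ʳ x) → GrowsAt (s ++ V) x q → ∀ {r} → r < q → sh (s ++ V) r ≡ sh s r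
  go [] x q i red g {r} l = cong (λ t → sh t r) (++-identityʳ s)
  go (V ∶ v ∶ʳ y) x q i red g {r} l rewrite ++-∷ʳ s V y with grows (s ++ V) y (Red-prefix ((s ++ V) ∷ʳ y) _ red)
  ... | p , h = trans (grown h r) (trans (cong (sh (s ++ V) r +_) (ι-≢ (>⇒≢ r<p))) (trans (+-identityʳ _) (go v y p (proj₁ (AP-∷ʳ⁻ (V ∷ʳ y) i)) (Red-prefix ((s ++ V) ∷ʳ y) _ red) h r<p)))
    where r<p = <-≤-trans l (ascent-rows red h g (AP-last V i))

-- When a letter lands in row `suc r`, row `r` still has the length it has in `s` by `strip-rows`,
-- and the new row must fit under it.
strip-interlace : ∀ s V → Inc V → Red (s ++ V) → ∀ r → sh (s ++ V) (suc r) ≤ sh s r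
strip-interlace s V = go (reverseView V)
  where
  go : ∀ {V} → Reverse V → Inc V → Red (s ++ V) → ∀ r → sh (s ++ V) (suc r) ≤ sh s r
  go [] i red r rewrite ++-identityʳ s = sh-part red r
  go (V ∶ v ∶ʳ x) i red r rewrite ++-∷ʳ s V x with grows (s ++ V) x red
  ... | q , g with q ≟ suc r
  ...   | no ne = ≤-trans (≤-reflexive (trans (grown g (suc r)) (trans (cong (sh (s ++ V) (suc r) +_) (ι-≢ ne)) (+-identityʳ _)))) (go v (proj₁ (AP-∷ʳ⁻ V i)) (Red-prefix (s ++ V) _ red) r)
  ...   | yes refl = ≤-trans (sh-part red r) (≤-reflexive (trans (grown g r) (trans (cong (sh (s ++ V) r +_) (ι-≢ {suc r} {r} (>⇒≢ (n<1+n r)))) (trans (+-identityʳ _) (strip-rows s V x (suc r) i red g (n<1+n r))))))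

-- Removing boxes at corners

Ins-All⁻ : ∀ {P : ℕ → Set} {R x R' o} → Ins R x R' o → All P R' → All P o → All P R
Ins-All⁻ app        _        _       = []
Ins-All⁻ (bump _)   (_ ∷ ps) (q ∷ _) = q ∷ ps
Ins-All⁻ spec       ps       _       = ps
Ins-All⁻ (skip _ d) (p ∷ ps) qs      = p ∷ Ins-All⁻ d ps qs

-- Reverse bumping takes out the last entry below `y`. If the entry after it equals `y`, reducedness
-- forces the two to be neighbours, and the special rule is undone.
unbump : ∀ {y z} R' → Inc (z ∷ R') → z < y → Red (y ∷ z ∷ R') → ∃ λ R → ∃ λ x → Ins R x (z ∷ R') (y ∷ []) × Inc R
unbump {y} {z} [] i z<y r = y ∷ [] , z , bump z<y , [] ∷ []
unbump {y} {z} (z₂ ∷ R₂) (z< ∷ i) z<y r with <-cmp z₂ y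
... | tri< z₂<y _ _ with unbump R₂ i z₂<y (Red-suffix (z ∷ []) _ (Red-∼ (∼tri (cab (All.head z<) z₂<y)) r))
...   | R , x , d , j = z ∷ R , x , skip (Ins-x d z<) d , Ins-All⁻ d z< (z<y ∷ []) ∷ j
unbump {y} {z} (z₂ ∷ R₂) (z< ∷ i) z<y r | tri> _ _ y<z₂ = y ∷ z₂ ∷ R₂ , z , bump z<y , (y<z₂ ∷ All.map (<-trans y<z₂) (AllPairs.head i)) ∷ i
unbump {y} {z} (.y ∷ R₂) (z< ∷ i) z<y r | tri≈ _ refl _ with suc z ≟ y
... | yes refl = _ , _ , spec , z< ∷ i
... | no ne = ⊥-elim (Red-square y (z ∷ []) R₂ (inj₂ (≤∧≢⇒< z<y ne) ∷ []) r)

Dom-head : ∀ {R S y} → Dom R S → Inc S → y ∈ S → ∃ λ z → ∃ λ R₀ → (R ≡ z ∷ R₀) × (z < y)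
Dom-head (p ∷ D) (s< ∷ i) (here refl) = _ , _ , refl , p
Dom-head (p ∷ D) (s< ∷ i) (there m)   = _ , _ , refl , <-trans p (All.lookup s< m)

snoc : ∀ (R : Word) → 1 ≤ length R → ∃ λ R₀ → ∃ λ x → R ≡ R₀ ∷ʳ x
snoc R l with reverseView R
snoc .[] () | []
... | R₀ ∶ _ ∶ʳ x = R₀ , x , refl

last-row-∈ : ∀ w x → Red (w ∷ʳ x) → x ∈ row (w ∷ʳ x)
last-row-∈ w x r = Ins-x (proj₁ (proj₂ (row-Ins w x r))) (All.tabulate id)

-- Any corner can be made the box of the last letter: the corner is removed from the rows after the
-- first, and the letter obtained is bumped backwards through the first row.
corner′ : ∀ r {ρ} → Red ρ → sh ρ (suc r) < sh ρ r → ∃ λ σ → ∃ λ x → (ρ ∼ σ ∷ʳ x) × GrowsAt σ x r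
corner′ zero {ρ} red lt with snoc (row ρ) (≤-trans (s≤s z≤n) lt)
... | R₀ , x , e = σ , x , eq , result
  where
  σ = out ρ ++ R₀
  eq : ρ ∼ σ ∷ʳ x
  eq = ∼trans (∼-out-row red) (∼≡ (trans (cong (out ρ ++_) e) (++-∷ʳ (out ρ) R₀ x)))
  redσ = Red-∼ eq red
  result : GrowsAt σ x 0
  result with grows σ x redσ
  ... | zero , g = g
  -- Here `strip-rows` would leave the first row as long as the second, contrary to `lt`.
  ... | suc q , g = ⊥-elim (<⇒≢ lt (sym (trans (sh-∼ red eq 0) (trans (grown g 0) (trans (+-identityʳ _) (strip-rows (out ρ) R₀ x (suc q) (subst Inc e (Inc-row red)) redσ g (s≤s z≤n)))))))
corner′ (suc r) {ρ} red lt with corner′ r (Red-out red) lt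
... | σ' , y , p , g' with Dom-head (Dom-row red) (Inc-row (Red-out red)) (subst (y ∈_) (sym (proj₁ (rins-∼ p [] [] (Red-out red)))) (last-row-∈ σ' y (Red-∼ p (Red-out red))))
...   | z , R' , e , z<y = finish (unbump R' (subst Inc e (Inc-row red)) z<y (Red-suffix σ' _ (Red-∼ eq red)))
  where
  eq : ρ ∼ σ' ++ y ∷ z ∷ R'
  eq = ∼trans (∼-out-row red) (∼trans (∼-++ʳ (row ρ) p) (∼≡ (trans (∷ʳ-++ σ' y (row ρ)) (cong (λ t → σ' ++ y ∷ t) e))))
  finish : (∃ λ R → ∃ λ x → Ins R x (z ∷ R') (y ∷ []) × Inc R) → ∃ λ σ → ∃ λ x → (ρ ∼ σ ∷ʳ x) × GrowsAt σ x (suc r)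
  finish (R , x , d , i) = σ' ++ R , x , eq' , result
    where
    eq' : ρ ∼ (σ' ++ R) ∷ʳ x
    eq' = ∼trans eq (∼trans (∼-++ˡ σ' (∼sym (Ins-∼ i d))) (∼≡ (++-∷ʳ σ' R x)))
    redσ = Red-∼ eq' red
    result : GrowsAt (σ' ++ R) x (suc r)
    result with grows (σ' ++ R) x redσ
    -- Interlacing bounds row `suc r` before the growth by row `r` of `σ'`, one less than its final
    -- length; so the box must have been added in that row.
    ... | q , g = subst (GrowsAt (σ' ++ R) x) (ι-pos q (suc r) (lin (sh (σ' ++ R) (suc r) ∷ sh σ' r ∷ ι q (suc r) ∷ [])
        ((# 0 ≼ # 1 by strip-interlace σ' R i (Red-prefix (σ' ++ R) _ redσ) r) ∷
         (# 1 ⊕ ! 1 ≼ # 0 ⊕ # 2 by ≤-reflexive (trans (cong (sh σ' r +_) (sym (ι-refl r))) (trans (sym (grown g' r)) (trans (sym (sh-∼ (Red-out red) p r)) (trans (sh-∼ red eq' (suc r)) (grown g (suc r))))))) ∷ []) (! 1) (# 2))) g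

abstract
  corner : ∀ r {ρ} → Red ρ → sh ρ (suc r) < sh ρ r → ∃ λ σ → ∃ λ x → (ρ ∼ σ ∷ʳ x) × GrowsAt σ x r
  corner = corner′

Ins-injective : ∀ {R S x x' R' y} → Inc R → Inc S → Ins R x R' (y ∷ []) → Ins S x' R' (y ∷ []) → (R ≡ S) × (x ≡ x')
Ins-injective i j (bump p) (bump q) = refl , refl
Ins-injective ((y< ∷ _) ∷ i) j (bump p) spec = ⊥-elim (<-irrefl refl y<)
Ins-injective (y< ∷ i) j (bump p) (skip q e) with Ins-head< e
... | _ , _ , refl , l = ⊥-elim (<-asym l (All.head y<))
Ins-injective i ((y< ∷ _) ∷ j) spec (bump p) = ⊥-elim (<-irrefl refl y<)
Ins-injective i j spec spec = refl , refl
Ins-injective i j spec (skip q e) = ⊥-elim (<⇒≱ (Ins-out> e) q)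
Ins-injective i (y< ∷ j) (skip q e) (bump p) with Ins-head< e
... | _ , _ , refl , l = ⊥-elim (<-asym l (All.head y<))
Ins-injective i j (skip q e) spec = ⊥-elim (<⇒≱ (Ins-out> e) q)
Ins-injective (_ ∷ i) (_ ∷ j) (skip q d) (skip q' e) with Ins-injective i j d e
... | refl , refl = refl , refl

Ins-app : ∀ {R x R'} → Ins R x R' [] → R' ≡ R ∷ʳ x
Ins-app app        = refl
Ins-app (skip _ d) = cong (_ ∷_) (Ins-app d)

Grow-injective : ∀ {σ σ' x x' r} → Red (σ ∷ʳ x) → Grow σ x r → Grow σ' x' r → (σ ∷ʳ x) ∼ (σ' ∷ʳ x') → (x ≡ x') × (σ ∼ σ')
Grow-injective {σ} {σ'} red (stop d e) (stop d' e') p with rins-∼ p [] [] red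
... | a , b with ∷ʳ-injective (row σ) (row σ') (trans (sym (Ins-app d)) (trans a (Ins-app d')))
...   | c , f = f , ∼trans (∼-out-row (Red-prefix σ _ red)) (∼trans (∼-++ˡ (out σ) (∼≡ c)) (∼trans (∼-++ʳ (row σ') (∼trans (∼≡ (sym e)) (∼trans b (∼≡ e')))) (∼sym (∼-out-row (Red-prefix σ' _ (Red-∼ p red))))))
Grow-injective {σ} {σ'} {x} {x'} red (next d e g) (next d' e' g') p with rins-∼ p [] [] red
... | a , b with Grow-injective (subst Red e (Red-out red)) g g' (∼trans (∼≡ (sym e)) (∼trans b (∼≡ e')))
...   | refl , q with Ins-injective (Inc-row (Red-prefix σ _ red)) (Inc-row (Red-prefix σ' _ (Red-∼ p red))) d (subst (λ t → Ins (row σ') x' t _) (sym a) d')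
...     | c , f = f , ∼trans (∼-out-row (Red-prefix σ _ red)) (∼trans (∼-++ˡ (out σ) (∼≡ c)) (∼trans (∼-++ʳ (row σ') q) (∼sym (∼-out-row (Red-prefix σ' _ (Red-∼ p red))))))

grow-unique′ : ∀ {σ σ' x x' r} → Red (σ ∷ʳ x) → GrowsAt σ x r → GrowsAt σ' x' r → (σ ∷ʳ x) ∼ (σ' ∷ʳ x') → (x ≡ x') × (σ ∼ σ')
grow-unique′ red g g' p = Grow-injective red (GrowsAt⇒Grow red g) (GrowsAt⇒Grow (Red-∼ p red) g') p

abstract
  grow-unique : ∀ {σ σ' x x' r} → Red (σ ∷ʳ x) → GrowsAt σ x r → GrowsAt σ' x' r → (σ ∷ʳ x) ∼ (σ' ∷ʳ x') → (x ≡ x') × (σ ∼ σ')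
  grow-unique = grow-unique′

sh-at : ∀ {w σ x r} → Red w → w ∼ σ ∷ʳ x → GrowsAt σ x r → sh w r ≡ suc (sh σ r)
sh-at {σ = σ} {r = r} red p g = trans (sh-∼ red p r) (trans (grown g r) (trans (cong (sh σ r +_) (ι-refl r)) (+-comm _ 1)))

sh-off : ∀ {w σ x r s} → Red w → w ∼ σ ∷ʳ x → GrowsAt σ x r → s ≢ r → sh w s ≡ sh σ s
sh-off {σ = σ} {r = r} {s} red p g ne = trans (sh-∼ red p s) (trans (grown g s) (trans (cong (sh σ s +_) (ι-≢ (ne ∘ sym))) (+-identityʳ _)))

-- By `strip-rows` the last letter grows at the first row in which inner and outer shape differ.
-- This row is the same for both factorizations, and `grow-unique` removes the two last letters
-- together.
strip-unique′ : ∀ s s' V V' → Inc V → Inc V' → Red (s ++ V) → (s ++ V) ∼ (s' ++ V') → (∀ r → sh s r ≡ sh s' r) → (V ≡ V') × (s ∼ s')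
strip-unique′ s s' V V' = go (reverseView V) (reverseView V')
  where
  full : ∀ s s' V x → Red ((s ++ V) ∷ʳ x) → s' ∼ ((s ++ V) ∷ʳ x) → (∀ r → sh s r ≡ sh s' r) → ⊥
  full s s' V x red p e with grows (s ++ V) x red
  ... | q , g = <⇒≢ (≤-trans (s≤s (sh-mono s V (Red-prefix (s ++ V) _ red) q)) (≤-reflexive (sym (sh-at (Red-∼ (∼sym p) red) p g)))) (e q)
  rows≤ : ∀ s s' V V' x x' q q' → Inc (V' ∷ʳ x') → Red ((s ++ V) ∷ʳ x) → ((s ++ V) ∷ʳ x) ∼ ((s' ++ V') ∷ʳ x') → (∀ r → sh s r ≡ sh s' r) →
          GrowsAt (s ++ V) x q → GrowsAt (s' ++ V') x' q' → q < q' → ⊥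
  rows≤ s s' V V' x x' q q' i red p e g g' l = <-irrefl (e q)
    (<-≤-trans (≤-trans (s≤s (sh-mono s V (Red-prefix (s ++ V) _ red) q)) (≤-reflexive (sym (sh-at red ∼refl g))))
      (≤-reflexive (trans (sh-off red p g' (<⇒≢ l)) (strip-rows s' V' x' q' i (Red-∼ p red) g' l))))
  go : ∀ {V V'} → Reverse V → Reverse V' → Inc V → Inc V' → Red (s ++ V) → (s ++ V) ∼ (s' ++ V') → (∀ r → sh s r ≡ sh s' r) → (V ≡ V') × (s ∼ s')
  go [] [] i i' red p e = refl , ∼trans (∼≡ (sym (++-identityʳ s))) (∼trans p (∼≡ (++-identityʳ s')))
  go [] (V' ∶ v' ∶ʳ x') i i' red p e rewrite ++-identityʳ s | ++-∷ʳ s' V' x' = ⊥-elim (full s' s V' x' (Red-∼ p red) p (λ r → sym (e r)))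
  go (V ∶ v ∶ʳ x) [] i i' red p e rewrite ++-identityʳ s' | ++-∷ʳ s V x = ⊥-elim (full s s' V x red (∼sym p) e)
  go (V ∶ v ∶ʳ x) (V' ∶ v' ∶ʳ x') i i' red p e rewrite ++-∷ʳ s V x | ++-∷ʳ s' V' x' with grows (s ++ V) x red | grows (s' ++ V') x' (Red-∼ p red)
  ... | q , g | q' , g' with <-cmp q q'
  ...   | tri< l _ _ = ⊥-elim (rows≤ s s' V V' x x' q q' i' red p e g g' l)
  ...   | tri> _ _ l = ⊥-elim (rows≤ s' s V' V x' x q' q i (Red-∼ p red) (∼sym p) (λ r → sym (e r)) g' g l)
  ...   | tri≈ _ refl _ with grow-unique red g g' p
  ...     | refl , p' with go v v' (proj₁ (AP-∷ʳ⁻ V i)) (proj₁ (AP-∷ʳ⁻ V' i')) (Red-prefix (s ++ V) _ red) p' e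
  ...       | refl , p'' = refl , p''

abstract
  strip-unique : ∀ s s' V V' → Inc V → Inc V' → Red (s ++ V) → (s ++ V) ∼ (s' ++ V') → (∀ r → sh s r ≡ sh s' r) → (V ≡ V') × (s ∼ s')
  strip-unique = strip-unique′

first-gap : ∀ N (f g : ℕ → ℕ) → (∀ r → f r ≤ g r) → (∀ r → r < N → f r ≡ g r) ⊎ (∃ λ r → f r < g r × (∀ s → s < r → f s ≡ g s))
first-gap zero    f g p = inj₁ λ _ ()
first-gap (suc N) f g p with first-gap N f g p
... | inj₂ x = inj₂ x
... | inj₁ eq with f N ≟ g N
...   | no ne = inj₂ (N , ≤∧≢⇒< (p N) ne , eq)
...   | yes e = inj₁ λ r l → case m≤n⇒m<n∨m≡n (≤-pred l) of λ { (inj₁ l') → eq r l' ; (inj₂ refl) → e }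

last-gap : ∀ N (f g : ℕ → ℕ) → (∀ r → f r ≤ g r) → (∀ r → r < N → f r ≡ g r) ⊎ (∃ λ r → f r < g r × (∀ s → r < s → s < N → f s ≡ g s))
last-gap zero    f g p = inj₁ λ _ ()
last-gap (suc N) f g p with f N ≟ g N
... | no ne = inj₂ (N , ≤∧≢⇒< (p N) ne , λ s l l' → ⊥-elim (<⇒≱ l (≤-pred l')))
... | yes e with last-gap N f g p
...   | inj₁ eq = inj₁ λ r l → case m≤n⇒m<n∨m≡n (≤-pred l) of λ { (inj₁ l') → eq r l' ; (inj₂ refl) → e }
...   | inj₂ (r , lt , eq) = inj₂ (r , lt , λ s l l' → case m≤n⇒m<n∨m≡n (≤-pred l') of λ { (inj₁ l'') → eq s l l'' ; (inj₂ refl) → e })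

beyond : ∀ {w} (B : ℕ → ℕ) → Red w → (∀ r → B r ≤ sh w r) → ∀ r → length w ≤ r → B r ≡ sh w r
beyond B red p r l = trans (n≤0⇒n≡0 (subst (B r ≤_) (sh-zero r red l) (p r))) (sym (sh-zero r red l))

∼-∷ʳ-length : ∀ {w σ x n} → w ∼ σ ∷ʳ x → length w ≤ n → length σ < n
∼-∷ʳ-length {σ = σ} p l = subst (_≤ _) (trans (∼-length p) (trans (length-++ σ) (+-comm _ 1))) l

below-corner : ∀ {w σ x r} (B : ℕ → ℕ) → Red w → w ∼ σ ∷ʳ x → GrowsAt σ x r → (∀ s → B s ≤ sh w s) → B r < sh w r → ∀ s → B s ≤ sh σ s
below-corner {r = r} B red p g le lt s with s ≟ r
... | yes refl = ≤-pred (subst (B s <_) (sh-at red p g) lt)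
... | no ne    = subst (B s ≤_) (sh-off red p g ne) (le s)

-- The first row with a gap ends in a corner because of interlacing. Removing boxes there, the
-- letters split off one after another come from rows of weakly increasing index, so by
-- `rows-ascent` they form an increasing word. `n` bounds the recursion.
hstrip′ : ∀ n w (B : ℕ → ℕ) → length w ≤ n → Red w → (∀ r → B r ≤ sh w r) → (∀ r → sh w (suc r) ≤ B r) →
  ∃ λ s → ∃ λ V → (w ∼ s ++ V) × Inc V × (∀ r → sh s r ≡ B r)
hstrip′ n w B l red le il with first-gap (length w) B (sh w) le
... | inj₁ eq = w , [] , ∼≡ (sym (++-identityʳ w)) , [] , λ r → case r <? length w of λ { (yes l) → sym (eq r l) ; (no l) → sym (beyond B red le r (≮⇒≥ l)) }
... | inj₂ (r , lt , eq) with corner r red (≤-<-trans (il r) lt)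
...   | σ , x , p , g = go n l
  where
  redσ = Red-prefix σ (x ∷ []) (Red-∼ p red)
  σ≤w : ∀ s → sh σ s ≤ sh w s
  σ≤w s = ≤-trans (sh-mono σ (x ∷ []) (Red-∼ p red) s) (≤-reflexive (sym (sh-∼ red p s)))
  extend : (∃ λ s → ∃ λ V → (σ ∼ s ++ V) × Inc V × (∀ r → sh s r ≡ B r)) → ∃ λ s → ∃ λ V → (w ∼ s ++ V) × Inc V × (∀ r → sh s r ≡ B r)
  extend (s , V , q , i , e) = s , V ∷ʳ x , ∼trans p (∼trans (∼-++ʳ (x ∷ []) q) (∼≡ (sym (++-∷ʳ s V x)))) , inc (reverseView V) i q , e
    where
    inc : ∀ {V} → Reverse V → Inc V → σ ∼ s ++ V → Inc (V ∷ʳ x)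
    inc [] i q = [] ∷ []
    inc (V ∶ _ ∶ʳ y) i q with ∼trans q (∼≡ (++-∷ʳ s V y))
    ... | q' with grows (s ++ V) y (Red-∼ q' redσ)
    ...   | t , h = AP-∷ʳ² <-trans V i (rows-ascent (Red-∼ (∼-++ʳ (x ∷ []) q') (Red-∼ p red)) h (GrowsAt-∼ (Red-∼ p red) q' g) (≮⇒≥ λ t<r →
            <-irrefl (eq t t<r) (≤-trans (s≤s (≤-trans (≤-reflexive (sym (e t))) (sh-mono s V (Red-prefix (s ++ V) _ (Red-∼ q' redσ)) t))) (≤-trans (≤-reflexive (sym (sh-at redσ q' h))) (σ≤w t)))))
  go : ∀ n → length w ≤ n → ∃ λ s → ∃ λ V → (w ∼ s ++ V) × Inc V × (∀ r → sh s r ≡ B r)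
  go zero    l = ⊥-elim (<⇒≱ (∼-∷ʳ-length {σ = σ} p l) z≤n)
  go (suc n) l = extend (hstrip′ n σ B (≤-pred (∼-∷ʳ-length {σ = σ} p l)) redσ (below-corner B red p g le lt) (λ s → ≤-trans (σ≤w (suc s)) (il s)))

abstract
  hstrip : ∀ n w (B : ℕ → ℕ) → length w ≤ n → Red w → (∀ r → B r ≤ sh w r) → (∀ r → sh w (suc r) ≤ B r) →
    ∃ λ s → ∃ λ V → (w ∼ s ++ V) × Inc V × (∀ r → sh s r ≡ B r)
  hstrip = hstrip′

Decr : Word → Set
Decr = AllPairs (λ a b → b < a)

-- Boxes are removed from the last row with a gap, which is a corner since all later rows already
-- agree with `μ`. In a vertical strip every row is used at most once, so the letters decrease.
peel′ : ∀ n w (μ : ℕ → ℕ) → length w ≤ n → Red w → (∀ r → μ r ≤ sh w r) → (∀ r → μ (suc r) ≤ μ r) →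
  ∃ λ u → ∃ λ v → (w ∼ u ++ v) × (∀ r → sh u r ≡ μ r) × ((∀ r → sh w r ≤ suc (μ r)) → Decr v)
peel′ n w μ l red le anti with last-gap (length w) μ (sh w) le
... | inj₁ eq = w , [] , ∼≡ (sym (++-identityʳ w)) , (λ r → case r <? length w of λ { (yes l) → sym (eq r l) ; (no l) → sym (beyond μ red le r (≮⇒≥ l)) }) , λ _ → []
... | inj₂ (r , lt , eq) = go (corner r red (≤-<-trans (≤-reflexive (sym (above (suc r) (n<1+n r)))) (≤-<-trans (anti r) lt))) n l
  where
  above : ∀ s → r < s → μ s ≡ sh w s
  above s l with s <? length w
  ... | yes l' = eq s l l'
  ... | no l'  = beyond μ red le s (≮⇒≥ l')
  Goal = ∃ λ u → ∃ λ v → (w ∼ u ++ v) × (∀ r → sh u r ≡ μ r) × ((∀ r → sh w r ≤ suc (μ r)) → Decr v)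
  go : (∃ λ σ → ∃ λ x → (w ∼ σ ∷ʳ x) × GrowsAt σ x r) → ∀ n → length w ≤ n → Goal
  go (σ , x , p , g) zero    l = ⊥-elim (<⇒≱ (∼-∷ʳ-length {σ = σ} p l) z≤n)
  go (σ , x , p , g) (suc n) l = extend (peel′ n σ μ (≤-pred (∼-∷ʳ-length {σ = σ} p l)) redσ (below-corner μ red p g le lt) anti)
    where
    redσ = Red-prefix σ (x ∷ []) (Red-∼ p red)
    σ≤w : ∀ s → sh σ s ≤ sh w s
    σ≤w s = ≤-trans (sh-mono σ (x ∷ []) (Red-∼ p red) s) (≤-reflexive (sym (sh-∼ red p s)))
    extend : (∃ λ u → ∃ λ v → (σ ∼ u ++ v) × (∀ r → sh u r ≡ μ r) × ((∀ r → sh σ r ≤ suc (μ r)) → Decr v)) → Goal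
    extend (u , v , q , e , dec) = u , v ∷ʳ x , ∼trans p (∼trans (∼-++ʳ (x ∷ []) q) (∼≡ (sym (++-∷ʳ u v x)))) , e ,
        λ vert → dec' vert (reverseView v) (dec λ s → ≤-trans (σ≤w s) (vert s)) q
      where
      dec' : (∀ r → sh w r ≤ suc (μ r)) → ∀ {v} → Reverse v → Decr v → σ ∼ u ++ v → Decr (v ∷ʳ x)
      dec' vert [] i q = [] ∷ []
      dec' vert (v ∶ _ ∶ʳ y) i q with ∼trans q (∼≡ (++-∷ʳ u v y))
      ... | q' with grows (u ++ v) y (Red-∼ q' redσ)
      ...   | t , h = AP-∷ʳ² (λ a b → <-trans b a) v i (rows-descent (Red-∼ (∼-++ʳ (x ∷ []) q') (Red-∼ p red)) h (GrowsAt-∼ (Red-∼ p red) q' g) t<r)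
        where
        gap : μ t < sh σ t
        gap = ≤-trans (s≤s (≤-trans (≤-reflexive (sym (e t))) (sh-mono u v (Red-prefix (u ++ v) _ (Red-∼ q' redσ)) t))) (≤-reflexive (sym (sh-at redσ q' h)))
        t<r : t < r
        t<r with <-cmp t r
        ... | tri< l _ _ = l
        ... | tri≈ _ refl _ = ⊥-elim (<⇒≱ gap (≤-pred (subst (_≤ suc (μ t)) (sh-at red p g) (vert t))))
        ... | tri> _ _ l = ⊥-elim (<-irrefl (above t l) (<-≤-trans gap (σ≤w t)))

abstract
  peel : ∀ n w (μ : ℕ → ℕ) → length w ≤ n → Red w → (∀ r → μ r ≤ sh w r) → (∀ r → μ (suc r) ≤ μ r) →
    ∃ λ u → ∃ λ v → (w ∼ u ++ v) × (∀ r → sh u r ≡ μ r) × ((∀ r → sh w r ≤ suc (μ r)) → Decr v)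
  peel = peel′

-- Reversal transposes the shape

Sum : ℕ → (ℕ → ℕ) → ℕ
Sum zero    f = 0
Sum (suc n) f = Sum n f + f n

Sum-mono : ∀ n {f g : ℕ → ℕ} → (∀ i → f i ≤ g i) → Sum n f ≤ Sum n g
Sum-mono zero    p = z≤n
Sum-mono (suc n) p = +-mono-≤ (Sum-mono n p) (p n)

Sum-cong : ∀ n {f g : ℕ → ℕ} → (∀ i → f i ≡ g i) → Sum n f ≡ Sum n g
Sum-cong zero    p = refl
Sum-cong (suc n) p = cong₂ _+_ (Sum-cong n p) (p n)

Sum-+ : ∀ n (f g : ℕ → ℕ) → Sum n (λ i → f i + g i) ≡ Sum n f + Sum n g
Sum-+ zero    f g = refl
Sum-+ (suc n) f g = trans (cong (_+ (f n + g n)) (Sum-+ n f g)) (+-interchange (Sum n f) (Sum n g) (f n) (g n))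

Sum-shift : ∀ n (f : ℕ → ℕ) → Sum (suc n) f ≡ f 0 + Sum n (f ∘ suc)
Sum-shift zero    f = sym (+-identityʳ (f 0))
Sum-shift (suc n) f = trans (cong (_+ f (suc n)) (Sum-shift n f)) (+-assoc (f 0) _ _)

Sum-split : ∀ m n (f : ℕ → ℕ) → Sum (m + n) f ≡ Sum m f + Sum n (λ i → f (m + i))
Sum-split zero    n f = refl
Sum-split (suc m) n f = trans (Sum-shift (m + n) f) (trans (cong (f 0 +_) (Sum-split m n (f ∘ suc)))
  (trans (sym (+-assoc (f 0) _ _)) (cong (_+ Sum n (λ i → f (suc m + i))) (sym (Sum-shift m f)))))

Sum-sh : ∀ N {w} → Red w → length w ≤ N → Sum N (sh w) ≡ length w
Sum-sh zero    {[]} red l = refl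
Sum-sh (suc N) {w} red l = trans (Sum-shift N (sh w)) (trans (cong (length (row w) +_) (Sum-sh N (Red-out red) (length-out red l)))
  (trans (+-comm (length (row w)) _) (sym (length-out-row red))))

vstrip-rows : ∀ t d x q → Decr (d ∷ʳ x) → Red ((t ++ d) ∷ʳ x) → GrowsAt (t ++ d) x q → ∀ {r} → q ≤ r → sh (t ++ d) r ≡ sh t r
vstrip-rows t d x q = go (reverseView d) x q
  where
  go : ∀ {d} → Reverse d → ∀ x q → Decr (d ∷ʳ x) → Red ((t ++ d) ∷ʳ x) → GrowsAt (t ++ d) x q → ∀ {r} → q ≤ r → sh (t ++ d) r ≡ sh t r
  go [] x q i red g {r} l = cong (λ t → sh t r) (++-identityʳ t)
  go (d ∶ v ∶ʳ y) x q i red g {r} l rewrite ++-∷ʳ t d y with grows (t ++ d) y (Red-prefix ((t ++ d) ∷ʳ y) _ red)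
  ... | p , h = trans (sh-off (Red-prefix ((t ++ d) ∷ʳ y) _ red) ∼refl h (>⇒≢ p<r)) (go v y p (proj₁ (AP-∷ʳ⁻ (d ∷ʳ y) i)) (Red-prefix ((t ++ d) ∷ʳ y) _ red) h (<⇒≤ p<r))
    where p<r = <-≤-trans (descent-rows red h g (AP-last d i)) l

vstrip-bound : ∀ t d → Decr d → Red (t ++ d) → ∀ s → sh (t ++ d) s ≤ suc (sh t s)
vstrip-bound t d = go (reverseView d)
  where
  go : ∀ {d} → Reverse d → Decr d → Red (t ++ d) → ∀ s → sh (t ++ d) s ≤ suc (sh t s)
  go [] i red s rewrite ++-identityʳ t = n≤1+n _
  go (d ∶ v ∶ʳ x) i red s rewrite ++-∷ʳ t d x with grows (t ++ d) x red
  ... | q , g with s ≟ q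
  ...   | yes refl = ≤-reflexive (trans (sh-at red ∼refl g) (cong suc (vstrip-rows t d x q i red g ≤-refl)))
  ...   | no ne = ≤-trans (≤-reflexive (sh-off red ∼refl g ne)) (go v (proj₁ (AP-∷ʳ⁻ d i)) (Red-prefix (t ++ d) _ red) s)

AP-reverse : ∀ {R S : ℕ → ℕ → Set} → (∀ {a b} → R a b → S b a) → ∀ {V} → AllPairs R V → AllPairs S (reverse V)
AP-reverse f [] = []
AP-reverse f {x ∷ V} (p ∷ a) rewrite unfold-reverse x V = AP-∷ʳ (AP-reverse f a) (reverse-All V (All.map f p))

∼-reverse-++ : ∀ {ρ} u v → ρ ∼ u ++ v → reverse ρ ∼ reverse v ++ reverse u
∼-reverse-++ u v p = ∼trans (∼-reverse p) (∼≡ (reverse-++ u v))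

-- `u` is the product of the first `j` rows of the tableau of `ρ`, each reversed; every decreasing
-- factor lengthens a row by at most one.
dec-prefix : ∀ j {ρ} → Red ρ → ∃ λ u → ∃ λ v → (reverse ρ ∼ u ++ v) × (length u ≡ Sum j (sh ρ)) × (∀ t → Red (t ++ u) → ∀ s → sh (t ++ u) s ≤ sh t s + j)
dec-prefix zero {ρ} red = [] , reverse ρ , ∼refl , refl , λ t _ s → ≤-reflexive (trans (cong (λ t → sh t s) (++-identityʳ t)) (sym (+-identityʳ _)))
dec-prefix (suc j) {ρ} red with dec-prefix j (Red-out red)
... | u , v , p , e , b = d ++ u , v , ∼trans (∼-reverse-++ (out ρ) (row ρ) (∼-out-row red)) (∼trans (∼-++ˡ d p) (∼≡ (sym (++-assoc d u v)))) ,
    trans (length-++ d) (trans (cong₂ _+_ (length-reverse (row ρ)) e) (sym (Sum-shift j (sh ρ)))) , bound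
  where
  d = reverse (row ρ)
  bound : ∀ t → Red (t ++ d ++ u) → ∀ s → sh (t ++ d ++ u) s ≤ sh t s + suc j
  bound t r s rewrite sym (++-assoc t d u) = lin (sh ((t ++ d) ++ u) s ∷ sh (t ++ d) s ∷ j ∷ sh t s ∷ [])
    ((# 0 ≼ # 1 ⊕ # 2 by b (t ++ d) r s) ∷ (# 1 ≼ ! 1 ⊕ # 3 by vstrip-bound t d (AP-reverse id (Inc-row red)) (Red-prefix (t ++ d) u r) s) ∷ []) (# 0) (# 3 ⊕ (! 1 ⊕ # 2))

-- A shape with at most `j` columns is cut into `j` vertical strips; reversed, they are `j`
-- increasing factors, each contributing one interlacing.
inc-chain : ∀ j {u} → Red u → (∀ s → sh u s ≤ j) → ∀ t → Red (t ++ reverse u) → ∀ r → sh (t ++ reverse u) (r + j) ≤ sh t r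
inc-chain zero {u} red b t rt r = ≤-reflexive (cong₂ sh (trans (cong (λ u → t ++ reverse u) (empty u (trans (sym (Sum-sh (length u) red ≤-refl)) (zeros (length u))))) (++-identityʳ t)) (+-identityʳ r))
  where
  zeros : ∀ n → Sum n (sh u) ≡ 0
  zeros zero    = refl
  zeros (suc n) = cong₂ _+_ (zeros n) (n≤0⇒n≡0 (b n))
  empty : ∀ (u : Word) → length u ≡ 0 → u ≡ []
  empty [] _ = refl
inc-chain (suc j) {u} red b t rt r with peel (length u) u (λ s → j ⊓ sh u s) ≤-refl red (λ s → m⊓n≤n j _) (λ s → ⊓-monoʳ-≤ j (sh-part red s))
... | u' , d , p , e , dec = ≤-trans (≤-reflexive (cong (sh (t ++ reverse u)) (+-suc r j))) (≤-trans (≤-reflexive (sh-∼ rt q (suc r + j)))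
    (≤-trans (inc-chain j (Red-prefix u' d (Red-∼ p red)) (λ s → ≤-trans (≤-reflexive (e s)) (m⊓n≤m j _)) (t ++ reverse d) rq (suc r))
      (strip-interlace t (reverse d) (AP-reverse id (dec vert)) (Red-prefix (t ++ reverse d) (reverse u') rq) r)))
  where
  q : (t ++ reverse u) ∼ ((t ++ reverse d) ++ reverse u')
  q = ∼trans (∼-++ˡ t (∼-reverse-++ u' d p)) (∼≡ (sym (++-assoc t _ _)))
  rq = Red-∼ q rt
  vert : ∀ s → sh u s ≤ suc (j ⊓ sh u s)
  vert s with ≤-total j (sh u s)
  ... | inj₁ l rewrite m≤n⇒m⊓n≡m l = b s
  ... | inj₂ l rewrite m≥n⇒m⊓n≡n l = n≤1+n _

sh-[] : ∀ s → sh [] s ≡ 0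
sh-[] zero    = refl
sh-[] (suc s) = sh-[] s

-- A theorem in the manner of Greene; the right side counts the boxes in the first `j` columns of
-- the reversed word. The prefix of `dec-prefix` fits into these columns. Conversely, `peel`
-- isolates them, and by `inc-chain` the boxes of `ρ` from row `j` on number at most the rest.
transpose-Sum : ∀ j {ρ} N → Red ρ → length ρ ≤ N → Sum j (sh ρ) ≡ Sum N (λ s → j ⊓ sh (reverse ρ) s)
transpose-Sum j {ρ} N red l = ≤-antisym le ge
  where
  redw = Red-reverse ρ red
  lw : length (reverse ρ) ≤ N
  lw = subst (_≤ N) (sym (length-reverse ρ)) l
  le : Sum j (sh ρ) ≤ Sum N (λ s → j ⊓ sh (reverse ρ) s)
  le with dec-prefix j red
  ... | u , v , p , e , b = ≤-trans (≤-reflexive (trans (sym e) (sym (Sum-sh N ru lu)))) (Sum-mono N λ s → ⊓-glb (subst (sh u s ≤_) (cong (_+ j) (sh-[] s)) (b [] ru s)) (≤-trans (sh-mono u v (Red-∼ p redw) s) (≤-reflexive (sym (sh-∼ redw p s)))))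
    where
    ru = Red-prefix u v (Red-∼ p redw)
    lu : length u ≤ N
    lu = ≤-trans (m≤m+n _ (length v)) (≤-trans (≤-reflexive (trans (sym (length-++ u)) (sym (∼-length p)))) lw)
  ge : Sum N (λ s → j ⊓ sh (reverse ρ) s) ≤ Sum j (sh ρ)
  ge with peel (length (reverse ρ)) (reverse ρ) (λ s → j ⊓ sh (reverse ρ) s) ≤-refl redw (λ s → m⊓n≤n j _) (λ s → ⊓-monoʳ-≤ j (sh-part redw s))
  ... | u , v , p , e , _ = lin (Sum N (λ s → j ⊓ sh (reverse ρ) s) ∷ length u ∷ length v ∷ Sum j (sh ρ) ∷ Sum N (λ i → sh ρ (j + i)) ∷ [])
      ((# 0 ≼ # 1 by ≤-reflexive (trans (Sum-cong N (λ s → sym (e s))) (Sum-sh N ru (≤-trans (m≤m+n _ _) luv)))) ∷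
       (# 4 ≼ # 2 by ≤-trans (Sum-mono N (λ i → ≤-trans (≤-reflexive (trans (sh-∼ red q (j + i)) (cong (sh (reverse v ++ reverse u)) (+-comm j i)))) (inc-chain j ru (λ s → ≤-trans (≤-reflexive (e s)) (m⊓n≤m j _)) (reverse v) rq i))) (≤-reflexive (trans (Sum-sh N (Red-prefix (reverse v) _ rq) (≤-trans (≤-reflexive (length-reverse v)) (≤-trans (m≤n+m _ _) luv))) (length-reverse v)))) ∷
       (# 1 ⊕ # 2 ≼ # 3 ⊕ # 4 by ≤-reflexive (trans (sym lρ) (trans (sym (Sum-sh (j + N) red (≤-trans l (m≤n+m N j)))) (Sum-split j N (sh ρ))))) ∷ []) (# 0) (# 3)
    where
    ru = Red-prefix u v (Red-∼ p redw)
    q : ρ ∼ reverse v ++ reverse u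
    q = ∼trans (∼≡ (sym (reverse-involutive ρ))) (∼-reverse-++ u v p)
    rq = Red-∼ q red
    lρ : length ρ ≡ length u + length v
    lρ = trans (sym (length-reverse ρ)) (trans (∼-length p) (length-++ u))
    luv : length u + length v ≤ N
    luv = subst (_≤ N) lρ l

lt : ℕ → ℕ → ℕ
lt j       zero    = 0
lt zero    (suc n) = 1
lt (suc j) (suc n) = lt j n

⊓-suc : ∀ j n → suc j ⊓ n ≡ j ⊓ n + lt j n
⊓-suc j       zero    = sym (trans (+-identityʳ _) (⊓-zeroʳ j))
⊓-suc zero    (suc n) = refl
⊓-suc (suc j) (suc n) = cong suc (⊓-suc j n)

lt-1 : ∀ {j n} → j < n → lt j n ≡ 1
lt-1 {zero}  {suc n} p       = refl
lt-1 {suc j} {suc n} (s≤s p) = lt-1 p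

-- The difference of `transpose-Sum` at `suc j` and at `j`.
col-count : ∀ j {ρ} N → Red ρ → length ρ ≤ N → sh ρ j ≡ Sum N (λ s → lt j (sh (reverse ρ) s))
col-count j {ρ} N red l = +-cancelˡ-≡ (Sum j (sh ρ)) _ _ (trans (transpose-Sum (suc j) N red l)
  (trans (Sum-cong N (λ s → ⊓-suc j (sh (reverse ρ) s))) (trans (Sum-+ N _ _) (cong (_+ Sum N (λ s → lt j (sh (reverse ρ) s))) (sym (transpose-Sum j N red l))))))

count-≥ : ∀ N {f : ℕ → ℕ} {j u} → (∀ r → f (suc r) ≤ f r) → j < f u → u < N → u < Sum N (λ s → lt j (f s))
count-≥ N {f} {j} {u} anti p u<N with m≤n⇒∃[o]m+o≡n u<N
... | k , refl = ≤-trans (ones (suc u) (λ i l → <-≤-trans p (antitone anti (≤-pred l)))) (≤-trans (m≤m+n _ _) (≤-reflexive (sym (Sum-split (suc u) k (λ s → lt j (f s))))))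
  where
  ones : ∀ n → (∀ i → i < n → j < f i) → n ≤ Sum n (λ s → lt j (f s))
  ones zero    q = z≤n
  ones (suc n) q = ≤-trans (≤-reflexive (+-comm 1 n)) (+-mono-≤ (ones n (λ i l → q i (m≤n⇒m≤1+n l))) (≤-reflexive (sym (lt-1 (q n ≤-refl)))))

sh-pos : ∀ {w u j} → Red w → j < sh w u → u < length w
sh-pos {w} {u} {j} red p with u <? length w
... | yes l = l
... | no l  = ⊥-elim (<⇒≱ p (≤-trans (≤-reflexive (sh-zero u red (≮⇒≥ l))) z≤n))

transpose′ : ∀ {ρ j u} → Red ρ → j < sh (reverse ρ) u → u < sh ρ j
transpose′ {ρ} {j} {u} red p = subst (u <_) (sym (col-count j (length ρ) red ≤-refl))
  (count-≥ (length ρ) (sh-part (Red-reverse ρ red)) p (subst (u <_) (length-reverse ρ) (sh-pos (Red-reverse ρ red) p)))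

abstract
  transpose : ∀ {ρ j u} → Red ρ → j < sh (reverse ρ) u → u < sh ρ j
  transpose = transpose′

transpose⁻′ : ∀ {ρ j u} → Red ρ → u < sh ρ j → j < sh (reverse ρ) u
transpose⁻′ {ρ} {j} {u} red p = transpose (Red-reverse ρ red) (subst (λ t → u < sh t j) (sym (reverse-involutive ρ)) p)

abstract
  transpose⁻ : ∀ {ρ j u} → Red ρ → u < sh ρ j → j < sh (reverse ρ) u
  transpose⁻ = transpose⁻′

≤-by-< : ∀ {a b} → (∀ u → u < a → u < b) → a ≤ b
≤-by-< {zero}  p = z≤n
≤-by-< {suc a} p = p a ≤-refl

-- Prepending a letter: growth, the local rule and sliding

record LGrowsAt (z : ℕ) (σ : Word) (r : ℕ) : Set where
  constructor lgrowsAt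
  field lgrown : ∀ s → sh (z ∷ σ) s ≡ sh σ s + ι r s
open LGrowsAt

-- The box added in row `c` and column `sh σ c` reappears transposed. This translates statements
-- about the last letter into statements about the first letter of the reversed word.
grow-transpose′ : ∀ {σ x c} → Red (σ ∷ʳ x) → GrowsAt σ x c → LGrowsAt x (reverse σ) (sh σ c) × (sh (reverse σ) (sh σ c) ≡ c)
grow-transpose′ {σ} {x} {c} red g = lgrowsAt main , e₀
  where
  w = reverse σ
  j₀ = sh σ c
  redσ = Red-prefix σ (x ∷ []) red
  rev : reverse (σ ∷ʳ x) ≡ x ∷ w
  rev = reverse-++ σ (x ∷ [])
  tr : ∀ {u s} → u < sh (x ∷ w) s → s < sh (σ ∷ʳ x) u
  tr {u} {s} p = transpose red (subst (λ t → u < sh t s) (sym rev) p)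
  tr⁻ : ∀ {u s} → s < sh (σ ∷ʳ x) u → u < sh (x ∷ w) s
  tr⁻ {u} {s} p = subst (λ t → u < sh t s) rev (transpose⁻ red p)
  at-c : sh (σ ∷ʳ x) c ≡ suc j₀
  at-c = sh-at red ∼refl g
  off-c : ∀ {u} → u ≢ c → sh (σ ∷ʳ x) u ≡ sh σ u
  off-c = sh-off red ∼refl g
  e₀ : sh w j₀ ≡ c
  e₀ = ≤-antisym (≤-by-< λ u p → ≰⇒> λ l → <⇒≱ (transpose redσ p) (sh-anti redσ l))
                 (≤-by-< λ u l → transpose⁻ redσ (subst₂ _≤_ at-c (off-c (<⇒≢ l)) (sh-anti red (<⇒≤ l))))
  off : ∀ {s} → s ≢ j₀ → sh (x ∷ w) s ≡ sh w s
  off {s} ne = ≤-antisym (≤-by-< f) (≤-by-< λ u p → tr⁻ {u} {s} (<-≤-trans (transpose redσ p) (sh-mono σ (x ∷ []) red u)))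
    where
    f : ∀ u → u < sh (x ∷ w) s → u < sh w s
    f u p with u ≟ c
    ... | yes refl = transpose⁻ redσ (≤∧≢⇒< (≤-pred (subst (s <_) at-c (tr p))) ne)
    ... | no ne'   = transpose⁻ redσ (subst (s <_) (off-c ne') (tr p))
  on : sh (x ∷ w) j₀ ≡ suc c
  on = ≤-antisym (≤-by-< λ u p → ≰⇒> λ l → <⇒≱ (tr p) (subst (_≤ j₀) (sym (off-c (>⇒≢ l))) (sh-anti redσ (<⇒≤ l))))
                 (≤-by-< λ u l → tr⁻ (≤-trans (≤-reflexive (sym at-c)) (sh-anti red (≤-pred l))))
  main : ∀ s → sh (x ∷ w) s ≡ sh w s + ι j₀ s
  main s with s ≟ j₀
  ... | yes refl = trans on (sym (trans (cong₂ _+_ e₀ (ι-refl s)) (+-comm c 1)))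
  ... | no ne    = trans (off {s} ne) (sym (trans (cong (sh w s +_) (ι-≢ (ne ∘ sym))) (+-identityʳ _)))

abstract
  grow-transpose : ∀ {σ x c} → Red (σ ∷ʳ x) → GrowsAt σ x c → LGrowsAt x (reverse σ) (sh σ c) × (sh (reverse σ) (sh σ c) ≡ c)
  grow-transpose = grow-transpose′

Red-∷-reverse : ∀ z σ → Red (z ∷ σ) → Red (reverse σ ∷ʳ z)
Red-∷-reverse z σ red = subst Red (unfold-reverse z σ) (Red-reverse (z ∷ σ) red)

lgrows′ : ∀ z σ → Red (z ∷ σ) → ∃ (LGrowsAt z σ)
lgrows′ z σ red with grows (reverse σ) z (Red-∷-reverse z σ red)
... | c , g = _ , subst (λ t → LGrowsAt z t (sh (reverse σ) c)) (reverse-involutive σ) (proj₁ (grow-transpose (Red-∷-reverse z σ red) g))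

abstract
  lgrows : ∀ z σ → Red (z ∷ σ) → ∃ (LGrowsAt z σ)
  lgrows = lgrows′

lgrow-injective : ∀ {z σ r r'} → LGrowsAt z σ r → LGrowsAt z σ r' → r ≡ r'
lgrow-injective {z} {σ} {r} {r'} g g' = sym (ι-pos r' r (subst (1 ≤_) (trans (sym (ι-refl r)) (+-cancelˡ-≡ (sh σ r) _ _ (trans (sym (lgrown g r)) (lgrown g' r)))) ≤-refl))

lgrow-∼ : ∀ {z σ σ' r} → Red (z ∷ σ) → σ ∼ σ' → LGrowsAt z σ r → LGrowsAt z σ' r
lgrow-∼ {z} {σ} {σ'} {r} red p g = lgrowsAt λ s → trans (sym (sh-∼ red (∼cons z p) s)) (trans (lgrown g s) (cong (_+ ι r s) (sh-∼ (Red-suffix (z ∷ []) σ red) p s)))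

ι-square : ∀ {σ x z p j p' v} → GrowsAt σ x p → LGrowsAt z σ j → GrowsAt (z ∷ σ) x p' → LGrowsAt z (σ ∷ʳ x) v → ∀ s → ι j s + ι p' s ≡ ι p s + ι v s
ι-square {σ} {x} {z} {p} {j} {p'} {v} g l g' l' s = +-cancelˡ-≡ (sh σ s) _ _
  (trans (sym (+-assoc (sh σ s) _ _)) (trans (cong (_+ ι p' s) (sym (lgrown l s))) (trans (sym (grown g' s)) (trans (lgrown l' s) (trans (cong (_+ ι v s) (grown g s)) (+-assoc (sh σ s) _ _))))))

-- If `z` and `x` would add the same box to `σ`, the second of them cannot move to another row
-- addable in `σ`. The row just before the larger of `p` and `q` ends in a corner; let `y` be the
-- letter split off there. Whether `y < x` can be read off from rows both with and without `z`, and
-- the two readings disagree.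
local-rule : ∀ {z σ x p q} → Red (z ∷ (σ ∷ʳ x)) → GrowsAt σ x p → LGrowsAt z σ p → GrowsAt (z ∷ σ) x q → q ≢ p → (∀ q' → q ≡ suc q' → sh σ q < sh σ q') → ⊥
local-rule {z} {σ} {x} {p} {q} red g l h ne addable with <-cmp p q
... | tri≈ _ e _ = ne (sym e)
local-rule {z} {σ} {x} {p} {suc q'} red g l h ne addable | tri< (s≤s p≤q') _ _ with corner q' redσ (addable q' refl)
  where redσ = Red-prefix σ (x ∷ []) (Red-suffix (z ∷ []) _ red)
... | σ' , y , e , k = <-asym (rows-ascent (Red-∼ (∼-++ʳ (x ∷ []) e) redσx) k (GrowsAt-∼ redσx e g) p≤q')
                              (rows-descent (Red-∼ (∼cons z (∼-++ʳ (x ∷ []) e)) red) k' (GrowsAt-∼ red (∼cons z e) h) (s≤s t'≤q'))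
  where
  redσx = Red-suffix (z ∷ []) _ red
  redzσ : Red (z ∷ σ)
  redzσ = Red-prefix (z ∷ σ) (x ∷ []) red
  rz = Red-∼ (∼cons z e) redzσ
  t = lgrows z σ' (Red-prefix (z ∷ σ') (y ∷ []) rz)
  t' = proj₁ (grows (z ∷ σ') y rz)
  k' = proj₂ (grows (z ∷ σ') y rz)
  -- By `ι-square` the letter `y` lands either in row `q'` or in row `p`.
  t'≤q' : t' ≤ q'
  t'≤q' with t' ≟ q' | t' ≟ p
  ... | yes a | _     = ≤-reflexive a
  ... | no a  | yes b = ≤-trans (≤-reflexive b) p≤q'
  ... | no a  | no b  = ⊥-elim (1+n≰n {0} (lin (ι (proj₁ t) t' ∷ ι q' t' ∷ ι p t' ∷ []) ((# 0 ⊕ ! 1 ≼ # 1 ⊕ # 2 by ≤-reflexive (trans (cong (ι (proj₁ t) t' +_) (sym (ι-refl t'))) (ι-square k (proj₂ t) k' (lgrow-∼ redzσ e l) t'))) ∷ (# 1 ≼ ! 0 by ≤-reflexive (ι-≢ (a ∘ sym))) ∷ (# 2 ≼ ! 0 by ≤-reflexive (ι-≢ (b ∘ sym))) ∷ []) (! 1) (! 0)))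
local-rule {z} {σ} {x} {suc p'} {q} red g l h ne addable | tri> _ _ (s≤s q≤p') with corner p' redσ corn
  where
  redσx = Red-suffix (z ∷ []) _ red
  redσ = Red-prefix σ (x ∷ []) redσx
  corn : sh σ (suc p') < sh σ p'
  corn = subst₂ _≤_ (sh-at redσx ∼refl g) (sh-off redσx ∼refl g (<⇒≢ (n<1+n p'))) (sh-part redσx p')
... | σ' , y , e , k = <-asym (rows-ascent (Red-∼ (∼cons z (∼-++ʳ (x ∷ []) e)) red) k' (GrowsAt-∼ red (∼cons z e) h) (≤-trans q≤p' p'≤t'))
                              (rows-descent (Red-∼ (∼-++ʳ (x ∷ []) e) redσx) k (GrowsAt-∼ redσx e g) ≤-refl)
  where
  redσx = Red-suffix (z ∷ []) _ red
  redzσ : Red (z ∷ σ)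
  redzσ = Red-prefix (z ∷ σ) (x ∷ []) red
  rz = Red-∼ (∼cons z e) redzσ
  t = lgrows z σ' (Red-prefix (z ∷ σ') (y ∷ []) rz)
  t' = proj₁ (grows (z ∷ σ') y rz)
  k' = proj₂ (grows (z ∷ σ') y rz)
  p'≤t' : p' ≤ t'
  p'≤t' with t' ≟ p' | t' ≟ suc p'
  ... | yes a | _     = ≤-reflexive (sym a)
  ... | no a  | yes b = ≤-trans (n≤1+n p') (≤-reflexive (sym b))
  ... | no a  | no b  = ⊥-elim (1+n≰n {0} (lin (ι (proj₁ t) t' ∷ ι p' t' ∷ ι (suc p') t' ∷ []) ((# 0 ⊕ ! 1 ≼ # 1 ⊕ # 2 by ≤-reflexive (trans (cong (ι (proj₁ t) t' +_) (sym (ι-refl t'))) (ι-square k (proj₂ t) k' (lgrow-∼ redzσ e l) t'))) ∷ (# 1 ≼ ! 0 by ≤-reflexive (ι-≢ (a ∘ sym))) ∷ (# 2 ≼ ! 0 by ≤-reflexive (ι-≢ (b ∘ sym))) ∷ []) (! 1) (! 0)))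


-- When the outer shape `C` of a horizontal strip grows in row `u`, the inner shape `B` grows in row
-- `u` if interlacing permits, and otherwise in the row before. The alternatives exclude each other,
-- so `j` is determined by `u` and the two shapes.
Slid : (B C : ℕ → ℕ) → ℕ → ℕ → Set
Slid B C u j = ((j ≡ u) × (∀ u' → u ≡ suc u' → C u < B u')) ⊎ ((u ≡ suc j) × (C u ≡ B j))

-- `Y` is built up letter by letter while `Inv` follows the row of `z`. It changes only if the new
-- letter occupies the box of `z`; `local-rule` then allows at most a move to the next row, and
-- interlacing prevents a second move.
slide′ : ∀ z s Y {u} → Inc Y → Red (z ∷ s ++ Y) → LGrowsAt z (s ++ Y) u → ∃ λ j → LGrowsAt z s j × Slid (sh s) (sh (s ++ Y)) u j
slide′ z s Y {u} i red l = j , lj , finish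
  where
  reds : Red (z ∷ s)
  reds = Red-prefix (z ∷ s) Y red
  j = proj₁ (lgrows z s reds)
  lj = proj₂ (lgrows z s reds)
  Inv : Word → ℕ → Set
  Inv Y u = (u ≡ j) ⊎ ((u ≡ suc j) × (sh (s ++ Y) u ≡ sh s j))
  step : ∀ Y x u v p p' → Inc (Y ∷ʳ x) → Red (z ∷ ((s ++ Y) ∷ʳ x)) → Inv Y u → LGrowsAt z (s ++ Y) u → LGrowsAt z ((s ++ Y) ∷ʳ x) v → GrowsAt (s ++ Y) x p → GrowsAt (z ∷ s ++ Y) x p' →
         (v ≡ j) ⊎ ((v ≡ suc j) × (sh ((s ++ Y) ∷ʳ x) v ≡ sh s j))
  step Y x u v p p' i red inv lu lv g g' with u ≟ p
  step Y x u v p p' i red inv lu lv g g' | no ne with ι-pos v u (lin (ι u u ∷ ι p' u ∷ ι p u ∷ ι v u ∷ []) ((# 0 ⊕ # 1 ≼ # 2 ⊕ # 3 by ≤-reflexive (ι-square g lu g' lv u)) ∷ (! 1 ≼ # 0 by ≤-reflexive (sym (ι-refl u))) ∷ (# 2 ≼ ! 0 by ≤-reflexive (ι-≢ (ne ∘ sym))) ∷ []) (! 1) (# 3)) | inv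
  ... | refl | inj₁ e = inj₁ e
  ... | refl | inj₂ (e , e') = inj₂ (e , trans (sh-off (Red-suffix (z ∷ []) _ red) ∼refl g ne) e')
  step Y x u v .u p' i red (inj₂ (refl , e')) lu lv g g' | yes refl = ⊥-elim (<⇒≱ (≤-reflexive (sym (trans (sh-at (Red-suffix (z ∷ []) _ red) ∼refl g) (cong suc e'))))
     (subst (λ t → sh t (suc j) ≤ sh s j) (++-∷ʳ s Y x) (strip-interlace s (Y ∷ʳ x) i (subst Red (sym (++-∷ʳ s Y x)) (Red-suffix (z ∷ []) _ red)) j)))
  step Y x u v .u p' i red (inj₁ refl) lu lv g g' | yes refl with v ≟ u
  ... | yes e = inj₁ e
  ... | no ne = inj₂ (proj₁ q , subst (λ v → sh ((s ++ Y) ∷ʳ x) v ≡ sh s j) (sym (proj₁ q)) (≤-antisym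
            (subst (λ t → sh t (suc j) ≤ sh s j) (++-∷ʳ s Y x) (strip-interlace s (Y ∷ʳ x) i (subst Red (sym (++-∷ʳ s Y x)) rx) j))
            (≤-trans (sh-mono s Y rY j) (≤-trans (proj₂ q) (≤-reflexive (sym (sh-off rx ∼refl g (>⇒≢ (n<1+n j)))))))))
    where
    rx = Red-suffix (z ∷ []) _ red
    rY = Red-prefix (s ++ Y) _ rx
    e' : p' ≡ v
    e' = sym (ι-pos v p' (subst (1 ≤_) (+-cancelˡ-≡ (ι u p') _ _ (ι-square g lu g' lv p')) (≤-reflexive (sym (ι-refl p')))))
    -- v is addable after adding row u but, by the local rule, not before.
    addable : ∀ v → v ≢ u → GrowsAt (z ∷ s ++ Y) x v → (v ≡ suc j) × (sh (s ++ Y) j ≤ sh (s ++ Y) (suc j))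
    addable zero ne h = ⊥-elim (local-rule red g lu h ne (λ _ ()))
    addable (suc v') ne h with sh (s ++ Y) (suc v') <? sh (s ++ Y) v'
    ... | yes a = ⊥-elim (local-rule red g lu h ne (λ { .v' refl → a }))
    ... | no a with v' ≟ u
    ...   | yes refl = refl , ≮⇒≥ a
    ...   | no b = ⊥-elim (a (subst₂ _≤_ (trans (sh-at red ∼refl h) (cong suc (trans (lgrown lu (suc v')) (trans (cong (sh (s ++ Y) (suc v') +_) (ι-≢ (ne ∘ sym))) (+-identityʳ _)))))
                (trans (sh-off red ∼refl h (<⇒≢ (n<1+n v'))) (trans (lgrown lu v') (trans (cong (sh (s ++ Y) v' +_) (ι-≢ (b ∘ sym))) (+-identityʳ _)))) (sh-part red v')))
    q = addable v ne (subst (GrowsAt (z ∷ s ++ Y) x) e' g')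
  go : ∀ {Y} → Reverse Y → Inc Y → Red (z ∷ s ++ Y) → ∀ u → LGrowsAt z (s ++ Y) u → Inv Y u
  go [] i red u l = inj₁ (lgrow-injective l (subst (λ t → LGrowsAt z t j) (sym (++-identityʳ s)) lj))
  go (Y ∶ v ∶ʳ x) i red u l rewrite ++-∷ʳ s Y x with lgrows z (s ++ Y) (Red-prefix (z ∷ s ++ Y) (x ∷ []) red)
  ... | u₀ , l₀ = step Y x u₀ u _ _ i red (go v (proj₁ (AP-∷ʳ⁻ Y i)) (Red-prefix (z ∷ s ++ Y) (x ∷ []) red) u₀ l₀) l₀ l (proj₂ (grows (s ++ Y) x (Red-suffix (z ∷ []) _ red))) (proj₂ (grows (z ∷ s ++ Y) x red))
  finish : Slid (sh s) (sh (s ++ Y)) u j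
  finish with go (reverseView Y) i red u l
  ... | inj₂ (e , e') = inj₂ (e , e')
  ... | inj₁ refl = inj₁ (refl , f)
    where
    f : ∀ u' → u ≡ suc u' → sh (s ++ Y) u < sh s u'
    f u' e = subst₂ _≤_ (trans (lgrown l u) (trans (cong (sh (s ++ Y) u +_) (ι-refl u)) (+-comm _ 1)))
      (trans (lgrown lj u') (trans (cong (sh s u' +_) (ι-≢ (λ a → <⇒≢ (n<1+n u') (trans (sym a) e)))) (+-identityʳ _)))
      (subst (λ t → sh (z ∷ s ++ Y) t ≤ sh (z ∷ s) u') (sym e) (strip-interlace (z ∷ s) Y i red u'))

abstract
  slide : ∀ z s Y {u} → Inc Y → Red (z ∷ s ++ Y) → LGrowsAt z (s ++ Y) u → ∃ λ j → LGrowsAt z s j × Slid (sh s) (sh (s ++ Y)) u j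
  slide = slide′

-- The raising operator on two factors

T⇒≡ : ∀ {b} → T b → b ≡ true
T⇒≡ {true} _ = refl

¬T⇒≡ : ∀ {b} → ¬ T b → b ≡ false
¬T⇒≡ {true}  n = ⊥-elim (n tt)
¬T⇒≡ {false} n = refl

≡ᵇ-true : ∀ {x y} → x ≡ y → (x ≡ᵇ y) ≡ true
≡ᵇ-true {x} {y} e = T⇒≡ (≡⇒≡ᵇ x y e)

≡ᵇ-false : ∀ {x y} → x ≢ y → (x ≡ᵇ y) ≡ false
≡ᵇ-false {x} {y} n = ¬T⇒≡ (n ∘ ≡ᵇ⇒≡ x y)

<ᵇ-true : ∀ {x y} → x < y → (x <ᵇ y) ≡ true
<ᵇ-true p = T⇒≡ (<⇒<ᵇ p)

<ᵇ-false : ∀ {x y} → y ≤ x → (x <ᵇ y) ≡ false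
<ᵇ-false {x} {y} p = ¬T⇒≡ (λ t → <⇒≱ (<ᵇ⇒< x y t) p)

≤ᵇ-true : ∀ {x y} → x ≤ y → (x ≤ᵇ y) ≡ true
≤ᵇ-true p = T⇒≡ (≤⇒≤ᵇ p)

≤ᵇ-false : ∀ {x y} → y < x → (x ≤ᵇ y) ≡ false
≤ᵇ-false {x} {y} p = ¬T⇒≡ (λ t → <⇒≱ p (≤ᵇ⇒≤ x y t))

unpaired-++ : ∀ X u v → unpaired X (u ++ v) ≡ unpaired (unpaired X v) u
unpaired-++ X u v rewrite reverse-++ u v = foldl-++ (λ av b → removeFirstGT b av) X (reverse v) (reverse u)

unpaired-∷ : ∀ X y Y → unpaired X (y ∷ Y) ≡ removeFirstGT y (unpaired X Y)
unpaired-∷ X y Y = unpaired-++ X (y ∷ []) Y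

removeFirstGT-All : ∀ {P : ℕ → Set} y L → All P L → All P (removeFirstGT y L)
removeFirstGT-All y []      []       = []
removeFirstGT-All y (l ∷ L) (p ∷ ps) with y <ᵇ l
... | true  = ps
... | false = p ∷ removeFirstGT-All y L ps

unpaired-All : ∀ {P : ℕ → Set} X Y → All P X → All P (unpaired X Y)
unpaired-All X []      ps = ps
unpaired-All X (y ∷ Y) ps rewrite unpaired-∷ X y Y = removeFirstGT-All y (unpaired X Y) (unpaired-All X Y ps)

unpaired-[] : ∀ Y → unpaired [] Y ≡ []
unpaired-[] []      = refl
unpaired-[] (y ∷ Y) rewrite unpaired-∷ [] y Y | unpaired-[] Y = refl

unpaired-skip : ∀ x X Y → All (x ≤_) Y → unpaired (x ∷ X) Y ≡ x ∷ unpaired X Y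
unpaired-skip x X []      []       = refl
unpaired-skip x X (y ∷ Y) (p ∷ ps) rewrite unpaired-∷ (x ∷ X) y Y | unpaired-∷ X y Y | unpaired-skip x X Y ps | <ᵇ-false p = refl

-- What matters is `fit-RIns`: such a `Y`, inserted into a row beginning with `X`, never reaches
-- what stands behind `X`.
data Fit : Word → Word → Set where
  []    : ∀ {X} → Fit X []
  fdrop  : ∀ {x X Y} → Fit X Y → Fit (x ∷ X) Y
  fmatch : ∀ {x X y Y} → y < x → Fit X Y → Fit (x ∷ X) (y ∷ Y)

Fit-length : ∀ {X Y} → Fit X Y → length Y ≤ length X
Fit-length []          = z≤n
Fit-length (fdrop f)    = m≤n⇒m≤1+n (Fit-length f)
Fit-length (fmatch _ f) = s≤s (Fit-length f)

Fit-tail : ∀ {X y Y} → Fit X (y ∷ Y) → Fit X Y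
Fit-tail (fdrop f)    = fdrop (Fit-tail f)
Fit-tail (fmatch _ f) = fdrop f

Fit-cons : ∀ {X y Y} → Inc X → Fit X Y → All (y <_) X → length Y < length X → Fit X (y ∷ Y)
Fit-cons {x ∷ X} i []          (p ∷ _) l = fmatch p []
Fit-cons         i (fdrop f)    (p ∷ _) l = fmatch p f
Fit-cons (x< ∷ i) (fmatch q f) (p ∷ _) (s≤s l) = fmatch p (Fit-cons i f (All.map (<-trans q) x<) l)

Dom-tail : ∀ {Y x X} → Inc (x ∷ X) → Dom Y (x ∷ X) → Dom Y X
Dom-tail {X = []}    i                  (p ∷ D) = []
Dom-tail {X = _ ∷ _} ((x< ∷ _) ∷ i) (p ∷ D) = <-trans p x< ∷ Dom-tail i D

Dom-shift : ∀ X₀ {a X₁ y Y₀ Y₁} → Inc (X₀ ++ a ∷ X₁) → Fit X₀ Y₀ → length X₀ ≡ length Y₀ → All (y <_) (X₀ ++ a ∷ X₁) → Dom Y₁ X₁ → Dom (y ∷ Y₀ ++ Y₁) (X₀ ++ a ∷ X₁)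
Dom-shift []       i []          e (p ∷ _) D = p ∷ D
Dom-shift (x ∷ X₀) i (fdrop f)    e (p ∷ _) D = ⊥-elim (<⇒≱ (≤-reflexive e) (Fit-length f))
Dom-shift (x ∷ X₀) (x< ∷ i) (fmatch q f) e (p ∷ _) D = p ∷ Dom-shift X₀ i f (suc-injective e) (All.map (<-trans q) x<) D

Dom-⊥ : ∀ X₀ {a X₁} Y₀ {Y₁} → Inc (X₀ ++ a ∷ X₁) → All (a ≤_) Y₁ → length Y₀ ≤ length X₀ → ¬ Dom (Y₀ ++ Y₁) (X₀ ++ a ∷ X₁)
Dom-⊥ []       []       i (q ∷ _) l (p ∷ D) = <⇒≱ p q
Dom-⊥ (x ∷ X₀) []       (x< ∷ i) (q ∷ _) l (p ∷ D) = <⇒≱ (<-trans p (All.head (Allₚ.++⁻ʳ X₀ x<))) q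
Dom-⊥ (x ∷ X₀) (y ∷ Y₀) (_ ∷ i) q (s≤s l) (p ∷ D) = Dom-⊥ X₀ Y₀ i q l D

-- The pairing seen from its largest unpaired letter `a`: all of `X₁` is paired inside `Y₁` (`dom`),
-- all of `Y₀` inside `X₀` (`fit`), and what is left unpaired besides `a` comes from `X₀`.
record Split (X Y : Word) : Set where
  constructor mkSplit
  field
    X₀ X₁ Y₀ Y₁ : Word
    a     : ℕ
    X≡    : X ≡ X₀ ++ a ∷ X₁
    Y≡    : Y ≡ Y₀ ++ Y₁
    Y₀<a  : All (_< a) Y₀
    a≤Y₁  : All (a ≤_) Y₁
    dom   : Dom Y₁ X₁
    fit   : Fit X₀ Y₀
    left  : unpaired X Y ≡ unpaired X₀ Y₀ ∷ʳ a
    count : length X₀ ≡ length (unpaired X₀ Y₀) + length Y₀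

SplitCases : Word → Word → Set
SplitCases X Y = ((unpaired X Y ≡ []) × Dom Y X) ⊎ Split X Y

-- If `x ≤ y`, nothing can pair `x`, which joins `X₀`. If `y < x`, the letter `y` is processed last
-- and takes the smallest letter still unpaired; if that is `a`, everything is paired.
split-step : ∀ x X y Y → Inc (x ∷ X) → Inc (y ∷ Y) → SplitCases X (y ∷ Y) → SplitCases (x ∷ X) Y → SplitCases (x ∷ X) (y ∷ Y)
split-step x X y Y (x< ∷ i) (y< ∷ j) rX rY with x ≤? y
... | yes x≤y = cases rX
  where
  all : All (x ≤_) (y ∷ Y)
  all = x≤y ∷ All.map (λ l → ≤-trans x≤y (<⇒≤ l)) y<
  eq = unpaired-skip x X (y ∷ Y) all
  cases : SplitCases X (y ∷ Y) → SplitCases (x ∷ X) (y ∷ Y)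
  cases (inj₁ (e , D)) = inj₂ (mkSplit [] X [] (y ∷ Y) x refl refl [] all D [] (trans eq (cong (x ∷_) e)) refl)
  cases (inj₂ (mkSplit X₀ X₁ Y₀ Y₁ a refl q lo hi D f e c)) =
    inj₂ (mkSplit (x ∷ X₀) X₁ Y₀ Y₁ a refl q lo hi D (fdrop f) (trans eq (trans (cong (x ∷_) e) (cong (_∷ʳ a) (sym sk)))) (trans (cong suc c) (cong (_+ length Y₀) (cong length (sym sk)))))
    where sk = unpaired-skip x X₀ Y₀ (Allₚ.++⁻ˡ Y₀ (subst (All (x ≤_)) q all))
... | no x≰y = cases rY
  where
  y<x = ≰⇒> x≰y
  y<X : All (y <_) (x ∷ X)
  y<X = y<x ∷ All.map (<-trans y<x) x<
  cases : SplitCases (x ∷ X) Y → SplitCases (x ∷ X) (y ∷ Y)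
  cases (inj₁ (e , D)) = inj₁ (trans (unpaired-∷ (x ∷ X) y Y) (cong (removeFirstGT y) e) , y<x ∷ Dom-tail (x< ∷ i) D)
  cases (inj₂ (mkSplit X₀ X₁ Y₀ Y₁ a p refl lo hi D f e c)) = sub (unpaired X₀ Y₀) refl
    where
    pos = subst (All (y <_)) p y<X
    y<a = All.head (Allₚ.++⁻ʳ X₀ pos)
    incX = subst Inc p (x< ∷ i)
    incX₀ : ∀ U {V} → Inc (U ++ V) → Inc U
    incX₀ []      i       = []
    incX₀ (u ∷ U) (q ∷ i) = Allₚ.++⁻ˡ U q ∷ incX₀ U i
    sub : ∀ L → unpaired X₀ Y₀ ≡ L → SplitCases (x ∷ X) (y ∷ Y₀ ++ Y₁)
    sub [] q = inj₁ (trans (unpaired-∷ (x ∷ X) y (Y₀ ++ Y₁)) (trans (cong (removeFirstGT y) (trans e (cong (_∷ʳ a) q))) rm) ,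
                     subst (Dom (y ∷ Y₀ ++ Y₁)) (sym p) (Dom-shift X₀ incX f (trans c (cong (λ L → length L + length Y₀) q)) pos D))
      where
      rm : removeFirstGT y (a ∷ []) ≡ []
      rm rewrite <ᵇ-true y<a = refl
    sub (l ∷ L) q = inj₂ (mkSplit X₀ X₁ (y ∷ Y₀) Y₁ a p refl (y<a ∷ lo) hi D
        (Fit-cons (incX₀ X₀ incX) f (Allₚ.++⁻ˡ X₀ pos) (≤-trans (s≤s (m≤n+m (length Y₀) (length L))) (≤-reflexive (sym c'))))
        (trans (unpaired-∷ (x ∷ X) y (Y₀ ++ Y₁)) (trans (cong (removeFirstGT y) (trans e (cong (_∷ʳ a) q))) (trans (rm a) (cong (_∷ʳ a) (sym u')))))
        (trans c' (trans (sym (+-suc (length L) (length Y₀))) (cong (λ L → length L + suc (length Y₀)) (sym u')))))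
      where
      c' : length X₀ ≡ suc (length L) + length Y₀
      c' = trans c (cong (λ L → length L + length Y₀) q)
      y<l : y < l
      y<l = All.head (subst (All (y <_)) q (unpaired-All X₀ Y₀ (Allₚ.++⁻ˡ X₀ pos)))
      rm : ∀ a → removeFirstGT y ((l ∷ L) ∷ʳ a) ≡ L ∷ʳ a
      rm a rewrite <ᵇ-true y<l = refl
      u' : unpaired X₀ (y ∷ Y₀) ≡ L
      u' = trans (unpaired-∷ X₀ y Y₀) (trans (cong (removeFirstGT y) q) (cong (λ b → if b then L else (l ∷ removeFirstGT y L)) (<ᵇ-true y<l)))

split : ∀ X Y → Inc X → Inc Y → SplitCases X Y
split []      Y       i j = inj₁ (unpaired-[] Y , [])
split (x ∷ X) []      i j with snoc (x ∷ X) (s≤s z≤n)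
... | X₀ , a , e = inj₂ (mkSplit X₀ [] [] [] a e refl [] [] [] [] e (sym (+-identityʳ _)))
split (x ∷ X) (y ∷ Y) i@(_ ∷ i') j@(_ ∷ j') = split-step x X y Y i j (split X (y ∷ Y) i' j) (split (x ∷ X) Y i j')

unpaired-Dom : ∀ X Y → Inc X → Inc Y → Dom Y X → unpaired X Y ≡ []
unpaired-Dom X Y i j D with split X Y i j
... | inj₁ (e , _) = e
... | inj₂ (mkSplit X₀ X₁ Y₀ Y₁ a refl refl lo hi D' f e c) = ⊥-elim (Dom-⊥ X₀ Y₀ i hi (Fit-length f) D)

RIns-skip : ∀ {y R w R' o} → All (y <_) w → RIns R w R' o → RIns (y ∷ R) w (y ∷ R') o
RIns-skip []       []       = []
RIns-skip (p ∷ ps) (d ∷ ds) = skip p d ∷ RIns-skip ps ds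

RIns-skips : ∀ Z {R w R' o} → All (λ z → All (z <_) w) Z → RIns R w R' o → RIns (Z ++ R) w (Z ++ R') o
RIns-skips []      []       d = d
RIns-skips (z ∷ Z) (p ∷ ps) d = RIns-skip p (RIns-skips Z ps d)

RIns-++ : ∀ {R u R₁ o₁ v R₂ o₂} → RIns R u R₁ o₁ → RIns R₁ v R₂ o₂ → RIns R (u ++ v) R₂ (o₁ ++ o₂)
RIns-++ [] e = e
RIns-++ {R} {v = v} {R₂} {o₂} (_∷_ {x = x} {w} {o₁ = o₁} {o₂ = o₁'} d ds) e = subst (RIns R (x ∷ w ++ v) R₂) (sym (++-assoc o₁ o₁' o₂)) (d ∷ RIns-++ ds e)

Red-RIns : ∀ {R u R' o} w → Inc R → RIns R u R' o → Red (R ++ u ++ w) → Red (R' ++ w)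
Red-RIns w i []       r = r
Red-RIns w i (d ∷ ds) r = Red-RIns w (Ins-Inc i d) ds (Red-Ins i d r)

Dom-RIns : ∀ {X Y} → Inc X → Inc Y → Dom Y X → RIns X Y Y X
Dom-RIns {Y = []}    i j         []      = []
Dom-RIns {Y = y ∷ Y} i (y< ∷ j)  []      = app ∷ RIns-skip y< (Dom-RIns [] j [])
Dom-RIns (_ ∷ i) (y< ∷ j) (p ∷ D) = bump p ∷ RIns-skip y< (Dom-RIns i j D)

insertSorted-All : ∀ {P : ℕ → Set} x Y → P x → All P Y → All P (insertSorted x Y)
insertSorted-All x []      p []       = p ∷ []
insertSorted-All x (y ∷ Y) p (q ∷ qs) with x ≤ᵇ y
... | true  = p ∷ q ∷ qs
... | false = q ∷ insertSorted-All x Y p qs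

insertSorted-skip : ∀ x Y₀ Y₁ → All (_< x) Y₀ → insertSorted x (Y₀ ++ Y₁) ≡ Y₀ ++ insertSorted x Y₁
insertSorted-skip x []       Y₁ []       = refl
insertSorted-skip x (y ∷ Y₀) Y₁ (p ∷ ps) rewrite ≤ᵇ-false p = cong (y ∷_) (insertSorted-skip x Y₀ Y₁ ps)

insertSorted-head : ∀ x Y → All (x ≤_) Y → insertSorted x Y ≡ x ∷ Y
insertSorted-head x []      []      = refl
insertSorted-head x (y ∷ Y) (p ∷ _) rewrite ≤ᵇ-true p = refl

-- Inserting `Y₁` into the row `a ∷ X₁` bumps exactly `X₁` and leaves `Y₁` with `end` added. By
-- `dom⁺` the same row and the same bumped word result from inserting the enlarged `Y₁` into `X₁`.
record Run (a : ℕ) (X₁ Y₁ : Word) : Set where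
  constructor mkRun
  field
    end      : ℕ
    a≤end    : a ≤ end
    run      : ∀ b → a < b → b ≤ end → b ∈ X₁
    stops    : suc end ∉ X₁
    short    : end ≤ length X₁ + a
    new      : end ∉ Y₁
    rins-run : RIns (a ∷ X₁) Y₁ (insertSorted end Y₁) X₁
    dom⁺     : Dom (insertSorted end Y₁) X₁

run-stop : ∀ a X₁ Y₁ → suc a ∉ X₁ → All (a <_) X₁ → Inc X₁ → All (a ≤_) Y₁ → Inc Y₁ → Dom Y₁ X₁ → Red (a ∷ X₁ ++ Y₁) → Run a X₁ Y₁
run-stop a X₁ Y₁ ∉X lo i hi j D r = mkRun a ≤-refl (λ b l l' → ⊥-elim (<⇒≱ l l')) ∉X (m≤n+m a (length X₁)) (λ m → <-irrefl refl (All.lookup strict m))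
    (subst (λ Y → RIns (a ∷ X₁) Y₁ Y X₁) (sym eq) (RIns-skip strict (Dom-RIns i j D))) (subst (λ Y → Dom Y X₁) (sym eq) (dom⁺ X₁ i lo D))
  where
  far : All (Far a) X₁
  far = All.tabulate λ {x} m → inj₁ (≤∧≢⇒< (All.lookup lo m) λ { refl → ∉X m })
  strict′ : ∀ Y₁ → All (a ≤_) Y₁ → Inc Y₁ → Red (a ∷ X₁ ++ Y₁) → All (a <_) Y₁
  strict′ [] hi j r = []
  strict′ (y ∷ Y) (p ∷ hi) (y< ∷ j) r with a ≟ y
  ... | yes refl = ⊥-elim (Red-square a X₁ Y far r)
  ... | no ne    = ≤∧≢⇒< p ne ∷ All.map (≤-<-trans p) y<
  strict = strict′ Y₁ hi j r
  eq = insertSorted-head a Y₁ hi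
  dom⁺ : ∀ X₁ → Inc X₁ → All (a <_) X₁ → Dom Y₁ X₁ → Dom (a ∷ Y₁) X₁
  dom⁺ []      i lo      D = []
  dom⁺ (x ∷ X) i (p ∷ _) D = p ∷ Dom-tail i D

-- If `X₁` begins with `suc a`, then `dom` and `a ≤ y` force `Y₁` to begin with `a`; the special
-- rule applies and the problem recurs with `suc a`.
run-of : ∀ a X₁ Y₁ → All (a <_) X₁ → Inc X₁ → All (a ≤_) Y₁ → Inc Y₁ → Dom Y₁ X₁ → Red (a ∷ X₁ ++ Y₁) → Run a X₁ Y₁
run-of a [] Y₁ lo i hi j D r = run-stop a [] Y₁ (λ ()) lo i hi j D r
run-of a (x ∷ X₂) Y₁ (p ∷ lo) (x< ∷ i) hi j D r with suc a ≟ x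
... | no ne = run-stop a (x ∷ X₂) Y₁ (λ { (here e) → ne e ; (there m) → <⇒≱ (All.lookup x< m) p }) (p ∷ lo) (x< ∷ i) hi j D r
run-of a (.(suc a) ∷ X₂) (y ∷ Y₂) (p ∷ lo) (x< ∷ i) (q ∷ hi) (y< ∷ j) (s ∷ D) r | yes refl with ≤-antisym q (≤-pred s)
... | refl with run-of (suc a) X₂ Y₂ x< i y< j D (Red-suffix (a ∷ []) _ (Red-Ins {o = suc a ∷ []} ((p ∷ lo) ∷ x< ∷ i) spec r))
...   | mkRun end l run stops short new ri D⁺ = mkRun end (<⇒≤ l) run' stops' (≤-trans short (≤-reflexive (+-suc (length X₂) a))) new'
          (subst (λ Y → RIns (a ∷ suc a ∷ X₂) (a ∷ Y₂) Y (suc a ∷ X₂)) (sym eq) (spec ∷ RIns-skip y< ri)) (subst (λ Y → Dom Y (suc a ∷ X₂)) (sym eq) (n<1+n a ∷ D⁺))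
  where
  eq = insertSorted-skip end (a ∷ []) Y₂ (l ∷ [])
  run' : ∀ b → a < b → b ≤ end → b ∈ suc a ∷ X₂
  run' b u v with suc a ≟ b
  ... | yes refl = here refl
  ... | no ne    = there (run b (≤∧≢⇒< u ne) v)
  stops' : suc end ∉ suc a ∷ X₂
  stops' (here e)  = <⇒≱ l (≤-reflexive (suc-injective e))
  stops' (there m) = stops m
  new' : end ∉ a ∷ Y₂
  new' (here e)  = <⇒≱ l (≤-reflexive e)
  new' (there m) = new m

-- The tail `T'` is arbitrary because the insertion of `Y₀` is needed both with `a ∷ X₁` and with
-- `X₁` behind `X₀`.
fit-Ins : ∀ X₀ {T W y Y R o} → Ins W y R o → W ≡ X₀ ++ T → Fit X₀ (y ∷ Y) → ∃ λ Z → (R ≡ Z ++ T) × (∀ T' → Ins (X₀ ++ T') y (Z ++ T') o) × Fit Z Y × (∀ {P : ℕ → Set} → All P X₀ → P y → All P Z)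
fit-Ins (x ∷ X₀) (bump q) refl (fmatch p f) = _ , refl , (λ T' → bump q) , fdrop f , λ { (_ ∷ ps) p → p ∷ ps }
fit-Ins (x ∷ X₀) (bump q) refl (fdrop f)    = _ , refl , (λ T' → bump q) , fdrop (Fit-tail f) , λ { (_ ∷ ps) p → p ∷ ps }
fit-Ins (x ∷ x' ∷ X₀) spec refl f         = x ∷ x' ∷ X₀ , refl , (λ T' → spec) , Fit-tail f , λ ps _ → ps
fit-Ins (x ∷ [])  spec refl (fmatch p f)   = ⊥-elim (<-irrefl refl p)
fit-Ins (x ∷ X₀) (skip q d) refl (fmatch p f) = ⊥-elim (<-asym p q)
fit-Ins (x ∷ X₀) (skip q d) refl (fdrop f) with fit-Ins X₀ d refl f
... | Z , refl , h , f' , al = x ∷ Z , refl , (λ T' → skip q (h T')) , fdrop f' , λ { (p ∷ ps) py → p ∷ al ps py }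

fit-RIns : ∀ {Y X₀ T R o} → Fit X₀ Y → RIns (X₀ ++ T) Y R o → ∃ λ Z → (R ≡ Z ++ T) × (∀ T' → RIns (X₀ ++ T') Y (Z ++ T') o) × (∀ {P : ℕ → Set} → All P X₀ → All P Y → All P Z)
fit-RIns {[]} {X₀} f [] = X₀ , refl , (λ T' → []) , λ ps _ → ps
fit-RIns {y ∷ Y} {X₀} f (d ∷ ds) with fit-Ins X₀ d refl f
... | Z₁ , refl , h , f' , al with fit-RIns f' ds
...   | Z , refl , h' , al' = Z , refl , (λ T' → h T' ∷ h' T') , λ { ps (q ∷ qs) → al' (al ps q) qs }

removeVal-none : ∀ a X → All (_≢ a) X → removeVal a X ≡ X
removeVal-none a []      []       = refl
removeVal-none a (x ∷ X) (p ∷ ps) rewrite ≡ᵇ-false p = cong (x ∷_) (removeVal-none a X ps)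

removeVal-split : ∀ a X₀ X₁ → All (_≢ a) X₀ → All (_≢ a) X₁ → removeVal a (X₀ ++ a ∷ X₁) ≡ X₀ ++ X₁
removeVal-split a []       X₁ []       qs rewrite ≡ᵇ-true {a} refl = removeVal-none a X₁ qs
removeVal-split a (x ∷ X₀) X₁ (p ∷ ps) qs rewrite ≡ᵇ-false p = cong (x ∷_) (removeVal-split a X₀ X₁ ps qs)

memᵇ-true : ∀ {a X} → a ∈ X → memᵇ a X ≡ true
memᵇ-true {a} (here refl) rewrite ≡ᵇ-true {a} refl = refl
memᵇ-true {a} {x ∷ X} (there m) rewrite memᵇ-true m with a ≡ᵇ x
... | true  = refl
... | false = refl

memᵇ-false : ∀ {a} X → a ∉ X → memᵇ a X ≡ false
memᵇ-false []      n = refl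
memᵇ-false {a} (x ∷ X) n rewrite ≡ᵇ-false (λ e → n (here e)) = memᵇ-false X (n ∘ there)

runEnd-spec : ∀ n a e X → a ≤ e → e ≤ n + a → (∀ b → a < b → b ≤ e → b ∈ X) → suc e ∉ X → runEnd n a X ≡ e
runEnd-spec zero    a e X l s r st = ≤-antisym l s
runEnd-spec (suc n) a e X l s r st with m≤n⇒m<n∨m≡n l
... | inj₂ refl rewrite memᵇ-false X st = refl
... | inj₁ a<e rewrite memᵇ-true (r (suc a) ≤-refl a<e) = runEnd-spec n (suc a) e X a<e (≤-trans s (≤-reflexive (sym (+-suc n a)))) (λ b p q → r b (<-trans (n<1+n a) p) q) st

maxL-snoc : ∀ L a → All (_≤ a) L → maxL (L ∷ʳ a) ≡ a
maxL-snoc []      a []       = ⊔-identityʳ a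
maxL-snoc (l ∷ L) a (p ∷ ps) rewrite maxL-snoc L a ps = m≤n⇒m⊔n≡n p

AP-++⁻ : ∀ {R : ℕ → ℕ → Set} u {v} → AllPairs R (u ++ v) → AllPairs R u × AllPairs R v × All (λ x → All (R x) v) u
AP-++⁻ []      a       = [] , a , []
AP-++⁻ (x ∷ u) (p ∷ a) with AP-++⁻ u a
... | b , c , d = Allₚ.++⁻ˡ u p ∷ b , c , Allₚ.++⁻ʳ u p ∷ d

AP-++ : ∀ {R : ℕ → ℕ → Set} {u v} → AllPairs R u → AllPairs R v → All (λ x → All (R x) v) u → AllPairs R (u ++ v)
AP-++ []      b []       = b
AP-++ (p ∷ a) b (q ∷ qs) = Allₚ.++⁺ p q ∷ AP-++ a b qs

record Raised (X Y X' Y' L : Word) (a e : ℕ) : Set where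
  field
    equiv  : (X ++ Y) ∼ (X' ++ Y')
    incX   : Inc X'
    incY   : Inc Y'
    X'≡    : X' ≡ removeVal a X
    Y'≡    : Y' ≡ insertSorted e Y
    L'≡    : unpaired X' Y' ≡ L
    a≡     : maxL (unpaired X Y) ≡ a
    e≡     : runEnd (length X) a X ≡ e
    a≤e    : a ≤ e
    a∉X'   : a ∉ X'
    e∉Y    : e ∉ Y
    lenX   : length X ≡ suc (length X')
    runX   : ∀ b → a < b → b ≤ e → b ∈ X

-- Raising preserves the class: inserting the second factor into the first yields, before and after,
-- the same row and the same bumped word. `Y₀` acts only on `X₀`, and the rest is `Run`.
raise′ : ∀ X Y → Inc X → Inc Y → Red (X ++ Y) → (S : Split X Y) → ∃ λ X' → ∃ λ Y' → ∃ λ e → Raised X Y X' Y' (unpaired (Split.X₀ S) (Split.Y₀ S)) (Split.a S) e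
raise′ X Y i j r (mkSplit X₀ X₁ Y₀ Y₁ a refl refl lo hi D f e c) with AP-++⁻ X₀ i | AP-++⁻ Y₀ j
... | i₀ , a<X₁ ∷ i₁ , X₀< | j₀ , j₁ , Y₀< = go (fit-RIns f dX)
  where
  dX = RIns-total Y₀ i (Red-prefix ((X₀ ++ a ∷ X₁) ++ Y₀) Y₁ (subst Red (sym (++-assoc (X₀ ++ a ∷ X₁) Y₀ Y₁)) r))
  X₀<a : All (_< a) X₀
  X₀<a = All.map All.head X₀<
  go : (∃ λ Z → (rins (X₀ ++ a ∷ X₁) Y₀ ≡ Z ++ a ∷ X₁) × (∀ T' → RIns (X₀ ++ T') Y₀ (Z ++ T') (routs (X₀ ++ a ∷ X₁) Y₀)) × (∀ {P : ℕ → Set} → All P X₀ → All P Y₀ → All P Z)) →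
       ∃ λ X' → ∃ λ Y' → ∃ λ e → Raised (X₀ ++ a ∷ X₁) (Y₀ ++ Y₁) X' Y' (unpaired X₀ Y₀) a e
  go (Z , _ , h , al) = build (run-of a X₁ Y₁ a<X₁ i₁ hi j₁ D (Red-suffix Z _ (subst Red (++-assoc Z (a ∷ X₁) Y₁) (Red-RIns Y₁ i (h (a ∷ X₁)) r))))
    where
    Z<a = al X₀<a lo
    build : Run a X₁ Y₁ → ∃ λ X' → ∃ λ Y' → ∃ λ e → Raised (X₀ ++ a ∷ X₁) (Y₀ ++ Y₁) X' Y' (unpaired X₀ Y₀) a e
    build (mkRun end a≤end run stops short new ri D⁺) = X₀ ++ X₁ , Y₀ ++ Y⁺ , end , record
      { equiv = ∼trans (RIns-∼ i (RIns-++ (h (a ∷ X₁)) (RIns-skips Z (All.map (λ z → All.map (<-≤-trans z) hi) Z<a) ri)))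
                       (∼sym (RIns-∼ incX' (RIns-++ (h X₁) (RIns-skips Z (All.map (λ z → All.map (<-≤-trans z) hi⁺) Z<a) (Dom-RIns i₁ inc⁺ D⁺)))))
      ; incX = incX'
      ; incY = AP-++ j₀ inc⁺ (All.map (λ p → All.map (<-≤-trans p) hi⁺) lo)
      ; X'≡ = sym (removeVal-split a X₀ X₁ (All.map <⇒≢ X₀<a) (All.map >⇒≢ a<X₁))
      ; Y'≡ = sym (insertSorted-skip end Y₀ Y₁ (All.map (λ p → <-≤-trans p a≤end) lo))
      ; L'≡ = trans (unpaired-++ (X₀ ++ X₁) Y₀ Y⁺) (cong (λ W → unpaired W Y₀) (trans (skips X₀ (All.map (λ p → All.map (λ q → ≤-trans (<⇒≤ p) q) hi⁺) X₀<a)) (trans (cong (X₀ ++_) (unpaired-Dom X₁ Y⁺ i₁ inc⁺ D⁺)) (++-identityʳ X₀))))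
      ; a≡ = trans (cong maxL e) (maxL-snoc (unpaired X₀ Y₀) a (unpaired-All X₀ Y₀ (All.map <⇒≤ X₀<a)))
      ; e≡ = runEnd-spec (length (X₀ ++ a ∷ X₁)) a end (X₀ ++ a ∷ X₁) a≤end (≤-trans short (+-monoˡ-≤ a (≤-trans (m≤n+m (length X₁) (suc (length X₀))) (≤-reflexive (sym (trans (length-++ X₀) (+-suc (length X₀) (length X₁)))))))) (λ b p q → ∈-++⁺ʳ X₀ (there (run b p q))) st
      ; a≤e = a≤end
      ; a∉X' = λ m → case ∈-++⁻ X₀ m of λ { (inj₁ m) → <-irrefl refl (All.lookup X₀<a m) ; (inj₂ m) → <-irrefl refl (All.lookup a<X₁ m) }
      ; e∉Y = λ m → case ∈-++⁻ Y₀ m of λ { (inj₁ m) → <⇒≱ (All.lookup lo m) a≤end ; (inj₂ m) → new m }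
      ; lenX = trans (length-++ X₀) (trans (+-suc (length X₀) (length X₁)) (cong suc (sym (length-++ X₀))))
      ; runX = λ b p q → ∈-++⁺ʳ X₀ (there (run b p q))
      }
      where
      Y⁺ = insertSorted end Y₁
      hi⁺ : All (a ≤_) Y⁺
      hi⁺ = insertSorted-All end Y₁ a≤end hi
      inc⁺ : Inc Y⁺
      inc⁺ = RIns-Inc (a<X₁ ∷ i₁) ri
      incX' : Inc (X₀ ++ X₁)
      incX' = AP-++ i₀ i₁ (All.map All.tail X₀<)
      st : suc end ∉ X₀ ++ a ∷ X₁
      st m with ∈-++⁻ X₀ m
      ... | inj₁ m' = <⇒≱ (All.lookup X₀<a m') (≤-trans a≤end (n≤1+n end))
      ... | inj₂ (here q) = <-irrefl (sym q) (s≤s a≤end)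
      ... | inj₂ (there m') = stops m'
      skips : ∀ W → All (λ x → All (x ≤_) Y⁺) W → unpaired (W ++ X₁) Y⁺ ≡ W ++ unpaired X₁ Y⁺
      skips []      []       = refl
      skips (w ∷ W) (p ∷ ps) = trans (unpaired-skip w (W ++ X₁) Y⁺ p) (cong (w ∷_) (skips W ps))

abstract
  raise : ∀ X Y → Inc X → Inc Y → Red (X ++ Y) → (S : Split X Y) → ∃ λ X' → ∃ λ Y' → ∃ λ e → Raised X Y X' Y' (unpaired (Split.X₀ S) (Split.Y₀ S)) (Split.a S) e
  raise = raise′

-- Which box of the middle shape the raising operator removes

-- Written without subtraction: `r₀` is the last minimum of the number of boxes of `B/A` in rows
-- before `r` minus the number of boxes of `C/B` in rows up to and including `r`. This is the
-- bracketing of the two strips, expressed by row lengths.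
record Best (A B C : ℕ → ℕ) (r₀ : ℕ) : Set where
  constructor best
  field
    before : ∀ r → r < r₀ → (Sum r₀ B + Sum (suc r₀) B) + (Sum r A + Sum (suc r) C) ≤ (Sum r B + Sum (suc r) B) + (Sum r₀ A + Sum (suc r₀) C)
    after  : ∀ r → r₀ < r → (Sum r₀ B + Sum (suc r₀) B) + (Sum r A + Sum (suc r) C) < (Sum r B + Sum (suc r) B) + (Sum r₀ A + Sum (suc r₀) C)
open Best

lt-suc : ∀ m r → lt m (suc r) ≡ lt m r + ι m r
lt-suc zero    zero    = refl
lt-suc zero    (suc r) = refl
lt-suc (suc m) zero    = refl
lt-suc (suc m) (suc r) = lt-suc m r

lt-ι : ∀ m r → lt m r ≡ lt (suc m) r + ι (suc m) r
lt-ι m       zero    = refl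
lt-ι m       (suc r) = lt-suc m r

Sum-ι : ∀ n (f : ℕ → ℕ) u → Sum n (λ t → f t + ι u t) ≡ Sum n f + lt u n
Sum-ι n f u = trans (Sum-+ n f (ι u)) (cong (Sum n f +_) (go n))
  where
  go : ∀ n → Sum n (ι u) ≡ lt u n
  go zero    = refl
  go (suc n) = trans (cong (_+ ι u n) (go n)) (sym (lt-suc u n))

-- The effect of prepending one letter, by which `C`, `B`, `B'` and `A` grow in the rows `u`, `u₁`,
-- `u₂` and `u₃`.
module Step (A B C B' : ℕ → ℕ) (r₀ : ℕ) (eqB : ∀ t → B t ≡ B' t + ι r₀ t) (bst : Best A B C r₀) where

  P N : ℕ → ℕ
  P r = Sum r B + Sum (suc r) B
  N r = Sum r A + Sum (suc r) C

  Goal : ℕ → ℕ → ℕ → ℕ → Set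
  Goal u u₁ u₂ u₃ = ∃ λ r → (∀ t → B t + ι u₁ t ≡ B' t + ι u₂ t + ι r t) × Best (λ t → A t + ι u₃ t) (λ t → B t + ι u₁ t) (λ t → C t + ι u t) r

  -- ε⁺ and ε⁻ record by how much the potential P - N changes.
  module _ (u u₁ u₃ : ℕ) (ε⁺ ε⁻ : ℕ → ℕ) (ε : ∀ r → (lt u₁ r + lt u₁ (suc r)) + ε⁻ r ≡ (lt u₃ r + lt u (suc r)) + ε⁺ r) where
    transfer-≤ : ∀ r s k → k + (P r + N s + (ε⁺ r + ε⁻ s)) ≤ P s + N r + (ε⁺ s + ε⁻ r) →
      k + ((Sum r (λ t → B t + ι u₁ t) + Sum (suc r) (λ t → B t + ι u₁ t)) + (Sum s (λ t → A t + ι u₃ t) + Sum (suc s) (λ t → C t + ι u t)))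
      ≤ (Sum s (λ t → B t + ι u₁ t) + Sum (suc s) (λ t → B t + ι u₁ t)) + (Sum r (λ t → A t + ι u₃ t) + Sum (suc r) (λ t → C t + ι u t))
    transfer-≤ r s k h = subst₂ _≤_ (cong (k +_) (sym (expand r s))) (sym (expand s r))
      (go (Sum r B) (Sum (suc r) B) (Sum s A) (Sum (suc s) C) (Sum s B) (Sum (suc s) B) (Sum r A) (Sum (suc r) C)
         (lt u₁ r) (lt u₁ (suc r)) (lt u₃ s) (lt u (suc s)) (lt u₁ s) (lt u₁ (suc s)) (lt u₃ r) (lt u (suc r)) (ε⁺ r) (ε⁻ r) (ε⁺ s) (ε⁻ s) h (≤-reflexive (ε r)) (≤-reflexive (sym (ε s))))
      where
      expand : ∀ r s → (Sum r (λ t → B t + ι u₁ t) + Sum (suc r) (λ t → B t + ι u₁ t)) + (Sum s (λ t → A t + ι u₃ t) + Sum (suc s) (λ t → C t + ι u t))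
        ≡ (Sum r B + lt u₁ r + (Sum (suc r) B + lt u₁ (suc r))) + (Sum s A + lt u₃ s + (Sum (suc s) C + lt u (suc s)))
      expand r s = cong₂ _+_ (cong₂ _+_ (Sum-ι r B u₁) (Sum-ι (suc r) B u₁)) (cong₂ _+_ (Sum-ι s A u₃) (Sum-ι (suc s) C u))
      go : ∀ a b c d e f g h' l₁ l₂ l₃ l₄ l₅ l₆ l₇ l₈ p q p' q' → k + (a + b + (c + d) + (p + q')) ≤ e + f + (g + h') + (p' + q) → (l₁ + l₂) + q ≤ (l₇ + l₈) + p → (l₃ + l₄) + p' ≤ (l₅ + l₆) + q' →
           k + (a + l₁ + (b + l₂) + (c + l₃ + (d + l₄))) ≤ e + l₅ + (f + l₆) + (g + l₇ + (h' + l₈))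
      go a b c d e f g h' l₁ l₂ l₃ l₄ l₅ l₆ l₇ l₈ p q p' q' H E E' = lin (k ∷ a ∷ b ∷ c ∷ d ∷ e ∷ f ∷ g ∷ h' ∷ l₁ ∷ l₂ ∷ l₃ ∷ l₄ ∷ l₅ ∷ l₆ ∷ l₇ ∷ l₈ ∷ p ∷ q ∷ p' ∷ q' ∷ [])
        ((# 0 ⊕ (# 1 ⊕ # 2 ⊕ (# 3 ⊕ # 4) ⊕ (# 17 ⊕ # 20)) ≼ # 5 ⊕ # 6 ⊕ (# 7 ⊕ # 8) ⊕ (# 19 ⊕ # 18) by H) ∷
         ((# 9 ⊕ # 10) ⊕ # 18 ≼ (# 15 ⊕ # 16) ⊕ # 17 by E) ∷ ((# 11 ⊕ # 12) ⊕ # 19 ≼ (# 13 ⊕ # 14) ⊕ # 20 by E') ∷ [])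
        (# 0 ⊕ (# 1 ⊕ # 9 ⊕ (# 2 ⊕ # 10) ⊕ (# 3 ⊕ # 11 ⊕ (# 4 ⊕ # 12)))) (# 5 ⊕ # 13 ⊕ (# 6 ⊕ # 14) ⊕ (# 7 ⊕ # 15 ⊕ (# 8 ⊕ # 16)))

  zeroε : ℕ → ℕ
  zeroε _ = 0

  keep : ∀ u₁ t → B t + ι u₁ t ≡ B' t + ι u₁ t + ι r₀ t
  keep u₁ t = trans (cong (_+ ι u₁ t) (eqB t)) (trans (+-assoc (B' t) _ _) (trans (cong (B' t +_) (+-comm (ι r₀ t) (ι u₁ t))) (sym (+-assoc (B' t) _ _))))

  same : ∀ u u₁ u₃ → (∀ r → lt u₁ r + lt u₁ (suc r) ≡ lt u₃ r + lt u (suc r)) → Goal u u₁ u₁ u₃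
  same u u₁ u₃ e = r₀ , keep u₁ , best
      (λ r l → transfer-≤ u u₁ u₃ zeroε zeroε (λ r → cong (_+ 0) (e r)) r₀ r 0 (+-monoˡ-≤ 0 (before bst r l)))
      (λ r l → transfer-≤ u u₁ u₃ zeroε zeroε (λ r → cong (_+ 0) (e r)) r₀ r 1 (+-monoˡ-≤ 0 (after bst r l)))

  increase : ∀ u u₁ u₃ m → m ≢ r₀ → (∀ r → lt u₁ r + lt u₁ (suc r) ≡ lt u₃ r + lt u (suc r) + ι m r) → Goal u u₁ u₁ u₃
  increase u u₁ u₃ m ne e = r₀ , keep u₁ , best
      (λ r l → transfer-≤ u u₁ u₃ (ι m) zeroε (λ r → trans (+-identityʳ _) (e r)) r₀ r 0 (bound r 0 (before bst r l)))
      (λ r l → transfer-≤ u u₁ u₃ (ι m) zeroε (λ r → trans (+-identityʳ _) (e r)) r₀ r 1 (bound r 1 (after bst r l)))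
    where
    bound : ∀ r k → k + (P r₀ + N r) ≤ P r + N r₀ → k + (P r₀ + N r + (ι m r₀ + 0)) ≤ P r + N r₀ + (ι m r + 0)
    bound r k h rewrite ι-≢ ne | +-identityʳ (P r₀ + N r) = ≤-trans h (m≤m+n _ _)

  -- Since B (suc m) = A m, the potential at suc m exceeds that at m by B m - C (suc m).
  jump : ∀ m → B (suc m) ≡ A m → P (suc m) + N m + C (suc m) ≡ P m + N (suc m) + B m
  jump m e = ≤-antisym
      (lin env ((# 2 ≼ # 4 by ≤-reflexive e) ∷ []) ((# 0 ⊕ # 1 ⊕ (# 0 ⊕ # 1 ⊕ # 2)) ⊕ (# 3 ⊕ # 5) ⊕ # 6) ((# 0 ⊕ (# 0 ⊕ # 1)) ⊕ (# 3 ⊕ # 4 ⊕ (# 5 ⊕ # 6)) ⊕ # 1))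
      (lin env ((# 4 ≼ # 2 by ≤-reflexive (sym e)) ∷ []) ((# 0 ⊕ (# 0 ⊕ # 1)) ⊕ (# 3 ⊕ # 4 ⊕ (# 5 ⊕ # 6)) ⊕ # 1) ((# 0 ⊕ # 1 ⊕ (# 0 ⊕ # 1 ⊕ # 2)) ⊕ (# 3 ⊕ # 5) ⊕ # 6))
    where env = Sum m B ∷ B m ∷ B (suc m) ∷ Sum m A ∷ A m ∷ Sum (suc m) C ∷ C (suc m) ∷ []

  εdec : ∀ m r → (lt (suc m) r + lt (suc m) (suc r)) + ι (suc m) r ≡ (lt m r + lt (suc m) (suc r)) + 0
  εdec m r = trans (+-assoc (lt (suc m) r) _ _) (trans (cong (lt (suc m) r +_) (+-comm _ (ι (suc m) r))) (trans (sym (+-assoc (lt (suc m) r) _ _)) (trans (cong (_+ lt (suc m) (suc r)) (sym (lt-ι m r))) (sym (+-identityʳ _)))))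

  -- The potential drops by one at `suc m`. By `jump` it exceeded the one at `m` before, by at least
  -- two if `m` is `r₀`, so `suc m` does not take over.
  decrease : ∀ m → suc m ≢ r₀ → B (suc m) ≡ A m → C (suc m) < B' m → Goal (suc m) (suc m) (suc m) m
  decrease m ne e lt' = r₀ , keep (suc m) , best
      (λ r l → transfer-≤ (suc m) (suc m) m zeroε (ι (suc m)) (εdec m) r₀ r 0 (bound₀ r l))
      (λ r l → transfer-≤ (suc m) (suc m) m zeroε (ι (suc m)) (εdec m) r₀ r 1 (bound₁ r l))
    where
    B'≤B : B' m ≤ B m
    B'≤B = ≤-trans (m≤m+n _ _) (≤-reflexive (sym (eqB m)))
    bound₀ : ∀ r → r < r₀ → P r₀ + N r + (0 + ι (suc m) r) ≤ P r + N r₀ + (0 + ι (suc m) r₀)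
    bound₀ r l with suc m ≟ r
    ... | no ne' rewrite ι-≢ ne | ι-≢ ne' = +-monoˡ-≤ 0 (before bst r l)
    ... | yes refl rewrite ι-≢ ne | ι-refl (suc m) = lin (P r₀ ∷ N (suc m) ∷ P (suc m) ∷ N r₀ ∷ P m ∷ N m ∷ B m ∷ C (suc m) ∷ [])
      ((# 0 ⊕ # 5 ≼ # 4 ⊕ # 3 by before bst m (<-trans (n<1+n m) l)) ∷ (# 4 ⊕ # 1 ⊕ # 6 ≼ # 2 ⊕ # 5 ⊕ # 7 by ≤-reflexive (sym (jump m e))) ∷ (! 1 ⊕ # 7 ≼ # 6 by ≤-trans lt' B'≤B) ∷ [])
      (# 0 ⊕ # 1 ⊕ (! 0 ⊕ ! 1)) (# 2 ⊕ # 3 ⊕ (! 0 ⊕ ! 0))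
    bound₁ : ∀ r → r₀ < r → suc (P r₀ + N r + (0 + ι (suc m) r)) ≤ P r + N r₀ + (0 + ι (suc m) r₀)
    bound₁ r l with suc m ≟ r
    ... | no ne' rewrite ι-≢ ne | ι-≢ ne' = +-monoˡ-≤ 0 (after bst r l)
    ... | yes refl with m ≟ r₀
    ...   | yes refl rewrite ι-≢ ne | ι-refl (suc m) = lin (P m ∷ N (suc m) ∷ P (suc m) ∷ N m ∷ B m ∷ C (suc m) ∷ B' m ∷ [])
      ((# 0 ⊕ # 1 ⊕ # 4 ≼ # 2 ⊕ # 3 ⊕ # 5 by ≤-reflexive (sym (jump m e))) ∷ (! 1 ⊕ # 5 ≼ # 6 by lt') ∷ (# 6 ⊕ ! 1 ≼ # 4 by ≤-reflexive (sym (trans (eqB m) (cong (B' m +_) (ι-refl m))))) ∷ [])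
      (! 1 ⊕ (# 0 ⊕ # 1 ⊕ (! 0 ⊕ ! 1))) (# 2 ⊕ # 3 ⊕ (! 0 ⊕ ! 0))
    ...   | no ne'' rewrite ι-≢ ne | ι-refl (suc m) = lin (P r₀ ∷ N (suc m) ∷ P (suc m) ∷ N r₀ ∷ P m ∷ N m ∷ B m ∷ C (suc m) ∷ [])
      ((! 1 ⊕ (# 0 ⊕ # 5) ≼ # 4 ⊕ # 3 by after bst m (≤∧≢⇒< (≤-pred l) (ne'' ∘ sym))) ∷ (# 4 ⊕ # 1 ⊕ # 6 ≼ # 2 ⊕ # 5 ⊕ # 7 by ≤-reflexive (sym (jump m e))) ∷ (! 1 ⊕ # 7 ≼ # 6 by ≤-trans lt' B'≤B) ∷ [])
      (! 1 ⊕ (# 0 ⊕ # 1 ⊕ (! 0 ⊕ ! 1))) (# 2 ⊕ # 3 ⊕ (! 0 ⊕ ! 0))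

  -- The only case in which the removed box changes its row: the potential at `suc m` was larger by
  -- one and drops by one, which creates a tie, and the last minimum is wanted.
  move : ∀ m → m ≡ r₀ → B (suc m) ≡ A m → C (suc m) ≡ B' m → Goal (suc m) (suc m) m m
  move m refl e e' = suc m , (λ t → cong (_+ ι (suc m) t) (eqB t)) , best
      (λ r l → transfer-≤ (suc m) (suc m) m zeroε (ι (suc m)) (εdec m) (suc m) r 0 (bound₀ r l))
      (λ r l → transfer-≤ (suc m) (suc m) m zeroε (ι (suc m)) (εdec m) (suc m) r 1 (bound₁ r l))
    where
    B≡ : B m ≡ suc (C (suc m))
    B≡ = trans (eqB m) (trans (cong (B' m +_) (ι-refl m)) (trans (+-comm (B' m) 1) (cong suc (sym e'))))
    bound₀ : ∀ r → r < suc m → P (suc m) + N r + (0 + ι (suc m) r) ≤ P r + N (suc m) + (0 + ι (suc m) (suc m))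
    bound₀ r l rewrite ι-≢ {suc m} {r} (>⇒≢ l) | ι-refl (suc m) = lin (P (suc m) ∷ N r ∷ P r ∷ N (suc m) ∷ P m ∷ N m ∷ B m ∷ C (suc m) ∷ [])
      ((# 4 ⊕ # 1 ≼ # 2 ⊕ # 5 by weak) ∷ (# 0 ⊕ # 5 ⊕ # 7 ≼ # 4 ⊕ # 3 ⊕ # 6 by ≤-reflexive (jump m e)) ∷ (# 6 ≼ ! 1 ⊕ # 7 by ≤-reflexive B≡) ∷ [])
      (# 0 ⊕ # 1 ⊕ (! 0 ⊕ ! 0)) (# 2 ⊕ # 3 ⊕ (! 0 ⊕ ! 1))
      where
      weak : P m + N r ≤ P r + N m
      weak with m≤n⇒m<n∨m≡n (≤-pred l)
      ... | inj₁ l' = before bst r l'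
      ... | inj₂ refl = ≤-refl
    bound₁ : ∀ r → suc m < r → suc (P (suc m) + N r + (0 + ι (suc m) r)) ≤ P r + N (suc m) + (0 + ι (suc m) (suc m))
    bound₁ r l rewrite ι-≢ {suc m} {r} (<⇒≢ l) | ι-refl (suc m) = lin (P (suc m) ∷ N r ∷ P r ∷ N (suc m) ∷ P m ∷ N m ∷ B m ∷ C (suc m) ∷ [])
      ((! 1 ⊕ (# 4 ⊕ # 1) ≼ # 2 ⊕ # 5 by after bst r (<-trans (n<1+n m) l)) ∷ (# 0 ⊕ # 5 ⊕ # 7 ≼ # 4 ⊕ # 3 ⊕ # 6 by ≤-reflexive (jump m e)) ∷ (# 6 ≼ ! 1 ⊕ # 7 by ≤-reflexive B≡) ∷ [])
      (! 1 ⊕ (# 0 ⊕ # 1 ⊕ (! 0 ⊕ ! 0))) (# 2 ⊕ # 3 ⊕ (! 0 ⊕ ! 1))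

  off-r₀ : ∀ {m} → B m ≡ B' m → m ≢ r₀
  off-r₀ {m} e refl = 1+n≢n {B' m} (trans (+-comm 1 _) (trans (cong (B' m +_) (sym (ι-refl m))) (trans (sym (eqB m)) e)))

  step : ∀ u u₁ u₂ u₃ → Slid B C u u₁ → Slid B' C u u₂ → Slid A B u₁ u₃ → Slid A B' u₂ u₃ → Goal u u₁ u₂ u₃
  step u .u .u .u (inj₁ (refl , _)) (inj₁ (refl , _)) (inj₁ (refl , _)) _ = same u u u (λ r → refl)
  step .(suc m) .(suc m) .(suc m) m (inj₁ (refl , _)) (inj₁ (refl , h₂)) (inj₂ (refl , e)) (inj₁ (() , _))
  step .(suc m) .(suc m) .(suc m) m (inj₁ (refl , _)) (inj₁ (refl , h₂)) (inj₂ (refl , e)) (inj₂ (_ , e')) = decrease m (off-r₀ (trans e (sym e'))) e (h₂ m refl)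
  step .(suc m) .(suc m) m m (inj₁ (refl , h₁)) (inj₂ (refl , e₂)) (inj₂ (refl , e)) (inj₁ (refl , _)) = move m (sym (ι-pos r₀ m (lin (B m ∷ B' m ∷ ι r₀ m ∷ C (suc m) ∷ []) ((# 0 ≼ # 1 ⊕ # 2 by ≤-reflexive (eqB m)) ∷ (! 1 ⊕ # 3 ≼ # 0 by h₁ m refl) ∷ (# 1 ≼ # 3 by ≤-reflexive (sym e₂)) ∷ []) (! 1) (# 2)))) e e₂
  step .(suc m) .(suc m) m .(suc m) (inj₁ (refl , h₁)) (inj₂ (refl , e₂)) (inj₁ (refl , _)) (inj₁ (() , _))
  step u .u m u₃ (inj₁ (refl , h₁)) (inj₂ (refl , e₂)) (inj₁ (refl , _)) (inj₂ (q , _)) = ⊥-elim (<⇒≱ (<-trans (n<1+n m) (n<1+n (suc m))) (≤-reflexive (sym q)))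
  step u .u m u₃ (inj₁ (refl , h₁)) (inj₂ (refl , e₂)) (inj₂ (p , e)) (inj₂ (q , _)) = ⊥-elim (1+n≢n (trans (cong suc (suc-injective p)) (sym q)))
  step u u₁ .u u₃ (inj₂ (refl , e₁)) (inj₁ (refl , h₂)) _ _ = ⊥-elim (<⇒≱ (h₂ u₁ refl) (≤-trans (≤-trans (m≤m+n _ _) (≤-reflexive (sym (eqB u₁)))) (≤-reflexive (sym e₁))))
  step .(suc m) m .m .m (inj₂ (refl , e₁)) (inj₂ (refl , e₂)) (inj₁ (refl , _)) _ = increase (suc m) m m m (off-r₀ (trans (sym e₁) e₂)) (λ r → trans (cong (lt m r +_) (lt-suc m r)) (sym (+-assoc (lt m r) _ _)))
  step .(suc (suc n)) .(suc n) .(suc n) n (inj₂ (refl , e₁)) (inj₂ (refl , e₂)) (inj₂ (refl , _)) _ = same (suc (suc n)) (suc n) n (λ r → +-comm (lt (suc n) r) (lt n r))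

sh-Inc : ∀ {X} → Inc X → (sh X 0 ≡ length X) × (∀ r → sh X (suc r) ≡ 0)
sh-Inc {X} i with RIns-rins (Dom-RIns [] i [])
... | e , e' = cong length e , λ r → trans (cong (λ t → sh t r) e') (sh-[] r)

Best-cong : ∀ {A A' B B' C C' r} → (∀ t → A t ≡ A' t) → (∀ t → B t ≡ B' t) → (∀ t → C t ≡ C' t) → Best A B C r → Best A' B' C' r
Best-cong {A} {A'} {B} {B'} {C} {C'} {r} a b c (best p q) = best (λ s l → subst₂ _≤_ (eq r s) (eq s r) (p s l)) (λ s l → subst₂ _<_ (eq r s) (eq s r) (q s l))
  where
  eq : ∀ r s → (Sum r B + Sum (suc r) B) + (Sum s A + Sum (suc s) C) ≡ (Sum r B' + Sum (suc r) B') + (Sum s A' + Sum (suc s) C')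
  eq r s = cong₂ _+_ (cong₂ _+_ (Sum-cong r b) (Sum-cong (suc r) b)) (cong₂ _+_ (Sum-cong s a) (Sum-cong (suc s) c))

-- Induction on the prefix `s`. For the empty prefix the two middle shapes are single rows; for
-- `z ∷ s` four slides of `z`, along both factorizations, feed `Step.step`.
raise-rows′ : ∀ {X Y X' Y'} → Inc X → Inc Y → Inc X' → Inc Y' → (X ++ Y) ∼ (X' ++ Y') → length X ≡ suc (length X') →
  ∀ s → Red ((s ++ X) ++ Y) → ∃ λ r₀ → (∀ t → sh (s ++ X) t ≡ sh (s ++ X') t + ι r₀ t) × Best (sh s) (sh (s ++ X)) (sh ((s ++ X) ++ Y)) r₀
raise-rows′ {X} {Y} {X'} {Y'} i j i' j' p len [] red = 0 , eqB , best (λ _ ()) aft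
  where
  eqB : ∀ t → sh X t ≡ sh X' t + ι 0 t
  eqB zero    = trans (proj₁ (sh-Inc i)) (trans len (trans (cong suc (sym (proj₁ (sh-Inc i')))) (+-comm 1 _)))
  eqB (suc t) = trans (proj₂ (sh-Inc i) t) (sym (trans (+-identityʳ _) (proj₂ (sh-Inc i') t)))
  zeros : ∀ n {f : ℕ → ℕ} → (∀ t → f t ≡ 0) → Sum n f ≡ 0
  zeros zero    e = refl
  zeros (suc n) e = cong₂ _+_ (zeros n e) (e n)
  single : ∀ r {f : ℕ → ℕ} → (∀ t → f (suc t) ≡ 0) → Sum (suc r) f ≡ f 0
  single r {f} e = trans (Sum-shift r f) (trans (cong (f 0 +_) (zeros r e)) (+-identityʳ _))
  -- All rows of `X ++ Y` after the first hold at most `length X'` boxes in total, fewer than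
  -- `length X`.
  aft : ∀ r → 0 < r → (Sum 0 (sh X) + Sum 1 (sh X)) + (Sum r (sh []) + Sum (suc r) (sh (X ++ Y))) < (Sum r (sh X) + Sum (suc r) (sh X)) + (Sum 0 (sh []) + Sum 1 (sh (X ++ Y)))
  aft (suc r) _ =
    lin (sh X 0 ∷ Sum (suc (suc r)) (sh (X ++ Y)) ∷ sh (X ++ Y) 0 ∷ Sum (suc r) (sh (X ++ Y) ∘ suc) ∷ sh X' 0 ∷ Sum (suc r) (sh []) ∷ Sum (suc r) (sh X) ∷ Sum (suc (suc r)) (sh X) ∷ [])
      ((# 1 ≼ # 2 ⊕ # 3 by ≤-reflexive (Sum-shift (suc r) (sh (X ++ Y)))) ∷
       (# 3 ≼ # 4 by ≤-trans (Sum-mono (suc r) (λ t → ≤-trans (≤-reflexive (sh-∼ red p (suc t))) (strip-interlace X' Y' j' (Red-∼ p red) t))) (≤-reflexive (single r {sh X'} (proj₂ (sh-Inc i'))))) ∷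
       (# 4 ⊕ ! 1 ≼ # 0 by ≤-reflexive (sym (eqB 0))) ∷ (# 5 ≼ ! 0 by ≤-reflexive (zeros (suc r) sh-[])) ∷
       (# 0 ≼ # 6 by ≤-reflexive (sym (single r {sh X} (proj₂ (sh-Inc i))))) ∷ (# 0 ≼ # 7 by ≤-reflexive (sym (single (suc r) {sh X} (proj₂ (sh-Inc i))))) ∷ [])
      (! 1 ⊕ (# 0 ⊕ (# 5 ⊕ # 1))) ((# 6 ⊕ # 7) ⊕ # 2)
raise-rows′ {X} {Y} {X'} {Y'} i j i' j' p len (z ∷ s) red with raise-rows′ i j i' j' p len s (Red-suffix (z ∷ []) _ red) | lgrows z ((s ++ X) ++ Y) red
... | r₀ , eqB , bst | u , lu with slide z (s ++ X) Y j red lu | slide z (s ++ X') Y' j' (Red-∼ (∼cons z q) red) (lgrow-∼ red q lu)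
  where
  q : ((s ++ X) ++ Y) ∼ ((s ++ X') ++ Y')
  q = ∼trans (∼≡ (++-assoc s X Y)) (∼trans (∼-++ˡ s p) (∼≡ (sym (++-assoc s X' Y'))))
... | u₁ , l₁ , s₁ | u₂ , l₂ , s₂ with slide z s X i (Red-prefix (z ∷ s ++ X) Y red) l₁ | slide z s X' i' (Red-prefix (z ∷ s ++ X') Y' (Red-∼ (∼cons z q) red)) l₂
  where
  q : ((s ++ X) ++ Y) ∼ ((s ++ X') ++ Y')
  q = ∼trans (∼≡ (++-assoc s X Y)) (∼trans (∼-++ˡ s p) (∼≡ (sym (++-assoc s X' Y'))))
... | u₃ , l₃ , s₃ | u₄ , l₄ , s₄ = finish (Step.step (sh s) (sh (s ++ X)) C (sh (s ++ X')) r₀ eqB bst u u₁ u₂ u₃ s₁ (slid-cong s₂) s₃ (subst (Slid (sh s) (sh (s ++ X')) u₂) (lgrow-injective l₄ l₃) s₄))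
  where
  C = sh ((s ++ X) ++ Y)
  redC = Red-suffix (z ∷ []) ((s ++ X) ++ Y) red
  q : ((s ++ X) ++ Y) ∼ ((s ++ X') ++ Y')
  q = ∼trans (∼≡ (++-assoc s X Y)) (∼trans (∼-++ˡ s p) (∼≡ (sym (++-assoc s X' Y'))))
  slid-cong : Slid (sh (s ++ X')) (sh ((s ++ X') ++ Y')) u u₂ → Slid (sh (s ++ X')) C u u₂
  slid-cong (inj₁ (e , h)) = inj₁ (e , λ u' e' → subst (_< sh (s ++ X') u') (sym (sh-∼ redC q u)) (h u' e'))
  slid-cong (inj₂ (e , h)) = inj₂ (e , trans (sh-∼ redC q u) h)
  finish : (∃ λ r → (∀ t → sh (s ++ X) t + ι u₁ t ≡ sh (s ++ X') t + ι u₂ t + ι r t) × Best (λ t → sh s t + ι u₃ t) (λ t → sh (s ++ X) t + ι u₁ t) (λ t → C t + ι u t) r) →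
    ∃ λ r₀ → (∀ t → sh (z ∷ s ++ X) t ≡ sh (z ∷ s ++ X') t + ι r₀ t) × Best (sh (z ∷ s)) (sh (z ∷ s ++ X)) (sh (z ∷ (s ++ X) ++ Y)) r₀
  finish (r , e , b) = r , (λ t → trans (lgrown l₁ t) (trans (e t) (cong (_+ ι r t) (sym (lgrown l₂ t))))) , Best-cong (λ t → sym (lgrown l₃ t)) (λ t → sym (lgrown l₁ t)) (λ t → sym (lgrown lu t)) b

abstract
  raise-rows : ∀ {X Y X' Y'} → Inc X → Inc Y → Inc X' → Inc Y' → (X ++ Y) ∼ (X' ++ Y') → length X ≡ suc (length X') →
    ∀ s → Red ((s ++ X) ++ Y) → ∃ λ r₀ → (∀ t → sh (s ++ X) t ≡ sh (s ++ X') t + ι r₀ t) × Best (sh s) (sh (s ++ X)) (sh ((s ++ X) ++ Y)) r₀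
  raise-rows = raise-rows′

-- The columns of the key of a reduced word

del : ℕ → (ℕ → ℕ) → ℕ → ℕ
del zero    f r       = f (suc r)
del (suc c) f zero    = f 0
del (suc c) f (suc r) = del c (f ∘ suc) r

del-< : ∀ {c r} (f : ℕ → ℕ) → r < c → del c f r ≡ f r
del-< {suc c} {zero}  f l       = refl
del-< {suc c} {suc r} f (s≤s l) = del-< (f ∘ suc) l

del-≥ : ∀ {c r} (f : ℕ → ℕ) → c ≤ r → del c f r ≡ f (suc r)
del-≥ {zero}  {r}     f l       = refl
del-≥ {suc c} {suc r} f (s≤s l) = del-≥ (f ∘ suc) l

Sum-del : ∀ c N (f : ℕ → ℕ) → c ≤ N → Sum (suc N) f ≡ Sum N (del c f) + f c
Sum-del zero    N       f l       = trans (Sum-shift N f) (+-comm (f 0) _)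
Sum-del (suc c) (suc N) f (s≤s l) = trans (Sum-shift (suc N) f) (trans (cong (f 0 +_) (Sum-del c N (f ∘ suc) l))
  (trans (sym (+-assoc (f 0) _ _)) (cong (_+ f (suc c)) (sym (Sum-shift N (del (suc c) f))))))

-- By strip-unique, V is determined by w and c: reading w backwards, it is the
-- column of a key at the position of column c of the insertion tableau.
record Col (c : ℕ) (w V : Word) : Set where
  constructor mkCol
  field
    base  : Word
    equiv : w ∼ base ++ V
    inc   : Inc V
    shape≡ : ∀ r → sh base r ≡ del c (sh w) r

col-exists′ : ∀ {w} → Red w → ∀ c → ∃ (Col c w)
col-exists′ {w} red c with hstrip (length w) w (del c (sh w)) ≤-refl red le ge
  where
  le : ∀ r → del c (sh w) r ≤ sh w r
  le r with r <? c
  ... | yes l = ≤-reflexive (del-< (sh w) l)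
  ... | no l  = ≤-trans (≤-reflexive (del-≥ (sh w) (≮⇒≥ l))) (sh-part red r)
  ge : ∀ r → sh w (suc r) ≤ del c (sh w) r
  ge r with r <? c
  ... | yes l = ≤-trans (sh-part red r) (≤-reflexive (sym (del-< (sh w) l)))
  ... | no l  = ≤-reflexive (sym (del-≥ (sh w) (≮⇒≥ l)))
... | s , V , p , i , e = V , mkCol s p i e

abstract
  col-exists : ∀ {w} → Red w → ∀ c → ∃ (Col c w)
  col-exists = col-exists′

col-unique′ : ∀ {c w V V'} → Red w → Col c w V → Col c w V' → V ≡ V'
col-unique′ {V = V} {V'} red (mkCol s p i e) (mkCol s' p' i' e') = proj₁ (strip-unique s s' V V' i i' (Red-∼ p red) (∼trans (∼sym p) p') (λ r → trans (e r) (sym (e' r))))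

abstract
  col-unique : ∀ {c w V V'} → Red w → Col c w V → Col c w V' → V ≡ V'
  col-unique = col-unique′

del-cong : ∀ c {f g : ℕ → ℕ} → (∀ r → f r ≡ g r) → ∀ r → del c f r ≡ del c g r
del-cong zero    e r       = e (suc r)
del-cong (suc c) e zero    = e 0
del-cong (suc c) e (suc r) = del-cong c (e ∘ suc) r

col-∼ : ∀ {c w w' V} → Red w → w ∼ w' → Col c w V → Col c w' V
col-∼ {c} red q (mkCol s p i e) = mkCol s (∼trans (∼sym q) p) i (λ r → trans (e r) (del-cong c (sh-∼ red q) r))

col-length′ : ∀ {c w V} → Red w → Col c w V → length V ≡ sh w c
col-length′ {c} {w} {V} red (mkCol s p i e) = +-cancelˡ-≡ (length s) _ _
  (trans (sym (trans (∼-length p) (length-++ s))) (trans (sym (Sum-sh (suc N) red (≤-trans lw (n≤1+n N))))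
    (trans (Sum-del c N (sh w) (m≤n+m c (length w))) (cong (_+ sh w c) (trans (Sum-cong N (λ r → sym (e r))) (Sum-sh N (Red-prefix s V (Red-∼ p red)) ls))))))
  where
  N = length w + c
  lw = m≤m+n (length w) c
  ls : length s ≤ N
  ls = ≤-trans (≤-trans (m≤m+n (length s) (length V)) (≤-reflexive (sym (trans (∼-length p) (length-++ s))))) lw

abstract
  col-length : ∀ {c w V} → Red w → Col c w V → length V ≡ sh w c
  col-length = col-length′

lgrow-at : ∀ {z w u} → LGrowsAt z w u → sh (z ∷ w) u ≡ suc (sh w u)
lgrow-at {z} {w} {u} g = trans (lgrown g u) (trans (cong (sh w u +_) (ι-refl u)) (+-comm _ 1))

lgrow-off : ∀ {z w u s} → LGrowsAt z w u → s ≢ u → sh (z ∷ w) s ≡ sh w s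
lgrow-off {z} {w} {u} {s} g ne = trans (lgrown g s) (trans (cong (sh w s +_) (ι-≢ (ne ∘ sym))) (+-identityʳ _))

col-slide : ∀ {z w u c V} → Red (z ∷ w) → LGrowsAt z w u → (C : Col c w V) → u ≤ c → LGrowsAt z (Col.base C) u
col-slide {z} {w} {u} {c} {V} red g (mkCol s p i e) u≤c with slide z s V i (Red-∼ (∼cons z p) red) (lgrow-∼ red p g)
... | j , l , inj₁ (refl , _) = l
... | j , l , inj₂ (refl , q) = ⊥-elim (<⇒≱ (≤-trans (≤-reflexive (sym (lgrow-at g))) (≤-trans (sh-part red j) (≤-reflexive (lgrow-off g (<⇒≢ (n<1+n j)))))) 
    (≤-reflexive (sym (trans (sh-∼ redw p (suc j)) (trans q (trans (e j) (del-< (sh w) u≤c)))))))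
  where redw = Red-suffix (z ∷ []) w red

-- Sliding past `V`, the letter `z` grows the base in row `u` if `u < c` and in the row before if
-- `c < u`. That is where deleting row `c` puts the new box, so the same `V` still splits off.
col-other′ : ∀ {z w u c V} → Red (z ∷ w) → LGrowsAt z w u → c ≢ u → Col c w V → Col c (z ∷ w) V
col-other′ {z} {w} {u} {c} {V} red g ne C@(mkCol s p i e) with <-cmp c u
... | tri≈ _ q _ = ⊥-elim (ne q)
... | tri> _ _ u<c = mkCol (z ∷ s) (∼cons z p) i λ r → trans (lgrown (col-slide red g C (<⇒≤ u<c)) r) (trans (cong (_+ ι u r) (e r)) (eq r))
  where
  eq : ∀ r → del c (sh w) r + ι u r ≡ del c (sh (z ∷ w)) r
  eq r with r <? c
  ... | yes l = trans (cong (_+ ι u r) (del-< (sh w) l)) (sym (trans (del-< (sh (z ∷ w)) l) (lgrown g r)))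
  ... | no l  = trans (cong₂ _+_ (del-≥ (sh w) c≤r) (ι-≢ (<⇒≢ (<-≤-trans u<c c≤r)))) (trans (+-identityʳ _) (sym (trans (del-≥ (sh (z ∷ w)) c≤r) (lgrow-off g (>⇒≢ (<-≤-trans u<c (m≤n⇒m≤1+n c≤r)))))))
    where c≤r = ≮⇒≥ l
... | tri< c<u _ _ with slide z s V i (Red-∼ (∼cons z p) red) (lgrow-∼ red p g)
...   | j , l , inj₁ (refl , h) = ⊥-elim (contra j c<u h)
  where
  redw = Red-suffix (z ∷ []) w red
  contra : ∀ u → c < u → (∀ u' → u ≡ suc u' → sh (s ++ V) u < sh s u') → ⊥
  contra (suc m) (s≤s c≤m) h = <-irrefl (trans (sym (sh-∼ redw p (suc m))) (sym (trans (e m) (del-≥ (sh w) c≤m)))) (h m refl)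
...   | j , l , inj₂ (refl , _) = mkCol (z ∷ s) (∼cons z p) i λ r → trans (lgrown l r) (trans (cong (_+ ι j r) (e r)) (eq r))
  where
  eq : ∀ r → del c (sh w) r + ι j r ≡ del c (sh (z ∷ w)) r
  eq r with r <? c
  ... | yes l = trans (cong₂ _+_ (del-< (sh w) l) (ι-≢ (>⇒≢ (<-≤-trans l (≤-pred c<u))))) (trans (+-identityʳ _) (sym (trans (del-< (sh (z ∷ w)) l) (lgrow-off g (<⇒≢ (<-trans l c<u))))))
  ... | no l  = trans (cong (_+ ι j r) (del-≥ (sh w) c≤r)) (sym (trans (del-≥ (sh (z ∷ w)) c≤r) (lgrown g (suc r))))
    where c≤r = ≮⇒≥ l

abstract
  col-other : ∀ {z w u c V} → Red (z ∷ w) → LGrowsAt z w u → c ≢ u → Col c w V → Col c (z ∷ w) V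
  col-other = col-other′

-- Column `c` before its newest entry: the base keeps one box more in row `c` than in `Col`. By
-- `col-same` the old column of `w` is of this kind for `z ∷ w`.
record PreCol (c : ℕ) (w V : Word) : Set where
  constructor mkPreCol
  field
    base  : Word
    equiv : w ∼ base ++ V
    inc   : Inc V
    shape≡ : ∀ r → sh base r ≡ del c (sh w) r + ι c r

precol-unique′ : ∀ {c w V V'} → Red w → PreCol c w V → PreCol c w V' → V ≡ V'
precol-unique′ {V = V} {V'} red (mkPreCol s p i e) (mkPreCol s' p' i' e') = proj₁ (strip-unique s s' V V' i i' (Red-∼ p red) (∼trans (∼sym p) p') (λ r → trans (e r) (sym (e' r))))

abstract
  precol-unique : ∀ {c w V V'} → Red w → PreCol c w V → PreCol c w V' → V ≡ V'
  precol-unique = precol-unique′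

col-same′ : ∀ {z w u V} → Red (z ∷ w) → LGrowsAt z w u → Col u w V → PreCol u (z ∷ w) V
col-same′ {z} {w} {u} {V} red g C@(mkCol s p i e) = mkPreCol (z ∷ s) (∼cons z p) i λ r → trans (lgrown (col-slide red g C ≤-refl) r) (cong (_+ ι u r) (trans (e r) (eq r)))
  where
  eq : ∀ r → del u (sh w) r ≡ del u (sh (z ∷ w)) r
  eq r with r <? u
  ... | yes l = trans (del-< (sh w) l) (sym (trans (del-< (sh (z ∷ w)) l) (lgrow-off g (<⇒≢ l))))
  ... | no l  = trans (del-≥ (sh w) (≮⇒≥ l)) (sym (trans (del-≥ (sh (z ∷ w)) (≮⇒≥ l)) (lgrow-off g (>⇒≢ (s≤s (≮⇒≥ l))))))

abstract
  col-same : ∀ {z w u V} → Red (z ∷ w) → LGrowsAt z w u → Col u w V → PreCol u (z ∷ w) V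
  col-same = col-same′

unpaired-length : ∀ X Y → length X ≤ length (unpaired X Y) + length Y
unpaired-length X []      = m≤m+n _ 0
unpaired-length X (y ∷ Y) rewrite unpaired-∷ X y Y = ≤-trans (unpaired-length X Y) (≤-trans (+-monoˡ-≤ (length Y) (rm (unpaired X Y))) (≤-reflexive (sym (+-suc _ (length Y)))))
  where
  rm : ∀ L → length L ≤ suc (length (removeFirstGT y L))
  rm []      = z≤n
  rm (l ∷ L) with y <ᵇ l
  ... | true  = ≤-refl
  ... | false = s≤s (rm L)

insertSorted-∈⁻ : ∀ {k} e Y → k ∈ insertSorted e Y → (k ≡ e) ⊎ (k ∈ Y)
insertSorted-∈⁻ e []      (here p) = inj₁ p
insertSorted-∈⁻ e (y ∷ Y) m with e ≤ᵇ y
insertSorted-∈⁻ e (y ∷ Y) (here p)  | true = inj₁ p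
insertSorted-∈⁻ e (y ∷ Y) (there m) | true = inj₂ m
insertSorted-∈⁻ e (y ∷ Y) (here p)  | false = inj₂ (here p)
insertSorted-∈⁻ e (y ∷ Y) (there m) | false with insertSorted-∈⁻ e Y m
... | inj₁ p = inj₁ p
... | inj₂ q = inj₂ (there q)

insertSorted-∈ : ∀ {k} e Y → (k ≡ e) ⊎ (k ∈ Y) → k ∈ insertSorted e Y
insertSorted-∈ e []      (inj₁ p) = here p
insertSorted-∈ e (y ∷ Y) m with e ≤ᵇ y
insertSorted-∈ e (y ∷ Y) (inj₁ p)         | true  = here p
insertSorted-∈ e (y ∷ Y) (inj₂ m)         | true  = there m
insertSorted-∈ e (y ∷ Y) (inj₁ p)         | false = there (insertSorted-∈ e Y (inj₁ p))
insertSorted-∈ e (y ∷ Y) (inj₂ (here p))  | false = here p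
insertSorted-∈ e (y ∷ Y) (inj₂ (there m)) | false = there (insertSorted-∈ e Y (inj₂ m))

-- Raising turns the factors (column u of the rest | column u+1) step by step
-- into (_ | column u); each added letter is smaller than the previous ones.
module Chain {w : Word} (red : Red w) (u : ℕ) {s₀ : Word} (s₀≡ : ∀ r → sh s₀ r ≡ del u (del (suc u) (sh w)) r) (V* : Word) where

  record State (X Y : Word) (A : ℕ) : Set where
    constructor mkState
    field
      incX  : Inc X
      incY  : Inc Y
      equiv : w ∼ (s₀ ++ X) ++ Y
      A∉X   : A ∉ X
      L<A   : All (_< A) (unpaired X Y)
      sub   : ∀ {k} → k ∈ V* → k ∈ Y
      added : ∀ {k} → k ∈ Y → (k ∈ V*) ⊎ (A ≤ k)

  -- Interlacing with `s₀` and with `w` pins every row of the middle shape except row `u`. Hence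
  -- each raising step must shorten row `u`.
  middle : ∀ {X Y} → Inc X → Inc Y → w ∼ (s₀ ++ X) ++ Y → ∀ {t} → t ≢ u → sh (s₀ ++ X) t ≡ del u (sh w) t
  middle {X} {Y} i j p {t} ne with <-cmp t u
  ... | tri≈ _ q _ = ⊥-elim (ne q)
  ... | tri< l _ _ = trans (≤-antisym (≤-trans (sh-mono (s₀ ++ X) Y redp t) (≤-reflexive (sym (sh-∼ red p t))))
          (≤-trans (≤-reflexive (sym (trans (s₀≡ t) (trans (del-< _ l) (del-< (sh w) (m<n⇒m<1+n l)))))) (sh-mono s₀ X (Red-prefix (s₀ ++ X) Y redp) t))) (sym (del-< (sh w) l))
    where redp = Red-∼ p red
  middle {X} {Y} i j p {suc t} ne | tri> _ _ (s≤s l) = trans (≤-antisym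
      (≤-trans (strip-interlace s₀ X i (Red-prefix (s₀ ++ X) Y redp) t) (≤-reflexive (trans (s₀≡ t) (trans (del-≥ _ l) (del-≥ (sh w) (s≤s l))))))
      (≤-trans (≤-reflexive (sh-∼ red p (suc (suc t)))) (strip-interlace (s₀ ++ X) Y j redp (suc t)))) (sym (del-≥ (sh w) (m≤n⇒m≤1+n l)))
    where redp = Red-∼ p red

  Step : Word → Word → ℕ → Set
  Step X Y A = ∃ λ X' → ∃ λ A' → ∃ λ e → State X' (insertSorted e Y) A' × (e ∉ Y) × (e < A) × (sh (s₀ ++ X) u ≡ suc (sh (s₀ ++ X') u)) × (length (unpaired X Y) ≡ suc (length (unpaired X' (insertSorted e Y))))

  advance : ∀ {X Y A} → State X Y A → 1 ≤ length (unpaired X Y) → Step X Y A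
  advance {X} {Y} {A} (mkState i j p A∉ L< sub add) l with split X Y i j
  ... | inj₁ (e , _) = ⊥-elim (<⇒≱ l (≤-reflexive (cong length e)))
  ... | inj₂ S = go S (raise X Y i j (Red-suffix s₀ _ (subst Red (++-assoc s₀ X Y) (Red-∼ p red))) S)
    where
    go : (S : Split X Y) → (∃ λ X' → ∃ λ Y' → ∃ λ e → Raised X Y X' Y' (unpaired (Split.X₀ S) (Split.Y₀ S)) (Split.a S) e) → Step X Y A
    go S (X' , Y' , e , R) with Raised.Y'≡ R
    ... | refl = X' , a , e , mkState (Raised.incX R) (Raised.incY R) p' (Raised.a∉X' R) L'< (λ m → insertSorted-∈ e Y (inj₂ (sub m))) add' , Raised.e∉Y R , e<A , rowᵤ , len
      where
      a = Split.a S
      a<A : a < A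
      a<A = All.head (Allₚ.++⁻ʳ (unpaired (Split.X₀ S) (Split.Y₀ S)) (subst (All (_< A)) (Split.left S) L<))
      -- The run from `a` to `e` lies in `X`, so it cannot pass `A`, which is missing from `X`.
      e<A : e < A
      e<A = ≰⇒> λ A≤e → A∉ (Raised.runX R A a<A A≤e)
      p' : w ∼ (s₀ ++ X') ++ insertSorted e Y
      p' = ∼trans p (∼trans (∼≡ (++-assoc s₀ X Y)) (∼trans (∼-++ˡ s₀ (Raised.equiv R)) (∼≡ (sym (++-assoc s₀ X' _)))))
      L'< : All (_< a) (unpaired X' (insertSorted e Y))
      L'< = subst (All (_< a)) (sym (Raised.L'≡ R)) (unpaired-All (Split.X₀ S) (Split.Y₀ S) (All.map All.head (proj₂ (proj₂ (AP-++⁻ (Split.X₀ S) (subst Inc (Split.X≡ S) i))))))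
      add' : ∀ {k} → k ∈ insertSorted e Y → (k ∈ V*) ⊎ (a ≤ k)
      add' m with insertSorted-∈⁻ e Y m
      ... | inj₁ refl = inj₂ (Raised.a≤e R)
      ... | inj₂ m' with add m'
      ...   | inj₁ v = inj₁ v
      ...   | inj₂ A≤k = inj₂ (≤-trans (<⇒≤ a<A) A≤k)
      len : length (unpaired X Y) ≡ suc (length (unpaired X' (insertSorted e Y)))
      len = trans (cong length (Split.left S)) (trans (length-++ (unpaired (Split.X₀ S) (Split.Y₀ S))) (trans (+-comm _ 1) (cong (suc ∘ length) (sym (Raised.L'≡ R)))))
      rowᵤ : sh (s₀ ++ X) u ≡ suc (sh (s₀ ++ X') u)
      rowᵤ with raise-rows i j (Raised.incX R) (Raised.incY R) (Raised.equiv R) (Raised.lenX R) s₀ (Red-∼ p red)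
      ... | r₀ , eq , _ with r₀ ≟ u
      ...   | yes refl = trans (eq u) (trans (cong (sh (s₀ ++ X') u +_) (ι-refl u)) (+-comm _ 1))
      ...   | no ne = ⊥-elim (1+n≢n (trans (+-comm 1 _) (trans (cong (sh (s₀ ++ X') r₀ +_) (sym (ι-refl r₀))) (trans (sym (eq r₀)) (trans (middle i j p ne) (sym (middle (Raised.incX R) (Raised.incY R) p' ne)))))))

  iterate : ∀ m {X Y A} → State X Y A → m ≤ length (unpaired X Y) → ∃ λ X' → ∃ λ Y' → ∃ λ A' → State X' Y' A' × (sh (s₀ ++ X) u ≡ m + sh (s₀ ++ X') u) × (length (unpaired X Y) ≡ m + length (unpaired X' Y'))
  iterate zero    st l = _ , _ , _ , st , refl , refl
  iterate (suc m) st l with advance st (≤-trans (s≤s z≤n) l)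
  ... | X' , A' , e , st' , _ , _ , rowᵤ , len with iterate m st' (≤-pred (subst (suc m ≤_) len l))
  ...   | X″ , Y″ , A″ , st″ , rowᵤ' , len' = X″ , Y″ , A″ , st″ , trans rowᵤ (cong suc rowᵤ') , trans len (cong suc len')

  to-col : ∀ {X Y} → Inc X → Inc Y → w ∼ (s₀ ++ X) ++ Y → sh (s₀ ++ X) u ≡ sh w (suc u) → Col u w Y
  to-col {X} {Y} i j p e = mkCol (s₀ ++ X) p j eq
    where
    eq : ∀ r → sh (s₀ ++ X) r ≡ del u (sh w) r
    eq r with r ≟ u
    ... | yes refl = trans e (sym (del-≥ (sh w) (≤-refl {u})))
    ... | no ne    = middle i j p ne

  to-precol : ∀ {X Y} → Inc X → Inc Y → w ∼ (s₀ ++ X) ++ Y → sh (s₀ ++ X) u ≡ suc (sh w (suc u)) → PreCol u w Y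
  to-precol {X} {Y} i j p e = mkPreCol (s₀ ++ X) p j eq
    where
    eq : ∀ r → sh (s₀ ++ X) r ≡ del u (sh w) r + ι u r
    eq r with r ≟ u
    ... | yes refl = trans e (sym (trans (cong₂ _+_ (del-≥ (sh w) (≤-refl {u})) (ι-refl u)) (+-comm _ 1)))
    ... | no ne    = trans (middle i j p ne) (sym (trans (cong (del u (sh w) r +_) (ι-≢ (ne ∘ sym))) (+-identityʳ _)))

maxL-All : ∀ X → All (_≤ maxL X) X
maxL-All []      = []
maxL-All (x ∷ X) = m≤m⊔n x (maxL X) ∷ All.map (λ l → ≤-trans l (m≤n⊔m x (maxL X))) (maxL-All X)

record Start (w : Word) (red : Red w) (u : ℕ) (V* : Word) : Set where
  field
    s₀ X : Word
    s₀≡ : ∀ r → sh s₀ r ≡ del u (del (suc u) (sh w)) r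
    A   : ℕ
    state : Chain.State red u s₀≡ V* X V* A
    rowᵤ   : sh (s₀ ++ X) u ≡ sh w u
    big   : sh w u ∸ sh w (suc u) ≤ length (unpaired X V*)

-- After column `suc u` is split off as `V*`, column `u` of the base serves as `X`. It has `sh w u`
-- letters against `sh w (suc u)` in `V*`, so at least the difference stays unpaired and can be
-- raised.
start : ∀ {w u V*} (red : Red w) → Col (suc u) w V* → Start w red u V*
start {w} {u} {V*} red C*@(mkCol s₁ p i e) with col-exists (Red-prefix s₁ V* (Red-∼ p red)) u
... | X , C@(mkCol s₀ q j e') = record
  { s₀ = s₀ ; X = X ; s₀≡ = λ r → trans (e' r) (del-cong u e r) ; A = suc (maxL X)
  ; state = Chain.mkState j i (∼trans p (∼-++ʳ V* q)) (λ m → <-irrefl refl (All.lookup (maxL-All X) m)) (unpaired-All X V* (All.map s≤s (maxL-All X))) id inj₁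
  ; rowᵤ = trans (sym (sh-∼ red₁ q u)) row₁
  ; big = ≤-trans (∸-mono {sh w u} (≤-reflexive (sym (trans (col-length red₁ C) row₁))) (≤-reflexive (col-length red C*))) (≤-trans (∸-monoˡ-≤ (length V*) (unpaired-length X V*)) (≤-reflexive (m+n∸n≡m (length (unpaired X V*)) (length V*))))
  }
  where
  red₁ = Red-prefix s₁ V* (Red-∼ p red)
  row₁ : sh s₁ u ≡ sh w u
  row₁ = trans (e u) (del-< (sh w) (n<1+n u))

-- Raising only adds letters to the right factor. After enough steps the middle shape is the one
-- that defines column `u`, and uniqueness identifies the factor.
col-nested′ : ∀ {w u V V'} → Red w → Col u w V → Col (suc u) w V' → ∀ {k} → k ∈ V' → k ∈ V
col-nested′ {w} {u} {V} {V'} red C C' {k} m with start red C'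
... | record { s₀≡ = s₀≡ ; state = st ; rowᵤ = rowᵤ ; big = big } with Chain.iterate red u s₀≡ V' (sh w u ∸ sh w (suc u)) st big
...   | X , Y , A , Chain.mkState i j p _ _ sub _ , rowᵤ' , _ = subst (k ∈_) (col-unique red (Chain.to-col red u s₀≡ V' i j p
          (+-cancelˡ-≡ (sh w u ∸ sh w (suc u)) _ _ (trans (sym rowᵤ') (trans rowᵤ (sym (m∸n+n≡m (sh-part red u))))))) C) (sub m)

abstract
  col-nested : ∀ {w u V V'} → Red w → Col u w V → Col (suc u) w V' → ∀ {k} → k ∈ V' → k ∈ V
  col-nested = col-nested′

-- Stopped one step early, the chain has produced `V⁻`, so its last step adds the single new letter
-- `R`. Letters added along the chain decrease, which makes `R` the least letter of `V` outside
-- `V*`.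
col-new′ : ∀ {w u V V* V⁻} → Red w → sh w (suc u) < sh w u → Col u w V → Col (suc u) w V* → PreCol u w V⁻ →
  ∃ λ R → (R ∉ V⁻) × (V ≡ insertSorted R V⁻) × (∀ k → k ∈ V → k ∉ V* → R ≤ k)
col-new′ {w} {u} {V} {V*} {V⁻} red lt C C* C⁻ with start red C* | m≤n⇒∃[o]m+o≡n lt
... | record { X = X* ; s₀≡ = s₀≡ ; state = st ; rowᵤ = rowᵤ ; big = big } | n , d = go (Chain.iterate red u s₀≡ V* n st (≤-trans (n≤1+n n) big'))
  where
  open Chain red u s₀≡ V*
  big' : suc n ≤ length (unpaired X* V*)
  big' = subst (_≤ length (unpaired X* V*)) (trans (cong (_∸ sh w (suc u)) (trans (sym d) (sym (+-suc (sh w (suc u)) n)))) (m+n∸m≡n (sh w (suc u)) (suc n))) big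
  go : (∃ λ X' → ∃ λ Y' → ∃ λ A' → State X' Y' A' × _ × _) → _
  go (X , Y , A , st'@(mkState i j p _ _ _ add) , rowᵤ' , len) with advance st' (+-cancelˡ-≤ n _ _ (≤-trans (≤-reflexive (+-comm n 1)) (≤-trans big' (≤-reflexive len))))
  ... | X' , A' , e , mkState i' j' p' _ _ _ _ , e∉ , e<A , rowᵤ″ , _ with precol-unique red (to-precol i j p rowX) C⁻
    where
    rowX : sh (_ ++ X) u ≡ suc (sh w (suc u))
    rowX = +-cancelˡ-≡ n _ _ (trans (sym rowᵤ') (trans rowᵤ (trans (sym d) (+-comm (suc (sh w (suc u))) n))))
  ...   | refl with col-unique red C (to-col i' j' p' (suc-injective (trans (sym rowᵤ″) rowX)))
    where
    rowX : sh (_ ++ X) u ≡ suc (sh w (suc u))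
    rowX = +-cancelˡ-≡ n _ _ (trans (sym rowᵤ') (trans rowᵤ (trans (sym d) (+-comm (suc (sh w (suc u))) n))))
  ...     | refl = e , e∉ , refl , low
    where
    low : ∀ k → k ∈ insertSorted e Y → k ∉ V* → e ≤ k
    low k m n with insertSorted-∈⁻ e Y m
    ... | inj₁ refl = ≤-refl
    ... | inj₂ m' with add m'
    ...   | inj₁ v = ⊥-elim (n v)
    ...   | inj₂ A≤k = ≤-trans (<⇒≤ e<A) A≤k

abstract
  col-new : ∀ {w u V V* V⁻} → Red w → sh w (suc u) < sh w u → Col u w V → Col (suc u) w V* → PreCol u w V⁻ →
    ∃ λ R → (R ∉ V⁻) × (V ≡ insertSorted R V⁻) × (∀ k → k ∈ V → k ∉ V* → R ≤ k)
  col-new = col-new′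

-- The key as a function giving the length of each row

-- Row lengths can describe the key because its columns are nested. The columns are taken from the
-- reversed word so that appending a letter to `ρ` becomes prepending.
record KeyShape (ρ : Word) (a : ℕ → ℕ) : Set where
  constructor mkKey
  field
    box⇒ : ∀ {c V k} → Col c (reverse ρ) V → k ∈ V → c < a k
    box⇐ : ∀ {c V k} → Col c (reverse ρ) V → c < a k → k ∈ V
open KeyShape

key-≤ : ∀ {ρ a b} → Red ρ → KeyShape ρ a → KeyShape ρ b → ∀ k → a k ≤ b k
key-≤ {ρ} red A B k = ≤-by-< λ c l → case col-exists (Red-reverse ρ red) c of λ { (V , C) → box⇒ B C (box⇐ A C l) }

key-unique : ∀ {ρ a b} → Red ρ → KeyShape ρ a → KeyShape ρ b → ∀ k → a k ≡ b k
key-unique red A B k = ≤-antisym (key-≤ red A B k) (key-≤ red B A k)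

key-∼ : ∀ {ρ τ a} → Red ρ → ρ ∼ τ → KeyShape ρ a → KeyShape τ a
key-∼ {ρ} {τ} red p A = mkKey (λ C → box⇒ A (back C)) (λ C → box⇐ A (back C))
  where
  back : ∀ {c V} → Col c (reverse τ) V → Col c (reverse ρ) V
  back = col-∼ (Red-reverse τ (Red-∼ p red)) (∼sym (∼-reverse p))

key-cong : ∀ {ρ a b} → (∀ k → a k ≡ b k) → KeyShape ρ a → KeyShape ρ b
key-cong e A = mkKey (λ {c} {V} {k} C m → subst (c <_) (e k) (box⇒ A C m)) (λ {c} {V} {k} C l → box⇐ A C (subst (c <_) (sym (e k)) l))

key-[] : KeyShape [] (λ _ → 0)
key-[] = mkKey (λ { {V = V} (mkCol s p i e) m → ⊥-elim (noBox s V p m) }) (λ _ ())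
  where
  noBox : ∀ s V {k} → [] ∼ s ++ V → k ∈ V → ⊥
  noBox s (v ∷ V) p m = <⇒≱ (s≤s z≤n) (≤-trans (m≤n+m (suc (length V)) (length s)) (≤-reflexive (trans (sym (length-++ s)) (sym (∼-length p)))))

-- In the reversed word `x` grows row `sh σ r`, so only that column of the key changes, by the
-- letter of `col-new`. Its minimality says that the new box takes the lowest row ending in that
-- column.
key-snoc′ : ∀ {σ x r a} → Red (σ ∷ʳ x) → GrowsAt σ x r → KeyShape σ a →
  ∃ λ R → (a R ≡ sh σ r) × KeyShape (σ ∷ʳ x) (λ k → a k + ι R k) × (∀ k → a k + ι R k ≡ suc (sh σ r) → R ≤ k)
key-snoc′ {σ} {x} {r} {a} red g A = build (col-exists redw u) (col-exists redw' u) (col-exists redw' (suc u))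
  where
  w = reverse σ
  u = sh σ r
  redσ = Red-prefix σ (x ∷ []) red
  redw : Red w
  redw = Red-reverse σ redσ
  rev : reverse (σ ∷ʳ x) ≡ x ∷ w
  rev = reverse-++ σ (x ∷ [])
  redw' : Red (x ∷ w)
  redw' = subst Red rev (Red-reverse (σ ∷ʳ x) red)
  l : LGrowsAt x w u
  l = proj₁ (grow-transpose red g)
  build : ∃ (Col u w) → ∃ (Col u (x ∷ w)) → ∃ (Col (suc u) (x ∷ w)) →
    ∃ λ R → (a R ≡ u) × KeyShape (σ ∷ʳ x) (λ k → a k + ι R k) × (∀ k → a k + ι R k ≡ suc u → R ≤ k)
  build (V , C) (V' , C') (V⁺ , C⁺) with col-new redw' (subst (sh (x ∷ w) (suc u) <_) (sym (lgrow-at l)) (s≤s (≤-trans (≤-reflexive (lgrow-off l (>⇒≢ (n<1+n u)))) (sh-part redw u)))) C' C⁺ (col-same redw' l C)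
  ... | R , R∉ , refl , low = R , aR , key , λ k e → low k (box⇐′ C' (≤-reflexive (sym e))) (λ m → <-irrefl (sym e) (box⇒′ C⁺ m))
    where
    aR≤ : a R ≤ u
    aR≤ = ≮⇒≥ λ l → R∉ (box⇐ A C l)
    -- By nestedness `R` also lies in the column to the left, which `x` has not altered.
    lower : ∀ u → a R ≤ u → LGrowsAt x w u → ∀ {V'} → Col u (x ∷ w) V' → R ∈ V' → a R ≡ u
    lower zero    h l C' m = n≤0⇒n≡0 h
    lower (suc v) h l C' m with col-exists redw v
    ... | W , D = ≤-antisym h (box⇒ A D (col-nested redw' (col-other redw' l (<⇒≢ (n<1+n v)) D) C' m))
    aR : a R ≡ u
    aR = lower u aR≤ l C' (insertSorted-∈ R V (inj₁ refl))
    box⇒′ : ∀ {c W k} → Col c (x ∷ w) W → k ∈ W → c < a k + ι R k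
    box⇒′ {c} {W} {k} D m with c ≟ u
    ... | no ne with col-exists redw c
    ...   | W' , D' = <-≤-trans (box⇒ A D' (subst (k ∈_) (col-unique redw' D (col-other redw' l ne D')) m)) (m≤m+n _ _)
    box⇒′ {c} {W} {k} D m | yes refl with insertSorted-∈⁻ R V (subst (k ∈_) (col-unique redw' D C') m)
    ... | inj₁ refl = ≤-reflexive (sym (trans (cong₂ _+_ aR (ι-refl R)) (+-comm u 1)))
    ... | inj₂ m' = <-≤-trans (box⇒ A C m') (m≤m+n _ _)
    box⇐′ : ∀ {c W k} → Col c (x ∷ w) W → c < a k + ι R k → k ∈ W
    box⇐′ {c} {W} {k} D h with c ≟ u
    ... | yes refl = subst (k ∈_) (col-unique redw' C' D) (insertSorted-∈ R V here?)
      where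
      here? : (k ≡ R) ⊎ (k ∈ V)
      here? with k ≟ R
      ... | yes e = inj₁ e
      ... | no ne = inj₂ (box⇐ A C (subst (u <_) (trans (cong (a k +_) (ι-≢ (ne ∘ sym))) (+-identityʳ _)) h))
    ... | no ne with col-exists redw c
    ...   | W' , D' = subst (k ∈_) (col-unique redw' (col-other redw' l ne D') D) (box⇐ A D' c<)
      where
      c< : c < a k
      c< with k ≟ R
      ... | yes refl = ≤∧≢⇒< (≤-pred (subst (c <_) (trans (cong (a k +_) (ι-refl k)) (+-comm _ 1)) h)) (λ e → ne (trans e aR))
      ... | no ne'   = subst (c <_) (trans (cong (a k +_) (ι-≢ (ne' ∘ sym))) (+-identityʳ _)) h
    key : KeyShape (σ ∷ʳ x) (λ k → a k + ι R k)
    key = mkKey (λ {c} {W} D → box⇒′ (subst (λ t → Col c t W) rev D)) (λ {c} {W} D → box⇐′ (subst (λ t → Col c t W) rev D))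

abstract
  key-snoc : ∀ {σ x r a} → Red (σ ∷ʳ x) → GrowsAt σ x r → KeyShape σ a →
    ∃ λ R → (a R ≡ sh σ r) × KeyShape (σ ∷ʳ x) (λ k → a k + ι R k) × (∀ k → a k + ι R k ≡ suc (sh σ r) → R ≤ k)
  key-snoc = key-snoc′

key-exists′ : ∀ {ρ} → Reverse ρ → Red ρ → ∃ (KeyShape ρ)
key-exists′ [] red = _ , key-[]
key-exists′ (σ ∶ v ∶ʳ x) red with key-exists′ v (Red-prefix σ _ red) | grows σ x red
... | a , A | r , g = _ , proj₁ (proj₂ (proj₂ (key-snoc red g A)))

abstract
  key-exists : ∀ {ρ} → Red ρ → ∃ (KeyShape ρ)
  key-exists {ρ} = key-exists′ (reverseView ρ)

new-box : ∀ {σ x r a b} → Red (σ ∷ʳ x) → GrowsAt σ x r → KeyShape σ a → KeyShape (σ ∷ʳ x) b →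
  ∃ λ R → (a R ≡ sh σ r) × (∀ k → b k ≡ a k + ι R k) × (∀ k → b k ≡ suc (sh σ r) → R ≤ k)
new-box red g A B with key-snoc red g A
... | R , e , K , low = R , e , key-unique red B K , λ k h → low k (trans (key-unique red K B k) h)

key-letters : ∀ {ρ a k} {P : ℕ → Set} → Red ρ → KeyShape ρ a → All P ρ → 0 < a k → P k
key-letters {ρ} red A ps l with col-exists (Red-reverse ρ red) 0
... | V , C@(mkCol s p i e) = All.lookup (Allₚ.++⁻ʳ s (∼-All p (reverse-All ρ ps))) (box⇐ A C l)

insRow-∈ : ∀ R x → x ∈ insRow R x
insRow-∈ []      x = here refl
insRow-∈ (y ∷ R) x with <-cmp x y
... | tri< _ _ _ = here refl
... | tri≈ _ e _ = here e
... | tri> _ _ _ = there (insRow-∈ R x)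

insRow-keep : ∀ {k} R x → k ∈ R → k ≤ x → k ∈ insRow R x
insRow-keep (y ∷ R) x m l with <-cmp x y
insRow-keep (y ∷ R) x (here refl) l | tri< q _ _ = ⊥-elim (<⇒≱ q l)
insRow-keep (y ∷ R) x (there m)   l | tri< q _ _ = there m
insRow-keep (y ∷ R) x m           l | tri≈ _ _ _ = m
insRow-keep (y ∷ R) x (here e)    l | tri> _ _ _ = here e
insRow-keep (y ∷ R) x (there m)   l | tri> _ _ _ = there (insRow-keep R x m l)

rins-keep : ∀ {k} R w → k ∈ R → All (k ≤_) w → k ∈ rins R w
rins-keep R []      m []       = m
rins-keep R (x ∷ w) m (p ∷ ps) = rins-keep (insRow R x) w (insRow-keep R x m p) ps

min-∈-rins : ∀ {k} R w → k ∈ w → All (k ≤_) w → k ∈ rins R w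
min-∈-rins R (x ∷ w) (here refl) (_ ∷ ps) = rins-keep (insRow R x) w (insRow-∈ R x) ps
min-∈-rins R (x ∷ w) (there m)   (_ ∷ ps) = min-∈-rins (insRow R x) w m ps

∈-reverse : ∀ {k : ℕ} {ρ} → k ∈ ρ → k ∈ reverse ρ
∈-reverse {k} {ρ} m = All.lookup (reverse-All⁻ ρ) m
  where
  reverse-All⁻ : ∀ ρ → All (_∈ reverse ρ) ρ
  reverse-All⁻ ρ = subst (All (_∈ reverse ρ)) (reverse-involutive ρ) (reverse-All (reverse ρ) (All.tabulate id))

-- Column 0 is the first row of the tableau of the reversed word, and the smallest letter is never
-- bumped from it.
key-min : ∀ {ρ a k} → Red ρ → KeyShape ρ a → k ∈ ρ → All (k ≤_) ρ → 0 < a k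
key-min {ρ} {a} {k} red A m ps = box⇒ A (mkCol (out (reverse ρ)) (∼-out-row redw) (Inc-row redw) (λ r → refl)) (min-∈-rins [] (reverse ρ) (∈-reverse m) (reverse-All ρ ps))
  where redw = Red-reverse ρ red

key-mono : ∀ u v {a b} → Red (u ++ v) → KeyShape u a → KeyShape (u ++ v) b → ∀ k → a k ≤ b k
key-mono u v = go (reverseView v)
  where
  go : ∀ {v} → Reverse v → ∀ {a b} → Red (u ++ v) → KeyShape u a → KeyShape (u ++ v) b → ∀ k → a k ≤ b k
  go [] red A B k rewrite ++-identityʳ u = key-≤ red A B k
  go (v ∶ vs ∶ʳ x) red A B k rewrite ++-∷ʳ u v x with key-exists (Red-prefix (u ++ v) (x ∷ []) red) | grows (u ++ v) x red
  ... | a' , A' | r , g with new-box red g A' B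
  ...   | R , _ , e , _ = ≤-trans (go vs (Red-prefix (u ++ v) (x ∷ []) red) A A' k) (≤-trans (m≤m+n _ _) (≤-reflexive (sym (e k))))

key-size : ∀ {ρ a} N → Red ρ → KeyShape ρ a → All (_< N) ρ → Sum N a ≡ length ρ
key-size {ρ} N = go (reverseView ρ)
  where
  zeros : ∀ n → Sum n (λ _ → 0) ≡ 0
  zeros zero    = refl
  zeros (suc n) = trans (+-identityʳ _) (zeros n)
  go : ∀ {ρ} → Reverse ρ → ∀ {a} → Red ρ → KeyShape ρ a → All (_< N) ρ → Sum N a ≡ length ρ
  go [] red A ps = trans (Sum-cong N (key-unique red A key-[])) (zeros N)
  go (σ ∶ v ∶ʳ x) {a} red A ps with key-exists (Red-prefix σ (x ∷ []) red) | grows σ x red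
  ... | a' , A' | r , g with new-box red g A' A
  ...   | R , _ , e , _ = trans (Sum-cong N e) (trans (Sum-ι N a' R) (trans (cong₂ _+_ (go v (Red-prefix σ (x ∷ []) red) A' (Allₚ.++⁻ˡ σ ps)) (lt-1 R<N)) (sym (length-++ σ))))
    where
    R<N : R < N
    R<N = key-letters red A ps (≤-trans (≤-reflexive (sym (ι-refl R))) (≤-trans (m≤n+m (ι R R) (a' R)) (≤-reflexive (sym (e R)))))

Inc-ext : ∀ {V W} → Inc V → Inc W → (∀ k → k ∈ V → k ∈ W) → (∀ k → k ∈ W → k ∈ V) → V ≡ W
Inc-ext {[]}    {[]}    i j f g = refl
Inc-ext {[]}    {w ∷ W} i j f g = case g w (here refl) of λ ()
Inc-ext {v ∷ V} {[]}    i j f g = case f v (here refl) of λ ()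
Inc-ext {v ∷ V} {w ∷ W} (p ∷ i) (q ∷ j) f g = cong₂ _∷_ e (Inc-ext i j (λ k m → strip (sym e) p m (f k (there m))) (λ k m → strip e q m (g k (there m))))
  where
  e : v ≡ w
  e with f v (here refl) | g w (here refl)
  ... | here e | _ = e
  ... | there _ | here e = sym e
  ... | there a | there b = ⊥-elim (<-asym (All.lookup q a) (All.lookup p b))
  strip : ∀ {k v w V W} → w ≡ v → All (v <_) V → k ∈ V → k ∈ w ∷ W → k ∈ W
  strip refl p m (here refl) = ⊥-elim (<-irrefl refl (All.lookup p m))
  strip e    p m (there m')  = m'

-- The key determines its column heights, and these are the row lengths of the transposed shape.
key-sh : ∀ {ρ τ a} → Red ρ → Red τ → KeyShape ρ a → KeyShape τ a → ∀ r → sh ρ r ≡ sh τ r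
key-sh {ρ} {τ} redρ redτ A B r = ≤-antisym (le {r = r} redρ redτ A B) (le {r = r} redτ redρ B A)
  where
  cols : ∀ {ρ τ a} → Red ρ → Red τ → KeyShape ρ a → KeyShape τ a → ∀ c → sh (reverse ρ) c ≡ sh (reverse τ) c
  cols {ρ} {τ} redρ redτ A B c with col-exists (Red-reverse ρ redρ) c | col-exists (Red-reverse τ redτ) c
  ... | V , C | W , D = trans (sym (col-length (Red-reverse ρ redρ) C)) (trans (cong length (Inc-ext (Col.inc C) (Col.inc D) (λ k m → box⇐ B D (box⇒ A C m)) (λ k m → box⇐ A C (box⇒ B D m)))) (col-length (Red-reverse τ redτ) D))
  le : ∀ {ρ τ a r} → Red ρ → Red τ → KeyShape ρ a → KeyShape τ a → sh ρ r ≤ sh τ r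
  le {r = r} redρ redτ A B = ≤-by-< λ u l → transpose redτ (subst (r <_) (cols redρ redτ A B u) (transpose⁻ redρ l))

-- Fillings with increasing rows: Wd m k t reads the rows k+m, …, k+1 of t

Wd : ℕ → ℕ → (ℕ → Word) → Word
Wd zero    k t = []
Wd (suc m) k t = Wd m (suc k) t ++ t (suc k)

-- The two properties of weak descent tableaux that matter: rows are runs, and a run is never placed
-- above the row given by its first letter.
record Good (t : ℕ → Word) : Set where
  field
    incRow : ∀ j → Inc (t j)
    lowRow : ∀ j → All (j ≤_) (t j)
open Good

Wd-cong : ∀ m k {t t' : ℕ → Word} → (∀ j → k < j → j ≤ k + m → t j ≡ t' j) → Wd m k t ≡ Wd m k t'
Wd-cong zero    k e = refl
Wd-cong (suc m) k e = cong₂ _++_ (Wd-cong m (suc k) λ j l l' → e j (<-trans (n<1+n k) l) (≤-trans l' (≤-reflexive (sym (+-suc k m)))))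
  (e (suc k) (n<1+n k) (≤-trans (m≤m+n (suc k) m) (≤-reflexive (sym (+-suc k m)))))

Wd-top : ∀ m k t → Wd (suc m) k t ≡ t (k + suc m) ++ Wd m k t
Wd-top zero    k t = trans (cong t (+-comm 1 k)) (sym (++-identityʳ _))
Wd-top (suc m) k t = trans (cong (_++ t (suc k)) (Wd-top m (suc k) t)) (trans (++-assoc (t (suc k + suc m)) _ _) (cong (λ j → t j ++ Wd (suc m) k t) (sym (+-suc k (suc m)))))

Wd-extend : ∀ m k e t → (∀ j → k + m < j → t j ≡ []) → Wd (m + e) k t ≡ Wd m k t
Wd-extend m k zero    t z = cong (λ n → Wd n k t) (+-identityʳ m)
Wd-extend m k (suc e) t z = trans (cong (λ n → Wd n k t) (+-suc m e)) (trans (Wd-top (m + e) k t)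
  (trans (cong (_++ Wd (m + e) k t) (z (k + suc (m + e)) (+-monoʳ-< k (s≤s (m≤m+n m e))))) (Wd-extend m k e t z)))

Wd-length : ∀ m k t → length (Wd m k t) ≡ Sum m (λ i → length (t (suc k + i)))
Wd-length zero    k t = refl
Wd-length (suc m) k t = trans (cong length (Wd-top m k t)) (trans (length-++ (t (k + suc m))) (trans (+-comm _ (length (Wd m k t))) (cong₂ _+_ (Wd-length m k t) (cong (length ∘ t) (+-suc k m)))))

Wd-split : ∀ n m j t → Wd (n + m) j t ≡ Wd m (j + n) t ++ Wd n j t
Wd-split n zero    j t = cong (λ n → Wd n j t) (+-identityʳ n)
Wd-split n (suc m) j t = trans (cong (λ n → Wd n j t) (+-suc n m)) (trans (Wd-top (n + m) j t) (trans (cong₂ _++_ (cong t (trans (cong (j +_) (sym (+-suc n m))) (sym (+-assoc j n (suc m))))) (Wd-split n m j t))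
  (trans (sym (++-assoc (t (j + n + suc m)) _ _)) (cong (_++ Wd n j t) (sym (Wd-top m (j + n) t))))))

Wd-All : ∀ m k {t} → Good t → All (k <_) (Wd m k t)
Wd-All zero    k g = []
Wd-All (suc m) k g = Allₚ.++⁺ (All.map (<-trans (n<1+n k)) (Wd-All m (suc k) g)) (lowRow g (suc k))

Sum-zero : ∀ n {f : ℕ → ℕ} → (∀ i → i < n → f i ≡ 0) → Sum n f ≡ 0
Sum-zero zero    e = refl
Sum-zero (suc n) e = cong₂ _+_ (Sum-zero n (λ i l → e i (m≤n⇒m≤1+n l))) (e n (n<1+n n))

Sum-≤-≡ : ∀ n {f g : ℕ → ℕ} → (∀ i → f i ≤ g i) → Sum n g ≤ Sum n f → ∀ i → i < n → f i ≡ g i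
Sum-≤-≡ (suc n) {f} {g} le s i l with m≤n⇒m<n∨m≡n (≤-pred l)
... | inj₁ l' = Sum-≤-≡ n le (lin (Sum n g ∷ g n ∷ Sum n f ∷ f n ∷ []) ((# 0 ⊕ # 1 ≼ # 2 ⊕ # 3 by s) ∷ (# 3 ≼ # 1 by le n) ∷ []) (# 0) (# 2)) i l'
... | inj₂ refl = ≤-antisym (le n) (lin (Sum n g ∷ g n ∷ Sum n f ∷ f n ∷ []) ((# 0 ⊕ # 1 ≼ # 2 ⊕ # 3 by s) ∷ (# 2 ≼ # 0 by Sum-mono n le) ∷ []) (# 1) (# 3))

key-zero : ∀ {ρ a k j} → Red ρ → KeyShape ρ a → All (k <_) ρ → j ≤ k → a j ≡ 0
key-zero red A ps l = n≤0⇒n≡0 (≮⇒≥ λ p → <⇒≱ (key-letters red A ps p) l)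

key-tail-size : ∀ {ρ a} k M → Red ρ → KeyShape ρ a → All (k <_) ρ → All (_< suc k + M) ρ → Sum M (λ i → a (suc k + i)) ≡ length ρ
key-tail-size {ρ} {a} k M red A lo hi = trans (cong (_+ Sum M (λ i → a (suc k + i))) (sym (Sum-zero (suc k) (λ i l → key-zero red A lo (≤-pred l)))))
  (trans (sym (Sum-split (suc k) M a)) (key-size (suc k + M) red A hi))

All-maxL : ∀ ρ {N} → maxL ρ < N → All (_< N) ρ
All-maxL ρ l = All.map (λ p → ≤-<-trans p l) (maxL-All ρ)

-- The rows above `k` form a prefix with all letters larger than `k`. Its key lies in rows above `k`
-- and inside the whole key, so the whole key has at least as many boxes up there as the filling.
lower-bound : ∀ n {t a} → Good t → (∀ j → n < j → t j ≡ []) → Red (Wd n 0 t) → KeyShape (Wd n 0 t) a → ∀ k → Sum k (λ i → a (suc i)) ≤ Sum k (λ i → length (t (suc i)))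
lower-bound n {t} {a} g z red A k = go (key-exists redu)
  where
  τ = Wd n 0 t
  -- Large enough for the rows up to `k + M` to contain the filling and every row of the key.
  M = n + maxL τ
  u = Wd M k t
  eq : τ ≡ u ++ Wd k 0 t
  eq = trans (sym (Wd-extend n 0 (k + maxL τ) t z)) (trans (cong (λ n → Wd n 0 t) (trans (sym (+-assoc n k _)) (trans (cong (_+ maxL τ) (+-comm n k)) (+-assoc k n _)))) (Wd-split k M 0 t))
  redu : Red u
  redu = Red-prefix u _ (subst Red eq red)
  big : All (_< suc k + M) τ
  big = All-maxL τ (s≤s (≤-trans (m≤n+m (maxL τ) n) (m≤n+m M k)))
  go : ∃ (KeyShape u) → Sum k (λ i → a (suc i)) ≤ Sum k (λ i → length (t (suc i)))
  go (b , B) = lin (Sum k (λ i → a (suc i)) ∷ Sum M (λ i → a (suc k + i)) ∷ length τ ∷ length u ∷ Sum k (λ i → length (t (suc i))) ∷ a 0 ∷ Sum (suc k) a ∷ [])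
    ((# 6 ⊕ # 1 ≼ # 2 by ≤-reflexive (trans (sym (Sum-split (suc k) M a)) (key-size (suc k + M) red A big))) ∷
     (# 5 ⊕ # 0 ≼ # 6 by ≤-reflexive (sym (Sum-shift k a))) ∷
     (# 3 ≼ # 1 by ≤-trans (≤-reflexive (sym (key-tail-size k M redu B (Wd-All M k g) (Allₚ.++⁻ˡ u (subst (All (_< suc k + M)) eq big))))) (Sum-mono M (λ i → key-mono u (Wd k 0 t) (subst Red eq red) B (subst (λ τ → KeyShape τ a) eq A) (suc k + i)))) ∷
     (# 2 ≼ # 3 ⊕ # 4 by ≤-reflexive (trans (cong length eq) (trans (length-++ u) (cong (length u +_) (Wd-length k 0 t))))) ∷ []) (# 0) (# 4)

-- The key of the prefix lies inside the whole key row by row, and above row `suc k` both have as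
-- many boxes as the prefix has letters, so there they coincide.
rows-of-prefix : ∀ m k {t a b} → Good t → (∀ j → k + suc m < j → t j ≡ []) → Red (Wd (suc m) k t) → KeyShape (Wd (suc m) k t) a → (∀ j → k < j → length (t j) ≡ a j) →
  KeyShape (Wd m (suc k) t) b → ∀ j → suc k < j → length (t j) ≡ b j
rows-of-prefix m k {t} {a} {b} g z red A len B j l with m≤n⇒∃[o]m+o≡n l
... | i , refl = trans (len j (<-trans (n<1+n k) l)) (sym (Sum-≤-≡ M (λ i → key-mono u (t (suc k)) red B A (suc (suc k) + i)) sums i i<M))
  where
  u = Wd m (suc k) t
  M = m + (maxL u + suc i)
  i<M : i < M
  i<M = ≤-trans (m≤n+m (suc i) (maxL u)) (m≤n+m _ m)
  redu = Red-prefix u (t (suc k)) red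
  sums : Sum M (λ i → a (suc (suc k) + i)) ≤ Sum M (λ i → b (suc (suc k) + i))
  sums = ≤-reflexive (trans (trans (Sum-cong M (λ i → sym (len (suc (suc k) + i) (s≤s (≤-trans (n≤1+n k) (m≤m+n (suc k) i)))))) (trans (sym (Wd-length M (suc k) t)) (cong length (Wd-extend m (suc k) _ t (λ j l → z j (subst (_< j) (sym (+-suc k m)) l))))))
    (sym (key-tail-size (suc k) M redu B (Wd-All m (suc k) g) (All-maxL u (s≤s (≤-trans (≤-trans (m≤m+n (maxL u) (suc i)) (m≤n+m _ m)) (m≤n+m M (suc k))))))))

-- With the row lengths of the key, the words above the lowest row have the same key, hence the same
-- shape. `strip-unique` then identifies the lowest rows and leaves equivalent words above.
filling-unique : ∀ m k {t t' a} → Good t → Good t' → (∀ j → k + m < j → t j ≡ []) → (∀ j → k + m < j → t' j ≡ []) → Red (Wd m k t) → Wd m k t ∼ Wd m k t' →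
  KeyShape (Wd m k t) a → (∀ j → k < j → length (t j) ≡ a j) → (∀ j → k < j → length (t' j) ≡ a j) → ∀ j → k < j → t j ≡ t' j
filling-unique zero    k g g' z z' red p A e e' j l = trans (z j l') (sym (z' j l'))
  where l' = subst (_< j) (sym (+-identityʳ k)) l
filling-unique (suc m) k {t} {t'} {a} g g' z z' red p A e e' = go (key-exists redu) (key-exists redu')
  where
  u = Wd m (suc k) t
  u' = Wd m (suc k) t'
  redu = Red-prefix u (t (suc k)) red
  red' = Red-∼ p red
  redu' = Red-prefix u' (t' (suc k)) red'
  shift : ∀ {t : ℕ → Word} → (∀ j → k + suc m < j → t j ≡ []) → ∀ j → suc k + m < j → t j ≡ []
  shift z j l = z j (subst (_< j) (sym (+-suc k m)) l)
  go : ∃ (KeyShape u) → ∃ (KeyShape u') → ∀ j → k < j → t j ≡ t' j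
  go (b , B) (b' , B') = result (strip-unique u u' (t (suc k)) (t' (suc k)) (incRow g (suc k)) (incRow g' (suc k)) red p (key-sh redu redu' B (key-cong (λ j → sym (same j)) B')))
    where
    len = rows-of-prefix m k g z red A e B
    len' = rows-of-prefix m k g' z' red' (key-∼ red p A) e' B'
    same : ∀ j → b j ≡ b' j
    same j with suc k <? j
    ... | yes l = trans (sym (len j l)) (trans (trans (e j (<-trans (n<1+n k) l)) (sym (e' j (<-trans (n<1+n k) l)))) (len' j l))
    ... | no l  = trans (key-zero redu B (Wd-All m (suc k) g) (≮⇒≥ l)) (sym (key-zero redu' B' (Wd-All m (suc k) g') (≮⇒≥ l)))
    result : (t (suc k) ≡ t' (suc k)) × (u ∼ u') → ∀ j → k < j → t j ≡ t' j
    result (q , q') j l with m≤n⇒m<n∨m≡n l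
    ... | inj₂ refl = q
    ... | inj₁ l'   = filling-unique m (suc k) g g' (shift z) (shift z') redu q' B len (λ j l → trans (len' j l) (sym (same j))) j l'

-- The last component remembers the column of the box of the last letter of `v`; comparing it with
-- the column of the next box shows that the next letter is larger.
StripRow : ℕ → Word → (ℕ → ℕ) → ℕ → Set
StripRow p ρ a k = ∃ λ u → ∃ λ v → (ρ ∼ u ++ v) × Inc v × (length v ≡ p) × (∃ λ b → KeyShape u b × (b k ≡ 0) × (∀ j → j ≢ k → b j ≡ a j)) ×
  (∀ v' y r' → v ≡ v' ∷ʳ y → GrowsAt (u ++ v') y r' → suc (sh (u ++ v') r') ≡ p)

-- The last box of the lowest row k lies in column p, hence at a corner, and
-- new-box forces the letter removed at that corner to have come from row k.
strip-row : ∀ p {ρ a k} → Red ρ → KeyShape ρ a → All (k ≤_) ρ → a k ≡ p → StripRow p ρ a k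
strip-row zero {ρ} {a} red A lo e = ρ , [] , ∼≡ (sym (++-identityʳ ρ)) , [] , refl , (a , A , e , λ j _ → refl) , λ { [] y r' () ; (_ ∷ _) y r' () }
strip-row (suc p) {ρ} {a} {k} red A lo e = at-row (sh w p) refl
  where
  w = reverse ρ
  redw : Red w
  redw = Red-reverse ρ red
  drops : sh w (suc p) < sh w p
  drops with m≤n⇒m<n∨m≡n (sh-part redw p)
  ... | inj₁ l = l
  ... | inj₂ q with col-exists redw p
  ...   | V , C@(mkCol s eqv i f) = ⊥-elim (<-irrefl (sym e) (box⇒ A (mkCol s eqv i (λ r → trans (f r) (same r))) (box⇐ A C (≤-reflexive (sym e)))))
    where
    same : ∀ r → del p (sh w) r ≡ del (suc p) (sh w) r
    same r with <-cmp r p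
    ... | tri< l _ _ = trans (del-< (sh w) l) (sym (del-< (sh w) (m≤n⇒m≤1+n l)))
    ... | tri≈ _ refl _ = trans (del-≥ {r} {r} (sh w) ≤-refl) (trans q (sym (del-< {suc r} {r} (sh w) (n<1+n r))))
    ... | tri> _ _ l = trans (del-≥ (sh w) (<⇒≤ l)) (sym (del-≥ (sh w) l))
  at-row : ∀ h → sh w p ≡ h → StripRow (suc p) ρ a k
  at-row zero    q = ⊥-elim (<⇒≱ drops (≤-trans (≤-reflexive q) z≤n))
  at-row (suc r) q = go (corner r red (≤-<-trans below above))
    where
    above : p < sh ρ r
    above = transpose red (≤-reflexive (sym q))
    below : sh ρ (suc r) ≤ p
    below = ≮⇒≥ λ l → <-irrefl (sym q) (transpose⁻ red l)
    exact : sh ρ r ≡ suc p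
    exact = ≤-antisym (≮⇒≥ λ l → <⇒≱ (<-≤-trans drops (≤-reflexive q)) (transpose⁻ red l)) above
    go : (∃ λ σ → ∃ λ x → (ρ ∼ σ ∷ʳ x) × GrowsAt σ x r) → StripRow (suc p) ρ a k
    go (σ , x , eqv , g) = with-key (key-exists redσ)
      where
      redx = Red-∼ eqv red
      redσ = Red-prefix σ (x ∷ []) redx
      shσ : sh σ r ≡ p
      shσ = suc-injective (trans (sym (sh-at red eqv g)) exact)
      with-key : ∃ (KeyShape σ) → StripRow (suc p) ρ a k
      with-key (a' , A') with new-box redx g A' (key-∼ red eqv A)
      ... | R , aR , grow , low = extend (strip-row p redσ A' (Allₚ.++⁻ˡ σ (∼-All eqv lo)) (trans (cong a' (sym R≡k)) (trans aR shσ)))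
        where
        R≡k : R ≡ k
        R≡k = ≤-antisym (low k (trans e (cong suc (sym shσ)))) (key-letters red A lo (≤-trans (≤-reflexive (sym (ι-refl R))) (≤-trans (m≤n+m _ (a' R)) (≤-reflexive (sym (grow R))))))
        extend : StripRow p σ a' k → StripRow (suc p) ρ a k
        extend (u , v , eqv' , i , len , (b , B , bk , rest) , info) =
            u , v ∷ʳ x , ∼trans eqv (∼trans (∼-++ʳ (x ∷ []) eqv') (∼≡ (sym (++-∷ʳ u v x)))) , inc (reverseView v) i info eqv' , trans (length-++ v) (trans (cong (_+ 1) len) (+-comm p 1)) ,
            (b , B , bk , λ j ne → trans (rest j ne) (sym (trans (grow j) (trans (cong (a' j +_) (ι-≢ (λ q → ne (trans (sym q) R≡k)))) (+-identityʳ _))))) , info'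
          where
          g' : GrowsAt (u ++ v) x r
          g' = GrowsAt-∼ redx eqv' g
          info' : ∀ v' y r' → v ∷ʳ x ≡ v' ∷ʳ y → GrowsAt (u ++ v') y r' → suc (sh (u ++ v') r') ≡ suc p
          info' v' y r' q h with ∷ʳ-injective v v' q
          ... | refl , refl rewrite GrowsAt-injective {u ++ v} {x} {r'} {r} h g' = cong suc (trans (sym (sh-∼ redσ eqv' r)) shσ)
          inc : ∀ {v} → Reverse v → Inc v → (∀ v' y r' → v ≡ v' ∷ʳ y → GrowsAt (u ++ v') y r' → suc (sh (u ++ v') r') ≡ p) → σ ∼ u ++ v → Inc (v ∷ʳ x)
          inc [] i info eqv' = [] ∷ []
          inc (v ∶ _ ∶ʳ y) i info eqv' with ∼trans eqv' (∼≡ (++-∷ʳ u v y))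
          ... | eqv″ with grows (u ++ v) y (Red-∼ eqv″ redσ)
          ...   | r' , h = AP-∷ʳ² <-trans v i (rows-ascent redv h hx (≮⇒≥ λ l →
                    <⇒≱ (≤-reflexive (sym (trans (sh-at redv ∼refl hx) (cong suc (trans (sym (sh-∼ redσ eqv″ r)) shσ)))))
                        (≤-trans (sh-anti redv (<⇒≤ l)) (≤-reflexive (trans (sh-off redv ∼refl hx (<⇒≢ l)) (trans (sh-at (Red-∼ eqv″ redσ) ∼refl h) (info v y r' refl h)))))))
            where
            hx = GrowsAt-∼ redx eqv″ g
            redv = Red-∼ (∼-++ʳ (x ∷ []) eqv″) redx

-- A filling with such rows is recovered by `weakDesTab` from its own reading word (`exact-place`).
Exact : ℕ → Word → Set
Exact j V = (V ≡ []) ⊎ (∃ λ V' → V ≡ j ∷ V')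

upd : ℕ → Word → (ℕ → Word) → ℕ → Word
upd k v t j with j ≟ k
... | yes _ = v
... | no _  = t j

upd-at : ∀ k v t → upd k v t k ≡ v
upd-at k v t with k ≟ k
... | yes _ = refl
... | no ne = ⊥-elim (ne refl)

upd-off : ∀ {j k} v t → j ≢ k → upd k v t j ≡ t j
upd-off {j} {k} v t ne with j ≟ k
... | yes e = ⊥-elim (ne e)
... | no _  = refl

min-letter : ∀ (u : Word) → (u ≡ []) ⊎ (∃ λ k → k ∈ u × All (k ≤_) u)
min-letter [] = inj₁ refl
min-letter (x ∷ u) with min-letter u
... | inj₁ refl = inj₂ (x , here refl , ≤-refl ∷ [])
... | inj₂ (k , m , ps) with ≤-total x k
...   | inj₁ l = inj₂ (x , here refl , ≤-refl ∷ All.map (≤-trans l) ps)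
...   | inj₂ l = inj₂ (k , there m , l ∷ ps)

Filling : ℕ → ℕ → Word → (ℕ → ℕ) → Set
Filling m k ρ a = ∃ λ t → Good t × (∀ j → Exact j (t j)) × (ρ ∼ Wd m k t) × (∀ j → k < j → length (t j) ≡ a j) × (∀ j → k + m < j → t j ≡ [])

-- Attains `lower-bound`: `strip-row` splits off the lowest row of the key, and as the remaining key
-- has that row empty, `key-min` keeps the letter `suc k` out of the remaining word.
canonical : ∀ m k {ρ a} → Red ρ → KeyShape ρ a → All (k <_) ρ → All (_≤ k + m) ρ → Filling m k ρ a
canonical zero k {[]} red A lo hi = (λ _ → []) , record { incRow = λ _ → [] ; lowRow = λ _ → [] } , (λ _ → inj₁ refl) , ∼refl , (λ j _ → key-unique red key-[] A j) , λ _ _ → refl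
canonical zero k {x ∷ ρ} red A (p ∷ _) (q ∷ _) = ⊥-elim (<⇒≱ p (subst (x ≤_) (+-identityʳ k) q))
canonical (suc m) k {ρ} {a} red A lo hi = go (strip-row (a (suc k)) red A lo refl)
  where
  go : StripRow (a (suc k)) ρ a (suc k) → Filling (suc m) k ρ a
  go (u , v , eqv , i , len , (b , B , bk , rest) , _) = join (canonical m (suc k) redu B lou hiu)
    where
    redu = Red-prefix u v (Red-∼ eqv red)
    lou′ = Allₚ.++⁻ˡ u (∼-All eqv lo)
    lov : All (suc k ≤_) v
    lov = Allₚ.++⁻ʳ u (∼-All eqv lo)
    hiu : All (_≤ suc k + m) u
    hiu = subst (λ n → All (_≤ n) u) (+-suc k m) (Allₚ.++⁻ˡ u (∼-All eqv hi))
    lou : All (suc k <_) u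
    lou with min-letter u
    ... | inj₁ refl = []
    ... | inj₂ (x , mem , ps) = All.map (<-≤-trans (≤∧≢⇒< (All.lookup lou′ mem) λ { refl → <-irrefl (sym bk) (key-min redu B mem ps) })) ps
    exact : ∀ v → Inc v → All (suc k ≤_) v → length v ≡ a (suc k) → ρ ∼ u ++ v → Exact (suc k) v
    exact [] _ _ _ _ = inj₁ refl
    exact (y ∷ v) (y< ∷ _) (p ∷ _) len eqv with suc k ≟ y
    ... | yes refl = inj₂ (v , refl)
    -- Otherwise `suc k` would not occur in `ρ` at all, although row `suc k` of its key is not
    -- empty.
    ... | no ne = ⊥-elim (key-letters {P = _≢ suc k} red A (∼-All (∼sym eqv) (Allₚ.++⁺ (All.map >⇒≢ lou) (All.map >⇒≢ (p<y ∷ All.map (<-trans p<y) y<)))) (≤-trans (s≤s z≤n) (≤-reflexive len)) refl)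
      where p<y = ≤∧≢⇒< p ne
    join : Filling m (suc k) u b → Filling (suc m) k ρ a
    join (t' , g , ex , eqv' , len' , z) = t , good , ex' , ∼trans eqv (∼trans (∼-++ʳ v eqv') (∼≡ (cong₂ _++_ (Wd-cong m (suc k) (λ j l _ → sym (upd-off v t' (>⇒≢ l)))) (sym (upd-at (suc k) v t'))))) , lens , z'
      where
      t = upd (suc k) v t'
      good : Good t
      good = record { incRow = incs ; lowRow = lows }
        where
        incs : ∀ j → Inc (t j)
        incs j with j ≟ suc k
        ... | yes _ = i
        ... | no _  = incRow g j
        lows : ∀ j → All (j ≤_) (t j)
        lows j with j ≟ suc k
        ... | yes refl = lov
        ... | no _     = lowRow g j
      ex' : ∀ j → Exact j (t j)
      ex' j with j ≟ suc k
      ... | yes refl = exact v i lov len eqv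
      ... | no _     = ex j
      lens : ∀ j → k < j → length (t j) ≡ a j
      lens j l with j ≟ suc k
      ... | yes refl = len
      ... | no ne    = trans (len' j (≤∧≢⇒< l (ne ∘ sym))) (rest j ne)
      z' : ∀ j → k + suc m < j → t j ≡ []
      z' j l = trans (upd-off v t' (>⇒≢ (≤-<-trans (≤-trans (m≤m+n (suc k) m) (≤-reflexive (sym (+-suc k m)))) l))) (z j (subst (_< j) (+-suc k m) l))

-- Weak descent tableaux as fillings

RunOk : Word → Set
RunOk σ = Inc σ × (1 ≤ length σ)

concat-consRun : ∀ x rs → concat (consRun x rs) ≡ x ∷ concat rs
concat-consRun x []              = refl
concat-consRun x ([] ∷ rs)       = refl
concat-consRun x ((y ∷ ys) ∷ rs) with x <ᵇ y
... | true  = refl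
... | false = refl

concat-runs : ∀ τ → concat (runs τ) ≡ τ
concat-runs []      = refl
concat-runs (x ∷ τ) = trans (concat-consRun x (runs τ)) (cong (x ∷_) (concat-runs τ))

consRun-ok : ∀ x rs → All RunOk rs → All RunOk (consRun x rs)
consRun-ok x []              []             = ([] ∷ [] , s≤s z≤n) ∷ []
consRun-ok x ([] ∷ rs)       (_ ∷ oks)      = ([] ∷ [] , s≤s z≤n) ∷ oks
consRun-ok x ((y ∷ ys) ∷ rs) ((i , l) ∷ oks) with x <ᵇ y in e
... | true  = (((x<y ∷ All.map (<-trans x<y) (AllPairs.head i)) ∷ i) , s≤s z≤n) ∷ oks
  where x<y = <ᵇ⇒< x y (subst T (sym e) tt)
... | false = ([] ∷ [] , s≤s z≤n) ∷ (i , l) ∷ oks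

runs-ok : ∀ τ → All RunOk (runs τ)
runs-ok []      = []
runs-ok (x ∷ τ) = consRun-ok x (runs τ) (runs-ok τ)

runs-Inc : ∀ h v → Inc (h ∷ v) → runs (h ∷ v) ≡ (h ∷ v) ∷ []
runs-Inc h []      i                 = refl
runs-Inc h (y ∷ v) ((p ∷ _) ∷ i) rewrite runs-Inc y v i | <ᵇ-true p = refl

consRun-++ : ∀ x r rs v → consRun x ((r ∷ rs) ++ v ∷ []) ≡ consRun x (r ∷ rs) ++ v ∷ []
consRun-++ x []       rs v = refl
consRun-++ x (y ∷ ys) rs v with x <ᵇ y
... | true  = refl
... | false = refl

consRun-nonempty : ∀ x rs → ∃ λ r → ∃ λ rs' → consRun x rs ≡ r ∷ rs'
consRun-nonempty x []              = _ , _ , refl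
consRun-nonempty x ([] ∷ rs)       = _ , _ , refl
consRun-nonempty x ((y ∷ ys) ∷ rs) with x <ᵇ y
... | true  = _ , _ , refl
... | false = _ , _ , refl

runs-++ : ∀ u h v → Inc (h ∷ v) → All (h <_) u → runs (u ++ h ∷ v) ≡ runs u ++ (h ∷ v) ∷ []
runs-++ []          h v i []           = runs-Inc h v i
runs-++ (x ∷ [])    h v i (p ∷ [])     rewrite runs-Inc h v i | <ᵇ-false (<⇒≤ p) = refl
runs-++ (x ∷ y ∷ u) h v i (p ∷ q ∷ ps) rewrite runs-++ (y ∷ u) h v i (q ∷ ps) with consRun-nonempty y (runs u)
... | r , rs , e rewrite e = consRun-++ x r rs (h ∷ v)

words : List (ℕ × Word) → Word
words []             = []
words ((_ , σ) ∷ ps) = σ ++ words ps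

data Rows : ℕ → List (ℕ × Word) → Set where
  []   : ∀ {b} → Rows b []
  cons : ∀ {b r σ ps} → 1 ≤ r → r < b → RunOk σ → All (r ≤_) σ → Rows r ps → Rows b ((r , σ) ∷ ps)

head-low : ∀ {σ r} → RunOk σ → r ≤ headOr0 σ → All (r ≤_) σ
head-low {x ∷ σ} (p ∷ i , _) l = l ∷ All.map (λ q → ≤-trans l (<⇒≤ q)) p

placeRest-sound : ∀ prev rs ps → All RunOk rs → placeRest prev rs ≡ just ps → Rows prev ps × (words ps ≡ concat rs)
placeRest-sound prev []       .[] []         refl = [] , refl
placeRest-sound prev (σ ∷ rs) ps  (ok ∷ oks) e = go (if headOr0 σ <ᵇ prev then headOr0 σ else prev ∸ 1) refl e
  where
  small : ∀ row → (if headOr0 σ <ᵇ prev then headOr0 σ else prev ∸ 1) ≡ row → 1 ≤ row → (row < prev) × (row ≤ headOr0 σ)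
  small row q l with headOr0 σ <ᵇ prev in e
  small row refl l | true = <ᵇ⇒< (headOr0 σ) prev (subst T (sym e) tt) , ≤-refl
  small row q l | false = pre prev q , ≤-trans (≤-trans (≤-reflexive (sym q)) (pred[n]≤n {prev})) (≮⇒≥ λ l' → subst T e (<⇒<ᵇ l'))
    where
    pre : ∀ prev → prev ∸ 1 ≡ row → row < prev
    pre zero    refl = ⊥-elim (<⇒≱ l z≤n)
    pre (suc p) refl = ≤-refl
  go : ∀ row → (if headOr0 σ <ᵇ prev then headOr0 σ else prev ∸ 1) ≡ row → (if row ≡ᵇ 0 then nothing else consM (row , σ) (placeRest row rs)) ≡ just ps → Rows prev ps × (words ps ≡ σ ++ concat rs)
  go (suc row) q e with placeRest (suc row) rs in e'
  go (suc row) q refl | just ps' with placeRest-sound (suc row) rs ps' oks e' | small (suc row) q (s≤s z≤n)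
  ... | R , w | l , l' = cons (s≤s z≤n) l ok (head-low ok l') R , cong (σ ++_) w

place-sound : ∀ rs ps → All RunOk rs → place rs ≡ just ps → (∃ λ b → Rows b ps) × (words ps ≡ concat rs)
place-sound []       .[] []         refl = (0 , []) , refl
place-sound (σ ∷ rs) ps  (ok ∷ oks) e = go (headOr0 σ) refl e
  where
  go : ∀ h → headOr0 σ ≡ h → (if h ≡ᵇ 0 then nothing else consM (h , σ) (placeRest h rs)) ≡ just ps → (∃ λ b → Rows b ps) × (words ps ≡ σ ++ concat rs)
  go (suc h) q e with placeRest (suc h) rs in e'
  go (suc h) q refl | just ps' with placeRest-sound (suc h) rs ps' oks e'
  ... | R , w = (suc (suc h) , cons (s≤s z≤n) ≤-refl ok (head-low ok (≤-reflexive (sym q))) R) , cong (σ ++_) w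

rowAt-high : ∀ {b ps j} → Rows b ps → b ≤ j → rowAt j ps ≡ []
rowAt-high [] l = refl
rowAt-high (cons _ r<b _ _ R) l rewrite ≡ᵇ-false (<⇒≢ (<-≤-trans r<b l)) = rowAt-high R (<⇒≤ (<-≤-trans r<b l))

Rows-Wd : ∀ n {b ps} → Rows b ps → b ≤ suc n → Wd n 0 (λ j → rowAt j ps) ≡ words ps
Rows-Wd n [] l = Wd-extend 0 0 n (λ _ → []) (λ _ _ → refl)
Rows-Wd n {b} (cons {r = suc r} {σ} {ps} _ r<b ok lo R) l with m≤n⇒∃[o]m+o≡n (≤-pred (<-≤-trans r<b l))
... | e , refl = trans (Wd-extend (suc r) 0 e t (λ j q → rowAt-high (cons (s≤s z≤n) ≤-refl ok lo R) q)) (trans (Wd-top r 0 t)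
    (cong₂ _++_ at-r (trans (Wd-cong r 0 (λ j _ q → below j q)) (Rows-Wd r R ≤-refl))))
  where
  t = λ j → rowAt j ((suc r , σ) ∷ ps)
  at-r : t (suc r) ≡ σ
  at-r rewrite ≡ᵇ-true {r} refl = refl
  below : ∀ j → j ≤ r → t j ≡ rowAt j ps
  below j q rewrite ≡ᵇ-false {suc r} {j} (>⇒≢ (s≤s q)) = refl

Rows-Good : ∀ {b ps} → Rows b ps → Good (λ j → rowAt j ps)
Rows-Good [] = record { incRow = λ _ → [] ; lowRow = λ _ → [] }
Rows-Good {ps = (r , σ) ∷ ps} (cons _ _ ok lo R) = record { incRow = incs ; lowRow = lows }
  where
  incs : ∀ j → Inc (rowAt j ((r , σ) ∷ ps))
  incs j with r ≡ᵇ j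
  ... | true  = proj₁ ok
  ... | false = incRow (Rows-Good R) j
  lows : ∀ j → All (j ≤_) (rowAt j ((r , σ) ∷ ps))
  lows j with r ≡ᵇ j in e
  ... | true  = subst (λ j → All (j ≤_) σ) (≡ᵇ⇒≡ r j (subst T (sym e) tt)) lo
  ... | false = lowRow (Rows-Good R) j

tab : ℕ → (ℕ → Word) → Tab
tab n t = map (λ k → t (suc k)) (upTo n)

-- `topmost` excludes empty rows at the end of the list, so that fillings with equal rows give equal
-- tableaux.
record NonVirtual (τ : Word) (n : ℕ) (t : ℕ → Word) : Set where
  field
    good   : Good t
    word   : τ ≡ Wd n 0 t
    above  : ∀ j → n < j → t j ≡ []
    topmost : (n ≡ 0) ⊎ (t n ≢ [])
    tab≡   : weakDesTab τ ≡ just (tab n t)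

place-nonVirtual : ∀ {τ ps} → place (runs τ) ≡ just ps → NonVirtual τ (topRow ps) (λ j → rowAt j ps)
place-nonVirtual {τ} {ps} e = go ps e (place-sound (runs τ) ps (runs-ok τ) e)
  where
  weak : ∀ ps → place (runs τ) ≡ just ps → weakDesTab τ ≡ just (buildTab ps)
  weak ps e rewrite e = refl
  go : ∀ ps → place (runs τ) ≡ just ps → (∃ λ b → Rows b ps) × (words ps ≡ concat (runs τ)) → NonVirtual τ (topRow ps) (λ j → rowAt j ps)
  go [] e (_ , w) = record { good = Rows-Good {0} [] ; word = trans (sym (concat-runs τ)) (sym w) ; above = λ _ _ → refl ; topmost = inj₁ refl ; tab≡ = weak [] e }
  go ((r , σ) ∷ ps) e ((b , cons p l ok lo R) , w) = record
    { good = Rows-Good (cons p l ok lo R)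
    ; word = trans (sym (concat-runs τ)) (sym (trans (Rows-Wd r (cons p ≤-refl ok lo R) ≤-refl) w))
    ; above = λ j q → rowAt-high (cons p ≤-refl ok lo R) q
    ; topmost = inj₂ λ q → nonempty (subst (λ b → (if b then σ else rowAt r ps) ≡ []) (≡ᵇ-true {r} refl) q) (proj₂ ok)
    ; tab≡ = weak _ e
    }
    where
    nonempty : ∀ {σ : Word} → σ ≡ [] → ¬ (1 ≤ length σ)
    nonempty refl ()

nonVirtual⇒ : ∀ τ → nonVirtualᵇ τ ≡ true → ∃ λ n → ∃ λ t → NonVirtual τ n t
nonVirtual⇒ τ e with place (runs τ) in q
... | just ps = _ , _ , place-nonVirtual q

nonVirtual⇐ : ∀ {τ n t} → NonVirtual τ n t → nonVirtualᵇ τ ≡ true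
nonVirtual⇐ {τ} nv with weakDesTab τ | NonVirtual.tab≡ nv
... | just _ | _ = refl

des≡ : ∀ {τ n t} → NonVirtual τ n t → des τ ≡ map length (tab n t)
des≡ {τ} nv with weakDesTab τ | NonVirtual.tab≡ nv
... | just _ | refl = refl

map-applyUpTo : ∀ {A B : Set} (g : A → B) (f : ℕ → A) n → map g (applyUpTo f n) ≡ applyUpTo (g ∘ f) n
map-applyUpTo g f zero    = refl
map-applyUpTo g f (suc n) = cong (g (f 0) ∷_) (map-applyUpTo g (f ∘ suc) n)

sum-take : ∀ k n (f : ℕ → ℕ) → (∀ i → n ≤ i → f i ≡ 0) → sum (take k (applyUpTo f n)) ≡ Sum k f
sum-take zero    n       f z = refl
sum-take (suc k) zero    f z = sym (Sum-zero (suc k) (λ i _ → z i z≤n))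
sum-take (suc k) (suc n) f z = trans (cong (f 0 +_) (sum-take k n (f ∘ suc) (λ i l → z (suc i) (s≤s l)))) (sym (Sum-shift k f))

des-sum : ∀ {τ n t} → NonVirtual τ n t → ∀ k → sum (take k (des τ)) ≡ Sum k (λ i → length (t (suc i)))
des-sum {τ} {n} {t} nv k = trans (cong (λ l → sum (take k l)) (trans (des≡ nv) (trans (cong (map length) (map-applyUpTo (λ k → t (suc k)) id n)) (map-applyUpTo length (λ k → t (suc k)) n))))
  (sum-take k n (λ i → length (t (suc i))) (λ i l → cong length (NonVirtual.above nv (suc i) (s≤s l))))

allᵇ-intro : ∀ {A : Set} (p : A → Bool) xs → (∀ x → x ∈ xs → p x ≡ true) → allᵇ p xs ≡ true
allᵇ-intro p []       h = refl
allᵇ-intro p (x ∷ xs) h rewrite h x (here refl) = allᵇ-intro p xs (λ y m → h y (there m))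

allᵇ-elim : ∀ {A : Set} (p : A → Bool) xs → allᵇ p xs ≡ true → ∀ {x} → x ∈ xs → p x ≡ true
allᵇ-elim p (x ∷ xs) e m with p x in q
allᵇ-elim p (x ∷ xs) e (here refl) | true = q
allᵇ-elim p (x ∷ xs) e (there m)   | true = allᵇ-elim p xs e m

take-all : ∀ {A : Set} k (xs : List A) → length xs ≤ k → take k xs ≡ xs
take-all zero    []       l       = refl
take-all (suc k) []       l       = refl
take-all (suc k) (x ∷ xs) (s≤s l) = cong (x ∷_) (take-all k xs l)

dom-intro : ∀ μ ν → (∀ k → sum (take k μ) ≤ sum (take k ν)) → domᵇ μ ν ≡ true
dom-intro μ ν h = allᵇ-intro _ (upTo (suc (length μ + length ν))) (λ k _ → ≤ᵇ-true (h k))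

dom-elim-small : ∀ μ ν → domᵇ μ ν ≡ true → ∀ k → k ≤ length μ + length ν → sum (take k μ) ≤ sum (take k ν)
dom-elim-small μ ν e k l = ≤ᵇ⇒≤ _ _ (subst T (sym (allᵇ-elim (λ k → sum (take k μ) ≤ᵇ sum (take k ν)) (upTo (suc (length μ + length ν))) e (∈-upTo⁺ (s≤s l)))) tt)

dom-elim : ∀ μ ν → domᵇ μ ν ≡ true → ∀ k → sum (take k μ) ≤ sum (take k ν)
dom-elim μ ν e k with k ≤? length μ + length ν
... | yes l = dom-elim-small μ ν e k l
... | no l = subst₂ _≤_ (eq μ (m≤m+n _ _)) (eq ν (m≤n+m _ _)) (dom-elim-small μ ν e K ≤-refl)
  where
  K = length μ + length ν
  eq : ∀ ξ → length ξ ≤ K → sum (take K ξ) ≡ sum (take k ξ)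
  eq ξ q = cong sum (trans (take-all K ξ q) (sym (take-all k ξ (≤-trans q (<⇒≤ (≰⇒> l))))))

placeRest-∷ʳ : ∀ {h} prev rs ps σ → headOr0 σ ≡ h → 1 ≤ h → placeRest prev rs ≡ just ps → h < prev → All (λ p → h < proj₁ p) ps → placeRest prev (rs ∷ʳ σ) ≡ just (ps ∷ʳ (h , σ))
placeRest-∷ʳ {suc h} prev [] .[] σ e _ refl l [] rewrite e | <ᵇ-true l = refl
placeRest-∷ʳ {h} prev (ρ ∷ rs) ps σ e l q l' al = go (if headOr0 ρ <ᵇ prev then headOr0 ρ else prev ∸ 1) q
  where
  go : ∀ row → (if row ≡ᵇ 0 then nothing else consM (row , ρ) (placeRest row rs)) ≡ just ps → (if row ≡ᵇ 0 then nothing else consM (row , ρ) (placeRest row (rs ∷ʳ σ))) ≡ just (ps ∷ʳ (h , σ))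
  go (suc row) q with placeRest (suc row) rs in q'
  go (suc row) refl | just ps' rewrite placeRest-∷ʳ (suc row) rs ps' σ e l q' (All.head al) (All.tail al) = refl

place-∷ʳ : ∀ {h} rs ps σ → headOr0 σ ≡ h → 1 ≤ h → place rs ≡ just ps → All (λ p → h < proj₁ p) ps → place (rs ∷ʳ σ) ≡ just (ps ∷ʳ (h , σ))
place-∷ʳ {suc h} [] .[] σ e _ refl [] rewrite e = refl
place-∷ʳ {h} (ρ ∷ rs) ps σ e l q al = go (headOr0 ρ) q
  where
  go : ∀ row → (if row ≡ᵇ 0 then nothing else consM (row , ρ) (placeRest row rs)) ≡ just ps → (if row ≡ᵇ 0 then nothing else consM (row , ρ) (placeRest row (rs ∷ʳ σ))) ≡ just (ps ∷ʳ (h , σ))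
  go (suc row) q with placeRest (suc row) rs in q'
  go (suc row) refl | just ps' rewrite placeRest-∷ʳ (suc row) rs ps' σ e l q' (All.head al) (All.tail al) = refl

rowAt-∷ʳ-off : ∀ {j k} ps σ → j ≢ k → rowAt j (ps ∷ʳ (k , σ)) ≡ rowAt j ps
rowAt-∷ʳ-off []             σ ne rewrite ≡ᵇ-false (ne ∘ sym) = refl
rowAt-∷ʳ-off {j} ((r , _) ∷ ps) σ ne with r ≡ᵇ j
... | true  = refl
... | false = rowAt-∷ʳ-off ps σ ne

rowAt-∷ʳ-at : ∀ {k} ps σ → All (λ p → k < proj₁ p) ps → rowAt k (ps ∷ʳ (k , σ)) ≡ σ
rowAt-∷ʳ-at {k} []       σ []       rewrite ≡ᵇ-true {k} refl = refl
rowAt-∷ʳ-at     (_ ∷ ps) σ (p ∷ al) rewrite ≡ᵇ-false (>⇒≢ p) = rowAt-∷ʳ-at ps σ al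

rowAt-low : ∀ {k} ps → All (λ p → k < proj₁ p) ps → rowAt k ps ≡ []
rowAt-low []       []       = refl
rowAt-low (_ ∷ ps) (p ∷ al) rewrite ≡ᵇ-false (>⇒≢ p) = rowAt-low ps al

-- A nonempty row `j` starts with `j`, below every letter of the rows above it. So the rows are the
-- runs of the word, and each is placed by its first letter.
exact-place : ∀ m k {t} → Good t → (∀ j → Exact j (t j)) → (∀ j → k + m < j → t j ≡ []) →
  ∃ λ ps → (place (runs (Wd m k t)) ≡ just ps) × All (λ p → k < proj₁ p) ps × (∀ j → k < j → rowAt j ps ≡ t j)
exact-place zero    k g ex z = [] , refl , [] , λ j l → sym (z j (subst (_< j) (sym (+-identityʳ k)) l))
exact-place (suc m) k {t} g ex z with exact-place m (suc k) g ex (λ j l → z j (subst (_< j) (sym (+-suc k m)) l)) | ex (suc k)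
... | ps , e , al , rows | inj₁ q = ps , trans (cong (place ∘ runs) (trans (cong (Wd m (suc k) t ++_) q) (++-identityʳ _))) e , All.map (<-trans (n<1+n k)) al , rows'
  where
  rows' : ∀ j → k < j → rowAt j ps ≡ t j
  rows' j l with m≤n⇒m<n∨m≡n l
  ... | inj₁ l'   = rows j l'
  ... | inj₂ refl = trans (rowAt-low ps al) (sym q)
... | ps , e , al , rows | inj₂ (v , q) = ps ∷ʳ (suc k , t (suc k)) ,
    trans (cong place (trans (cong (λ s → runs (Wd m (suc k) t ++ s)) q) (trans (runs-++ (Wd m (suc k) t) (suc k) v (subst Inc q (incRow g (suc k))) (Wd-All m (suc k) g)) (cong (λ s → runs (Wd m (suc k) t) ++ s ∷ []) (sym q)))))
      (place-∷ʳ (runs (Wd m (suc k) t)) ps (t (suc k)) (cong headOr0 q) (s≤s z≤n) e al) ,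
    Allₚ.++⁺ (All.map (<-trans (n<1+n k)) al) (n<1+n k ∷ []) , rows'
  where
  rows' : ∀ j → k < j → rowAt j (ps ∷ʳ (suc k , t (suc k))) ≡ t j
  rows' j l with m≤n⇒m<n∨m≡n l
  ... | inj₁ l'   = trans (rowAt-∷ʳ-off ps (t (suc k)) (>⇒≢ l')) (rows j l')
  ... | inj₂ refl = rowAt-∷ʳ-at ps (t (suc k)) al

-- The computed Coxeter–Knuth class is the whole class

∈-if : ∀ {A : Set} {v x : A} b → v ∈ (if b then x ∷ [] else []) → T b × (v ≡ x)
∈-if true  (here e) = tt , e

∈-if⁺ : ∀ {A : Set} {x : A} {b} → b ≡ true → x ∈ (if b then x ∷ [] else [])
∈-if⁺ refl = here refl

moves3-sound : ∀ {m} p q r u → m ∈ moves3 p q r → (p ∷ q ∷ r ∷ u) ∼ (m ++ u)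
moves3-sound p q r u i with ∈-++⁻ (if (r <ᵇ p) ∧ (p <ᵇ q) then (p ∷ r ∷ q ∷ []) ∷ [] else []) i
... | inj₁ j with ∈-if ((r <ᵇ p) ∧ (p <ᵇ q)) j
...   | t , refl = ∼sym (∼tri (bac (<ᵇ⇒< r p (T-∧ˡ t)) (<ᵇ⇒< p q (T-∧ʳ {r <ᵇ p} t))))
moves3-sound p q r u i | inj₂ i₂ with ∈-++⁻ (if (q <ᵇ p) ∧ (p <ᵇ r) then (p ∷ r ∷ q ∷ []) ∷ [] else []) i₂
... | inj₁ j with ∈-if ((q <ᵇ p) ∧ (p <ᵇ r)) j
...   | t , refl = ∼tri (bac (<ᵇ⇒< q p (T-∧ˡ t)) (<ᵇ⇒< p r (T-∧ʳ {q <ᵇ p} t)))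
moves3-sound p q r u i | inj₂ i₂ | inj₂ i₃ with ∈-++⁻ (if (q <ᵇ r) ∧ (r <ᵇ p) then (q ∷ p ∷ r ∷ []) ∷ [] else []) i₃
... | inj₁ j with ∈-if ((q <ᵇ r) ∧ (r <ᵇ p)) j
...   | t , refl = ∼tri (cab (<ᵇ⇒< q r (T-∧ˡ t)) (<ᵇ⇒< r p (T-∧ʳ {q <ᵇ r} t)))
moves3-sound p q r u i | inj₂ i₂ | inj₂ i₃ | inj₂ i₄ with ∈-++⁻ (if (p <ᵇ r) ∧ (r <ᵇ q) then (q ∷ p ∷ r ∷ []) ∷ [] else []) i₄
... | inj₁ j with ∈-if ((p <ᵇ r) ∧ (r <ᵇ q)) j
...   | t , refl = ∼sym (∼tri (cab (<ᵇ⇒< p r (T-∧ˡ t)) (<ᵇ⇒< r q (T-∧ʳ {p <ᵇ r} t))))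
moves3-sound p q r u i | inj₂ i₂ | inj₂ i₃ | inj₂ i₄ | inj₂ i₅ with ∈-if ((p ≡ᵇ r) ∧ ((q ≡ᵇ suc p) ∨ (p ≡ᵇ suc q))) i₅
... | t , refl with ≡ᵇ⇒≡ p r (T-∧ˡ t) | q ≡ᵇ suc p in e
...   | refl | true rewrite ≡ᵇ⇒≡ q (suc p) (subst T (sym e) tt) = ∼sym (∼tri braid)
...   | refl | false rewrite ≡ᵇ⇒≡ p (suc q) (subst (λ b → T (b ∨ (p ≡ᵇ suc q))) e (T-∧ʳ {p ≡ᵇ p} t)) = ∼tri braid

moves3-complete : ∀ {x y z x' y' z'} → Tri x y z x' y' z' → ((x' ∷ y' ∷ z' ∷ []) ∈ moves3 x y z) × ((x ∷ y ∷ z ∷ []) ∈ moves3 x' y' z')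
moves3-complete (bac {a} {b} {c} p q) =
  ∈-++⁺ʳ (if (c <ᵇ b) ∧ (b <ᵇ a) then _ else []) (∈-++⁺ˡ (∈-if⁺ (cong₂ _∧_ (<ᵇ-true p) (<ᵇ-true q)))) ,
  ∈-++⁺ˡ (∈-if⁺ (cong₂ _∧_ (<ᵇ-true p) (<ᵇ-true q)))
moves3-complete (cab {a} {b} {c} p q) =
  ∈-++⁺ʳ (if (b <ᵇ c) ∧ (c <ᵇ a) then _ else []) (∈-++⁺ʳ (if (a <ᵇ c) ∧ (c <ᵇ b) then _ else []) (∈-++⁺ˡ (∈-if⁺ (cong₂ _∧_ (<ᵇ-true p) (<ᵇ-true q))))) ,
  ∈-++⁺ʳ (if (b <ᵇ a) ∧ (a <ᵇ c) then _ else []) (∈-++⁺ʳ (if (c <ᵇ a) ∧ (a <ᵇ b) then _ else []) (∈-++⁺ʳ (if (c <ᵇ b) ∧ (b <ᵇ a) then _ else []) (∈-++⁺ˡ (∈-if⁺ (cong₂ _∧_ (<ᵇ-true p) (<ᵇ-true q))))))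
moves3-complete (braid {i}) = last (suc i) i eq₁ , last i (suc i) eq₂
  where
  last : ∀ p q → (p ≡ᵇ p) ∧ ((q ≡ᵇ suc p) ∨ (p ≡ᵇ suc q)) ≡ true → (q ∷ p ∷ q ∷ []) ∈ moves3 p q p
  last p q e = ∈-++⁺ʳ (if (p <ᵇ p) ∧ (p <ᵇ q) then _ else []) (∈-++⁺ʳ (if (q <ᵇ p) ∧ (p <ᵇ p) then _ else []) (∈-++⁺ʳ (if (q <ᵇ p) ∧ (p <ᵇ p) then _ else []) (∈-++⁺ʳ (if (p <ᵇ p) ∧ (p <ᵇ q) then _ else []) (∈-if⁺ e))))
  eq₁ : (suc i ≡ᵇ suc i) ∧ ((i ≡ᵇ suc (suc i)) ∨ (suc i ≡ᵇ suc i)) ≡ true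
  eq₁ rewrite ≡ᵇ-true {i} refl | ≡ᵇ-false {i} {suc (suc i)} (<⇒≢ (<-trans (n<1+n i) (n<1+n (suc i)))) = refl
  eq₂ : (i ≡ᵇ i) ∧ ((suc i ≡ᵇ suc i) ∨ (i ≡ᵇ suc (suc i))) ≡ true
  eq₂ rewrite ≡ᵇ-true {i} refl = refl

ckNeighbours-sound : ∀ w {v} → v ∈ ckNeighbours w → w ∼ v
ckNeighbours-sound (a ∷ b ∷ c ∷ u) i with ∈-++⁻ (map (_++ u) (moves3 a b c)) i
... | inj₁ j with ∈-map⁻ (_++ u) j
...   | m , k , refl = moves3-sound a b c u k
ckNeighbours-sound (a ∷ b ∷ c ∷ u) i | inj₂ j with ∈-map⁻ (a ∷_) j
...   | m , k , refl = ∼cons a (ckNeighbours-sound (b ∷ c ∷ u) k)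

ckNeighbours-cons : ∀ a w {v} → v ∈ ckNeighbours w → (a ∷ v) ∈ ckNeighbours (a ∷ w)
ckNeighbours-cons a (b ∷ c ∷ u) i = ∈-++⁺ʳ (map (_++ u) (moves3 a b c)) (∈-map⁺ (a ∷_) i)

ckNeighbours-++ : ∀ s w {v} → v ∈ ckNeighbours w → (s ++ v) ∈ ckNeighbours (s ++ w)
ckNeighbours-++ []      w i = i
ckNeighbours-++ (a ∷ s) w i = ckNeighbours-cons a (s ++ w) (ckNeighbours-++ s w i)

Closed : List Word → Set
Closed S = ∀ {w v} → w ∈ S → v ∈ ckNeighbours w → v ∈ S

-- The prefix `s` is general because `∼cons` moves a letter into the context.
closed-∼ : ∀ {S} → Closed S → ∀ {u v} → u ∼ v → ∀ s → ((s ++ u) ∈ S → (s ++ v) ∈ S) × ((s ++ v) ∈ S → (s ++ u) ∈ S)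
closed-∼ cl (∼tri {u = u} t) s with moves3-complete t
... | i , j = (λ m → cl m (ckNeighbours-++ s _ (∈-++⁺ˡ (∈-map⁺ (_++ u) i)))) , (λ m → cl m (ckNeighbours-++ s _ (∈-++⁺ˡ (∈-map⁺ (_++ u) j))))
closed-∼ {S} cl (∼cons x {u} {v} p) s with closed-∼ cl p (s ∷ʳ x)
... | f , g = (λ m → subst (_∈ S) (∷ʳ-++ s x v) (f (subst (_∈ S) (sym (∷ʳ-++ s x u)) m))) , (λ m → subst (_∈ S) (∷ʳ-++ s x u) (g (subst (_∈ S) (sym (∷ʳ-++ s x v)) m)))
closed-∼ cl ∼refl s = id , id
closed-∼ cl (∼sym p) s = proj₂ (closed-∼ cl p s) , proj₁ (closed-∼ cl p s)
closed-∼ cl (∼trans p q) s = proj₁ (closed-∼ cl q s) ∘ proj₁ (closed-∼ cl p s) , proj₂ (closed-∼ cl p s) ∘ proj₂ (closed-∼ cl q s)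

eqW-≡ : ∀ u v → T (eqWᵇ u v) → u ≡ v
eqW-≡ []      []      t = refl
eqW-≡ (x ∷ u) (y ∷ v) t = cong₂ _∷_ (≡ᵇ⇒≡ x y (T-∧ˡ t)) (eqW-≡ u v (T-∧ʳ {x ≡ᵇ y} t))

∈-dedup⁺ : ∀ {w} S → w ∈ S → w ∈ deduplicateᵇ eqWᵇ S
∈-dedup⁺ (x ∷ S) (here e)  = here e
∈-dedup⁺ {w} (x ∷ S) (there m) with T? (eqWᵇ x w)
... | yes t = here (sym (eqW-≡ x w t))
... | no n  = there (∈-filter⁺ (¬? ∘ (λ v → T? (eqWᵇ x v))) (∈-dedup⁺ S m) n)

∈-dedup⁻ : ∀ {w} S → w ∈ deduplicateᵇ eqWᵇ S → w ∈ S
∈-dedup⁻ S = ∈-deduplicate⁻ (λ u v → T? (eqWᵇ u v)) S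

∈-concatMap : ∀ {A B : Set} {f : A → List B} {x y} S → x ∈ S → y ∈ f x → y ∈ concatMap f S
∈-concatMap (x ∷ S) (here refl) m = ∈-++⁺ˡ m
∈-concatMap {f = f} (x ∷ S) (there i) m = ∈-++⁺ʳ (f x) (∈-concatMap S i m)

∈-concatMap′ : ∀ {A B : Set} {f : A → List B} {y} S → y ∈ concatMap f S → ∃ λ x → x ∈ S × y ∈ f x
∈-concatMap′ {f = f} (x ∷ S) i with ∈-++⁻ (f x) i
... | inj₁ m = x , here refl , m
... | inj₂ m with ∈-concatMap′ S m
...   | x' , j , k = x' , there j , k

ckStep-⊆ : ∀ {S w} → w ∈ S → w ∈ ckStep S
ckStep-⊆ {S} m = ∈-dedup⁺ (S ++ concatMap ckNeighbours S) (∈-++⁺ˡ m)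

ckStep-nb : ∀ {S w v} → w ∈ S → v ∈ ckNeighbours w → v ∈ ckStep S
ckStep-nb {S} m n = ∈-dedup⁺ (S ++ concatMap ckNeighbours S) (∈-++⁺ʳ S (∈-concatMap S m n))

ckStep⁻ : ∀ {S v} → v ∈ ckStep S → (v ∈ S) ⊎ (∃ λ w → w ∈ S × v ∈ ckNeighbours w)
ckStep⁻ {S} m with ∈-++⁻ S (∈-dedup⁻ (S ++ concatMap ckNeighbours S) m)
... | inj₁ i = inj₁ i
... | inj₂ i = inj₂ (∈-concatMap′ S i)

closed-ckStep : ∀ {S} → Closed S → Closed (ckStep S)
closed-ckStep {S} cl m n = ckStep-nb (back m) n
  where
  back : ∀ {w} → w ∈ ckStep S → w ∈ S
  back m with ckStep⁻ m
  ... | inj₁ i = i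
  ... | inj₂ (w , i , j) = cl i j

closed-iterate : ∀ n {S} → Closed S → Closed (iterateN n ckStep S)
closed-iterate zero    cl = cl
closed-iterate (suc n) cl = closed-iterate n (closed-ckStep cl)

_∈W?_ : ∀ (w : Word) S → Dec (w ∈ S)
w ∈W? S = any? (≡-dec _≟_ w) S

missing : List Word → List Word → ℕ
missing S []      = 0
missing S (w ∷ W) with w ∈W? S
... | yes _ = missing S W
... | no _  = suc (missing S W)

missing-0 : ∀ {S} W → missing S W ≡ 0 → ∀ {w} → w ∈ W → w ∈ S
missing-0 {S} (x ∷ W) e m with x ∈W? S
missing-0 (x ∷ W) e (here refl) | yes i = i
missing-0 (x ∷ W) e (there m)   | yes i = missing-0 W e m

missing-≤ : ∀ {S} W → missing S W ≤ length W
missing-≤ []      = z≤n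
missing-≤ {S} (w ∷ W) with w ∈W? S
... | yes _ = m≤n⇒m≤1+n (missing-≤ W)
... | no _  = s≤s (missing-≤ W)

missing-step : ∀ {S S'} → (∀ {w} → w ∈ S → w ∈ S') → ∀ W → (missing S' W ≤ missing S W) × ((missing S' W < missing S W) ⊎ (∀ {w} → w ∈ W → w ∈ S' → w ∈ S))
missing-step sub [] = z≤n , inj₂ λ ()
missing-step {S} {S'} sub (w ∷ W) with w ∈W? S | w ∈W? S' | missing-step sub W
... | yes i | no n  | _ = ⊥-elim (n (sub i))
... | no n  | yes j | le , _ = m≤n⇒m≤1+n le , inj₁ (s≤s le)
... | yes i | yes j | le , inj₁ l = le , inj₁ l
... | yes i | yes j | le , inj₂ f = le , inj₂ λ { (here refl) _ → i ; (there m) → f m }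
... | no n  | no n' | le , inj₁ l = s≤s le , inj₁ (s≤s l)
... | no n  | no n' | le , inj₂ f = s≤s le , inj₂ λ { (here refl) k → ⊥-elim (n' k) ; (there m) → f m }

allWords : ℕ → ℕ → List Word
allWords m zero    = [] ∷ []
allWords m (suc l) = concatMap (λ x → map (x ∷_) (allWords m l)) (upTo (suc m))

allWords-∈ : ∀ m w → All (_≤ m) w → w ∈ allWords m (length w)
allWords-∈ m []      []       = here refl
allWords-∈ m (x ∷ w) (p ∷ ps) = ∈-concatMap (upTo (suc m)) (∈-upTo⁺ (s≤s p)) (∈-map⁺ (x ∷_) (allWords-∈ m w ps))

length-concatMap : ∀ {A B : Set} {c} (f : A → List B) → (∀ x → length (f x) ≡ c) → ∀ S → length (concatMap f S) ≡ length S * c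
length-concatMap f e []      = refl
length-concatMap f e (x ∷ S) = trans (length-++ (f x)) (cong₂ _+_ (e x) (length-concatMap f e S))

length-allWords : ∀ m l → length (allWords m l) ≡ suc m ^ l
length-allWords m zero    = refl
length-allWords m (suc l) = trans (length-concatMap (λ x → map (x ∷_) (allWords m l)) (λ x → trans (length-map (x ∷_) (allWords m l)) (length-allWords m l)) (upTo (suc m))) (cong (_* suc m ^ l) (length-upTo (suc m)))

-- `W` contains the class, and its size is the number of iterations in `ckClass`; counting the
-- missing members of `W` shows that this number suffices.
module Class (ρ : Word) where

  W : List Word
  W = allWords (maxL ρ) (length ρ)

  ∼⇒∈W : ∀ {w} → ρ ∼ w → w ∈ W
  ∼⇒∈W {w} p = subst (λ l → w ∈ allWords (maxL ρ) l) (sym (∼-length p)) (allWords-∈ (maxL ρ) w (∼-All p (maxL-All ρ)))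

  Sound : List Word → Set
  Sound S = ∀ {w} → w ∈ S → ρ ∼ w

  sound-ckStep : ∀ {S} → Sound S → Sound (ckStep S)
  sound-ckStep so m with ckStep⁻ m
  ... | inj₁ i = so i
  ... | inj₂ (w , i , j) = ∼trans (so i) (ckNeighbours-sound w j)

  sound-iterate : ∀ n {S} → Sound S → Sound (iterateN n ckStep S)
  sound-iterate zero    so = so
  sound-iterate (suc n) so = sound-iterate n (sound-ckStep so)

  ⊆-iterate : ∀ n {S w} → w ∈ S → w ∈ iterateN n ckStep S
  ⊆-iterate zero    m = m
  ⊆-iterate (suc n) m = ⊆-iterate n (ckStep-⊆ m)

  -- Each step adds a missing word unless the class is already complete.
  closed-after : ∀ n {S} → Sound S → missing S W ≤ n → Closed (iterateN n ckStep S)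
  closed-after zero    so l {w} m n = missing-0 W (n≤0⇒n≡0 l) (∼⇒∈W (∼trans (so m) (ckNeighbours-sound w n)))
  closed-after (suc n) {S} so l with proj₂ (missing-step {S} {ckStep S} ckStep-⊆ W)
  ... | inj₁ d = closed-after n (sound-ckStep so) (≤-pred (<-≤-trans d l))
  ... | inj₂ f = closed-iterate n (closed-ckStep λ {w} m k → f (∼⇒∈W (∼trans (so m) (ckNeighbours-sound w k))) (ckStep-nb m k))

  start-sound : Sound (ρ ∷ [])
  start-sound (here refl) = ∼refl

ckClass-sound : ∀ {ρ w} → w ∈ ckClass ρ → ρ ∼ w
ckClass-sound {ρ} = Class.sound-iterate ρ (suc (maxL ρ) ^ length ρ) (Class.start-sound ρ)

ckClass-complete : ∀ {ρ w} → ρ ∼ w → w ∈ ckClass ρ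
ckClass-complete {ρ} p = proj₁ (closed-∼ (Class.closed-after ρ (suc (maxL ρ) ^ length ρ) (Class.start-sound ρ)
  (≤-trans (missing-≤ (Class.W ρ)) (≤-reflexive (length-allWords (maxL ρ) (length ρ))))) p []) (Class.⊆-iterate ρ (suc (maxL ρ) ^ length ρ) (here refl))

-- P̂ has the shape of the key

find-some : ∀ {A : Set} (p : A → Bool) {x} xs → x ∈ xs → p x ≡ true → ∃ λ y → (findᵇ' p xs ≡ just y) × (y ∈ xs) × (p y ≡ true)
find-some p (z ∷ xs) m e with p z in q
... | true = z , refl , here refl , q
find-some p (z ∷ xs) (here refl) e | false = case trans (sym q) e of λ ()
find-some p (z ∷ xs) (there m)   e | false with find-some p xs m e
... | y , a , b , c = y , a , there b , c

PhatSpec : Word → (ℕ → ℕ) → ℕ → (ℕ → Word) → Set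
PhatSpec ρ a n t = (Phat ρ ≡ just (tab n t)) × Good t × (∀ j → n < j → t j ≡ []) × ((n ≡ 0) ⊎ (t n ≢ [])) × (ρ ∼ Wd n 0 t) × (∀ j → 0 < j → length (t j) ≡ a j)

-- The word of the canonical filling is non-virtual and passes the minimality test, so the search
-- succeeds. The word found is below it in dominance order, and above it by `lower-bound`; hence its
-- rows have the lengths of the key.
Phat-spec′ : ∀ {ρ a} → Red ρ → KeyShape ρ a → ∃ λ n → ∃ λ t → PhatSpec ρ a n t
Phat-spec′ {ρ} {a} red A = step₁ (canonical (maxL ρ) 0 red A (positive red) (maxL-All ρ))
  where
  nv = filterᵇ nonVirtualᵇ (ckClass ρ)
  test : Word → Bool
  test τ = allᵇ (λ τ' → domᵇ (des τ) (des τ')) nv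
  member : ∀ {τ} → τ ∈ nv → (ρ ∼ τ) × (nonVirtualᵇ τ ≡ true)
  member m with ∈-filter⁻ (T? ∘ nonVirtualᵇ) {xs = ckClass ρ} m
  ... | i , t = ckClass-sound {ρ} i , T⇒≡ t
  lower : ∀ {τ n t} → ρ ∼ τ → NonVirtual τ n t → ∀ k → Sum k (λ i → a (suc i)) ≤ sum (take k (des τ))
  lower {τ} {n} {t} p v k = ≤-trans (lower-bound n (NonVirtual.good v) (NonVirtual.above v) (subst Red (NonVirtual.word v) (Red-∼ p red)) (subst (λ τ → KeyShape τ a) (NonVirtual.word v) (key-∼ red p A)) k) (≤-reflexive (sym (des-sum v k)))
  step₁ : Filling (maxL ρ) 0 ρ a → ∃ λ n → ∃ λ t → PhatSpec ρ a n t
  step₁ (tc , g , ex , p , len , z) = step₂ (exact-place (maxL ρ) 0 g ex z)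
    where
    τc = Wd (maxL ρ) 0 tc
    step₂ : (∃ λ ps → (place (runs τc) ≡ just ps) × All (λ q → 0 < proj₁ q) ps × (∀ j → 0 < j → rowAt j ps ≡ tc j)) → ∃ λ n → ∃ λ t → PhatSpec ρ a n t
    step₂ (ps , e , _ , rows) = step₃ (find-some test nv (∈-filter⁺ (T? ∘ nonVirtualᵇ) (ckClass-complete p) (subst T (sym (nonVirtual⇐ nvc)) tt)) (allᵇ-intro _ nv minimal))
      where
      nvc : NonVirtual τc (topRow ps) (λ j → rowAt j ps)
      nvc = place-nonVirtual e
      sumc : ∀ k → sum (take k (des τc)) ≡ Sum k (λ i → a (suc i))
      sumc k = trans (des-sum nvc k) (Sum-cong k (λ i → trans (cong length (rows (suc i) (s≤s z≤n))) (len (suc i) (s≤s z≤n))))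
      minimal : ∀ τ → τ ∈ nv → domᵇ (des τc) (des τ) ≡ true
      minimal τ m with member m
      ... | q , v with nonVirtual⇒ τ v
      ...   | n , t , w = dom-intro (des τc) (des τ) (λ k → ≤-trans (≤-reflexive (sumc k)) (lower q w k))
      step₃ : (∃ λ y → (findᵇ' test nv ≡ just y) × (y ∈ nv) × (test y ≡ true)) → ∃ λ n → ∃ λ t → PhatSpec ρ a n t
      step₃ (y , f , m , ty) with member m
      ... | q , v with nonVirtual⇒ y v
      ...   | n , t , w = n , t , trans (phat f) (NonVirtual.tab≡ w) , NonVirtual.good w , NonVirtual.above w , NonVirtual.topmost w , ∼trans q (∼≡ (NonVirtual.word w)) , lens
        where
        phat : ∀ {y} → findᵇ' test nv ≡ just y → Phat ρ ≡ weakDesTab y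
        phat f rewrite f = refl
        sums : ∀ k → Sum k (λ i → length (t (suc i))) ≡ Sum k (λ i → a (suc i))
        sums k = ≤-antisym (≤-trans (≤-reflexive (sym (des-sum w k))) (≤-trans (dom-elim (des y) (des τc) (allᵇ-elim (λ τ' → domᵇ (des y) (des τ')) nv ty (∈-filter⁺ (T? ∘ nonVirtualᵇ) (ckClass-complete p) (subst T (sym (nonVirtual⇐ nvc)) tt))) k) (≤-reflexive (sumc k))))
                           (≤-trans (lower q w k) (≤-reflexive (des-sum w k)))
        lens : ∀ j → 0 < j → length (t j) ≡ a j
        lens (suc j) _ = +-cancelˡ-≡ (Sum j (λ i → length (t (suc i)))) _ _ (trans (sums (suc j)) (cong (_+ a (suc j)) (sym (sums j))))

abstract
  Phat-spec : ∀ {ρ a} → Red ρ → KeyShape ρ a → ∃ λ n → ∃ λ t → PhatSpec ρ a n t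
  Phat-spec = Phat-spec′

Phat-∼ : ∀ {ρ τ} → Red ρ → ρ ∼ τ → Phat ρ ≡ Phat τ
Phat-∼ {ρ} {τ} red p with key-exists red
... | a , A with Phat-spec red A | Phat-spec (Red-∼ p red) (key-∼ red p A)
...   | n , t , e , g , z , top , q , len | n' , t' , e' , g' , z' , top' , q' , len' = trans e (trans (cong just (trans (map-cong rows-eq (upTo n)) (cong (λ n → tab n t') n≡))) (sym e'))
  where
  ext : Wd (n + n') 0 t ≡ Wd n 0 t
  ext = Wd-extend n 0 n' t z
  ext' : Wd (n + n') 0 t' ≡ Wd n' 0 t'
  ext' = trans (cong (λ m → Wd m 0 t') (+-comm n n')) (Wd-extend n' 0 n t' z')
  q₀ : ρ ∼ Wd (n + n') 0 t
  q₀ = ∼trans q (∼≡ (sym ext))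
  rows : ∀ j → 0 < j → t j ≡ t' j
  rows = filling-unique (n + n') 0 g g' (λ j l → z j (≤-<-trans (m≤m+n n n') l)) (λ j l → z' j (≤-<-trans (m≤n+m n' n) l)) (Red-∼ q₀ red)
    (∼trans (∼sym q₀) (∼trans p (∼trans q' (∼≡ (sym ext'))))) (key-∼ red q₀ A) len len'
  rows-eq : (λ k → t (suc k)) ≗ (λ k → t' (suc k))
  rows-eq k = rows (suc k) (s≤s z≤n)
  tops : ∀ {m m'} {s s' : ℕ → Word} → (∀ j → 0 < j → s j ≡ s' j) → (∀ j → m < j → s j ≡ []) → (m' ≡ 0) ⊎ (s' m' ≢ []) → m' ≤ m
  tops eq z (inj₁ refl) = z≤n
  tops {m} {m'} eq z (inj₂ ne) = ≮⇒≥ λ l → ne (trans (sym (eq m' (≤-<-trans z≤n l))) (z m' l))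
  n≡ : n ≡ n'
  n≡ = ≤-antisym (tops (λ j l → sym (rows j l)) z' top) (tops rows z top')

at-applyUpTo : ∀ {A : Set} (d : A) (f : ℕ → A) n j → (∀ i → n ≤ i → f i ≡ d) → at d (applyUpTo f n) j ≡ f j
at-applyUpTo d f zero    j       z = sym (z j z≤n)
at-applyUpTo d f (suc n) zero    z = refl
at-applyUpTo d f (suc n) (suc j) z = at-applyUpTo d (f ∘ suc) n j (λ i l → z (suc i) (s≤s l))

at-tab : ∀ {n t} → (∀ j → n < j → t j ≡ []) → ∀ j → at [] (tab n t) j ≡ t (suc j)
at-tab {n} {t} z j = trans (cong (λ l → at [] l j) (map-applyUpTo (λ k → t (suc k)) id n)) (at-applyUpTo [] (λ k → t (suc k)) n j (λ i l → z (suc i) (s≤s l)))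

inDiag-key : ∀ {ρ a} → Red ρ → KeyShape ρ a → ∀ k c → inDiag (Phat ρ) (suc k) (suc c) ≡ (suc c ≤ᵇ a (suc k))
inDiag-key red A k c with Phat-spec red A
... | n , t , e , _ , z , _ , _ , len = trans (cong (λ m → inDiag m (suc k) (suc c)) e) (cong (suc c ≤ᵇ_) (trans (cong length (at-tab {n} {t} z k)) (len (suc k) (s≤s z≤n))))

-- Horizontal strips of keys

-- `low` says that the strip box in column `j` lies in the least row that reaches column `j` in `c`
-- but does not reach column `suc j` in `a`. So column `j` of `a` is determined by `c`, by column
-- `suc j` of `a`, and by whether the strip has a box in column `j`.
record Strip (a c hA hC : ℕ → ℕ) : Set where
  constructor mkStrip
  field
    le  : ∀ k → a k ≤ c k
    low : ∀ {j k k'} → a k ≤ j → j < c k → j < c k' → a k' ≤ suc j → k ≤ k'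
    col : ∀ j → ((hC j ≡ hA j) × (∀ k → j < c k → j < a k)) ⊎ ((hC j ≡ suc (hA j)) × (∃ λ k → (a k ≤ j) × (j < c k)))

  single : ∀ {j k k'} → a k ≤ j → j < c k → a k' ≤ j → j < c k' → k ≡ k'
  single p q p' q' = ≤-antisym (low p q q' (m≤n⇒m≤1+n p')) (low p' q' q (m≤n⇒m≤1+n p))

-- Letters of `V` add boxes in columns from left to right, which `Bound` records. When a box is
-- added, no strip box lies further right, so minimality in `new-box` becomes `low`.
strip-key : ∀ s V {a c} → Inc V → Red (s ++ V) → KeyShape s a → KeyShape (s ++ V) c → Strip a c (sh (reverse s)) (sh (reverse (s ++ V)))
strip-key s V {a} i red A C = proj₁ (go (reverseView V) i red C)
  where
  Bound : Word → (ℕ → ℕ) → Set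
  Bound V c = ∀ x r → Inc (V ∷ʳ x) → Red ((s ++ V) ∷ʳ x) → GrowsAt (s ++ V) x r → ∀ {j k} → a k ≤ j → j < c k → j < sh (s ++ V) r
  go : ∀ {V c} → Reverse V → Inc V → Red (s ++ V) → KeyShape (s ++ V) c → Strip a c (sh (reverse s)) (sh (reverse (s ++ V))) × Bound V c
  go {c = c} [] i red C rewrite ++-identityʳ s =
      mkStrip (λ k → ≤-reflexive (eq k)) (λ {j} {k} p q _ _ → ⊥-elim (<⇒≱ q (subst (_≤ j) (eq k) p))) (λ j → inj₁ (refl , λ k l → subst (j <_) (sym (eq k)) l)) ,
      (λ x r _ _ _ {j} {k} p q → ⊥-elim (<⇒≱ q (subst (_≤ j) (eq k) p)))
    where eq = key-unique red A C
  go {c = c} (V ∶ v ∶ʳ x) i red C rewrite ++-∷ʳ s V x with grows (s ++ V) x red | key-exists (Red-prefix (s ++ V) (x ∷ []) red)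
  ... | r , g | c₀ , C₀ with new-box red g C₀ C | go v (proj₁ (AP-∷ʳ⁻ V i)) (Red-prefix (s ++ V) (x ∷ []) red) C₀
  ...   | R , c₀R , grow , lowest | S , bound = mkStrip le' low' col' , bound'
    where
    u = sh (s ++ V) r
    open Strip S
    cR : c R ≡ suc u
    cR = trans (grow R) (trans (cong₂ _+_ c₀R (ι-refl R)) (+-comm u 1))
    c-off : ∀ {k} → k ≢ R → c k ≡ c₀ k
    c-off {k} ne = trans (grow k) (trans (cong (c₀ k +_) (ι-≢ (ne ∘ sym))) (+-identityʳ _))
    le' : ∀ k → a k ≤ c k
    le' k = ≤-trans (le k) (≤-trans (m≤m+n _ _) (≤-reflexive (sym (grow k))))
    back : ∀ {j k} → j ≢ u → j < c k → j < c₀ k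
    back {j} {k} ne l with k ≟ R
    ... | yes refl = subst (j <_) (sym c₀R) (≤∧≢⇒< (≤-pred (subst (j <_) cR l)) ne)
    ... | no ne'   = subst (j <_) (c-off ne') l
    old : ∀ {j k} → a k ≤ j → j < c₀ k → j < u
    old = bound x r i red g
    new≤u : ∀ {j k} → a k ≤ j → j < c k → j ≤ u
    new≤u {j} {k} p q with j ≟ u
    ... | yes refl = ≤-refl
    ... | no ne    = <⇒≤ (old p (back ne q))
    R-only : ∀ {k} → a k ≤ u → u < c k → k ≡ R
    R-only {k} p q with k ≟ R
    ... | yes e = e
    ... | no ne = ⊥-elim (<-irrefl refl (old p (subst (u <_) (c-off ne) q)))
    low' : ∀ {j k k'} → a k ≤ j → j < c k → j < c k' → a k' ≤ suc j → k ≤ k'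
    low' {j} {k} {k'} p q q' p' with j ≟ u
    ... | no ne = low p (back ne q) (back ne q') p'
    ... | yes refl = subst (_≤ k') (sym (R-only p q)) (lowest k' (≤-antisym (≮⇒≥ λ l → <⇒≱ (new≤u p' l) ≤-refl) q'))
    hts : ∀ j → sh (reverse ((s ++ V) ∷ʳ x)) j ≡ sh (reverse (s ++ V)) j + ι u j
    hts j = trans (cong (λ t → sh t j) (reverse-++ (s ++ V) (x ∷ []))) (lgrown (proj₁ (grow-transpose red g)) j)
    col' : ∀ j → ((sh (reverse ((s ++ V) ∷ʳ x)) j ≡ sh (reverse s) j) × (∀ k → j < c k → j < a k)) ⊎ ((sh (reverse ((s ++ V) ∷ʳ x)) j ≡ suc (sh (reverse s) j)) × (∃ λ k → (a k ≤ j) × (j < c k)))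
    col' j with j ≟ u
    col' j | no ne with col j | trans (hts j) (trans (cong (sh (reverse (s ++ V)) j +_) (ι-≢ (ne ∘ sym))) (+-identityʳ _))
    ... | inj₁ (e , f) | h = inj₁ (trans h e , λ k l → f k (back ne l))
    ... | inj₂ (e , k , p , q) | h = inj₂ (trans h e , k , p , ≤-trans q (≤-trans (m≤m+n _ _) (≤-reflexive (sym (grow k)))))
    col' .u | yes refl with col u | trans (hts u) (trans (cong (sh (reverse (s ++ V)) u +_) (ι-refl u)) (+-comm _ 1))
    ... | inj₁ (e , f) | h = inj₂ (trans h (cong suc e) , R , ≤-trans (le R) (≤-reflexive c₀R) , ≤-reflexive (sym cR))
    ... | inj₂ (e , k , p , q) | h = ⊥-elim (<-irrefl refl (old p q))
    bound' : ∀ y r' → Inc ((V ∷ʳ x) ∷ʳ y) → Red (((s ++ V) ∷ʳ x) ∷ʳ y) → GrowsAt ((s ++ V) ∷ʳ x) y r' → ∀ {j k} → a k ≤ j → j < c k → j < sh ((s ++ V) ∷ʳ x) r'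
    bound' y r' i' red' g' p q = ≤-trans (s≤s (new≤u p q)) (≤-trans (≤-reflexive (sym (sh-at red ∼refl g))) (sh-anti red (ascent-rows red' g g' (AP-last V i'))))

-- Raising replaces the middle key b of a chain a ⊆ b ⊆ c of keys by b'; all are
-- given by row lengths, and hA, …, hC are their column heights.
module Raising {a b b' c hA hB hB' hC : ℕ → ℕ} {c₀ : ℕ} (AB : Strip a b hA hB) (BC : Strip b c hB hC) (AB' : Strip a b' hA hB') (BC' : Strip b' c hB' hC)
               (hB≡ : ∀ j → hB j ≡ hB' j + ι c₀ j) (N : ℕ) (empty : ∀ k → c k ≤ N) where

  module AB = Strip AB
  module BC = Strip BC
  module AB' = Strip AB'
  module BC' = Strip BC'

  hB-at : hB c₀ ≡ suc (hB' c₀)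
  hB-at = trans (hB≡ c₀) (trans (cong (hB' c₀ +_) (ι-refl c₀)) (+-comm _ 1))

  hB-off : ∀ {j} → j ≢ c₀ → hB j ≡ hB' j
  hB-off {j} ne = trans (hB≡ j) (trans (cong (hB' j +_) (ι-≢ (ne ∘ sym))) (+-identityʳ _))

  -- In column `c₀` the middle key is one higher before raising than after, while the outer key
  -- exceeds each of the two by at most one.
  c₀∉L : (hC c₀ ≡ hB c₀) × (∀ k → c₀ < c k → c₀ < b k)
  c₀∉L with BC.col c₀ | BC'.col c₀
  ... | inj₁ x | _ = x
  ... | inj₂ (e , _) | inj₁ (e' , _) = ⊥-elim (<⇒≢ (<-trans (n<1+n (hB' c₀)) (n<1+n (suc (hB' c₀)))) (trans (sym e') (trans e (cong suc hB-at))))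
  ... | inj₂ (e , _) | inj₂ (e' , _) = ⊥-elim (1+n≢n (trans (sym hB-at) (suc-injective (trans (sym e) e'))))

  c₀∈L' : ∃ λ R → (b' R ≤ c₀) × (c₀ < c R)
  c₀∈L' with BC'.col c₀
  ... | inj₁ (e , _) = ⊥-elim (1+n≢n (trans (sym hB-at) (trans (sym (proj₁ c₀∉L)) e)))
  ... | inj₂ (_ , x) = x

  L⇒L' : ∀ {j k} → j ≢ c₀ → b k ≤ j → j < c k → ∃ λ k' → (b' k' ≤ j) × (j < c k')
  L⇒L' {j} {k} ne p q with BC.col j | BC'.col j
  ... | inj₁ (_ , f) | _ = ⊥-elim (<⇒≱ (f k q) p)
  ... | inj₂ (e , _) | inj₁ (e' , _) = ⊥-elim (1+n≢n (trans (sym e) (trans e' (sym (hB-off ne)))))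
  ... | inj₂ _       | inj₂ (_ , x) = x

  L'⇒L : ∀ {j k} → j ≢ c₀ → b' k ≤ j → j < c k → ∃ λ k' → (b k' ≤ j) × (j < c k')
  L'⇒L {j} {k} ne p q with BC'.col j | BC.col j
  ... | inj₁ (_ , f) | _ = ⊥-elim (<⇒≱ (f k q) p)
  ... | inj₂ (e , _) | inj₁ (e' , _) = ⊥-elim (1+n≢n (trans (sym e) (trans e' (hB-off ne))))
  ... | inj₂ _       | inj₂ (_ , x) = x

  SameAt : ℕ → Set
  SameAt j = ∀ k → (j < b k → j < b' k) × (j < b' k → j < b k)

  -- Away from `c₀` the strips over `b` and `b'` both have a box in column `j` or both have none. If
  -- the columns to the right agree, `low` selects the same row for both.
  same-col : ∀ {j} → j ≢ c₀ → SameAt (suc j) → SameAt j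
  same-col {j} ne same k = fwd , bwd
    where
    transfer : ∀ {x} → b x ≤ suc j → b' x ≤ suc j
    transfer {x} p = ≮⇒≥ λ l → <⇒≱ (proj₂ (same x) l) p
    transfer' : ∀ {x} → b' x ≤ suc j → b x ≤ suc j
    transfer' {x} p = ≮⇒≥ λ l → <⇒≱ (proj₁ (same x) l) p
    fwd : j < b k → j < b' k
    fwd l with j <? b' k
    ... | yes l' = l'
    ... | no n with L'⇒L ne (≮⇒≥ n) (<-≤-trans l (BC.le k))
    ...   | k' , p , q = ⊥-elim (<⇒≱ l (subst (λ x → b x ≤ j) (≤-antisym (BC.low p q (<-≤-trans l (BC.le k)) (transfer' (m≤n⇒m≤1+n (≮⇒≥ n)))) (BC'.low (≮⇒≥ n) (<-≤-trans l (BC.le k)) q (transfer (m≤n⇒m≤1+n p)))) p))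
    bwd : j < b' k → j < b k
    bwd l with j <? b k
    ... | yes l' = l'
    ... | no n with L⇒L' ne (≮⇒≥ n) (<-≤-trans l (BC'.le k))
    ...   | k' , p , q = ⊥-elim (<⇒≱ l (subst (λ x → b' x ≤ j) (≤-antisym (BC'.low p q (<-≤-trans l (BC'.le k)) (transfer (m≤n⇒m≤1+n (≮⇒≥ n)))) (BC.low (≮⇒≥ n) (<-≤-trans l (BC'.le k)) q (transfer' (m≤n⇒m≤1+n p)))) p))

  same-right : ∀ j → c₀ < j → SameAt j
  same-right j l = go (N ∸ j) refl l
    where
    go : ∀ n {j} → N ∸ j ≡ n → c₀ < j → SameAt j
    go zero    {j} e l k = (λ q → ⊥-elim (<⇒≱ q (≤-trans (BC.le k) (≤-trans (empty k) (m∸n≡0⇒m≤n e))))) , (λ q → ⊥-elim (<⇒≱ q (≤-trans (BC'.le k) (≤-trans (empty k) (m∸n≡0⇒m≤n e)))))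
    go (suc n) {j} e l = same-col (>⇒≢ l) (go n (trans (sym (pred[m∸n]≡m∸[1+n] N j)) (cong pred e)) (m≤n⇒m≤1+n l))

  R : ℕ
  R = proj₁ c₀∈L'

  -- The first changed column: raising alters row `R` exactly from `C₁` to `c₀`.
  C₁ : ℕ
  C₁ = b' R

  C₁≤c₀ : C₁ ≤ c₀
  C₁≤c₀ = proj₁ (proj₂ c₀∈L')

  c₀<cR : c₀ < c R
  c₀<cR = proj₂ (proj₂ c₀∈L')

  bR : b R ≡ suc c₀
  bR = ≤-antisym (≮⇒≥ λ l → <⇒≱ (proj₁ (same-right (suc c₀) (n<1+n c₀) R) l) (m≤n⇒m≤1+n C₁≤c₀)) (proj₂ c₀∉L R c₀<cR)

  aR : a R ≤ C₁
  aR = AB'.le R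

  R-new : ∀ {j k} → C₁ ≤ j → j ≤ c₀ → b' k ≤ j → j < c k → k ≡ R
  R-new p p' q q' = BC'.single q q' p (≤-<-trans p' c₀<cR)

  Above : ℕ → Set
  Above j = ∀ k → b k ≤ j → j < c k → R < k

  -- If the row of the strip box ends in column `j`, it is not below `R` by `low`. If not, its next
  -- box is again in the strip, and this cannot go on to `c₀`, where the strip has no box.
  above : ∀ j → C₁ ≤ j → j < c₀ → Above j
  above j p q = go (c₀ ∸ suc j) (m+[n∸m]≡n q) p
    where
    go : ∀ n {j} → suc j + n ≡ c₀ → C₁ ≤ j → Above j
    go n {j} e p k bk ck with suc j <? c k
    ... | no l = ≤∧≢⇒< (BC'.low p (<-trans j<c₀ c₀<cR) ck (≤-trans (BC'.le k) (≮⇒≥ l))) (λ { refl → <⇒≱ (subst (j <_) (sym bR) (m≤n⇒m≤1+n j<c₀)) bk })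
      where
      j<c₀ : j < c₀
      j<c₀ = ≤-trans (m≤m+n (suc j) n) (≤-reflexive e)
    go zero    {j} e p k bk ck | yes l = ⊥-elim (<⇒≱ (subst (_< b k) (sym (trans (sym (+-identityʳ (suc j))) e)) (proj₂ c₀∉L k (subst (_< c k) (trans (sym (+-identityʳ (suc j))) e) l))) (m≤n⇒m≤1+n bk))
    go (suc n) {j} e p k bk ck | yes l = go n (trans (sym (+-suc (suc j) n)) e) (m≤n⇒m≤1+n p) k (m≤n⇒m≤1+n bk) l

  in-L : ∀ {j} → C₁ ≤ j → j < c₀ → ∃ λ k → (b k ≤ j) × (j < c k)
  in-L p q = L'⇒L (<⇒≢ q) p (<-trans q c₀<cR)

  -- Just left of `C₁` the row `R` competes in `low` for the strip over `b'`, so that strip box lies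
  -- below `R`. This restarts the agreement of `b` and `b'` further left.
  left-of : ∀ {j k k*} → C₁ ≡ suc j → b k ≤ j → j < c k → b' k* ≤ j → j < c k* → (k ≡ k*) × (k* < R)
  left-of {j} {k} {k*} e p q p* q* = ≤-antisym k≤k* k*≤k , k*<R
    where
    j<c₀ : j < c₀
    j<c₀ = ≤-trans (≤-reflexive (sym e)) C₁≤c₀
    k*<R : k* < R
    k*<R = ≤∧≢⇒< (BC'.low p* q* (<-trans j<c₀ c₀<cR) (≤-reflexive e)) (λ { refl → <⇒≱ (≤-reflexive (sym e)) p* })
    k≤k* : k ≤ k*
    k≤k* = BC.low p q q* (≮⇒≥ λ l → <⇒≢ k*<R (R-new (≤-reflexive e) j<c₀ (m≤n⇒m≤1+n p*) (<-≤-trans l (BC.le k*))))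
    k*≤k : k* ≤ k
    k*≤k = BC'.low p* q* q (≮⇒≥ λ l → <⇒≱ (<-≤-trans k*<R (≤-trans (<⇒≤ (gap (<-≤-trans l (BC'.le k)))) ≤-refl)) k≤k*)
      where
      gap : suc j < c k → R < k
      gap l with m≤n⇒m<n∨m≡n j<c₀
      ... | inj₁ l' = above (suc j) (≤-reflexive e) l' k (m≤n⇒m≤1+n p) l
      ... | inj₂ refl = ⊥-elim (<⇒≱ (proj₂ c₀∉L k l) (m≤n⇒m≤1+n p))

  same-left : ∀ j → j < C₁ → SameAt j
  same-left j l = go (C₁ ∸ suc j) (m+[n∸m]≡n l)
    where
    go : ∀ n {j} → suc j + n ≡ C₁ → SameAt j
    go (suc n) {j} e = same-col (<⇒≢ (<-≤-trans (≤-trans (m≤m+n (suc j) (suc n)) (≤-reflexive e)) C₁≤c₀)) (go n (trans (sym (+-suc (suc j) n)) e))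
    go zero {j} e₀ k = fwd , bwd
      where
      e : C₁ ≡ suc j
      e = trans (sym e₀) (+-identityʳ (suc j))
      ne : j ≢ c₀
      ne = <⇒≢ (≤-trans (≤-reflexive (sym e)) C₁≤c₀)
      fwd : j < b k → j < b' k
      fwd l with j <? b' k
      ... | yes l' = l'
      ... | no n with L'⇒L ne (≮⇒≥ n) (<-≤-trans l (BC.le k))
      ...   | k' , p , q = ⊥-elim (<⇒≱ l (subst (λ x → b x ≤ j) (proj₁ (left-of e p q (≮⇒≥ n) (<-≤-trans l (BC.le k)))) p))
      bwd : j < b' k → j < b k
      bwd l with j <? b k
      ... | yes l' = l'
      ... | no n with L⇒L' ne (≮⇒≥ n) (<-≤-trans l (BC'.le k))
      ...   | k' , p , q = ⊥-elim (<⇒≱ l (subst (λ x → b' x ≤ j) (sym (proj₁ (left-of e (≮⇒≥ n) (<-≤-trans l (BC'.le k)) p q))) p))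

  -- If row `k` of `b` ended in column `j`, `low` would put the box of `l` no higher than `k`. So
  -- row `k` continues, and the upper strip stays above it, until a column without a box of the
  -- upper strip.
  run-right : ∀ {j k l} → a k ≤ j → j < b k → b l ≤ j → j < c l → k < l →
    ∃ λ n → (suc j + n < b k) × (∀ l → suc j + n < c l → suc j + n < b l) × (∀ m → m < n → ∃ λ l → (b l ≤ suc j + m) × (suc j + m < c l) × (k < l))
  run-right {j} {k} {l} p q bl cl k<l = go (N ∸ j) refl p q bl cl k<l
    where
    go : ∀ d {j l} → N ∸ j ≡ d → a k ≤ j → j < b k → b l ≤ j → j < c l → k < l →
      ∃ λ n → (suc j + n < b k) × (∀ l → suc j + n < c l → suc j + n < b l) × (∀ m → m < n → ∃ λ l → (b l ≤ suc j + m) × (suc j + m < c l) × (k < l))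
    go zero    {j} {l} e p q bl cl k<l = ⊥-elim (<⇒≱ cl (≤-trans (empty l) (m∸n≡0⇒m≤n e)))
    go (suc d) {j} {l} e p q bl cl k<l with suc j <? b k
    ... | no n = ⊥-elim (<⇒≱ k<l (BC.low bl cl (<-≤-trans q (BC.le k)) (≮⇒≥ n)))
    ... | yes sj with BC.col (suc j)
    ...   | inj₁ (_ , f) = 0 , subst (_< b k) (sym (+-identityʳ (suc j))) sj , (λ l → subst (λ x → x < c l → x < b l) (sym (+-identityʳ (suc j))) (f l)) , λ _ ()
    ...   | inj₂ (_ , l' , bl' , cl') with go d {suc j} {l'} (trans (sym (pred[m∸n]≡m∸[1+n] N j)) (cong pred e)) (m≤n⇒m≤1+n p) sj bl' cl' k<l'
      where
      k<l' : k < l'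
      k<l' = ≤-trans k<l (BC.low bl cl (<-trans (n<1+n j) cl') bl')
    ...     | n , x , y , z = suc n , subst (_< b k) (sym eq) x , (λ l → subst (λ t → t < c l → t < b l) (sym eq) (y l)) , run
      where
      eq : suc j + suc n ≡ suc (suc j) + n
      eq = +-suc (suc j) n
      k<l' : k < l'
      k<l' = ≤-trans k<l (BC.low bl cl (<-trans (n<1+n j) cl') bl')
      run : ∀ m → m < suc n → ∃ λ l → (b l ≤ suc j + m) × (suc j + m < c l) × (k < l)
      run zero    _ = l' , subst (b l' ≤_) (sym (+-identityʳ (suc j))) bl' , subst (_< c l') (sym (+-identityʳ (suc j))) cl' , k<l'
      run (suc m) (s≤s lm) with z m lm
      ... | l″ , u , v , w = l″ , subst (b l″ ≤_) (sym (+-suc (suc j) m)) u , subst (_< c l″) (sym (+-suc (suc j) m)) v , w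

-- The potential of the columns is first maximal at the column of the removed box

min-tail : ∀ q k (f : ℕ → ℕ) m → (∀ s → q ≤ s → f s ≤ m) → Sum (q + k) (λ s → m ⊓ f s) + Sum q f ≡ Sum q (λ s → m ⊓ f s) + Sum (q + k) f
min-tail q zero    f m h rewrite +-identityʳ q = refl
min-tail q (suc k) f m h rewrite +-suc q k | m≥n⇒m⊓n≡n (h (q + k) (m≤m+n q k)) =
  trans (+-assoc (Sum (q + k) (λ s → m ⊓ f s)) _ _) (trans (cong (Sum (q + k) (λ s → m ⊓ f s) +_) (+-comm (f (q + k)) (Sum q f)))
    (trans (sym (+-assoc (Sum (q + k) (λ s → m ⊓ f s)) _ _)) (trans (cong (_+ f (q + k)) (min-tail q k f m h)) (+-assoc (Sum q (λ s → m ⊓ f s)) _ _))))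

min-tail′ : ∀ q n (f : ℕ → ℕ) m → q ≤ n → (∀ s → q ≤ s → f s ≤ m) → Sum n (λ s → m ⊓ f s) + Sum q f ≡ Sum q (λ s → m ⊓ f s) + Sum n f
min-tail′ q n f m l h with m≤n⇒∃[o]m+o≡n l
... | k , refl = min-tail q k f m h

min-head : ∀ p (f : ℕ → ℕ) m → (∀ s → s < p → m ≤ f s) → Sum p (λ s → m ⊓ f s) ≡ p * m
min-head zero    f m h = refl
min-head (suc p) f m h = trans (cong₂ _+_ (min-head p f m (λ s l → h s (m≤n⇒m≤1+n l))) (m≤n⇒m⊓n≡m (h p (n<1+n p)))) (+-comm _ m)

-- `M f m` counts the boxes in the first `m` columns. A vertical cut at `m` meets the boundary of
-- `A` at a row `r`; by interlacing, all three shapes are known relative to `m` except in rows `r`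
-- and `suc r`, so the potential over columns is the negative of the one over rows up to a local
-- term.
module Peak (A B C B' : ℕ → ℕ) (r₀ : ℕ) (eqB : ∀ t → B t ≡ B' t + ι r₀ t) (bst : Best A B C r₀)
            (A≤B' : ∀ s → A s ≤ B' s) (B≤C : ∀ s → B s ≤ C s) (B≤A : ∀ s → B (suc s) ≤ A s) (C≤B' : ∀ s → C (suc s) ≤ B' s)
            (antiA : ∀ s → A (suc s) ≤ A s) (N : ℕ) (zeroC : ∀ s → N ≤ s → C s ≡ 0) where

  B'≤B : ∀ s → B' s ≤ B s
  B'≤B s = ≤-trans (m≤m+n _ _) (≤-reflexive (sym (eqB s)))

  A≤B : ∀ s → A s ≤ B s
  A≤B s = ≤-trans (A≤B' s) (B'≤B s)

  C≤B : ∀ s → C (suc s) ≤ B s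
  C≤B s = ≤-trans (C≤B' s) (B'≤B s)

  B₀ : B r₀ ≡ suc (B' r₀)
  B₀ = trans (eqB r₀) (trans (cong (B' r₀ +_) (ι-refl r₀)) (+-comm _ 1))

  n : ℕ
  n = suc (suc N)

  M : (ℕ → ℕ) → ℕ → ℕ
  M f m = Sum n (λ s → m ⊓ f s)

  Cut : ℕ → ℕ → Set
  Cut m r = (r ≤ N) × (∀ s → s < r → m ≤ A s) × (∀ s → r ≤ s → A s ≤ m)

  cut : ∀ m → ∃ (Cut m)
  cut m = go N ≤-refl (λ s l → ≤-trans (≤-trans (A≤B s) (B≤C s)) (≤-trans (≤-reflexive (zeroC s l)) z≤n))
    where
    go : ∀ r → r ≤ N → (∀ s → r ≤ s → A s ≤ m) → ∃ (Cut m)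
    go zero    l h = 0 , l , (λ _ ()) , h
    go (suc r) l h with m ≤? A r
    ... | yes p = suc r , l , (λ s q → ≤-trans p (antitone antiA (≤-pred q))) , h
    ... | no p  = go r (<⇒≤ l) (λ s q → case m≤n⇒m<n∨m≡n q of λ { (inj₁ q') → h s q' ; (inj₂ refl) → <⇒≤ (≰⇒> p) })

  MA : ∀ {m r} → Cut m r → M A m + Sum r A ≡ r * m + Sum n A
  MA {m} {r} (l , lo , hi) = trans (min-tail′ r n A m (≤-trans l (≤-trans (n≤1+n N) (n≤1+n (suc N)))) hi) (cong (_+ Sum n A) (min-head r A m lo))

  MB : ∀ {m r} → Cut m r → M B m + Sum (suc r) B ≡ r * m + m ⊓ B r + Sum n B
  MB {m} {r} (l , lo , hi) = trans (min-tail′ (suc r) n B m (≤-trans (s≤s l) (n≤1+n (suc N))) hi') (cong (λ x → x + m ⊓ B r + Sum n B) (min-head r B m (λ s q → ≤-trans (lo s q) (A≤B s))))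
    where
    hi' : ∀ s → suc r ≤ s → B s ≤ m
    hi' (suc s) (s≤s q) = ≤-trans (B≤A s) (hi s q)

  MC : ∀ {m r} → Cut m r → M C m + Sum (suc (suc r)) C ≡ r * m + m ⊓ C r + m ⊓ C (suc r) + Sum n C
  MC {m} {r} (l , lo , hi) = trans (min-tail′ (suc (suc r)) n C m (s≤s (s≤s l)) hi') (cong (λ x → x + m ⊓ C r + m ⊓ C (suc r) + Sum n C) (min-head r C m (λ s q → ≤-trans (lo s q) (≤-trans (A≤B s) (B≤C s)))))
    where
    hi' : ∀ s → suc (suc r) ≤ s → C s ≤ m
    hi' (suc (suc s)) (s≤s (s≤s q)) = ≤-trans (C≤B (suc s)) (≤-trans (B≤A s) (hi s q))

  m₀ : ℕ
  m₀ = B r₀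

  cut₀ : r₀ ≤ N → Cut m₀ r₀
  cut₀ l = l , lo r₀ , λ s q → ≤-trans (antitone antiA q) (A≤B r₀)
    where
    lo : ∀ r s → s < r → B r ≤ A s
    lo (suc r) s (s≤s q) = ≤-trans (B≤A r) (antitone antiA q)

  r₀≤N : r₀ ≤ N
  r₀≤N = ≮⇒≥ λ l → <⇒≱ (≤-trans (s≤s z≤n) (≤-reflexive (sym B₀))) (≤-trans (B≤C r₀) (≤-reflexive (zeroC r₀ (<⇒≤ l))))

  -- The local term of the comparison is at most zero; `bracket₀` shows that it vanishes at `m₀`.
  bracket : ∀ m r → m ⊓ B r + m ⊓ B r + C (suc r) ≤ B r + m ⊓ C r + m ⊓ C (suc r)
  bracket m r with ≤-total m (B r) | ≤-total m (C (suc r))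
  ... | inj₁ p | inj₁ q rewrite m≤n⇒m⊓n≡m p | m≤n⇒m⊓n≡m (≤-trans p (B≤C r)) | m≤n⇒m⊓n≡m q = lin (m ∷ C (suc r) ∷ B r ∷ []) ((# 1 ≼ # 2 by C≤B r) ∷ []) (# 0 ⊕ # 0 ⊕ # 1) (# 2 ⊕ # 0 ⊕ # 0)
  ... | inj₁ p | inj₂ q rewrite m≤n⇒m⊓n≡m p | m≤n⇒m⊓n≡m (≤-trans p (B≤C r)) | m≥n⇒m⊓n≡n q = +-monoˡ-≤ (C (suc r)) (+-monoˡ-≤ m p)
  ... | inj₂ p | inj₁ q rewrite m≥n⇒m⊓n≡n p | m≤n⇒m⊓n≡m q = lin (B r ∷ C (suc r) ∷ m ⊓ C r ∷ m ∷ []) ((# 1 ≼ # 0 by C≤B r) ∷ (# 0 ≼ # 3 by p) ∷ (# 0 ≼ # 2 by ⊓-glb p (B≤C r)) ∷ []) (# 0 ⊕ # 0 ⊕ # 1) (# 0 ⊕ # 2 ⊕ # 3)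
  ... | inj₂ p | inj₂ q rewrite m≥n⇒m⊓n≡n p | m≥n⇒m⊓n≡n q = +-monoˡ-≤ (C (suc r)) (+-monoʳ-≤ (B r) (⊓-glb p (B≤C r)))

  bracket-< : ∀ m r → m < B r → C (suc r) < B r → suc (m ⊓ B r + m ⊓ B r + C (suc r)) ≤ B r + m ⊓ C r + m ⊓ C (suc r)
  bracket-< m r p q with ≤-total m (C (suc r))
  ... | inj₁ s rewrite m≤n⇒m⊓n≡m (<⇒≤ p) | m≤n⇒m⊓n≡m (≤-trans (<⇒≤ p) (B≤C r)) | m≤n⇒m⊓n≡m s = lin (m ∷ C (suc r) ∷ B r ∷ []) ((! 1 ⊕ # 1 ≼ # 2 by q) ∷ []) (! 1 ⊕ (# 0 ⊕ # 0 ⊕ # 1)) (# 2 ⊕ # 0 ⊕ # 0)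
  ... | inj₂ s rewrite m≤n⇒m⊓n≡m (<⇒≤ p) | m≤n⇒m⊓n≡m (≤-trans (<⇒≤ p) (B≤C r)) | m≥n⇒m⊓n≡n s = lin (m ∷ C (suc r) ∷ B r ∷ []) ((! 1 ⊕ # 0 ≼ # 2 by p) ∷ []) (! 1 ⊕ (# 0 ⊕ # 0 ⊕ # 1)) (# 2 ⊕ # 0 ⊕ # 1)

  bracket₀ : B r₀ + m₀ ⊓ C r₀ + m₀ ⊓ C (suc r₀) ≤ m₀ ⊓ B r₀ + m₀ ⊓ B r₀ + C (suc r₀)
  bracket₀ rewrite ⊓-idem (B r₀) = +-mono-≤ (+-monoʳ-≤ (B r₀) (m⊓n≤m (B r₀) (C r₀))) (m⊓n≤n (B r₀) (C (suc r₀)))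

  compare : ∀ k k' m r → Cut m r → k + (m ⊓ B r + m ⊓ B r + C (suc r)) ≤ B r + m ⊓ C r + m ⊓ C (suc r) →
    k' + ((Sum r₀ B + Sum (suc r₀) B) + (Sum r A + Sum (suc r) C)) ≤ (Sum r B + Sum (suc r) B) + (Sum r₀ A + Sum (suc r₀) C) →
    k + k' + (M B m + M B m + (M A m₀ + M C m₀)) ≤ M B m₀ + M B m₀ + (M A m + M C m)
  compare k k' m r cm br bs = lin
    (k ∷ k' ∷ M B m ∷ M A m ∷ M C m ∷ M B m₀ ∷ M A m₀ ∷ M C m₀ ∷ Sum r A ∷ Sum r B ∷ B r ∷ Sum (suc r) C ∷ C (suc r) ∷ Sum r₀ A ∷ Sum r₀ B ∷ B r₀ ∷ Sum (suc r₀) C ∷ C (suc r₀) ∷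
     m ⊓ B r ∷ m ⊓ C r ∷ m ⊓ C (suc r) ∷ m₀ ⊓ B r₀ ∷ m₀ ⊓ C r₀ ∷ m₀ ⊓ C (suc r₀) ∷ r * m ∷ r₀ * m₀ ∷ Sum n A ∷ Sum n B ∷ Sum n C ∷ [])
    ((# 2 ⊕ (# 9 ⊕ # 10) ≼ # 24 ⊕ # 18 ⊕ # 27 by ≤-reflexive (MB cm)) ∷ (# 2 ⊕ (# 9 ⊕ # 10) ≼ # 24 ⊕ # 18 ⊕ # 27 by ≤-reflexive (MB cm)) ∷
     (# 24 ⊕ # 26 ≼ # 3 ⊕ # 8 by ≤-reflexive (sym (MA cm))) ∷ (# 24 ⊕ # 19 ⊕ # 20 ⊕ # 28 ≼ # 4 ⊕ (# 11 ⊕ # 12) by ≤-reflexive (sym (MC cm))) ∷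
     (# 6 ⊕ # 13 ≼ # 25 ⊕ # 26 by ≤-reflexive (MA c₀)) ∷ (# 7 ⊕ (# 16 ⊕ # 17) ≼ # 25 ⊕ # 22 ⊕ # 23 ⊕ # 28 by ≤-reflexive (MC c₀)) ∷
     (# 25 ⊕ # 21 ⊕ # 27 ≼ # 5 ⊕ (# 14 ⊕ # 15) by ≤-reflexive (sym (MB c₀))) ∷ (# 25 ⊕ # 21 ⊕ # 27 ≼ # 5 ⊕ (# 14 ⊕ # 15) by ≤-reflexive (sym (MB c₀))) ∷
     (# 0 ⊕ (# 18 ⊕ # 18 ⊕ # 12) ≼ # 10 ⊕ # 19 ⊕ # 20 by br) ∷ (# 15 ⊕ # 22 ⊕ # 23 ≼ # 21 ⊕ # 21 ⊕ # 17 by bracket₀) ∷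
     (# 1 ⊕ ((# 14 ⊕ (# 14 ⊕ # 15)) ⊕ (# 8 ⊕ # 11)) ≼ (# 9 ⊕ (# 9 ⊕ # 10)) ⊕ (# 13 ⊕ # 16) by bs) ∷ [])
    (# 0 ⊕ # 1 ⊕ (# 2 ⊕ # 2 ⊕ (# 6 ⊕ # 7))) (# 5 ⊕ # 5 ⊕ (# 3 ⊕ # 4))
    where c₀ = cut₀ r₀≤N

  peak-≤ : ∀ m → M B m + M B m + (M A m₀ + M C m₀) ≤ M B m₀ + M B m₀ + (M A m + M C m)
  peak-≤ m with cut m
  ... | r , cm with <-cmp r r₀
  ...   | tri< l _ _    = compare 0 0 m r cm (bracket m r) (before bst r l)
  ...   | tri≈ _ refl _ = compare 0 0 m r cm (bracket m r) ≤-refl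
  ...   | tri> _ _ l    = compare 0 0 m r cm (bracket m r) (<⇒≤ (after bst r l))

  peak-< : ∀ m → m < m₀ → M B m + M B m + (M A m₀ + M C m₀) < M B m₀ + M B m₀ + (M A m + M C m)
  peak-< m p with cut m
  ... | r , cm@(_ , _ , hi) with <-cmp r r₀
  -- A cut before `m₀` cannot meet `A` at a row before `r₀`, since those rows of `A` have length at
  -- least `m₀`.
  ...   | tri< l _ _    = ⊥-elim (<⇒≱ p (≤-trans (proj₁ (proj₂ (cut₀ r₀≤N)) r l) (hi r ≤-refl)))
  ...   | tri≈ _ refl _ = compare 1 0 m r cm (bracket-< m r p (≤-<-trans (C≤B' r) (≤-reflexive (sym B₀)))) ≤-refl
  ...   | tri> _ _ l    = compare 0 1 m r cm (bracket m r) (after bst r l)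

reverse-sh : ∀ {σ τ} → Red σ → Red τ → (∀ r → sh σ r ≡ sh τ r) → ∀ j → sh (reverse σ) j ≡ sh (reverse τ) j
reverse-sh {σ} {τ} redσ redτ e j = ≤-antisym (≤-by-< λ u l → transpose⁻ redτ (subst (j <_) (e u) (transpose redσ l))) (≤-by-< λ u l → transpose⁻ redσ (subst (j <_) (sym (e u)) (transpose redτ l)))

reverse-ι : ∀ {σ τ r} → Red σ → Red τ → (∀ t → sh σ t ≡ sh τ t + ι r t) → ∀ j → sh (reverse σ) j ≡ sh (reverse τ) j + ι (sh τ r) j
reverse-ι {σ} {τ} {r} redσ redτ e j with corner r redσ drops
  where
  drops : sh σ (suc r) < sh σ r
  drops = subst₂ _<_ (sym (trans (e (suc r)) (trans (cong (sh τ (suc r) +_) (ι-≢ (<⇒≢ (n<1+n r)))) (+-identityʳ _)))) (sym (trans (e r) (trans (cong (sh τ r +_) (ι-refl r)) (+-comm _ 1)))) (s≤s (sh-part redτ r))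
... | π , x , p , g = trans (sh-∼ (Red-reverse σ redσ) (∼-reverse p) j) (trans (cong (λ t → sh t j) (reverse-++ π (x ∷ []))) (trans (lgrown (proj₁ (grow-transpose redx g)) j)
    (cong₂ _+_ (reverse-sh redπ redτ same j) (cong (λ c → ι c j) (same r)))))
  where
  redx = Red-∼ p redσ
  redπ = Red-prefix π (x ∷ []) redx
  same : ∀ t → sh π t ≡ sh τ t
  same t = +-cancelʳ-≡ (ι r t) _ _ (trans (sym (grown g t)) (trans (sym (sh-∼ redσ p t)) (e t)))

heights-Sum : ∀ {σ} m N → Red σ → length σ ≤ N → Sum m (sh (reverse σ)) ≡ Sum N (λ s → m ⊓ sh σ s)
heights-Sum {σ} m N red l = trans (transpose-Sum m N (Red-reverse σ red) (subst (_≤ N) (sym (length-reverse σ)) l)) (Sum-cong N (λ s → cong (λ t → m ⊓ sh t s) (reverse-involutive σ)))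

-- Without subtraction: `m₀` is the first maximum of the number of boxes of the lower strip minus
-- that of the upper strip in the first `m` columns.
record PeakAt (hA hB hC : ℕ → ℕ) (m₀ : ℕ) : Set where
  field
    peak≤ : ∀ m → Sum m hB + Sum m hB + (Sum m₀ hA + Sum m₀ hC) ≤ Sum m₀ hB + Sum m₀ hB + (Sum m hA + Sum m hC)
    peak< : ∀ m → m < m₀ → Sum m hB + Sum m hB + (Sum m₀ hA + Sum m₀ hC) < Sum m₀ hB + Sum m₀ hB + (Sum m hA + Sum m hC)

raise-peak′ : ∀ {X Y X' Y'} → Inc X → Inc Y → Inc X' → Inc Y' → (X ++ Y) ∼ (X' ++ Y') → length X ≡ suc (length X') → ∀ s → Red ((s ++ X) ++ Y) →
  ∃ λ c₀ → (∀ j → sh (reverse (s ++ X)) j ≡ sh (reverse (s ++ X')) j + ι c₀ j) × PeakAt (sh (reverse s)) (sh (reverse (s ++ X))) (sh (reverse ((s ++ X) ++ Y))) (suc c₀)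
raise-peak′ {X} {Y} {X'} {Y'} i j i' j' p len s red with raise-rows i j i' j' p len s red
... | r₀ , eqB , bst = sh (s ++ X') r₀ , reverse-ι {r = r₀} redB redB' eqB , subst (PeakAt hA hB hC) m₀≡ record
    { peak≤ = λ m → subst₂ _≤_ (conv m m₀) (conv m₀ m) (peak-≤ m) ; peak< = λ m l → subst₂ _<_ (conv m m₀) (conv m₀ m) (peak-< m l) }
  where
  hA = sh (reverse s)
  hB = sh (reverse (s ++ X))
  hC = sh (reverse ((s ++ X) ++ Y))
  redB = Red-prefix (s ++ X) Y red
  redA = Red-prefix s X redB
  q : ((s ++ X) ++ Y) ∼ ((s ++ X') ++ Y')
  q = ∼trans (∼≡ (++-assoc s X Y)) (∼trans (∼-++ˡ s p) (∼≡ (sym (++-assoc s X' Y'))))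
  redB' = Red-prefix (s ++ X') Y' (Red-∼ q red)
  N₀ = length ((s ++ X) ++ Y)
  open Peak (sh s) (sh (s ++ X)) (sh ((s ++ X) ++ Y)) (sh (s ++ X')) r₀ eqB bst (sh-mono s X' redB') (sh-mono (s ++ X) Y red) (strip-interlace s X i redB)
    (λ t → ≤-trans (≤-reflexive (sh-∼ red q (suc t))) (strip-interlace (s ++ X') Y' j' (Red-∼ q red) t)) (sh-part redA) N₀ (λ t l → sh-zero t red l)
  m₀≡ : m₀ ≡ suc (sh (s ++ X') r₀)
  m₀≡ = B₀
  lB : length (s ++ X) ≤ n
  lB = ≤-trans (≤-trans (m≤m+n _ (length Y)) (≤-reflexive (sym (length-++ (s ++ X))))) (≤-trans (n≤1+n N₀) (n≤1+n (suc N₀)))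
  lA : length s ≤ n
  lA = ≤-trans (≤-trans (m≤m+n _ (length X)) (≤-reflexive (sym (length-++ s)))) lB
  conv : ∀ m m' → M (sh (s ++ X)) m + M (sh (s ++ X)) m + (M (sh s) m' + M (sh ((s ++ X) ++ Y)) m') ≡ Sum m hB + Sum m hB + (Sum m' hA + Sum m' hC)
  conv m m' = cong₂ _+_ (cong₂ _+_ (sym (heights-Sum m n redB lB)) (sym (heights-Sum m n redB lB))) (cong₂ _+_ (sym (heights-Sum m' n redA lA)) (sym (heights-Sum m' n red (≤-trans (n≤1+n N₀) (n≤1+n (suc N₀))))))

abstract
  raise-peak : ∀ {X Y X' Y'} → Inc X → Inc Y → Inc X' → Inc Y' → (X ++ Y) ∼ (X' ++ Y') → length X ≡ suc (length X') → ∀ s → Red ((s ++ X) ++ Y) →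
    ∃ λ c₀ → (∀ j → sh (reverse (s ++ X)) j ≡ sh (reverse (s ++ X')) j + ι c₀ j) × PeakAt (sh (reverse s)) (sh (reverse (s ++ X))) (sh (reverse ((s ++ X) ++ Y))) (suc c₀)
  raise-peak = raise-peak′

-- The raising operator on the recording filling

Box : Set
Box = ℕ × ℕ × ℕ

tot : (ℕ → ℕ) → List Box → ℕ
tot g []             = 0
tot g ((v , _) ∷ xs) = g v + tot g xs

tot-++ : ∀ g xs ys → tot g (xs ++ ys) ≡ tot g xs + tot g ys
tot-++ g []             ys = refl
tot-++ g ((v , _) ∷ xs) ys = trans (cong (g v +_) (tot-++ g xs ys)) (sym (+-assoc (g v) _ _))

up dn : ℕ → ℕ → ℕ
up i v = if v ≡ᵇ suc i then 1 else 0
dn i v = if v ≡ᵇ i then 1 else 0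

up-1 : ∀ {i v} → v ≡ suc i → up i v ≡ 1
up-1 {i} refl rewrite ≡ᵇ-true {i} refl = refl

up-0 : ∀ {i v} → v ≢ suc i → up i v ≡ 0
up-0 ne rewrite ≡ᵇ-false ne = refl

dn-1 : ∀ {i v} → v ≡ i → dn i v ≡ 1
dn-1 {i} refl rewrite ≡ᵇ-true {i} refl = refl

dn-0 : ∀ {i v} → v ≢ i → dn i v ≡ 0
dn-0 ne rewrite ≡ᵇ-false ne = refl

-- A single difference of natural numbers, so that comparisons reduce to inequalities for `lin`.
value : ℕ → List Box → ℤ
value i xs = tot (up i) xs ℤ.⊖ tot (dn i) xs

δ-⊖ : ∀ i v p n → δ i v ℤ.+ (p ℤ.⊖ n) ≡ (up i v + p) ℤ.⊖ (dn i v + n)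
δ-⊖ i v p n with v ≡ᵇ suc i in e
... | true rewrite ≡ᵇ⇒≡ v (suc i) (subst T (sym e) tt) | ≡ᵇ-false {suc i} {i} 1+n≢n = ℤₚ.distribʳ-⊖-+-pos 1 p n
... | false with v ≡ᵇ i
...   | true  = ℤₚ.distribʳ-⊖-+-neg 0 p n
...   | false = ℤₚ.+-identityˡ _

sufs : ℕ → List Box → List (ℤ × ℕ × ℕ)
sufs i []       = []
sufs i (x ∷ xs) = (value i (x ∷ xs) , proj₂ x) ∷ sufs i xs

suffixM-value : ∀ i xs → suffixM i (map (uncurry (λ v _ → v)) xs) ≡ map (uncurry (λ m _ → m)) (sufs i xs)
suffixM-value i [] = refl
suffixM-value i ((v , p) ∷ []) = cong (_∷ []) (trans (sym (ℤₚ.+-identityʳ (δ i v))) (δ-⊖ i v 0 0))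
suffixM-value i ((v , p) ∷ x ∷ xs) rewrite suffixM-value i (x ∷ xs) = cong (_∷ _) (δ-⊖ i v (tot (up i) (x ∷ xs)) (tot (dn i) (x ∷ xs)))

zip-sufs : ∀ i xs → zipL (suffixM i (map (uncurry (λ v _ → v)) xs)) (map (uncurry (λ _ p → p)) xs) ≡ sufs i xs
zip-sufs i xs rewrite suffixM-value i xs = go xs
  where
  go : ∀ xs → zipL (map (uncurry (λ m _ → m)) (sufs i xs)) (map (uncurry (λ _ p → p)) xs) ≡ sufs i xs
  go []       = refl
  go (x ∷ xs) = cong ((value i (x ∷ xs) , proj₂ x) ∷_) (go xs)

⊖-≤ : ∀ p n p' n' → p + n' ≤ p' + n → (p ℤ.⊖ n) ℤ.≤ (p' ℤ.⊖ n')
⊖-≤ p n p' n' l = subst₂ ℤ._≤_ (trans (cong₂ ℤ._⊖_ (+-comm p n') (+-comm n n')) (ℤₚ.+-cancelˡ-⊖ n' p n)) (trans (cong (ℤ._⊖ (n + n')) (+-comm p' n)) (ℤₚ.+-cancelˡ-⊖ n p' n')) (ℤₚ.⊖-monoˡ-≤ (n + n') l)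

⊖-< : ∀ p n p' n' → p + n' < p' + n → (p ℤ.⊖ n) ℤ.< (p' ℤ.⊖ n')
⊖-< p n p' n' l = subst₂ ℤ._<_ (trans (cong₂ ℤ._⊖_ (+-comm p n') (+-comm n n')) (ℤₚ.+-cancelˡ-⊖ n' p n)) (trans (cong (ℤ._⊖ (n + n')) (+-comm p' n)) (ℤₚ.+-cancelˡ-⊖ n p' n')) (ℤₚ.⊖-monoˡ-< (n + n') l)

ℤ≤ᵇ-true : ∀ {m n} → m ℤ.≤ n → (m ℤ.≤ᵇ n) ≡ true
ℤ≤ᵇ-true l = T⇒≡ (ℤₚ.≤⇒≤ᵇ l)

ℤ≤ᵇ-false : ∀ {m n} → n ℤ.< m → (m ℤ.≤ᵇ n) ≡ false
ℤ≤ᵇ-false l = ¬T⇒≡ λ t → ℤₚ.<⇒≱ l (ℤₚ.≤ᵇ⇒≤ t)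

pickMax-stay : ∀ M p l → All (λ y → proj₁ y ℤ.< M) l → pickMax ((M , p) ∷ l) ≡ just (M , p)
pickMax-stay M p []             []       = refl
pickMax-stay M p ((m , q) ∷ l) (h ∷ hs) rewrite ℤ≤ᵇ-false h = pickMax-stay M p l hs

pickMax-reach : ∀ M p x l₁ l₂ → proj₁ x ℤ.≤ M → All (λ y → proj₁ y ℤ.≤ M) l₁ → All (λ y → proj₁ y ℤ.< M) l₂ → pickMax (x ∷ l₁ ++ (M , p) ∷ l₂) ≡ just (M , p)
pickMax-reach M p x []             l₂ h []       k rewrite ℤ≤ᵇ-true h = pickMax-stay M p l₂ k
pickMax-reach M p x ((m , q) ∷ l₁) l₂ h (g ∷ gs) k with proj₁ x ℤ.≤ᵇ m
... | true  = pickMax-reach M p (m , q) l₁ l₂ g gs k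
... | false = pickMax-reach M p x l₁ l₂ h gs k

pickMax-spec : ∀ M p l₁ l₂ → All (λ y → proj₁ y ℤ.≤ M) l₁ → All (λ y → proj₁ y ℤ.< M) l₂ → pickMax (l₁ ++ (M , p) ∷ l₂) ≡ just (M , p)
pickMax-spec M p []       l₂ []       k = pickMax-stay M p l₂ k
pickMax-spec M p (x ∷ l₁) l₂ (h ∷ hs) k = pickMax-reach M p x l₁ l₂ h hs k

sufs-++ : ∀ i xs ys → ∃ λ l → sufs i (xs ++ ys) ≡ l ++ sufs i ys
sufs-++ i []       ys = [] , refl
sufs-++ i (x ∷ xs) ys with sufs-++ i xs ys
... | l , e = (value i (x ∷ xs ++ ys) , proj₂ x) ∷ l , cong ((value i (x ∷ xs ++ ys) , proj₂ x) ∷_) e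

-- With `changedEntry`, a named copy of the local functions of `eKey`.
changes : ℕ → Tab → ℕ → ℕ → ℕ → Bool
changes i t R C c = (C ≤ᵇ c) ∧ (entry t R c ≡ᵇ suc i) ∧ (c ≤ᵇ length (at [] t (R ∸ 1)))

changedEntry : ℕ → Tab → ℕ → ℕ → ℕ → ℕ → ℕ
changedEntry i t R C ρ c = if (ρ ≡ᵇ R) ∧ changes i t R C c then i
  else (if not (ρ ≡ᵇ R) ∧ changes i t R C c ∧ (entry t ρ c ≡ᵇ i) then suc i else entry t ρ c)

-- Matching on etaMap replaces the projections under map in eKey, which are
-- anonymous pattern-matching functions, by uncurried ones that can be named.
data EtaMap {A A' B : Set} : ((A × A' → B) → List (A × A') → List B) → Set where
  eta : EtaMap (λ f xs → map (uncurry (λ x y → f (x , y))) xs)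

etaMap : ∀ {A A' B : Set} → EtaMap {A} {A'} {B} map
etaMap = eta

eKey-just : ∀ i t {M R C} → pickMax (zipL (suffixM i (map (uncurry (λ v _ → v)) (colWord t))) (map (uncurry (λ _ p → p)) (colWord t))) ≡ just (M , R , C) →
  (M ℤ.≤ᵇ ℤ.+ 0) ≡ false → eKey i t ≡ just (fillRows (changedEntry i t R C) t)
eKey-just i t e f with map {A = ℕ × ℕ × ℕ} {B = ℕ} | etaMap {ℕ} {ℕ × ℕ} {ℕ} | map {A = ℕ × ℕ × ℕ} {B = ℕ × ℕ} | etaMap {ℕ} {ℕ × ℕ} {ℕ × ℕ}
... | _ | eta | _ | eta rewrite e | f = refl

-- The part of a column from row `ρ` downwards: every nonempty suffix of the column word has the
-- form `cb t ρ j ++ cols t j`.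
cb : Tab → ℕ → ℕ → List Box
cb t zero    j = []
cb t (suc ρ) j = (if suc j ≤ᵇ length (at [] t ρ) then (entry t (suc ρ) (suc j) , suc ρ , suc j) ∷ [] else []) ++ cb t ρ j

cb-box : ∀ t ρ j → j < length (at [] t ρ) → cb t (suc ρ) j ≡ (entry t (suc ρ) (suc j) , suc ρ , suc j) ∷ cb t ρ j
cb-box t ρ j l rewrite ≤ᵇ-true l = refl

cols : Tab → ℕ → List Box
cols t zero    = []
cols t (suc j) = cb t (length t) j ++ cols t j

colWord-cols : ∀ t → colWord t ≡ cols t (maxRowLen t)
colWord-cols t = go (maxRowLen t)
  where
  column : ∀ m j → concatMap (λ ρ → if suc j ≤ᵇ length (at [] t (ρ ∸ 1)) then (entry t ρ (suc j) , ρ , suc j) ∷ [] else []) (map suc (downFrom m)) ≡ cb t m j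
  column zero    j = refl
  column (suc m) j = cong ((if suc j ≤ᵇ length (at [] t m) then (entry t (suc m) (suc j) , suc m , suc j) ∷ [] else []) ++_) (column m j)
  go : ∀ m → concatMap (λ c → concatMap (λ ρ → if c ≤ᵇ length (at [] t (ρ ∸ 1)) then (entry t ρ c , ρ , c) ∷ [] else []) (map suc (downFrom (length t)))) (map suc (downFrom m)) ≡ cols t m
  go zero    = refl
  go (suc m) = cong₂ _++_ (column (length t) m) (go m)

cols-split : ∀ t {j m} → j ≤ m → ∃ λ xs → cols t m ≡ xs ++ cols t j
cols-split t {j} {m} l with m≤n⇒∃[o]m+o≡n l
... | k , refl = go k
  where
  go : ∀ k → ∃ λ xs → cols t (j + k) ≡ xs ++ cols t j
  go zero rewrite +-identityʳ j = [] , refl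
  go (suc k) rewrite +-suc j k with go k
  ... | xs , e = cb t (length t) (j + k) ++ xs , trans (cong (cb t (length t) (j + k) ++_) e) (sym (++-assoc (cb t (length t) (j + k)) xs _))

cb-split : ∀ t j {ρ m} → ρ ≤ m → ∃ λ xs → cb t m j ≡ xs ++ cb t ρ j
cb-split t j {ρ} {m} l with m≤n⇒∃[o]m+o≡n l
... | k , refl = go k
  where
  go : ∀ k → ∃ λ xs → cb t (ρ + k) j ≡ xs ++ cb t ρ j
  go zero rewrite +-identityʳ ρ = [] , refl
  go (suc k) rewrite +-suc ρ k with go k
  ... | xs , e = _ , trans (cong ((if suc j ≤ᵇ length (at [] t (ρ + k)) then (entry t (suc (ρ + k)) (suc j) , suc (ρ + k) , suc j) ∷ [] else []) ++_) e) (sym (++-assoc (if suc j ≤ᵇ length (at [] t (ρ + k)) then _ else []) xs _))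

sufs-cb : ∀ {P : ℤ → Set} i t ρ j rest → (∀ σ → σ ≤ ρ → P (value i (cb t σ j ++ rest))) → All (λ y → P (proj₁ y)) (sufs i rest) → All (λ y → P (proj₁ y)) (sufs i (cb t ρ j ++ rest))
sufs-cb i t zero    j rest h k = k
sufs-cb i t (suc ρ) j rest h k with suc j ≤ᵇ length (at [] t ρ) | h (suc ρ) ≤-refl
... | true  | v = v ∷ sufs-cb i t ρ j rest (λ σ l → h σ (m≤n⇒m≤1+n l)) k
... | false | _ = sufs-cb i t ρ j rest (λ σ l → h σ (m≤n⇒m≤1+n l)) k

sufs-cols : ∀ {P : ℤ → Set} i t m → (∀ j → j < m → ∀ ρ → ρ ≤ length t → P (value i (cb t ρ j ++ cols t j))) → All (λ y → P (proj₁ y)) (sufs i (cols t m))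
sufs-cols i t zero    h = []
sufs-cols i t (suc m) h = sufs-cb i t (length t) m (cols t m) (h m (n<1+n m)) (sufs-cols i t m (λ j l → h j (m≤n⇒m≤1+n l)))

applyUpTo-cong : ∀ {A : Set} {f g : ℕ → A} n → (∀ i → i < n → f i ≡ g i) → applyUpTo f n ≡ applyUpTo g n
applyUpTo-cong zero    e = refl
applyUpTo-cong (suc n) e = cong₂ _∷_ (e 0 (s≤s z≤n)) (applyUpTo-cong n (λ i l → e (suc i) (s≤s l)))

length-applyUpTo : ∀ {A : Set} (f : ℕ → A) n → length (applyUpTo f n) ≡ n
length-applyUpTo f zero    = refl
length-applyUpTo f (suc n) = cong suc (length-applyUpTo (f ∘ suc) n)

at-applyUpTo-< : ∀ {A : Set} (d : A) (f : ℕ → A) {n j} → j < n → at d (applyUpTo f n) j ≡ f j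
at-applyUpTo-< d f {suc n} {zero}  l       = refl
at-applyUpTo-< d f {suc n} {suc j} (s≤s l) = at-applyUpTo-< d (f ∘ suc) l

at-beyond : ∀ {A : Set} (d : A) xs {j} → length xs ≤ j → at d xs j ≡ d
at-beyond d []       l = refl
at-beyond d (x ∷ xs) {suc j} (s≤s l) = at-beyond d xs l

at-pos : ∀ (t : Tab) k {j} → j < length (at [] t k) → k < length t
at-pos t k {j} l = ≰⇒> λ h → <⇒≱ l (≤-trans (≤-reflexive (cong length (at-beyond [] t h))) z≤n)

fillRows-applyUpTo : ∀ g t → fillRows g t ≡ applyUpTo (λ k → applyUpTo (λ c → g (suc k) (suc c)) (length (at [] t k))) (length t)
fillRows-applyUpTo g t = trans (map-applyUpTo _ id (length t)) (applyUpTo-cong (length t) (λ k _ → map-applyUpTo (λ c → g (suc k) (suc c)) id (length (at [] t k))))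

at-fillRows : ∀ g t k → at [] (fillRows g t) k ≡ applyUpTo (λ c → g (suc k) (suc c)) (length (at [] t k))
at-fillRows g t k = trans (cong (λ l → at [] l k) (fillRows-applyUpTo g t)) (at-applyUpTo [] _ (length t) k (λ i l → cong (applyUpTo _) (cong length (at-beyond [] t l))))

length-fillRows : ∀ g t → length (fillRows g t) ≡ length t
length-fillRows g t = trans (cong length (fillRows-applyUpTo g t)) (length-applyUpTo _ (length t))

row-fillRows : ∀ g t k → length (at [] (fillRows g t) k) ≡ length (at [] t k)
row-fillRows g t k = trans (cong length (at-fillRows g t k)) (length-applyUpTo _ (length (at [] t k)))

entry-fillRows : ∀ g t k {j} → j < length (at [] t k) → entry (fillRows g t) (suc k) (suc j) ≡ g (suc k) (suc j)
entry-fillRows g t k {j} l = trans (cong (λ r → at 0 r j) (at-fillRows g t k)) (at-applyUpTo-< 0 (λ c → g (suc k) (suc c)) l)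

fillRows-cong : ∀ {g g' : ℕ → ℕ → ℕ} t t' → length t ≡ length t' → (∀ k → length (at [] t k) ≡ length (at [] t' k)) → (∀ k j → j < length (at [] t' k) → g (suc k) (suc j) ≡ g' (suc k) (suc j)) → fillRows g t ≡ fillRows g' t'
fillRows-cong {g} {g'} t t' e es h = trans (fillRows-applyUpTo g t) (trans (trans (cong (applyUpTo _) e) (applyUpTo-cong (length t') (λ k _ → trans (cong (applyUpTo _) (es k)) (applyUpTo-cong (length (at [] t' k)) (λ j l → h k j l)))))
  (sym (fillRows-applyUpTo g' t')))

maxRowLen-≥ : ∀ t k → length (at [] t k) ≤ maxRowLen t
maxRowLen-≥ []      k       = z≤n
maxRowLen-≥ (r ∷ t) zero    = m≤m⊔n (length r) _
maxRowLen-≥ (r ∷ t) (suc k) = ≤-trans (maxRowLen-≥ t k) (m≤n⊔m (length r) _)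

-- The entries with weight 1 form the strip between the keys x and y.
module Count (t : Tab) (g : ℕ → ℕ) {x y hX hY : ℕ → ℕ} (XY : Strip x y hX hY) (y0 : y 0 ≡ 0) (y≤ : ∀ k → y (suc k) ≤ length (at [] t k))
             (g1 : ∀ k j → x (suc k) ≤ j → j < y (suc k) → g (entry t (suc k) (suc j)) ≡ 1)
             (g0 : ∀ k j → j < length (at [] t k) → ¬ ((x (suc k) ≤ j) × (j < y (suc k))) → g (entry t (suc k) (suc j)) ≡ 0) where

  zero-cb : ∀ ρ j → (∀ k → k < ρ → ¬ ((x (suc k) ≤ j) × (j < y (suc k)))) → tot g (cb t ρ j) ≡ 0
  zero-cb zero    j h = refl
  zero-cb (suc ρ) j h with suc j ≤ᵇ length (at [] t ρ) in e
  ... | true  = cong₂ _+_ (g0 ρ j (≤ᵇ⇒≤ (suc j) _ (subst T (sym e) tt)) (h ρ (n<1+n ρ))) (zero-cb ρ j (λ k l → h k (m≤n⇒m≤1+n l)))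
  ... | false = zero-cb ρ j (λ k l → h k (m≤n⇒m≤1+n l))

  one-cb : ∀ ρ j k₀ → k₀ < ρ → x (suc k₀) ≤ j → j < y (suc k₀) → tot g (cb t ρ j) ≡ 1
  one-cb (suc ρ) j k₀ l p q with m≤n⇒m<n∨m≡n (≤-pred l)
  ... | inj₂ refl rewrite ≤ᵇ-true {suc j} (≤-trans q (y≤ k₀)) = cong₂ _+_ (g1 k₀ j p q) (zero-cb k₀ j (λ k l' (p' , q') → <⇒≢ l' (suc-injective (Strip.single XY p' q' p q))))
  ... | inj₁ l' with suc j ≤ᵇ length (at [] t ρ) in e
  ...   | true  = cong₂ _+_ (g0 ρ j (≤ᵇ⇒≤ (suc j) _ (subst T (sym e) tt)) (λ (p' , q') → >⇒≢ l' (suc-injective (Strip.single XY p' q' p q)))) (one-cb ρ j k₀ l' p q)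
  ...   | false = one-cb ρ j k₀ l' p q

  Column : ℕ → Set
  Column j = ((∀ ρ → tot g (cb t ρ j) ≡ 0) × (tot g (cols t (suc j)) ≡ tot g (cols t j)) × (hY j ≡ hX j) × (∀ k → j < y k → j < x k)) ⊎
    (∃ λ k → (x k ≤ j) × (j < y k) × (∀ ρ → ρ < k → tot g (cb t ρ j) ≡ 0) × (∀ ρ → k ≤ ρ → tot g (cb t ρ j) ≡ 1) × (tot g (cols t (suc j)) ≡ suc (tot g (cols t j))) × (hY j ≡ suc (hX j)))

  column : ∀ j → Column j
  column j with Strip.col XY j
  ... | inj₁ (e , f) = inj₁ (zeros , trans (tot-++ g (cb t (length t) j) (cols t j)) (cong (_+ tot g (cols t j)) (zeros (length t))) , e , f)
    where
    zeros : ∀ ρ → tot g (cb t ρ j) ≡ 0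
    zeros ρ = zero-cb ρ j (λ k _ (p , q) → <⇒≱ (f (suc k) q) p)
  ... | inj₂ (e , zero , p , q) = ⊥-elim (<⇒≱ q (≤-trans (≤-reflexive y0) z≤n))
  ... | inj₂ (e , suc k , p , q) = inj₂ (suc k , p , q , (λ ρ l → zero-cb ρ j (λ k' l' (p' , q') → <⇒≢ (<-≤-trans l' (≤-pred l)) (suc-injective (Strip.single XY p' q' p q)))) , (λ ρ l → one-cb ρ j k l p q) ,
      trans (tot-++ g (cb t (length t) j) (cols t j)) (cong (_+ tot g (cols t j)) (one-cb (length t) j k (at-pos t k (<-≤-trans q (y≤ k))) p q)) , e)

  total : ∀ m → Sum m hX + tot g (cols t m) ≡ Sum m hY
  total zero = refl
  total (suc m) with column m
  ... | inj₁ (_ , e , h , _) = trans (cong (Sum m hX + hX m +_) e) (trans (+-assoc (Sum m hX) _ _) (trans (cong (Sum m hX +_) (+-comm (hX m) _)) (trans (sym (+-assoc (Sum m hX) _ _)) (cong₂ _+_ (total m) (sym h)))))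
  ... | inj₂ (_ , _ , _ , _ , _ , e , h) = trans (cong (Sum m hX + hX m +_) e) (trans (+-suc (Sum m hX + hX m) _) (trans (cong suc (trans (+-assoc (Sum m hX) _ _) (trans (cong (Sum m hX +_) (+-comm (hX m) _)) (sym (+-assoc (Sum m hX) _ _))))) (trans (sym (+-suc _ (hX m))) (cong₂ _+_ (total m) (sym h)))))

module Eval (t₀ : Tab) (E E' : ℕ → ℕ → ℕ) (i : ℕ) {a b b' c hA hB hB' hC : ℕ → ℕ} {c₀ : ℕ}
  (AB : Strip a b hA hB) (BC : Strip b c hB hC) (AB' : Strip a b' hA hB') (BC' : Strip b' c hB' hC) (hB≡ : ∀ j → hB j ≡ hB' j + ι c₀ j)
  (N : ℕ) (empty : ∀ k → c k ≤ N) (pk : PeakAt hA hB hC (suc c₀)) (c0 : c 0 ≡ 0) (c≤ : ∀ k → c (suc k) ≤ length (at [] t₀ k))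
  (E-up : ∀ k j → a (suc k) ≤ j → j < b (suc k) → E (suc k) (suc j) ≡ suc i)
  (E-dn : ∀ k j → b (suc k) ≤ j → j < c (suc k) → E (suc k) (suc j) ≡ i)
  (E-up⁻ : ∀ k j → j < length (at [] t₀ k) → E (suc k) (suc j) ≡ suc i → (a (suc k) ≤ j) × (j < b (suc k)))
  (E-dn⁻ : ∀ k j → j < length (at [] t₀ k) → E (suc k) (suc j) ≡ i → (b (suc k) ≤ j) × (j < c (suc k)))
  (E'-up : ∀ k j → a (suc k) ≤ j → j < b' (suc k) → E' (suc k) (suc j) ≡ suc i)
  (E'-dn : ∀ k j → b' (suc k) ≤ j → j < c (suc k) → E' (suc k) (suc j) ≡ i)
  (E'-a : ∀ k j → j < a (suc k) → E' (suc k) (suc j) ≡ E (suc k) (suc j))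
  (E'-c : ∀ k j → j < length (at [] t₀ k) → c (suc k) ≤ j → E' (suc k) (suc j) ≡ E (suc k) (suc j)) where

  open Raising {c₀ = c₀} AB BC AB' BC' hB≡ N empty

  Q : Tab
  Q = fillRows E t₀

  lenQ : ∀ k → length (at [] Q k) ≡ length (at [] t₀ k)
  lenQ = row-fillRows E t₀

  entryQ : ∀ k {j} → j < length (at [] t₀ k) → entry Q (suc k) (suc j) ≡ E (suc k) (suc j)
  entryQ k l = entry-fillRows E t₀ k l

  inRow : ∀ k {j} → j < length (at [] Q k) → j < length (at [] t₀ k)
  inRow k {j} = subst (j <_) (lenQ k)

  b≤len : ∀ k → b (suc k) ≤ length (at [] t₀ k)
  b≤len k = ≤-trans (BC.le (suc k)) (c≤ k)

  module U = Count Q (up i) AB (n≤0⇒n≡0 (≤-trans (BC.le 0) (≤-reflexive c0))) (λ k → ≤-trans (b≤len k) (≤-reflexive (sym (lenQ k))))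
    (λ k j p q → up-1 (trans (entryQ k (<-≤-trans q (b≤len k))) (E-up k j p q)))
    (λ k j l n → up-0 (λ e → n (E-up⁻ k j (inRow k l) (trans (sym (entryQ k (inRow k l))) e))))

  module D = Count Q (dn i) BC c0 (λ k → ≤-trans (c≤ k) (≤-reflexive (sym (lenQ k))))
    (λ k j p q → dn-1 (trans (entryQ k (<-≤-trans q (c≤ k))) (E-dn k j p q)))
    (λ k j l n → dn-0 (λ e → n (E-dn⁻ k j (inRow k l) (trans (sym (entryQ k (inRow k l))) e))))

  m₀ : ℕ
  m₀ = suc c₀

  P M : ℕ → ℕ
  P j = tot (up i) (cols Q j)
  M j = tot (dn i) (cols Q j)

  peak-compare : ∀ k m → k + (Sum m hB + Sum m hB + (Sum m₀ hA + Sum m₀ hC)) ≤ Sum m₀ hB + Sum m₀ hB + (Sum m hA + Sum m hC) → k + (P m + M m₀) ≤ P m₀ + M m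
  peak-compare k m h = lin (k ∷ P m ∷ M m ∷ P m₀ ∷ M m₀ ∷ Sum m hA ∷ Sum m hB ∷ Sum m hC ∷ Sum m₀ hA ∷ Sum m₀ hB ∷ Sum m₀ hC ∷ [])
    ((# 0 ⊕ (# 6 ⊕ # 6 ⊕ (# 8 ⊕ # 10)) ≼ # 9 ⊕ # 9 ⊕ (# 5 ⊕ # 7) by h) ∷ (# 5 ⊕ # 1 ≼ # 6 by ≤-reflexive (U.total m)) ∷ (# 7 ≼ # 6 ⊕ # 2 by ≤-reflexive (sym (D.total m))) ∷
     (# 9 ≼ # 8 ⊕ # 3 by ≤-reflexive (sym (U.total m₀))) ∷ (# 9 ⊕ # 4 ≼ # 10 by ≤-reflexive (D.total m₀)) ∷ []) (# 0 ⊕ (# 1 ⊕ # 4)) (# 3 ⊕ # 2)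

  P≤ : ∀ m → P m + M m₀ ≤ P m₀ + M m
  P≤ m = peak-compare 0 m (PeakAt.peak≤ pk m)

  P< : ∀ m → m < m₀ → P m + M m₀ < P m₀ + M m
  P< m l = peak-compare 1 m (PeakAt.peak< pk m l)

  P-suc : ∀ {j k} → a k ≤ j → j < b k → P (suc j) ≡ suc (P j)
  P-suc {j} {k} p q with U.column j
  ... | inj₁ (_ , _ , _ , f) = ⊥-elim (<⇒≱ (f k q) p)
  ... | inj₂ (_ , _ , _ , _ , _ , e , _) = e

  M-suc : ∀ {j k} → b k ≤ j → j < c k → M (suc j) ≡ suc (M j)
  M-suc {j} {k} p q with D.column j
  ... | inj₁ (_ , _ , _ , f) = ⊥-elim (<⇒≱ (f k q) p)
  ... | inj₂ (_ , _ , _ , _ , _ , e , _) = e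

  M-same : ∀ {j} → (∀ k → j < c k → j < b k) → M (suc j) ≡ M j
  M-same {j} f with D.column j
  ... | inj₁ (_ , e , _) = e
  ... | inj₂ (k , p , q , _) = ⊥-elim (<⇒≱ (f k q) p)

  -- Every column of the stretch holds one `i+1` and one `i`, so the potential does not change.
  level : ∀ n {j k} → a k ≤ j → j + n ≤ b k → (∀ m → m < n → ∃ λ l → (b l ≤ j + m) × (j + m < c l)) → P (j + n) + M j ≡ P j + M (j + n)
  level zero    {j} p q h rewrite +-identityʳ j = refl
  level (suc n) {j} {k} p q h with h n (n<1+n n)
  ... | l , bl , cl = trans (cong (λ x → P x + M j) (+-suc j n)) (trans (cong (_+ M j) (P-suc (≤-trans p (m≤m+n j n)) q'))
      (trans (cong suc (level n p (≤-trans (n≤1+n (j + n)) q') (λ m l → h m (m≤n⇒m≤1+n l)))) (trans (sym (+-suc (P j) _)) (cong (P j +_) (trans (sym (M-suc bl cl)) (cong M (sym (+-suc j n))))))))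
    where
    q' : j + n < b k
    q' = ≤-trans (≤-reflexive (sym (+-suc j n))) q

  -- A box i+1 below the box i of its column: the potential reached there is
  -- reached again at the end t of the run.
  jump : ∀ {j k l} → a k ≤ j → j < b k → b l ≤ j → j < c l → k < l →
    ∃ λ t → (j < t) × (t < b k) × (∀ l → t < c l → t < b l) × (∀ m → j ≤ m → m < t → ∃ λ l → (b l ≤ m) × (m < c l) × (k < l)) × (suc (P j) + M (suc t) ≡ P (suc t) + M j)
  jump {j} {k} {l} p q bl cl kl with run-right p q bl cl kl
  ... | n , x , y , z = suc j + n , s≤s (m≤m+n j n) , x , y , cover , eq
    where
    cover : ∀ m → j ≤ m → m < suc j + n → ∃ λ l → (b l ≤ m) × (m < c l) × (k < l)
    cover m h h' with m≤n⇒m<n∨m≡n h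
    ... | inj₂ refl = l , bl , cl , kl
    ... | inj₁ h″ with m≤n⇒∃[o]m+o≡n h″
    ...   | o , refl = z o (+-cancelˡ-< (suc j) o n h')
    eq : suc (P j) + M (suc (suc j + n)) ≡ P (suc (suc j + n)) + M j
    eq = trans (cong (suc (P j) +_) (trans (M-same y) (cong M (sym (+-suc j n))))) (trans (cong suc (sym (level (suc n) p (≤-trans (≤-reflexive (+-suc j n)) (<⇒≤ x)) (λ m h → let (l , u , v , _) = cover (j + m) (m≤m+n j m) (≤-trans (+-monoʳ-< j h) (≤-reflexive (+-suc j n))) in l , u , v))))
      (cong (_+ M j) (trans (cong (suc ∘ P) (+-suc j n)) (sym (P-suc (≤-trans p (≤-trans (n≤1+n j) (m≤m+n (suc j) n))) x)))))

  u d : ℕ → ℕ → ℕ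
  u ρ j = tot (up i) (cb Q ρ j)
  d ρ j = tot (dn i) (cb Q ρ j)

  -- The suffix starting inside column `j` is compared with a union of full columns: those before
  -- `j` (`low`), those up to `j` if the column has no `i` (`step`), or those up to the end of a run
  -- if its `i` lies above its `i+1` (`run`).
  data Position (ρ j : ℕ) : Set where
    low  : u ρ j ≤ d ρ j → Position ρ j
    step : ∀ k → a k ≤ j → j < b k → k ≤ ρ → u ρ j ≡ 1 → (∀ l → j < c l → j < b l) → Position ρ j
    run  : ∀ k l → a k ≤ j → j < b k → k ≤ ρ → u ρ j ≡ 1 → b l ≤ j → j < c l → k < l → Position ρ j

  position : ∀ ρ j → Position ρ j
  position ρ j with U.column j
  ... | inj₁ (z , _) = low (≤-trans (≤-reflexive (z ρ)) z≤n)
  ... | inj₂ (k , p , q , z , o , _) with k ≤? ρ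
  ...   | no n = low (≤-trans (≤-reflexive (z ρ (≰⇒> n))) z≤n)
  ...   | yes kρ with D.column j
  ...     | inj₁ (_ , _ , _ , f) = step k p q kρ (o ρ kρ) f
  ...     | inj₂ (l , bl , cl , z' , o' , _) with l ≤? ρ
  ...       | yes lρ = low (≤-reflexive (trans (o ρ kρ) (sym (o' ρ lρ))))
  ...       | no n = run k l p q kρ (o ρ kρ) bl cl (≤-<-trans kρ (≰⇒> n))

  bound-≤ : ∀ ρ j → (u ρ j + P j) + M m₀ ≤ P m₀ + (d ρ j + M j)
  bound-≤ ρ j with position ρ j
  ... | low l = lin (u ρ j ∷ P j ∷ M m₀ ∷ P m₀ ∷ d ρ j ∷ M j ∷ []) ((# 1 ⊕ # 2 ≼ # 3 ⊕ # 5 by P≤ j) ∷ (# 0 ≼ # 4 by l) ∷ []) ((# 0 ⊕ # 1) ⊕ # 2) (# 3 ⊕ (# 4 ⊕ # 5))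
  ... | step k p q _ e f = lin (u ρ j ∷ P j ∷ M m₀ ∷ P m₀ ∷ d ρ j ∷ M j ∷ P (suc j) ∷ M (suc j) ∷ [])
      ((# 6 ⊕ # 2 ≼ # 3 ⊕ # 7 by P≤ (suc j)) ∷ (# 0 ≼ ! 1 by ≤-reflexive e) ∷ (! 1 ⊕ # 1 ≼ # 6 by ≤-reflexive (sym (P-suc p q))) ∷ (# 7 ≼ # 5 by ≤-reflexive (M-same f)) ∷ []) ((# 0 ⊕ # 1) ⊕ # 2) (# 3 ⊕ (# 4 ⊕ # 5))
  ... | run k l p q _ e bl cl kl with jump p q bl cl kl
  ...   | t , _ , _ , _ , _ , eq = lin (u ρ j ∷ P j ∷ M m₀ ∷ P m₀ ∷ d ρ j ∷ M j ∷ P (suc t) ∷ M (suc t) ∷ [])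
      ((# 6 ⊕ # 2 ≼ # 3 ⊕ # 7 by P≤ (suc t)) ∷ (# 0 ≼ ! 1 by ≤-reflexive e) ∷ (! 1 ⊕ # 1 ⊕ # 7 ≼ # 6 ⊕ # 5 by ≤-reflexive eq) ∷ []) ((# 0 ⊕ # 1) ⊕ # 2) (# 3 ⊕ (# 4 ⊕ # 5))

  R-box : ∀ {k} → a k ≤ c₀ → c₀ < b k → k ≡ R
  R-box p q = AB.single p q (≤-trans aR C₁≤c₀) (≤-reflexive (sym bR))

  -- A run in row `R` starting left of `C₁` would need an entry `i` above `R` in the column just
  -- before `C₁`, but `left-of` puts it below.
  not-earlier : ∀ {ρ j} → (j < C₁) ⊎ ((j ≡ C₁) × (ρ < R)) → R ≤ ρ → (∀ m → j ≤ m → m < c₀ → ∃ λ l → (b l ≤ m) × (m < c l) × (R < l)) → ⊥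
  not-earlier (inj₂ (_ , l)) h _ = <⇒≱ l h
  not-earlier {ρ} {j} (inj₁ l) h cover = go C₁ refl l
    where
    go : ∀ C → C₁ ≡ C → j < C → ⊥
    go (suc m) e (s≤s jm) with cover m jm (≤-trans (≤-reflexive (sym e)) C₁≤c₀)
    ... | l , bl , cl , Rl with L⇒L' (<⇒≢ (≤-trans (≤-reflexive (sym e)) C₁≤c₀)) bl cl
    ...   | k* , p* , q* with left-of e bl cl p* q*
    ...     | refl , lt = <-asym Rl lt

  -- For suffixes shorter than the one starting at row `R` of column `C₁`, the columns compared with
  -- end before `m₀`, where the peak is strict. This is why `eKey` selects that box.
  bound-< : ∀ ρ j → (j < C₁) ⊎ ((j ≡ C₁) × (ρ < R)) → (u ρ j + P j) + M m₀ < P m₀ + (d ρ j + M j)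
  bound-< ρ j side with position ρ j
  ... | low l = lin (u ρ j ∷ P j ∷ M m₀ ∷ P m₀ ∷ d ρ j ∷ M j ∷ []) ((! 1 ⊕ (# 1 ⊕ # 2) ≼ # 3 ⊕ # 5 by P< j (s≤s j≤c₀)) ∷ (# 0 ≼ # 4 by l) ∷ []) (! 1 ⊕ ((# 0 ⊕ # 1) ⊕ # 2)) (# 3 ⊕ (# 4 ⊕ # 5))
    where
    j≤c₀ : j ≤ c₀
    j≤c₀ = case side of λ { (inj₁ l) → ≤-trans (<⇒≤ l) C₁≤c₀ ; (inj₂ (e , _)) → ≤-trans (≤-reflexive e) C₁≤c₀ }
  ... | step k p q kρ e f = lin (u ρ j ∷ P j ∷ M m₀ ∷ P m₀ ∷ d ρ j ∷ M j ∷ P (suc j) ∷ M (suc j) ∷ [])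
      ((! 1 ⊕ (# 6 ⊕ # 2) ≼ # 3 ⊕ # 7 by P< (suc j) (s≤s j<c₀)) ∷ (# 0 ≼ ! 1 by ≤-reflexive e) ∷ (! 1 ⊕ # 1 ≼ # 6 by ≤-reflexive (sym (P-suc p q))) ∷ (# 7 ≼ # 5 by ≤-reflexive (M-same f)) ∷ []) (! 1 ⊕ ((# 0 ⊕ # 1) ⊕ # 2)) (# 3 ⊕ (# 4 ⊕ # 5))
    where
    j<c₀ : j < c₀
    j<c₀ = ≤∧≢⇒< (case side of λ { (inj₁ l) → ≤-trans (<⇒≤ l) C₁≤c₀ ; (inj₂ (e , _)) → ≤-trans (≤-reflexive e) C₁≤c₀ })
      λ eq → case side of λ { (inj₁ l) → <⇒≱ l (≤-trans C₁≤c₀ (≤-reflexive (sym eq)))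
                            ; (inj₂ (_ , l)) → <⇒≱ l (subst (_≤ ρ) (R-box (subst (a k ≤_) eq p) (subst (_< b k) eq q)) kρ) }
  ... | run k l p q kρ e bl cl kl with jump p q bl cl kl
  ...   | t , jt , tb , noL , cover , eq = lin (u ρ j ∷ P j ∷ M m₀ ∷ P m₀ ∷ d ρ j ∷ M j ∷ P (suc t) ∷ M (suc t) ∷ [])
      ((! 1 ⊕ (# 6 ⊕ # 2) ≼ # 3 ⊕ # 7 by P< (suc t) (s≤s t<c₀)) ∷ (# 0 ≼ ! 1 by ≤-reflexive e) ∷ (! 1 ⊕ # 1 ⊕ # 7 ≼ # 6 ⊕ # 5 by ≤-reflexive eq) ∷ []) (! 1 ⊕ ((# 0 ⊕ # 1) ⊕ # 2)) (# 3 ⊕ (# 4 ⊕ # 5))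
    where
    j≤c₀ : j ≤ c₀
    j≤c₀ = case side of λ { (inj₁ l) → ≤-trans (<⇒≤ l) C₁≤c₀ ; (inj₂ (e , _)) → ≤-trans (≤-reflexive e) C₁≤c₀ }
    t<c₀ : t < c₀
    t<c₀ with <-cmp t c₀
    ... | tri< l _ _ = l
    ... | tri> _ _ l with cover c₀ j≤c₀ l
    ...   | l' , x , y , _ = ⊥-elim (<⇒≱ (proj₂ c₀∉L l' y) x)
    t<c₀ | tri≈ _ refl _ with R-box (≤-trans p (<⇒≤ jt)) tb
    ...   | refl = ⊥-elim (not-earlier side kρ cover)

  c₁<bR : C₁ < b R
  c₁<bR = ≤-trans (s≤s C₁≤c₀) (≤-reflexive (sym bR))

  -- From `C₁` to just before `c₀` the entries balance, and column `c₀` adds an `i+1` without an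
  -- `i`; so the suffix starting at row `R` reaches the peak.
  level₀ : suc (P C₁) + M m₀ ≡ P m₀ + M C₁
  level₀ = trans (cong (suc (P C₁) +_) (M-same (proj₂ c₀∉L))) (trans (cong suc (sym eq)) (cong (_+ M C₁) (sym (P-suc (≤-trans aR C₁≤c₀) (≤-reflexive (sym bR))))))
    where
    n = c₀ ∸ C₁
    sum≡ : C₁ + n ≡ c₀
    sum≡ = m+[n∸m]≡n C₁≤c₀
    eq : P c₀ + M C₁ ≡ P C₁ + M c₀
    eq = subst (λ x → P x + M C₁ ≡ P C₁ + M x) sum≡ (level n aR (≤-trans (≤-reflexive sum≡) (≤-trans (n≤1+n c₀) (≤-reflexive (sym bR)))) (λ m l → in-L (m≤m+n C₁ m) (≤-trans (+-monoʳ-< C₁ l) (≤-reflexive sum≡))))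

  uR : u R C₁ ≡ 1
  uR with U.column C₁
  ... | inj₁ (_ , _ , _ , f) = ⊥-elim (<⇒≱ (f R c₁<bR) aR)
  ... | inj₂ (k , p , q , _ , o , _) = o R (≤-reflexive (AB.single p q aR c₁<bR))

  dR : d R C₁ ≡ 0
  dR with D.column C₁
  ... | inj₁ (z , _) = z R
  ... | inj₂ (l , bl , cl , z , _) with m≤n⇒m<n∨m≡n C₁≤c₀
  ...   | inj₁ lt = z R (above C₁ ≤-refl lt l bl cl)
  ...   | inj₂ e  = ⊥-elim (<⇒≱ (proj₂ c₀∉L l (subst (_< c l) e cl)) (subst (b l ≤_) e bl))

  Z : ℤ
  Z = value i (cb Q R C₁ ++ cols Q C₁)

  valueP : ∀ ρ j → value i (cb Q ρ j ++ cols Q j) ≡ (u ρ j + P j) ℤ.⊖ (d ρ j + M j)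
  valueP ρ j = cong₂ ℤ._⊖_ (tot-++ (up i) (cb Q ρ j) (cols Q j)) (tot-++ (dn i) (cb Q ρ j) (cols Q j))

  Z≡ : Z ≡ suc (P C₁) ℤ.⊖ M C₁
  Z≡ = trans (valueP R C₁) (cong₂ ℤ._⊖_ (cong (_+ P C₁) uR) (cong (_+ M C₁) dR))

  value-≤ : ∀ ρ j → value i (cb Q ρ j ++ cols Q j) ℤ.≤ Z
  value-≤ ρ j = subst₂ ℤ._≤_ (sym (valueP ρ j)) (sym Z≡) (⊖-≤ (u ρ j + P j) (d ρ j + M j) (suc (P C₁)) (M C₁)
    (lin (u ρ j ∷ P j ∷ M C₁ ∷ P C₁ ∷ d ρ j ∷ M j ∷ P m₀ ∷ M m₀ ∷ []) (((# 0 ⊕ # 1) ⊕ # 7 ≼ # 6 ⊕ (# 4 ⊕ # 5) by bound-≤ ρ j) ∷ (# 6 ⊕ # 2 ≼ ! 1 ⊕ # 3 ⊕ # 7 by ≤-reflexive (sym level₀)) ∷ []) ((# 0 ⊕ # 1) ⊕ # 2) (! 1 ⊕ # 3 ⊕ (# 4 ⊕ # 5))))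

  value-< : ∀ ρ j → (j < C₁) ⊎ ((j ≡ C₁) × (ρ < R)) → value i (cb Q ρ j ++ cols Q j) ℤ.< Z
  value-< ρ j s = subst₂ ℤ._<_ (sym (valueP ρ j)) (sym Z≡) (⊖-< (u ρ j + P j) (d ρ j + M j) (suc (P C₁)) (M C₁)
    (lin (u ρ j ∷ P j ∷ M C₁ ∷ P C₁ ∷ d ρ j ∷ M j ∷ P m₀ ∷ M m₀ ∷ []) ((! 1 ⊕ ((# 0 ⊕ # 1) ⊕ # 7) ≼ # 6 ⊕ (# 4 ⊕ # 5) by bound-< ρ j s) ∷ (# 6 ⊕ # 2 ≼ ! 1 ⊕ # 3 ⊕ # 7 by ≤-reflexive (sym level₀)) ∷ []) (! 1 ⊕ ((# 0 ⊕ # 1) ⊕ # 2)) (! 1 ⊕ # 3 ⊕ (# 4 ⊕ # 5))))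

  Z-positive : (Z ℤ.≤ᵇ ℤ.+ 0) ≡ false
  Z-positive = ℤ≤ᵇ-false (subst (ℤ.+ 0 ℤ.<_) (sym Z≡) (⊖-< 0 0 (suc (P C₁)) (M C₁)
    (lin (M C₁ ∷ P C₁ ∷ P m₀ ∷ M m₀ ∷ []) ((! 1 ⊕ # 3 ≼ # 2 ⊕ ! 0 by P< 0 (s≤s z≤n)) ∷ (# 2 ⊕ # 0 ≼ ! 1 ⊕ # 1 ⊕ # 3 by ≤-reflexive (sym level₀)) ∷ []) (! 1 ⊕ # 0) (! 1 ⊕ # 1 ⊕ ! 0))))

  R-suc : ∃ λ R' → R ≡ suc R'
  R-suc with R | c₀<cR
  ... | zero  | l = ⊥-elim (<⇒≱ l (≤-trans (≤-reflexive c0) z≤n))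
  ... | suc R' | _ = R' , refl

  module WithRow (R' : ℕ) (R≡ : R ≡ suc R') where

    inR : ∀ {j} → j < b R → j < length (at [] t₀ R')
    inR {j} l = <-≤-trans (subst (λ r → j < b r) R≡ l) (b≤len R')

    head-box : cb Q R C₁ ≡ (entry Q (suc R') (suc C₁) , R , suc C₁) ∷ cb Q R' C₁
    head-box = trans (cong (λ r → cb Q r C₁) R≡) (trans (cb-box Q R' C₁ (≤-trans (inR c₁<bR) (≤-reflexive (sym (lenQ R'))))) (cong (λ r → (entry Q (suc R') (suc C₁) , r , suc C₁) ∷ cb Q R' C₁) (sym R≡)))

    picked : pickMax (sufs i (colWord Q)) ≡ just (Z , R , suc C₁)
    picked with cols-split Q {suc C₁} {maxRowLen Q} (≤-trans (inR c₁<bR) (≤-trans (≤-reflexive (sym (lenQ R'))) (maxRowLen-≥ Q R'))) | cb-split Q C₁ {R} {length Q} (subst (_≤ length Q) (sym R≡) (≤-trans (at-pos t₀ R' (inR c₁<bR)) (≤-reflexive (sym (length-fillRows E t₀)))))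
    ... | xs , e | ys , e' with sufs-++ i (xs ++ ys) (cb Q R C₁ ++ cols Q C₁)
    ...   | l , e″ = trans (cong pickMax all≡) (pickMax-spec Z (R , suc C₁) l (sufs i (cb Q R' C₁ ++ cols Q C₁))
            (Allₚ.++⁻ˡ l (subst (All (λ y → proj₁ y ℤ.≤ Z)) (trans (cong (sufs i) (sym (colWord-cols Q))) all≡) (sufs-cols i Q (maxRowLen Q) (λ j _ ρ _ → value-≤ ρ j))))
            (sufs-cb i Q R' C₁ (cols Q C₁) (λ σ h → value-< σ C₁ (inj₂ (refl , subst (σ <_) (sym R≡) (s≤s h)))) (sufs-cols i Q C₁ (λ j h ρ _ → value-< ρ j (inj₁ h)))))
      where
      word≡ : colWord Q ≡ (xs ++ ys) ++ (cb Q R C₁ ++ cols Q C₁)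
      word≡ = trans (colWord-cols Q) (trans e (trans (cong (λ z → xs ++ (z ++ cols Q C₁)) e') (trans (cong (xs ++_) (++-assoc ys (cb Q R C₁) (cols Q C₁))) (sym (++-assoc xs ys _)))))
      head≡ : sufs i (cb Q R C₁ ++ cols Q C₁) ≡ (Z , R , suc C₁) ∷ sufs i (cb Q R' C₁ ++ cols Q C₁)
      head≡ = trans (cong (λ z → sufs i (z ++ cols Q C₁)) head-box) (cong (λ v → (v , R , suc C₁) ∷ sufs i (cb Q R' C₁ ++ cols Q C₁)) (cong (λ z → value i (z ++ cols Q C₁)) (sym head-box)))
      all≡ : sufs i (colWord Q) ≡ l ++ (Z , R , suc C₁) ∷ sufs i (cb Q R' C₁ ++ cols Q C₁)
      all≡ = trans (cong (sufs i) word≡) (trans e″ (cong (l ++_) head≡))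

    change : ℕ → Bool
    change j = changes i Q R (suc C₁) (suc j)

    change-true : ∀ {j} → C₁ ≤ j → j < b R → change j ≡ true
    change-true {j} p q = subst (λ r → changes i Q r (suc C₁) (suc j) ≡ true) (sym R≡)
      (T⇒≡ (T-∧ (≤⇒≤ᵇ (s≤s p)) (T-∧ (≡⇒≡ᵇ _ _ (trans (entryQ R' (inR q)) (E-up R' j (subst (λ r → a r ≤ j) R≡ (≤-trans aR p)) (subst (λ r → j < b r) R≡ q)))) (≤⇒≤ᵇ (≤-trans (inR q) (≤-reflexive (sym (lenQ R'))))))))

    change-false : ∀ {j} → ¬ ((C₁ ≤ j) × (j < b R)) → change j ≡ false
    change-false {j} n = ¬T⇒≡ λ t → n (≤-pred (≤ᵇ⇒≤ (suc C₁) (suc j) (T-∧ˡ t)) , inB (T-∧ʳ {suc C₁ ≤ᵇ suc j} t))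
      where
      inB : T ((entry Q R (suc j) ≡ᵇ suc i) ∧ (suc j ≤ᵇ length (at [] Q (R ∸ 1)))) → j < b R
      inB t = subst (λ r → j < b r) (sym R≡) (proj₂ (E-up⁻ R' j l (trans (sym (entryQ R' l)) (≡ᵇ⇒≡ (entry Q (suc R') (suc j)) (suc i) (T-∧ˡ t')))))
        where
        t' : T ((entry Q (suc R') (suc j) ≡ᵇ suc i) ∧ (suc j ≤ᵇ length (at [] Q R')))
        t' = subst (λ r → T ((entry Q r (suc j) ≡ᵇ suc i) ∧ (suc j ≤ᵇ length (at [] Q (r ∸ 1))))) R≡ t
        l = inRow R' (≤ᵇ⇒≤ (suc j) _ (T-∧ʳ {entry Q (suc R') (suc j) ≡ᵇ suc i} t'))

    same-entry : ∀ k j → j < length (at [] t₀ k) → (j < b (suc k) → j < b' (suc k)) → (j < b' (suc k) → j < b (suc k)) → E (suc k) (suc j) ≡ E' (suc k) (suc j)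
    same-entry k j l f g with j <? a (suc k)
    ... | yes la = sym (E'-a k j la)
    ... | no na with j <? b (suc k)
    ...   | yes lb = trans (E-up k j (≮⇒≥ na) lb) (sym (E'-up k j (≮⇒≥ na) (f lb)))
    ...   | no nb with j <? c (suc k)
    ...     | yes lc = trans (E-dn k j (≮⇒≥ nb) lc) (sym (E'-dn k j (≮⇒≥ λ h → nb (g h)) lc))
    ...     | no nc = sym (E'-c k j l (≮⇒≥ nc))

    outside : ∀ {j} → ¬ ((C₁ ≤ j) × (j < b R)) → SameAt j
    outside {j} n with j <? C₁
    ... | yes l = same-left j l
    ... | no l  = same-right j (≤-trans (≤-reflexive (sym bR)) (≮⇒≥ λ h → n (≮⇒≥ l , h)))

    unchanged : ∀ k j → j < length (at [] t₀ k) → ¬ ((C₁ ≤ j) × (j < b R)) → changedEntry i Q R (suc C₁) (suc k) (suc j) ≡ E' (suc k) (suc j)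
    unchanged k j l n rewrite change-false n with suc k ≡ᵇ R
    ... | true  = trans (entryQ k l) (same-entry k j l (proj₁ (outside n (suc k))) (proj₂ (outside n (suc k))))
    ... | false = trans (entryQ k l) (same-entry k j l (proj₁ (outside n (suc k))) (proj₂ (outside n (suc k))))

    -- Between `C₁` and `c₀` the only `i` left in a column after raising is the one in row `R`, so
    -- an `i` in another row must have become `i+1`. All other columns agree.
    changed≡ : ∀ k j → j < length (at [] t₀ k) → changedEntry i Q R (suc C₁) (suc k) (suc j) ≡ E' (suc k) (suc j)
    changed≡ k j l with C₁ ≤? j | j <? b R
    ... | no n  | _    = unchanged k j l (n ∘ proj₁)
    ... | yes _ | no n = unchanged k j l (n ∘ proj₂)
    ... | yes p | yes q rewrite change-true p q with suc k ≟ R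
    ...   | yes e rewrite ≡ᵇ-true e = sym (E'-dn k j (subst (λ r → b' r ≤ j) (sym e) p) (subst (λ r → j < c r) (sym e) (<-≤-trans q (BC.le R))))
    ...   | no ne rewrite ≡ᵇ-false ne with entry Q (suc k) (suc j) ≡ᵇ i in e
    ...     | true = sym (E'-up k j (≤-trans (AB.le (suc k)) (proj₁ box)) (≰⇒> λ h → ne (R-new p (≤-pred (≤-trans q (≤-reflexive bR))) h (proj₂ box))))
      where
      box = E-dn⁻ k j l (trans (sym (entryQ k l)) (≡ᵇ⇒≡ _ _ (subst T (sym e) tt)))
    ...     | false = trans (entryQ k l) (same-entry k j l (λ lb → ≰⇒> λ h → ne (R-new p j≤c₀ h (<-≤-trans lb (BC.le (suc k)))))
        (λ lb' → ≰⇒> λ h → subst T e (≡⇒≡ᵇ _ _ (trans (entryQ k l) (E-dn k j h (<-≤-trans lb' (BC'.le (suc k))))))))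
      where
      j≤c₀ : j ≤ c₀
      j≤c₀ = ≤-pred (≤-trans q (≤-reflexive bR))

    result : eKey i Q ≡ just (fillRows E' t₀)
    result = trans (eKey-just i Q (trans (cong pickMax (zip-sufs i (colWord Q))) picked) Z-positive)
      (cong just (fillRows-cong {changedEntry i Q R (suc C₁)} {E'} Q t₀ (length-fillRows E t₀) lenQ changed≡))

  eKey-fillRows : eKey i (fillRows E t₀) ≡ just (fillRows E' t₀)
  eKey-fillRows = WithRow.result (proj₁ R-suc) (proj₂ R-suc)

-- Recording fillings and the theorem

concat-reverse-++ : ∀ (F G : Fac) → concat (reverse (F ++ G)) ≡ concat (reverse G) ++ concat (reverse F)
concat-reverse-++ F G = trans (cong concat (reverse-++ F G)) (sym (concat-++ (reverse G) (reverse F)))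

concat-reverse-∷ : ∀ X (F : Fac) → concat (reverse (X ∷ F)) ≡ concat (reverse F) ++ X
concat-reverse-∷ X F = trans (concat-reverse-++ (X ∷ []) F) (cong (concat (reverse F) ++_) (++-identityʳ X))

tailWord : Fac → ℕ → Word
tailWord f m = concat (reverse (drop m f))

tailWord-prefix : ∀ f m → ∃ λ v → facWord f ≡ tailWord f m ++ v
tailWord-prefix f m = concat (reverse (take m f)) , trans (cong (concat ∘ reverse) (sym (take++drop≡id m f))) (concat-reverse-++ (take m f) (drop m f))

drop-++-≤ : ∀ m (F G : Fac) → m ≤ length F → drop m (F ++ G) ≡ drop m F ++ G
drop-++-≤ zero    F       G l       = refl
drop-++-≤ (suc m) (X ∷ F) G (s≤s l) = drop-++-≤ m F G l

drop-++-+ : ∀ (F G : Fac) n → drop (length F + n) (F ++ G) ≡ drop n G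
drop-++-+ []      G n = refl
drop-++-+ (X ∷ F) G n = drop-++-+ F G n

drop-all : ∀ (f : Fac) → drop (length f) f ≡ []
drop-all []      = refl
drop-all (X ∷ f) = drop-all f

drop-suc : ∀ m (f : Fac) → m < length f → ∃ λ X → drop m f ≡ X ∷ drop (suc m) f
drop-suc zero    (X ∷ f) l       = X , refl
drop-suc (suc m) (X ∷ f) (s≤s l) = drop-suc m f l

findᵇ'-first : ∀ {A : Set} (p : A → Bool) (h : ℕ → A) n m → m < n → p (h m) ≡ true → (∀ m' → m' < m → p (h m') ≡ false) → findᵇ' p (applyUpTo h n) ≡ just (h m)
findᵇ'-first p h (suc n) zero    l       e z rewrite e = refl
findᵇ'-first p h (suc n) (suc m) (s≤s l) e z rewrite z 0 (s≤s z≤n) = findᵇ'-first p (h ∘ suc) n m l e (λ m' l' → z (suc m') (s≤s l'))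

key-bound : ∀ {ρ a} → Red ρ → KeyShape ρ a → ∀ k → a k ≤ length ρ
key-bound {ρ} {a} red A k = ≤-by-< λ c l → inside c l (col-exists (Red-reverse ρ red) c)
  where
  nonempty : ∀ {V : Word} → k ∈ V → 1 ≤ length V
  nonempty (here _)  = s≤s z≤n
  nonempty (there _) = s≤s z≤n
  inside : ∀ c → c < a k → ∃ (Col c (reverse ρ)) → c < length ρ
  inside c l (V , C) = subst (c <_) (length-reverse ρ) (sh-pos (Red-reverse ρ red) (subst (0 <_) (col-length (Red-reverse ρ red) C) (nonempty (box⇐ A C l))))

-- `g m` belongs to the product of all components except the first `m`, so a box at level `m`
-- carries the entry `suc m`.
module Recording (f : Fac) (red : Red (facWord f)) where

  redW : ∀ m → Red (tailWord f m)
  redW m = Red-prefix (tailWord f m) _ (subst Red (proj₂ (tailWord-prefix f m)) red)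

  g : ℕ → ℕ → ℕ
  g m = proj₁ (key-exists (redW m))

  key : ∀ m → KeyShape (tailWord f m) (g m)
  key m = proj₂ (key-exists (redW m))

  g-step : ∀ m → m < length f → ∀ k → g (suc m) k ≤ g m k
  g-step m l k with drop-suc m f l
  ... | X , e = key-mono (tailWord f (suc m)) X (subst Red eq (redW m)) (key (suc m)) (subst (λ τ → KeyShape τ (g m)) eq (key m)) k
    where
    eq : tailWord f m ≡ tailWord f (suc m) ++ X
    eq = trans (cong (concat ∘ reverse) e) (concat-reverse-∷ X (drop (suc m) f))

  g-anti : ∀ {m m'} → m ≤ m' → m' ≤ length f → ∀ k → g m' k ≤ g m k
  g-anti {m} {m'} l l' k with m≤n⇒∃[o]m+o≡n l
  ... | o , refl = go o l'
    where
    go : ∀ o → m + o ≤ length f → g (m + o) k ≤ g m k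
    go zero    h = ≤-reflexive (cong (λ x → g x k) (+-identityʳ m))
    go (suc o) h = ≤-trans (≤-trans (≤-reflexive (cong (λ x → g x k) (+-suc m o))) (g-step (m + o) h' k)) (go o (<⇒≤ h'))
      where h' = subst (_≤ length f) (+-suc m o) h

  g-end : ∀ k → g (length f) k ≡ 0
  g-end k = key-unique (redW (length f)) (key (length f)) (subst (λ τ → KeyShape τ (λ _ → 0)) (sym (cong (concat ∘ reverse) (drop-all f))) key-[]) k

  at-level : ℕ → ℕ → ℕ → Set
  at-level m k j = (m < length f) × (j < g m (suc k)) × (g (suc m) (suc k) ≤ j)

  test : ℕ → ℕ → ℕ → Bool
  test k j m = inDiag (Phat (prefixFac f m)) (suc k) (suc j) ∧ not (inDiag (Phat (prefixFac f (suc m))) (suc k) (suc j))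

  test≡ : ∀ k j m → test k j (suc m) ≡ (suc j ≤ᵇ g m (suc k)) ∧ not (suc j ≤ᵇ g (suc m) (suc k))
  test≡ k j m = cong₂ (λ x y → x ∧ not y) (inDiag-key (redW m) (key m) k j) (inDiag-key (redW (suc m)) (key (suc m)) k j)

  qEntry-find : ∀ k j {m} → findᵇ' (test k j) (map suc (upTo (length f))) ≡ just m → qEntry f (suc k) (suc j) ≡ m
  qEntry-find k j e rewrite e = refl

  -- The search takes the first hit; at smaller indices the box lies in both of the diagrams
  -- compared.
  qEntry-level : ∀ {m k j} → at-level m k j → qEntry f (suc k) (suc j) ≡ suc m
  qEntry-level {m} {k} {j} (l , p , q) = qEntry-find k j (trans (cong (findᵇ' (test k j)) (map-applyUpTo suc id (length f))) (findᵇ'-first (test k j) suc (length f) m l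
    (trans (test≡ k j m) (cong₂ (λ x y → x ∧ not y) (≤ᵇ-true p) (≤ᵇ-false (s≤s q))))
    (λ m' l' → trans (test≡ k j m') (trans (cong (λ y → (suc j ≤ᵇ g m' (suc k)) ∧ not y) (≤ᵇ-true (≤-trans p (g-anti l' (<⇒≤ l) (suc k))))) (∧-falseʳ _)))))
    where
    ∧-falseʳ : ∀ x → x ∧ false ≡ false
    ∧-falseʳ true  = refl
    ∧-falseʳ false = refl

  find-level : ∀ k j → j < g 0 (suc k) → ∃ λ m → at-level m k j
  find-level k j l = go (length f) ≤-refl (≤-trans (≤-reflexive (g-end (suc k))) z≤n)
    where
    go : ∀ n → n ≤ length f → g n (suc k) ≤ j → ∃ λ m → at-level m k j
    go zero    h q = ⊥-elim (<⇒≱ l q)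
    go (suc n) h q with j <? g n (suc k)
    ... | yes p = n , h , p , q
    ... | no p  = go n (<⇒≤ h) (≮⇒≥ p)

  level-of : ∀ {m k j} → j < g 0 (suc k) → qEntry f (suc k) (suc j) ≡ suc m → at-level m k j
  level-of {m} {k} {j} l e = go (find-level k j l)
    where
    go : (∃ λ m → at-level m k j) → at-level m k j
    go (m₁ , h) = subst (λ m → at-level m k j) (suc-injective (trans (sym (qEntry-level h)) e)) h

strip-heights : ∀ {a c hA hC hC'} → (∀ j → hC' j ≡ hC j) → Strip a c hA hC' → Strip a c hA hC
strip-heights e S = mkStrip (Strip.le S) (Strip.low S) λ j → case Strip.col S j of λ { (inj₁ (p , q)) → inj₁ (trans (sym (e j)) p , q) ; (inj₂ (p , q)) → inj₂ (trans (sym (e j)) p , q) }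

Qhat-just : ∀ f {t} → PhatFac f ≡ just t → Qhat f ≡ fillRows (qEntry f) t
Qhat-just f e rewrite e = refl


module Core (F₀ F₁ : Fac) {X Y X' Y' : Word} (iX : Inc X) (iY : Inc Y) (iX' : Inc X') (iY' : Inc Y') (eqv : (X ++ Y) ∼ (X' ++ Y')) (len : length X ≡ suc (length X'))
            (red : Red (facWord (F₀ ++ Y ∷ X ∷ F₁))) where

  f f' : Fac
  f  = F₀ ++ Y ∷ X ∷ F₁
  f' = F₀ ++ Y' ∷ X' ∷ F₁

  k : ℕ
  k = length F₀

  s : Word
  s = concat (reverse F₁)

  q : ((s ++ X) ++ Y) ∼ ((s ++ X') ++ Y')
  q = ∼trans (∼≡ (++-assoc s X Y)) (∼trans (∼-++ˡ s eqv) (∼≡ (sym (++-assoc s X' Y'))))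

  middle-word : ∀ X Y → concat (reverse (Y ∷ X ∷ F₁)) ≡ (s ++ X) ++ Y
  middle-word X Y = trans (concat-reverse-∷ Y (X ∷ F₁)) (cong (_++ Y) (concat-reverse-∷ X F₁))

  word-k : ∀ X Y → tailWord (F₀ ++ Y ∷ X ∷ F₁) k ≡ (s ++ X) ++ Y
  word-k X Y = trans (cong (concat ∘ reverse) (trans (cong (λ n → drop n (F₀ ++ Y ∷ X ∷ F₁)) (sym (+-identityʳ k))) (drop-++-+ F₀ (Y ∷ X ∷ F₁) 0))) (middle-word X Y)

  word-k+1 : ∀ X Y → tailWord (F₀ ++ Y ∷ X ∷ F₁) (suc k) ≡ s ++ X
  word-k+1 X Y = trans (cong (concat ∘ reverse) (trans (cong (λ n → drop n (F₀ ++ Y ∷ X ∷ F₁)) (+-comm 1 k)) (drop-++-+ F₀ (Y ∷ X ∷ F₁) 1))) (concat-reverse-∷ X F₁)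

  word-above : ∀ X Y n → tailWord (F₀ ++ Y ∷ X ∷ F₁) (suc (suc k) + n) ≡ tailWord F₁ n
  word-above X Y n = cong (concat ∘ reverse) (trans (cong (λ m → drop m (F₀ ++ Y ∷ X ∷ F₁)) (trans (cong suc (sym (+-suc k n))) (sym (+-suc k (suc n))))) (drop-++-+ F₀ (Y ∷ X ∷ F₁) (suc (suc n))))

  word-below : ∀ X Y m → m ≤ k → tailWord (F₀ ++ Y ∷ X ∷ F₁) m ≡ ((s ++ X) ++ Y) ++ tailWord F₀ m
  word-below X Y m l = trans (cong (concat ∘ reverse) (drop-++-≤ m F₀ (Y ∷ X ∷ F₁) l)) (trans (concat-reverse-++ (drop m F₀) (Y ∷ X ∷ F₁)) (cong (_++ tailWord F₀ m) (middle-word X Y)))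

  -- Only the prefix product ending between the two factors leaves its class, so all other diagrams
  -- used by the recording filling are unchanged.
  tails∼ : ∀ m → m ≢ suc k → tailWord f m ∼ tailWord f' m
  tails∼ m ne with m ≤? k
  ... | yes l = ∼trans (∼≡ (word-below X Y m l)) (∼trans (∼-++ʳ (tailWord F₀ m) q) (∼≡ (sym (word-below X' Y' m l))))
  ... | no l with m≤n⇒∃[o]m+o≡n (≤∧≢⇒< (≰⇒> l) (ne ∘ sym))
  ...   | n , refl = ∼≡ (trans (word-above X Y n) (sym (word-above X' Y' n)))

  words∼ : facWord f ∼ facWord f'
  words∼ = tails∼ 0 (λ ())

  red' : Red (facWord f')
  red' = Red-∼ words∼ red

  module F = Recording f red
  module F' = Recording f' red'

  levels : ∀ m → m ≢ suc k → ∀ r → F.g m r ≡ F'.g m r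
  levels m ne = key-unique (F'.redW m) (key-∼ (F.redW m) (tails∼ m ne) (F.key m)) (F'.key m)

  a b c b' : ℕ → ℕ
  a  = F.g (suc (suc k))
  b  = F.g (suc k)
  c  = F.g k
  b' = F'.g (suc k)

  redC : Red ((s ++ X) ++ Y)
  redC = subst Red (word-k X Y) (F.redW k)

  redC' : Red ((s ++ X') ++ Y')
  redC' = Red-∼ q redC

  keyA : KeyShape s a
  keyA = subst (λ τ → KeyShape τ a) (trans (cong (tailWord f) (sym (+-identityʳ (suc (suc k))))) (word-above X Y 0)) (F.key (suc (suc k)))

  keyB : KeyShape (s ++ X) b
  keyB = subst (λ τ → KeyShape τ b) (word-k+1 X Y) (F.key (suc k))

  keyB' : KeyShape (s ++ X') b'
  keyB' = subst (λ τ → KeyShape τ b') (word-k+1 X' Y') (F'.key (suc k))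

  keyC : KeyShape ((s ++ X) ++ Y) c
  keyC = subst (λ τ → KeyShape τ c) (word-k X Y) (F.key k)

  hA hB hB' hC : ℕ → ℕ
  hA  = sh (reverse s)
  hB  = sh (reverse (s ++ X))
  hB' = sh (reverse (s ++ X'))
  hC  = sh (reverse ((s ++ X) ++ Y))

  AB : Strip a b hA hB
  AB = strip-key s X iX (Red-prefix (s ++ X) Y redC) keyA keyB

  BC : Strip b c hB hC
  BC = strip-key (s ++ X) Y iY redC keyB keyC

  AB' : Strip a b' hA hB'
  AB' = strip-key s X' iX' (Red-prefix (s ++ X') Y' redC') keyA keyB'

  BC' : Strip b' c hB' hC
  BC' = strip-heights (λ j → sh-∼ (Red-reverse _ redC') (∼-reverse (∼sym q)) j) (strip-key (s ++ X') Y' iY' redC' keyB' (key-∼ redC q keyC))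

  length-f : ∀ X Y → length (F₀ ++ Y ∷ X ∷ F₁) ≡ suc (suc k) + length F₁
  length-f X Y = trans (length-++ F₀) (trans (+-suc k (suc (length F₁))) (cong suc (+-suc k (length F₁))))

  k+1< : ∀ X Y → suc k < length (F₀ ++ Y ∷ X ∷ F₁)
  k+1< X Y = ≤-trans (m≤m+n (suc (suc k)) (length F₁)) (≤-reflexive (sym (length-f X Y)))

  c≤top : ∀ r → c r ≤ F.g 0 r
  c≤top r = F.g-anti z≤n (<⇒≤ (<-trans (n<1+n k) (k+1< X Y))) r

  c'≡ : ∀ r → F'.g k r ≡ c r
  c'≡ r = sym (levels k (<⇒≢ (n<1+n k)) r)

  a'≡ : ∀ r → F'.g (suc (suc k)) r ≡ a r
  a'≡ r = sym (levels (suc (suc k)) (>⇒≢ (n<1+n (suc k))) r)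

  move-level : ∀ {m r j} → m ≢ k → m ≢ suc k → F.at-level m r j → qEntry f' (suc r) (suc j) ≡ qEntry f (suc r) (suc j)
  move-level {m} {r} {j} n₀ n₁ (l , p , h) = trans (F'.qEntry-level (subst (m <_) (trans (length-f X Y) (sym (length-f X' Y'))) l , subst (j <_) (levels m n₁ (suc r)) p , subst (_≤ j) (levels (suc m) (n₀ ∘ suc-injective) (suc r)) h)) (sym (F.qEntry-level (l , p , h)))

  E'-a : ∀ r j → j < a (suc r) → qEntry f' (suc r) (suc j) ≡ qEntry f (suc r) (suc j)
  E'-a r j l = go (F.find-level r j (<-≤-trans l (≤-trans (Strip.le AB (suc r)) (≤-trans (Strip.le BC (suc r)) (c≤top (suc r))))))
    where
    go : (∃ λ m → F.at-level m r j) → qEntry f' (suc r) (suc j) ≡ qEntry f (suc r) (suc j)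
    go (m , h@(_ , _ , low)) = move-level (λ { refl → <⇒≱ l (≤-trans (Strip.le AB (suc r)) low) }) (λ { refl → <⇒≱ l low }) h

  E'-c : ∀ r j → j < F.g 0 (suc r) → c (suc r) ≤ j → qEntry f' (suc r) (suc j) ≡ qEntry f (suc r) (suc j)
  E'-c r j l h = go (F.find-level r j l)
    where
    go : (∃ λ m → F.at-level m r j) → qEntry f' (suc r) (suc j) ≡ qEntry f (suc r) (suc j)
    go (m , h'@(_ , p , _)) = move-level (λ { refl → <⇒≱ p h }) (λ { refl → <⇒≱ p (≤-trans (Strip.le BC (suc r)) h) }) h'

  P-same : PhatFac f' ≡ PhatFac f
  P-same = sym (Phat-∼ red words∼)

  key-raised : eKey (suc k) (Qhat f) ≡ just (Qhat f')
  key-raised = build (Phat-spec red (F.key 0)) (raise-peak iX iY iX' iY' eqv len s redC)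
    where
    build : (∃ λ n → ∃ λ t → PhatSpec (facWord f) (F.g 0) n t) → (∃ λ c₀ → (∀ j → hB j ≡ hB' j + ι c₀ j) × PeakAt hA hB hC (suc c₀)) → eKey (suc k) (Qhat f) ≡ just (Qhat f')
    build (n , t , e , _ , z , _ , _ , lens) (c₀ , hB≡ , pk) =
        trans (cong (eKey (suc k)) (Qhat-just f e)) (trans evaluated (cong just (sym (Qhat-just f' (trans P-same e)))))
      where
      t₀ = tab n t
      rowLen : ∀ r → length (at [] t₀ r) ≡ F.g 0 (suc r)
      rowLen r = trans (cong length (at-tab {n} {t} z r)) (lens (suc r) (s≤s z≤n))
      in-top : ∀ r {j} → j < length (at [] t₀ r) → j < F.g 0 (suc r)
      in-top r {j} = subst (j <_) (rowLen r)
      flip-level : ∀ {m r j} → F.at-level m r j → (F.g (suc m) (suc r) ≤ j) × (j < F.g m (suc r))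
      flip-level (_ , p , q) = q , p
      evaluated : eKey (suc k) (fillRows (qEntry f) t₀) ≡ just (fillRows (qEntry f') t₀)
      evaluated = Eval.eKey-fillRows t₀ (qEntry f) (qEntry f') (suc k) {c₀ = c₀} AB BC AB' BC' hB≡ (length ((s ++ X) ++ Y)) (key-bound redC keyC) pk
        (key-zero redC keyC (positive redC) z≤n) (λ r → ≤-trans (c≤top (suc r)) (≤-reflexive (sym (rowLen r))))
        (λ r j p q → F.qEntry-level (k+1< X Y , q , p))
        (λ r j p q → F.qEntry-level (<-trans (n<1+n k) (k+1< X Y) , q , p))
        (λ r j l e → flip-level (F.level-of (in-top r l) e))
        (λ r j l e → flip-level (F.level-of (in-top r l) e))
        (λ r j p q → F'.qEntry-level (k+1< X' Y' , q , subst (_≤ j) (sym (a'≡ (suc r))) p))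
        (λ r j p q → F'.qEntry-level (<-trans (n<1+n k) (k+1< X' Y') , subst (j <_) (sym (c'≡ (suc r))) q , p))
        E'-a (λ r j l → E'-c r j (in-top r l))

split-fac : ∀ k (f : Fac) X' Y' → suc k < length f → ∃ λ F₀ → ∃ λ F₁ → (length F₀ ≡ k) × (f ≡ F₀ ++ at [] f k ∷ at [] f (suc k) ∷ F₁) × (setAt [] (setAt [] f (suc k) X') k Y' ≡ F₀ ++ Y' ∷ X' ∷ F₁)
split-fac zero    (Y ∷ X ∷ F₁) X' Y' l = [] , F₁ , refl , refl , refl
split-fac (suc k) (Z ∷ f)      X' Y' (s≤s l) with split-fac k f X' Y' l
... | F₀ , F₁ , e , p , q = Z ∷ F₀ , F₁ , cong suc e , cong (Z ∷_) p , cong (Z ∷_) q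
split-fac zero (Y ∷ []) X' Y' (s≤s ())

eFac-just : ∀ k f {r'} → eFac (suc k) f ≡ just r' → let X = at [] f (suc k) ; Y = at [] f k ; a = maxL (unpaired X Y) in
  (unpaired X Y ≢ []) × (r' ≡ setAt [] (setAt [] f (suc k) (removeVal a X)) k (insertSorted (runEnd (length X) a X) Y))
eFac-just k f e with unpaired (at [] f (suc k)) (at [] f k)
eFac-just k f refl | _ ∷ _ = (λ ()) , refl

theorem4p12 : (w : ℕ → ℕ) (F : Flag) (r : Fac) (i : ℕ) → RFC w F r → 1 ≤ i →
    (r' : Fac) → eFac i r ≡ just r' →
    (PhatFac r' ≡ PhatFac r) × (eKey i (Qhat r) ≡ just (Qhat r'))
theorem4p12 w F r (suc k) (incs , reduced , _) _ r' e = main (split-fac k r (removeVal a X) (insertSorted (runEnd (length X) a X) Y) inside)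
  where
  X = at [] r (suc k)
  Y = at [] r k
  a = maxL (unpaired X Y)
  Goal : Set
  Goal = (PhatFac r' ≡ PhatFac r) × (eKey (suc k) (Qhat r) ≡ just (Qhat r'))
  ne = proj₁ (eFac-just k r e)
  r'≡ = proj₂ (eFac-just k r e)
  -- A missing component counts as empty and would leave nothing unpaired.
  inside : suc k < length r
  inside = ≰⇒> λ l → ne (trans (cong (λ X → unpaired X Y) (at-beyond [] r l)) (unpaired-[] Y))
  main : (∃ λ F₀ → ∃ λ F₁ → (length F₀ ≡ k) × (r ≡ F₀ ++ Y ∷ X ∷ F₁) × (setAt [] (setAt [] r (suc k) (removeVal a X)) k (insertSorted (runEnd (length X) a X) Y) ≡ F₀ ++ insertSorted (runEnd (length X) a X) Y ∷ removeVal a X ∷ F₁)) → Goal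
  main (F₀ , F₁ , k≡ , r≡ , set≡) = cases (split X Y iX iY)
    where
    linked : All (Linked _<_) (Y ∷ X ∷ F₁)
    linked = Allₚ.++⁻ʳ F₀ (subst (All (Linked _<_)) r≡ incs)
    iX : Inc X
    iX = Linked⇒AllPairs <-trans (All.head (All.tail linked))
    iY : Inc Y
    iY = Linked⇒AllPairs <-trans (All.head linked)
    red : Red (facWord (F₀ ++ Y ∷ X ∷ F₁))
    red = subst (Red ∘ facWord) r≡ (ReducedWordFor⇒Red reduced)
    s = concat (reverse F₁)
    word≡ : facWord (F₀ ++ Y ∷ X ∷ F₁) ≡ (s ++ (X ++ Y)) ++ facWord F₀
    word≡ = trans (concat-reverse-++ F₀ (Y ∷ X ∷ F₁)) (cong (_++ facWord F₀) (trans (concat-reverse-∷ Y (X ∷ F₁)) (trans (cong (_++ Y) (concat-reverse-∷ X F₁)) (++-assoc s X Y))))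
    redXY : Red (X ++ Y)
    redXY = Red-suffix s _ (Red-prefix (s ++ (X ++ Y)) (facWord F₀) (subst Red word≡ red))
    finish : ∀ {L a₀} → (∃ λ X' → ∃ λ Y' → ∃ λ e → Raised X Y X' Y' L a₀ e) → Goal
    finish (X' , Y' , e' , R) = subst₂ (λ u v → (PhatFac v ≡ PhatFac u) × (eKey (suc k) (Qhat u) ≡ just (Qhat v))) (sym r≡) (sym r'≡′)
        (Core.P-same F₀ F₁ iX iY R.incX R.incY R.equiv R.lenX red , subst (λ k → eKey (suc k) (Qhat (F₀ ++ Y ∷ X ∷ F₁)) ≡ just (Qhat (F₀ ++ Y' ∷ X' ∷ F₁))) k≡ (Core.key-raised F₀ F₁ iX iY R.incX R.incY R.equiv R.lenX red))
      where
      module R = Raised R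
      r'≡′ : r' ≡ F₀ ++ Y' ∷ X' ∷ F₁
      r'≡′ = trans r'≡ (trans set≡ (cong₂ (λ u v → F₀ ++ v ∷ u ∷ F₁) (trans (cong (λ a → removeVal a X) R.a≡) (sym R.X'≡)) (trans (cong (λ e → insertSorted e Y) (trans (cong (λ a → runEnd (length X) a X) R.a≡) R.e≡)) (sym R.Y'≡))))
    cases : SplitCases X Y → Goal
    cases (inj₁ (u , _)) = ⊥-elim (ne u)
    cases (inj₂ S)       = finish (raise X Y iX iY redXY S)
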